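{- Let $\mathsf{R}$ be a principal ideal domain. Then there is an isomorphism of PROPs $\mathbb{IH}^{\mathsf{Sp}}_{\mathsf{R}} \cong \mathsf{Span}(\mathsf{Mat}\,\mathsf{R})$.
   Context: A PROP is a strict symmetric monoidal category whose objects are the natural numbers and whose monoidal product $\oplus$ on objects is addition. Morphisms of PROPs are identity-on-objects strict symmetric monoidal functors. Composition is written in diagrammatic order $f;g$. The PROP presented by generators $\Sigma$ and equations $E$ has as arrows the terms built from $\Sigma$, $\mathrm{id}_1$ and the symmetry $\sigma:=\sigma_{1,1}$ using $;$ and $\oplus$, modulo the laws of symmetric monoidal categories and the smallest congruence containing $E$. The PROP $\mathbb{HA}_{\mathsf{R}}$ has generators $\Delta_\bullet:1\to2$, $\varepsilon_\bullet:1\to0$, $\mu_\circ:2\to1$, $\eta_\circ:0\to1$ and $s_k:1\to1$ for each $k\in\mathsf{R}$, and equations (for all $k,k_1,k_2\in\mathsf{R}$): (A1) $(\eta_\circ\oplus\mathrm{id}_1);\mu_\circ=\mathrm{id}_1$; (A2) $\sigma;\mu_\circ=\mu_\circ$; (A3) $(\mu_\circ\oplus\mathrm{id}_1);\mu_\circ=(\mathrm{id}_1\oplus\mu_\circ);\mu_\circ$; (A4) $\Delta_\bullet;(\varepsilon_\bullet\oplus\mathrm{id}_1)=\mathrm{id}_1$; (A5) $\Delta_\bullet;\sigma=\Delta_\bullet$; (A6) $\Delta_\bullet;(\Delta_\bullet\oplus\mathrm{id}_1)=\Delta_\bullet;(\mathrm{id}_1\oplus\Delta_\bullet)$; (A7)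 $\mu_\circ;\varepsilon_\bullet=\varepsilon_\bullet\oplus\varepsilon_\bullet$; (A8) $\mu_\circ;\Delta_\bullet=(\Delta_\bullet\oplus\Delta_\bullet);(\mathrm{id}_1\oplus\sigma\oplus\mathrm{id}_1);(\mu_\circ\oplus\mu_\circ)$; (A9) $\eta_\circ;\Delta_\bullet=\eta_\circ\oplus\eta_\circ$; (A10) $\eta_\circ;\varepsilon_\bullet=\mathrm{id}_0$; (A11) $s_1=\mathrm{id}_1$; (A12) $s_{k_1};s_{k_2}=s_{k_1k_2}$; (A13) $\mu_\circ;s_k=(s_k\oplus s_k);\mu_\circ$; (A14) $\eta_\circ;s_k=\eta_\circ$; (A15) $s_k;\Delta_\bullet=\Delta_\bullet;(s_k\oplus s_k)$; (A16) $s_k;\varepsilon_\bullet=\varepsilon_\bullet$; (A17) $s_0=\varepsilon_\bullet;\eta_\circ$; (A18) $\Delta_\bullet;(s_{k_1}\oplus s_{k_2});\mu_\circ=s_{k_1+k_2}$. The opposite PROP $\mathbb{HA}_{\mathsf{R}}^{op}$ is presented by generators $\mu_\bullet:2\to1$, $\eta_\bullet:0\to1$, $\Delta_\circ:1\to2$, $\varepsilon_\circ:1\to0$, $\bar s_k:1\to1$ ($k\in\mathsf{R}$), the opposites of $\Delta_\bullet,\varepsilon_\bullet,\mu_\circ,\eta_\circ,s_k$ respectively, and the reversed equations (A1)$^{op}$–(A18)$^{op}$. The coproduct $\mathbb{HA}_{\mathsf{R}}+\mathbb{HA}_{\mathsf{R}}^{op}$ is presented by the disjoint union of the generators and of the equations.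 $\mathbb{IH}^{\mathsf{Sp}}_{\mathsf{R}}$ is the quotient of $\mathbb{HA}_{\mathsf{R}}+\mathbb{HA}_{\mathsf{R}}^{op}$ by the following equations, for $l$ any non-zero element and $k$ any element of $\mathsf{R}$: (W1) $s_l;\bar s_l=\mathrm{id}_1$; (W2) $\eta_\circ;\varepsilon_\circ=\mathrm{id}_0$; (W3) $(\Delta_\circ\oplus\mathrm{id}_1);(\mathrm{id}_1\oplus\mu_\circ)=\mu_\circ;\Delta_\circ=(\mathrm{id}_1\oplus\Delta_\circ);(\mu_\circ\oplus\mathrm{id}_1)$; (W4) $(\Delta_\bullet\oplus\mathrm{id}_1);(\mathrm{id}_1\oplus\mu_\bullet)=\mu_\bullet;\Delta_\bullet=(\mathrm{id}_1\oplus\Delta_\bullet);(\mu_\bullet\oplus\mathrm{id}_1)$; (W5) $\eta_\circ;\Delta_\circ=\eta_\bullet;\Delta_\bullet;(\mathrm{id}_1\oplus s_{ -1})$; (W6) $\mu_\circ;\varepsilon_\circ=(\mathrm{id}_1\oplus s_{ -1});\mu_\bullet;\varepsilon_\bullet$; (W7) $(s_k\oplus\mathrm{id}_1);\mu_\bullet=(\mathrm{id}_1\oplus\bar s_k);\mu_\bullet;s_k$; (W8) $\Delta_\bullet;(\bar s_k\oplus\mathrm{id}_1)=\bar s_k;\Delta_\bullet;(\mathrm{id}_1\oplus s_k)$. $\mathsf{Mat}\,\mathsf{R}$ is the PROP whose arrows $n\to m$ are $m\times n$ matrices over $\mathsf{R}$, with $A;B$ the matrix product $BA$, $A\oplus B$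 the block-diagonal matrix, and permutation matrices as symmetries; it has pullbacks since $\mathsf{R}$ is a PID. $\mathsf{Span}(\mathsf{Mat}\,\mathsf{R})$ is the PROP whose arrows $n\to m$ are isomorphism classes of spans $n\leftarrow z\rightarrow m$ in $\mathsf{Mat}\,\mathsf{R}$, composed by pullback, with $\oplus$ inherited from $\mathsf{Mat}\,\mathsf{R}$. -}

module Defs where

open import Algebra.Bundles using (CommutativeRing)
open import Data.Fin.Base as Fin using (Fin; zero; suc; splitAt; join; cast; _↑ˡ_; _↑ʳ_)
open import Data.Fin.Properties as Finₚ
  using (cast-is-id; splitAt-↑ˡ; splitAt-↑ʳ; splitAt-join; join-splitAt; toℕ-injective;
         toℕ-cast; toℕ-↑ˡ; toℕ-↑ʳ)
open import Data.Nat.Base using (ℕ; zero; suc; _+_)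
open import Data.Nat.Properties using (+-assoc; +-identityʳ)
open import Data.Product.Base using (Σ; ∃; _×_; _,_; proj₁; proj₂)
open import Data.Sum.Base as Sum using (_⊎_; inj₁; inj₂; [_,_]′)
open import Data.Sum.Properties using (swap-involutive)
open import Function.Base using (flip)
open import Function.Bundles using (_⇔_; Equivalence)
open import Level using (Level; _⊔_; Lift; lift) renaming (suc to lsuc)
open import Relation.Binary.Bundles using (Setoid)
open import Relation.Binary.Core using (Rel)
open import Relation.Binary.Definitions using (_Respects_)
open import Relation.Binary.PropositionalEquality as ≡ using (_≡_; subst; subst₂)
open import Relation.Binary.Structures using (IsEquivalence)
open import Relation.Nullary.Negation using (¬_; contradiction)
open import Relation.Nullary.Decidable using (yes; no)
open import Relation.Unary using (Pred; _∈_)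
import Relation.Binary.Reasoning.Setoid as SetoidReasoning

private variable
  c ℓ c′ ℓ′ e e′ : Level

-- Strictness of ⊕ on arrows is stated by transport along the equalities
-- +-assoc and +-identityʳ of ℕ, which are not definitional.
record PROP c ℓ : Set (lsuc (c ⊔ ℓ)) where
  infix  4 _≈_
  infixr 5 _⨾_
  infixr 6 _⊕_
  field
    Hom           : ℕ → ℕ → Set c
    _≈_           : ∀ {n m} → Rel (Hom n m) ℓ
    isEquivalence : ∀ {n m} → IsEquivalence (_≈_ {n} {m})

    id  : ∀ n → Hom n n
    _⨾_ : ∀ {n m k} → Hom n m → Hom m k → Hom n k
    _⊕_ : ∀ {n m n′ m′} → Hom n m → Hom n′ m′ → Hom (n + n′) (m + m′)
    σ   : ∀ n m → Hom (n + m) (m + n)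

    ⨾-cong  : ∀ {n m k} {f f′ : Hom n m} {g g′ : Hom m k} →
              f ≈ f′ → g ≈ g′ → f ⨾ g ≈ f′ ⨾ g′
    ⨾-assoc : ∀ {n m k l} (f : Hom n m) (g : Hom m k) (h : Hom k l) →
              (f ⨾ g) ⨾ h ≈ f ⨾ (g ⨾ h)
    ⨾-idˡ   : ∀ {n m} (f : Hom n m) → id n ⨾ f ≈ f
    ⨾-idʳ   : ∀ {n m} (f : Hom n m) → f ⨾ id m ≈ f

    ⊕-cong        : ∀ {n m n′ m′} {f f′ : Hom n m} {g g′ : Hom n′ m′} →
                    f ≈ f′ → g ≈ g′ → f ⊕ g ≈ f′ ⊕ g′
    ⊕-id          : ∀ n m → id n ⊕ id m ≈ id (n + m)
    ⊕-interchange : ∀ {n m k n′ m′ k′}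
                    (f : Hom n m) (g : Hom m k) (f′ : Hom n′ m′) (g′ : Hom m′ k′) →
                    (f ⨾ g) ⊕ (f′ ⨾ g′) ≈ (f ⊕ f′) ⨾ (g ⊕ g′)
    ⊕-assoc       : ∀ {n₁ m₁ n₂ m₂ n₃ m₃}
                    (f : Hom n₁ m₁) (g : Hom n₂ m₂) (h : Hom n₃ m₃) →
                    subst₂ Hom (+-assoc n₁ n₂ n₃) (+-assoc m₁ m₂ m₃) ((f ⊕ g) ⊕ h)
                      ≈ f ⊕ (g ⊕ h)
    ⊕-idˡ         : ∀ {n m} (f : Hom n m) → id 0 ⊕ f ≈ f
    ⊕-idʳ         : ∀ {n m} (f : Hom n m) →
                    subst₂ Hom (+-identityʳ n) (+-identityʳ m) (f ⊕ id 0) ≈ f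

    σ-natural    : ∀ {n m n′ m′} (f : Hom n m) (g : Hom n′ m′) →
                   (f ⊕ g) ⨾ σ m m′ ≈ σ n n′ ⨾ (g ⊕ f)
    σ-involutive : ∀ n m → σ n m ⨾ σ m n ≈ id (n + m)
    σ-hexagon    : ∀ n m k →
                   subst₂ Hom (+-assoc n m k) (+-assoc m n k) (σ n m ⊕ id k)
                     ⨾ (id m ⊕ σ n k)
                   ≈ subst₂ Hom ≡.refl (+-assoc m k n) (σ n (m + k))

  setoid : ℕ → ℕ → Setoid c ℓ
  setoid n m = record { isEquivalence = isEquivalence {n} {m} }

  module Eq {n m} = IsEquivalence (isEquivalence {n} {m})

record PROPMorphism (P : PROP c ℓ) (Q : PROP c′ ℓ′) : Set (c ⊔ ℓ ⊔ c′ ⊔ ℓ′) where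
  private
    module P = PROP P
    module Q = PROP Q
  field
    map    : ∀ {n m} → P.Hom n m → Q.Hom n m
    cong   : ∀ {n m} {f g : P.Hom n m} → f P.≈ g → map f Q.≈ map g
    map-id : ∀ n → map (P.id n) Q.≈ Q.id n
    map-⨾  : ∀ {n m k} (f : P.Hom n m) (g : P.Hom m k) →
             map (f P.⨾ g) Q.≈ map f Q.⨾ map g
    map-⊕  : ∀ {n m n′ m′} (f : P.Hom n m) (g : P.Hom n′ m′) →
             map (f P.⊕ g) Q.≈ map f Q.⊕ map g
    map-σ  : ∀ n m → map (P.σ n m) Q.≈ Q.σ n m

infix 4 _≅_

record _≅_ (P : PROP c ℓ) (Q : PROP c′ ℓ′) : Set (c ⊔ ℓ ⊔ c′ ⊔ ℓ′) where
  field
    to   : PROPMorphism P Q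
    from : PROPMorphism Q P
  private
    module P = PROP P
    module Q = PROP Q
    module to = PROPMorphism to
    module from = PROPMorphism from
  field
    from∘to : ∀ {n m} (f : P.Hom n m) → from.map (to.map f) P.≈ f
    to∘from : ∀ {n m} (g : Q.Hom n m) → to.map (from.map g) Q.≈ g

module Pullbacks (C : PROP c ℓ) where
  open PROP C

  record IsPullback {a b x p} (f : Hom a x) (g : Hom b x)
                    (p₁ : Hom p a) (p₂ : Hom p b) : Set (c ⊔ ℓ) where
    field
      commute     : p₁ ⨾ f ≈ p₂ ⨾ g
      universal   : ∀ {q} {h₁ : Hom q a} {h₂ : Hom q b} → h₁ ⨾ f ≈ h₂ ⨾ g → Hom q p
      universal⨾₁ : ∀ {q} {h₁ : Hom q a} {h₂ : Hom q b} (eq : h₁ ⨾ f ≈ h₂ ⨾ g) →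
                    universal eq ⨾ p₁ ≈ h₁
      universal⨾₂ : ∀ {q} {h₁ : Hom q a} {h₂ : Hom q b} (eq : h₁ ⨾ f ≈ h₂ ⨾ g) →
                    universal eq ⨾ p₂ ≈ h₂
      unique      : ∀ {q} {h₁ : Hom q a} {h₂ : Hom q b} (eq : h₁ ⨾ f ≈ h₂ ⨾ g)
                    {u : Hom q p} → u ⨾ p₁ ≈ h₁ → u ⨾ p₂ ≈ h₂ → u ≈ universal eq

  record Pullback {a b x} (f : Hom a x) (g : Hom b x) : Set (c ⊔ ℓ) where
    field
      {apex}     : ℕ
      p₁         : Hom apex a
      p₂         : Hom apex b
      isPullback : IsPullback f g p₁ p₂
    open IsPullback isPullback public

  HasPullbacks : Set (c ⊔ ℓ)
  HasPullbacks = ∀ {a b x} (f : Hom a x) (g : Hom b x) → Pullback f g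

  ⊕-PreservesPullbacks : Set (c ⊔ ℓ)
  ⊕-PreservesPullbacks =
    ∀ {a b x p a′ b′ x′ p′}
    {f : Hom a x} {g : Hom b x} {p₁ : Hom p a} {p₂ : Hom p b}
    {f′ : Hom a′ x′} {g′ : Hom b′ x′} {p₁′ : Hom p′ a′} {p₂′ : Hom p′ b′} →
    IsPullback f g p₁ p₂ → IsPullback f′ g′ p₁′ p₂′ →
    IsPullback (f ⊕ f′) (g ⊕ g′) (p₁ ⊕ p₁′) (p₂ ⊕ p₂′)

  record SpanArrow (n m : ℕ) : Set c where
    constructor mkSpan
    field
      {apex} : ℕ
      left   : Hom apex n
      right  : Hom apex m

  infix 4 _≃_

  record _≃_ {n m} (S T : SpanArrow n m) : Set (c ⊔ ℓ) where
    private
      module S = SpanArrow S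
      module T = SpanArrow T
    field
      to       : Hom S.apex T.apex
      from     : Hom T.apex S.apex
      to⨾from  : to ⨾ from ≈ id S.apex
      from⨾to  : from ⨾ to ≈ id T.apex
      to⨾left  : to ⨾ T.left ≈ S.left
      to⨾right : to ⨾ T.right ≈ S.right

module Spans (C : PROP c ℓ) (pullback : Pullbacks.HasPullbacks C)
             (⊕-pullback : Pullbacks.⊕-PreservesPullbacks C) where
  open PROP C
  open Pullbacks C

  module Span⨾ {n m k} (S : SpanArrow n m) (T : SpanArrow m k) where
    open Pullback (pullback (SpanArrow.right S) (SpanArrow.left T)) public

  infixr 5 _⨾ˢ_
  infixr 6 _⊕ˢ_

  _⨾ˢ_ : ∀ {n m k} → SpanArrow n m → SpanArrow m k → SpanArrow n k
  S ⨾ˢ T = mkSpan (p₁ ⨾ SpanArrow.left S) (p₂ ⨾ SpanArrow.right T)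
    where open Span⨾ S T

  _⊕ˢ_ : ∀ {n m n′ m′} → SpanArrow n m → SpanArrow n′ m′ → SpanArrow (n + n′) (m + m′)
  mkSpan l r ⊕ˢ mkSpan l′ r′ = mkSpan (l ⊕ l′) (r ⊕ r′)

  graph : ∀ {n m} → Hom n m → SpanArrow n m
  graph f = mkSpan (id _) f

  ⨾-congˡ : ∀ {n m k} {f f′ : Hom n m} {g : Hom m k} → f ≈ f′ → f ⨾ g ≈ f′ ⨾ g
  ⨾-congˡ p = ⨾-cong p Eq.refl

  ⨾-congʳ : ∀ {n m k} {f : Hom n m} {g g′ : Hom m k} → g ≈ g′ → f ⨾ g ≈ f ⨾ g′
  ⨾-congʳ p = ⨾-cong Eq.refl p

  sym-assoc : ∀ {n m k l} {f : Hom n m} {g : Hom m k} {h : Hom k l} →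
              f ⨾ (g ⨾ h) ≈ (f ⨾ g) ⨾ h
  sym-assoc = Eq.sym (⨾-assoc _ _ _)

  pullʳ : ∀ {n m k l} {f : Hom n m} {g : Hom m k} {h : Hom k l} {gh : Hom m l} →
          g ⨾ h ≈ gh → (f ⨾ g) ⨾ h ≈ f ⨾ gh
  pullʳ p = Eq.trans (⨾-assoc _ _ _) (⨾-congʳ p)

  pullˡ : ∀ {n m k l} {f : Hom n m} {g : Hom m k} {h : Hom k l} {fg : Hom n k} →
          f ⨾ g ≈ fg → f ⨾ (g ⨾ h) ≈ fg ⨾ h
  pullˡ p = Eq.trans sym-assoc (⨾-congˡ p)

  cancelˡ : ∀ {n m l} {f : Hom n m} {g : Hom m n} {h : Hom n l} →
            f ⨾ g ≈ id n → f ⨾ (g ⨾ h) ≈ h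
  cancelˡ p = Eq.trans (pullˡ p) (⨾-idˡ _)

  ≃-refl : ∀ {n m} {S : SpanArrow n m} → S ≃ S
  ≃-refl = record
    { to = id _ ; from = id _ ; to⨾from = ⨾-idˡ _ ; from⨾to = ⨾-idˡ _
    ; to⨾left = ⨾-idˡ _ ; to⨾right = ⨾-idˡ _ }

  ≃-sym : ∀ {n m} {S T : SpanArrow n m} → S ≃ T → T ≃ S
  ≃-sym α = record
    { to = α.from ; from = α.to ; to⨾from = α.from⨾to ; from⨾to = α.to⨾from
    ; to⨾left  = Eq.trans (⨾-congʳ (Eq.sym α.to⨾left)) (cancelˡ α.from⨾to)
    ; to⨾right = Eq.trans (⨾-congʳ (Eq.sym α.to⨾right)) (cancelˡ α.from⨾to) }
    where
    module α = _≃_ α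

  ≃-trans : ∀ {n m} {S T U : SpanArrow n m} → S ≃ T → T ≃ U → S ≃ U
  ≃-trans α β = record
    { to = α.to ⨾ β.to ; from = β.from ⨾ α.from
    ; to⨾from  = Eq.trans (pullʳ (cancelˡ β.to⨾from)) α.to⨾from
    ; from⨾to  = Eq.trans (pullʳ (cancelˡ α.from⨾to)) β.from⨾to
    ; to⨾left  = Eq.trans (pullʳ β.to⨾left) α.to⨾left
    ; to⨾right = Eq.trans (pullʳ β.to⨾right) α.to⨾right }
    where
    module α = _≃_ α
    module β = _≃_ β

  ≃-isEquivalence : ∀ {n m} → IsEquivalence (_≃_ {n} {m})
  ≃-isEquivalence = record { refl = ≃-refl ; sym = ≃-sym ; trans = ≃-trans }

  module ≃ {n m} = IsEquivalence (≃-isEquivalence {n} {m})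

  legs : ∀ {n m a} {l l′ : Hom a n} {r r′ : Hom a m} →
         l ≈ l′ → r ≈ r′ → mkSpan l r ≃ mkSpan l′ r′
  legs p q = record
    { to = id _ ; from = id _ ; to⨾from = ⨾-idˡ _ ; from⨾to = ⨾-idˡ _
    ; to⨾left  = Eq.trans (⨾-idˡ _) (Eq.sym p)
    ; to⨾right = Eq.trans (⨾-idˡ _) (Eq.sym q) }

  jointly-monic : ∀ {a b x p q} {f : Hom a x} {g : Hom b x} {p₁ : Hom p a} {p₂ : Hom p b} →
                  IsPullback f g p₁ p₂ → {u v : Hom q p} →
                  u ⨾ p₁ ≈ v ⨾ p₁ → u ⨾ p₂ ≈ v ⨾ p₂ → u ≈ v
  jointly-monic pb α β = Eq.trans (unique eq α β) (Eq.sym (unique eq Eq.refl Eq.refl))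
    where
    open IsPullback pb
    eq = Eq.trans (pullʳ commute) sym-assoc

  any-pullback : ∀ {n m k p} (S : SpanArrow n m) (T : SpanArrow m k)
                 {p₁ : Hom p (SpanArrow.apex S)} {p₂ : Hom p (SpanArrow.apex T)} →
                 IsPullback (SpanArrow.right S) (SpanArrow.left T) p₁ p₂ →
                 mkSpan (p₁ ⨾ SpanArrow.left S) (p₂ ⨾ SpanArrow.right T) ≃ S ⨾ˢ T
  any-pullback S T pb = record
    { to = t ; from = f
    ; to⨾from = jointly-monic pb
        (Eq.trans (pullʳ (P.universal⨾₁ _)) (Eq.trans (Q.universal⨾₁ _) (Eq.sym (⨾-idˡ _))))
        (Eq.trans (pullʳ (P.universal⨾₂ _)) (Eq.trans (Q.universal⨾₂ _) (Eq.sym (⨾-idˡ _))))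
    ; from⨾to = jointly-monic Q.isPullback
        (Eq.trans (pullʳ (Q.universal⨾₁ _)) (Eq.trans (P.universal⨾₁ _) (Eq.sym (⨾-idˡ _))))
        (Eq.trans (pullʳ (Q.universal⨾₂ _)) (Eq.trans (P.universal⨾₂ _) (Eq.sym (⨾-idˡ _))))
    ; to⨾left  = pullˡ (Q.universal⨾₁ _)
    ; to⨾right = pullˡ (Q.universal⨾₂ _) }
    where
    module P = IsPullback pb
    module Q = Span⨾ S T
    t = Q.universal P.commute
    f = P.universal Q.commute

  ⨾ˢ-cong : ∀ {n m k} {S S′ : SpanArrow n m} {T T′ : SpanArrow m k} →
            S ≃ S′ → T ≃ T′ → S ⨾ˢ T ≃ S′ ⨾ˢ T′
  ⨾ˢ-cong {S = S} {S′} {T} {T′} α β = ≃.trans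
    (legs (Eq.sym (pullʳ α.to⨾left)) (Eq.sym (pullʳ β.to⨾right)))
    (any-pullback S′ T′ {P.p₁ ⨾ α.to} {P.p₂ ⨾ β.to} record
      { commute     = Eq.trans (pullʳ α.to⨾right) (Eq.trans P.commute (Eq.sym (pullʳ β.to⨾left)))
      ; universal   = λ eq → P.universal (eq′ eq)
      ; universal⨾₁ = λ eq → Eq.trans (pullˡ (P.universal⨾₁ _)) (cancel α.from⨾to)
      ; universal⨾₂ = λ eq → Eq.trans (pullˡ (P.universal⨾₂ _)) (cancel β.from⨾to)
      ; unique      = λ eq u₁ u₂ → P.unique (eq′ eq)
          (Eq.sym (Eq.trans (⨾-congˡ (Eq.sym (Eq.trans (⨾-assoc _ _ _) u₁))) (cancel α.to⨾from)))
          (Eq.sym (Eq.trans (⨾-congˡ (Eq.sym (Eq.trans (⨾-assoc _ _ _) u₂))) (cancel β.to⨾from)))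
      })
    where
    module P = Span⨾ S T
    module α = _≃_ α
    module β = _≃_ β
    module α⁻ = _≃_ (≃.sym α)
    module β⁻ = _≃_ (≃.sym β)
    cancel : ∀ {a b x} {h : Hom x a} {f : Hom a b} {g : Hom b a} → f ⨾ g ≈ id a →
             (h ⨾ f) ⨾ g ≈ h
    cancel p = Eq.trans (pullʳ p) (⨾-idʳ _)
    eq′ : ∀ {q} {h₁ : Hom q _} {h₂ : Hom q _} →
          h₁ ⨾ SpanArrow.right S′ ≈ h₂ ⨾ SpanArrow.left T′ →
          (h₁ ⨾ α.from) ⨾ SpanArrow.right S ≈ (h₂ ⨾ β.from) ⨾ SpanArrow.left T
    eq′ eq = Eq.trans (pullʳ α⁻.to⨾right) (Eq.trans eq (Eq.sym (pullʳ β⁻.to⨾left)))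

  ⨾ˢ-assoc : ∀ {n m k l} (S : SpanArrow n m) (T : SpanArrow m k) (U : SpanArrow k l) →
             (S ⨾ˢ T) ⨾ˢ U ≃ S ⨾ˢ (T ⨾ˢ U)
  ⨾ˢ-assoc S T U = ≃.trans
    (≃.sym (any-pullback (S ⨾ˢ T) U {w} {Q.p₂ ⨾ TU.p₂} record
      { commute     = commute
      ; universal   = λ eq → Q.universal (outer eq)
      ; universal⨾₁ = λ eq → jointly-monic ST.isPullback
          (Eq.trans (pullʳ (ST.universal⨾₁ _)) (Q.universal⨾₁ _))
          (Eq.trans (pullʳ (ST.universal⨾₂ _))
            (Eq.trans (pullˡ (Q.universal⨾₂ _)) (TU.universal⨾₁ _)))
      ; universal⨾₂ = λ eq → Eq.trans (pullˡ (Q.universal⨾₂ _)) (TU.universal⨾₂ _)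
      ; unique      = λ {_} {h₁} {h₂} eq {u} u₁ u₂ → Q.unique (outer eq)
          (Eq.trans (⨾-congʳ (Eq.sym (ST.universal⨾₁ Q-eq))) (pullˡ u₁))
          (TU.unique (inner eq)
            (Eq.trans (⨾-assoc _ _ _)
              (Eq.trans (⨾-congʳ (Eq.sym (ST.universal⨾₂ Q-eq))) (pullˡ u₁)))
            (Eq.trans (⨾-assoc _ _ _) u₂))
      }))
    (legs (pullˡ (ST.universal⨾₁ _)) (⨾-assoc _ _ _))
    where
    module S = SpanArrow S
    module T = SpanArrow T
    module U = SpanArrow U
    module ST = Span⨾ S T
    module TU = Span⨾ T U
    module Q = Span⨾ S (T ⨾ˢ U)
    Q-eq : Q.p₁ ⨾ S.right ≈ (Q.p₂ ⨾ TU.p₁) ⨾ T.left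
    Q-eq = Eq.trans Q.commute sym-assoc
    w : Hom Q.apex ST.apex
    w = ST.universal Q-eq
    commute : w ⨾ (ST.p₂ ⨾ T.right) ≈ (Q.p₂ ⨾ TU.p₂) ⨾ U.left
    commute = Eq.trans (pullˡ (ST.universal⨾₂ _))
                (Eq.trans (pullʳ TU.commute) sym-assoc)
    module _ {q} {h₁ : Hom q ST.apex} {h₂ : Hom q U.apex}
             (eq : h₁ ⨾ (ST.p₂ ⨾ T.right) ≈ h₂ ⨾ U.left) where
      inner : (h₁ ⨾ ST.p₂) ⨾ T.right ≈ h₂ ⨾ U.left
      inner = Eq.trans (⨾-assoc _ _ _) eq
      outer : (h₁ ⨾ ST.p₁) ⨾ S.right ≈ TU.universal inner ⨾ (TU.p₁ ⨾ T.left)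
      outer = Eq.trans (pullʳ ST.commute)
                (Eq.trans sym-assoc (Eq.sym (pullˡ (TU.universal⨾₁ _))))

  iso-pullbackˡ : ∀ {n m a} {f : Hom n m} {g : Hom m n} {r : Hom a m} →
                  f ⨾ g ≈ id n → g ⨾ f ≈ id m → IsPullback f r (r ⨾ g) (id a)
  iso-pullbackˡ fg gf = record
    { commute     = Eq.trans (pullʳ gf) (Eq.trans (⨾-idʳ _) (Eq.sym (⨾-idˡ _)))
    ; universal   = λ {_} {_} {h₂} _ → h₂
    ; universal⨾₁ = λ eq → Eq.trans (pullˡ (Eq.sym eq)) (Eq.trans (pullʳ fg) (⨾-idʳ _))
    ; universal⨾₂ = λ _ → ⨾-idʳ _
    ; unique      = λ _ _ p → Eq.trans (Eq.sym (⨾-idʳ _)) p }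

  graph-⨾ˢ : ∀ {n m k} {f : Hom n m} {g : Hom m n} (T : SpanArrow m k) →
             f ⨾ g ≈ id n → g ⨾ f ≈ id m →
             graph f ⨾ˢ T ≃ mkSpan (SpanArrow.left T ⨾ g) (SpanArrow.right T)
  graph-⨾ˢ {f = f} T fg gf = ≃.trans
    (≃.sym (any-pullback (graph f) T (iso-pullbackˡ fg gf)))
    (legs (⨾-idʳ _) (⨾-idˡ _))

  ⨾ˢ-graph : ∀ {n m k} (S : SpanArrow n m) (g : Hom m k) →
             S ⨾ˢ graph g ≃ mkSpan (SpanArrow.left S) (SpanArrow.right S ⨾ g)
  ⨾ˢ-graph S g = ≃.trans
    (≃.sym (any-pullback S (graph g) {id _} {SpanArrow.right S} record
      { commute     = Eq.trans (⨾-idˡ _) (Eq.sym (⨾-idʳ _))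
      ; universal   = λ {_} {h₁} _ → h₁
      ; universal⨾₁ = λ _ → ⨾-idʳ _
      ; universal⨾₂ = λ eq → Eq.trans eq (⨾-idʳ _)
      ; unique      = λ _ p _ → Eq.trans (Eq.sym (⨾-idʳ _)) p }))
    (legs (⨾-idˡ _) Eq.refl)

  graph-⨾ : ∀ {n m k} (f : Hom n m) (g : Hom m k) → graph f ⨾ˢ graph g ≃ graph (f ⨾ g)
  graph-⨾ f g = ⨾ˢ-graph (graph f) g

  graph-⊕ : ∀ {n m n′ m′} (f : Hom n m) (g : Hom n′ m′) → graph f ⊕ˢ graph g ≃ graph (f ⊕ g)
  graph-⊕ f g = legs (⊕-id _ _) Eq.refl

  graph-cong : ∀ {n m} {f g : Hom n m} → f ≈ g → graph f ≃ graph g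
  graph-cong p = legs Eq.refl p

  graph-subst₂ : ∀ {n m n′ m′} (p : n ≡ n′) (q : m ≡ m′) (f : Hom n m) →
                 subst₂ SpanArrow p q (graph f) ≡ graph (subst₂ Hom p q f)
  graph-subst₂ ≡.refl ≡.refl f = ≡.refl

  subst₂-cong : ∀ {n m n′ m′} (p : n ≡ n′) (q : m ≡ m′) {S T : SpanArrow n m} →
                S ≃ T → subst₂ SpanArrow p q S ≃ subst₂ SpanArrow p q T
  subst₂-cong ≡.refl ≡.refl α = α

  subst₂-legs : ∀ {n m a n′ m′ a′} (p : n ≡ n′) (q : m ≡ m′) (r : a ≡ a′)
                {f : Hom a n} {g : Hom a m} {f′ : Hom a′ n′} {g′ : Hom a′ m′} →
                subst₂ Hom r p f ≈ f′ → subst₂ Hom r q g ≈ g′ →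
                subst₂ SpanArrow p q (mkSpan f g) ≃ mkSpan f′ g′
  subst₂-legs ≡.refl ≡.refl ≡.refl = legs

  ⊕ˢ-cong : ∀ {n m n′ m′} {S S′ : SpanArrow n m} {T T′ : SpanArrow n′ m′} →
            S ≃ S′ → T ≃ T′ → S ⊕ˢ T ≃ S′ ⊕ˢ T′
  ⊕ˢ-cong α β = record
    { to = α.to ⊕ β.to ; from = α.from ⊕ β.from
    ; to⨾from  = merge-id α.to⨾from β.to⨾from
    ; from⨾to  = merge-id α.from⨾to β.from⨾to
    ; to⨾left  = merge α.to⨾left β.to⨾left
    ; to⨾right = merge α.to⨾right β.to⨾right }
    where
    module α = _≃_ α
    module β = _≃_ β
    merge : ∀ {n m k n′ m′ k′} {f : Hom n m} {g : Hom m k} {h : Hom n k}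
            {f′ : Hom n′ m′} {g′ : Hom m′ k′} {h′ : Hom n′ k′} →
            f ⨾ g ≈ h → f′ ⨾ g′ ≈ h′ → (f ⊕ f′) ⨾ (g ⊕ g′) ≈ h ⊕ h′
    merge p q = Eq.trans (Eq.sym (⊕-interchange _ _ _ _)) (⊕-cong p q)
    merge-id : ∀ {n m n′ m′} {f : Hom n m} {g : Hom m n} {f′ : Hom n′ m′} {g′ : Hom m′ n′} →
               f ⨾ g ≈ id n → f′ ⨾ g′ ≈ id n′ → (f ⊕ f′) ⨾ (g ⊕ g′) ≈ id (n + n′)
    merge-id p q = Eq.trans (merge p q) (⊕-id _ _)

  ⊕ˢ-interchange : ∀ {n m k n′ m′ k′}
    (S : SpanArrow n m) (T : SpanArrow m k) (S′ : SpanArrow n′ m′) (T′ : SpanArrow m′ k′) →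
    (S ⨾ˢ T) ⊕ˢ (S′ ⨾ˢ T′) ≃ (S ⊕ˢ S′) ⨾ˢ (T ⊕ˢ T′)
  ⊕ˢ-interchange S T S′ T′ = ≃.trans
    (legs (⊕-interchange _ _ _ _) (⊕-interchange _ _ _ _))
    (any-pullback (S ⊕ˢ S′) (T ⊕ˢ T′)
      (⊕-pullback (Span⨾.isPullback S T) (Span⨾.isPullback S′ T′)))

  σˢ-natural : ∀ {n m n′ m′} (S : SpanArrow n m) (T : SpanArrow n′ m′) →
               (S ⊕ˢ T) ⨾ˢ graph (σ m m′) ≃ graph (σ n n′) ⨾ˢ (T ⊕ˢ S)
  σˢ-natural {n} {m} {n′} {m′} S T = ≃.trans (⨾ˢ-graph (S ⊕ˢ T) (σ m m′)) (≃.trans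
    (record
      { to = σ a a′ ; from = σ a′ a
      ; to⨾from = σ-involutive a a′ ; from⨾to = σ-involutive a′ a
      ; to⨾left  = Eq.trans (pullˡ (Eq.sym (σ-natural _ _)))
                     (Eq.trans (pullʳ (σ-involutive n n′)) (⨾-idʳ _))
      ; to⨾right = Eq.sym (σ-natural _ _) })
    (≃.sym (graph-⨾ˢ (T ⊕ˢ S) (σ-involutive n n′) (σ-involutive n′ n))))
    where
    a  = SpanArrow.apex S
    a′ = SpanArrow.apex T

  σˢ-hexagon : ∀ n m k →
    subst₂ SpanArrow (+-assoc n m k) (+-assoc m n k) (graph (σ n m) ⊕ˢ graph (id k))
      ⨾ˢ (graph (id m) ⊕ˢ graph (σ n k))
    ≃ subst₂ SpanArrow ≡.refl (+-assoc m k n) (graph (σ n (m + k)))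
  σˢ-hexagon n m k = ≃.trans
    (⨾ˢ-cong
      (≃.trans (subst₂-cong (+-assoc n m k) (+-assoc m n k) (graph-⊕ _ _))
        (≃.reflexive (graph-subst₂ (+-assoc n m k) (+-assoc m n k) _)))
      (graph-⊕ _ _))
    (≃.trans (graph-⨾ _ _)
      (≃.trans (graph-cong (σ-hexagon n m k))
        (≃.reflexive (≡.sym (graph-subst₂ ≡.refl (+-assoc m k n) _)))))

  Span : PROP c (c ⊔ ℓ)
  Span = record
    { Hom = SpanArrow ; _≈_ = _≃_ ; isEquivalence = ≃-isEquivalence
    ; id = λ n → mkSpan (id n) (id n)
    ; _⨾_ = _⨾ˢ_
    ; _⊕_ = _⊕ˢ_
    ; σ = λ n m → mkSpan (id (n + m)) (σ n m)
    ; ⨾-cong = ⨾ˢ-cong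
    ; ⨾-assoc = ⨾ˢ-assoc
    ; ⨾-idˡ = λ S → ≃.trans (graph-⨾ˢ S (⨾-idˡ _) (⨾-idˡ _)) (legs (⨾-idʳ _) Eq.refl)
    ; ⨾-idʳ = λ S → ≃.trans (⨾ˢ-graph S (id _)) (legs Eq.refl (⨾-idʳ _))
    ; ⊕-cong = ⊕ˢ-cong
    ; ⊕-id = λ n m → legs (⊕-id n m) (⊕-id n m)
    ; ⊕-interchange = ⊕ˢ-interchange
    ; ⊕-assoc = λ {n₁} {m₁} {n₂} {m₂} {n₃} {m₃} S T U →
        subst₂-legs (+-assoc n₁ n₂ n₃) (+-assoc m₁ m₂ m₃)
          (+-assoc (SpanArrow.apex S) (SpanArrow.apex T) (SpanArrow.apex U))
          (⊕-assoc _ _ _) (⊕-assoc _ _ _)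
    ; ⊕-idˡ = λ S → legs (⊕-idˡ _) (⊕-idˡ _)
    ; ⊕-idʳ = λ {n} {m} S →
        subst₂-legs (+-identityʳ n) (+-identityʳ m) (+-identityʳ (SpanArrow.apex S))
          (⊕-idʳ _) (⊕-idʳ _)
    ; σ-natural = σˢ-natural
    ; σ-involutive = λ n m → ≃.trans (graph-⨾ _ _) (graph-cong (σ-involutive n m))
    ; σ-hexagon = σˢ-hexagon
    }

module Matrices (R : CommutativeRing c ℓ) where
  open CommutativeRing R renaming
    (_+_ to _+ᴿ_; +-assoc to +ᴿ-assoc; +-identityʳ to +ᴿ-identityʳ; zero to *-zero)
  open import Algebra.Properties.Semiring.Sum semiring
    using (sum; sum-cong-≋; *-distribˡ-sum; *-distribʳ-sum; ∑-comm; ∑-distrib-+)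
  open SetoidReasoning setoid

  Matrix : ℕ → ℕ → Set c
  Matrix m n = Fin m → Fin n → Carrier

  infix  4 _≋_
  infixl 7 _·_
  infixr 6 _⊞_

  swap : ∀ n m → Fin (n + m) → Fin (m + n)
  swap n m i = join m n (Sum.swap (splitAt n i))

  _≋_ : ∀ {m n} → Rel (Matrix m n) ℓ
  A ≋ B = ∀ i j → A i j ≈ B i j

  δ : ∀ {n} → Matrix n n
  δ zero    zero    = 1#
  δ zero    (suc j) = 0#
  δ (suc i) zero    = 0#
  δ (suc i) (suc j) = δ i j

  _·_ : ∀ {m n k} → Matrix m n → Matrix n k → Matrix m k
  (A · B) i j = sum λ l → A i l * B l j

  block : ∀ {m n m′ n′} → Matrix m n → Matrix m′ n′ →
          Fin m ⊎ Fin m′ → Fin n ⊎ Fin n′ → Carrier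
  block A B (inj₁ i) (inj₁ j) = A i j
  block A B (inj₁ i) (inj₂ j) = 0#
  block A B (inj₂ i) (inj₁ j) = 0#
  block A B (inj₂ i) (inj₂ j) = B i j

  _⊞_ : ∀ {m n m′ n′} → Matrix m n → Matrix m′ n′ → Matrix (m + m′) (n + n′)
  _⊞_ {m} {n} A B i j = block A B (splitAt m i) (splitAt n j)

  permutationMatrix : ∀ {n m} → (Fin n → Fin m) → Matrix m n
  permutationMatrix f i j = δ i (f j)

  sum-0 : ∀ n {t : Fin n → Carrier} → (∀ i → t i ≈ 0#) → sum t ≈ 0#
  sum-0 zero    p = refl
  sum-0 (suc n) p = trans (+-cong (p zero) (sum-0 n (λ i → p (suc i)))) (+-identityˡ _)

  sum-δˡ : ∀ {n} (i : Fin n) (t : Fin n → Carrier) → sum (λ l → δ i l * t l) ≈ t i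
  sum-δˡ {suc n} zero t = trans (+-cong (*-identityˡ _) (sum-0 n (λ i → zeroˡ _))) (+ᴿ-identityʳ _)
  sum-δˡ {suc n} (suc i) t = trans (+-cong (zeroˡ _) (sum-δˡ i (λ l → t (suc l)))) (+-identityˡ _)

  δ-sym : ∀ {n} (i j : Fin n) → δ i j ≈ δ j i
  δ-sym zero    zero    = refl
  δ-sym zero    (suc j) = refl
  δ-sym (suc i) zero    = refl
  δ-sym (suc i) (suc j) = δ-sym i j

  sum-δʳ : ∀ {n} (j : Fin n) (t : Fin n → Carrier) → sum (λ l → t l * δ l j) ≈ t j
  sum-δʳ j t = trans
    (sum-cong-≋ (λ l → trans (*-comm (t l) (δ l j)) (*-congʳ (δ-sym l j))))
    (sum-δˡ j t)

  sum-+ : ∀ n {m} (t : Fin (n + m) → Carrier) →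
          sum t ≈ sum (λ i → t (i ↑ˡ m)) +ᴿ sum (λ i → t (n ↑ʳ i))
  sum-+ zero    t = sym (+-identityˡ _)
  sum-+ (suc n) t = trans (+-congˡ (sum-+ n (λ i → t (suc i)))) (sym (+ᴿ-assoc _ _ _))

  sum-splitAt : ∀ n {m} (t : Fin n ⊎ Fin m → Carrier) →
                sum (λ i → t (splitAt n i)) ≈ sum (λ i → t (inj₁ i)) +ᴿ sum (λ i → t (inj₂ i))
  sum-splitAt n {m} t = trans (sum-+ n (λ i → t (splitAt n i)))
    (+-cong (sum-cong-≋ (λ i → reflexive (≡.cong t (splitAt-↑ˡ n i m))))
            (sum-cong-≋ (λ i → reflexive (≡.cong t (splitAt-↑ʳ n m i)))))

  ·-cong : ∀ {m n k} {A A′ : Matrix m n} {B B′ : Matrix n k} →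
           A ≋ A′ → B ≋ B′ → A · B ≋ A′ · B′
  ·-cong p q i j = sum-cong-≋ (λ l → *-cong (p i l) (q l j))

  ·-assoc : ∀ {m n k l} (A : Matrix m n) (B : Matrix n k) (C : Matrix k l) →
            (A · B) · C ≋ A · (B · C)
  ·-assoc A B C i j = begin
    sum (λ y → sum (λ x → A i x * B x y) * C y j)
      ≈⟨ sum-cong-≋ (λ y → *-distribʳ-sum (C y j) (λ x → A i x * B x y)) ⟩
    sum (λ y → sum (λ x → (A i x * B x y) * C y j))
      ≈⟨ ∑-comm (λ y x → (A i x * B x y) * C y j) ⟩
    sum (λ x → sum (λ y → (A i x * B x y) * C y j))
      ≈⟨ sum-cong-≋ (λ x → sum-cong-≋ (λ y → *-assoc (A i x) (B x y) (C y j))) ⟩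
    sum (λ x → sum (λ y → A i x * (B x y * C y j)))
      ≈⟨ sum-cong-≋ (λ x → *-distribˡ-sum (A i x) (λ y → B x y * C y j)) ⟨
    sum (λ x → A i x * sum (λ y → B x y * C y j)) ∎

  ≋-isEquivalence : ∀ {m n} → IsEquivalence (_≋_ {m} {n})
  ≋-isEquivalence = record
    { refl = λ i j → refl ; sym = λ p i j → sym (p i j) ; trans = λ p q i j → trans (p i j) (q i j) }

  module ≋ {m n} = IsEquivalence (≋-isEquivalence {m} {n})

  block-cong : ∀ {m n m′ n′} {A A′ : Matrix m n} {B B′ : Matrix m′ n′} →
               A ≋ A′ → B ≋ B′ → ∀ x y → block A B x y ≈ block A′ B′ x y
  block-cong p q (inj₁ i) (inj₁ j) = p i j
  block-cong p q (inj₁ i) (inj₂ j) = refl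
  block-cong p q (inj₂ i) (inj₁ j) = refl
  block-cong p q (inj₂ i) (inj₂ j) = q i j

  block-δ : ∀ n {m} (i j : Fin (n + m)) → block δ δ (splitAt n i) (splitAt n j) ≈ δ i j
  block-δ zero    i       j       = refl
  block-δ (suc n) zero    zero    = refl
  block-δ (suc n) zero    (suc j) with splitAt n j
  ... | inj₁ _ = refl
  ... | inj₂ _ = refl
  block-δ (suc n) (suc i) zero    with splitAt n i
  ... | inj₁ _ = refl
  ... | inj₂ _ = refl
  block-δ (suc n) (suc i) (suc j) with splitAt n i | splitAt n j | block-δ n i j
  ... | inj₁ _ | inj₁ _ | p = p
  ... | inj₁ _ | inj₂ _ | p = p
  ... | inj₂ _ | inj₁ _ | p = p
  ... | inj₂ _ | inj₂ _ | p = p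

  block-· : ∀ {m n k m′ n′ k′}
            (A : Matrix m n) (B : Matrix n k) (A′ : Matrix m′ n′) (B′ : Matrix n′ k′) x z →
            block (A · B) (A′ · B′) x z
              ≈ sum (λ l → block A A′ x (inj₁ l) * block B B′ (inj₁ l) z)
                +ᴿ sum (λ l → block A A′ x (inj₂ l) * block B B′ (inj₂ l) z)
  block-· {n = n} {n′ = n′} A B A′ B′ (inj₁ i) (inj₁ j) =
    sym (trans (+-congˡ (sum-0 n′ (λ _ → zeroˡ _))) (+ᴿ-identityʳ _))
  block-· {n = n} {n′ = n′} A B A′ B′ (inj₁ i) (inj₂ j) =
    sym (trans (+-cong (sum-0 n (λ _ → zeroʳ _)) (sum-0 n′ (λ _ → zeroˡ _))) (+ᴿ-identityʳ _))
  block-· {n = n} {n′ = n′} A B A′ B′ (inj₂ i) (inj₁ j) =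
    sym (trans (+-cong (sum-0 n (λ _ → zeroˡ _)) (sum-0 n′ (λ _ → zeroʳ _))) (+ᴿ-identityʳ _))
  block-· {n = n} {n′ = n′} A B A′ B′ (inj₂ i) (inj₂ j) =
    sym (trans (+-congʳ (sum-0 n (λ _ → zeroˡ _))) (+-identityˡ _))

  ⊞-· : ∀ {m n k m′ n′ k′}
        (A : Matrix m n) (B : Matrix n k) (A′ : Matrix m′ n′) (B′ : Matrix n′ k′) →
        (A · B) ⊞ (A′ · B′) ≋ (A ⊞ A′) · (B ⊞ B′)
  ⊞-· {m} {n} {k} A B A′ B′ i j = trans
    (block-· A B A′ B′ (splitAt m i) (splitAt k j))
    (sym (sum-splitAt n
      (λ y → block A A′ (splitAt m i) y * block B B′ y (splitAt k j))))

  subst₂-matrix : ∀ {m n m′ n′} (p : n ≡ n′) (q : m ≡ m′) (A : Matrix m n) i j →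
                  subst₂ (flip Matrix) p q A i j ≡ A (cast (≡.sym q) i) (cast (≡.sym p) j)
  subst₂-matrix ≡.refl ≡.refl A i j =
    ≡.sym (≡.cong₂ A (cast-is-id ≡.refl i) (cast-is-id ≡.refl j))

  splitAt-cast-0 : ∀ {n} .(p : n ≡ n + 0) (i : Fin n) → splitAt n (cast p i) ≡ inj₁ i
  splitAt-cast-0 {suc n} p zero    = ≡.refl
  splitAt-cast-0 {suc n} p (suc i) =
    ≡.cong (Sum.map suc (λ x → x)) (splitAt-cast-0 _ i)

  reassoc : ∀ {a b d} → Fin a ⊎ Fin (b + d) → Fin (a + b) ⊎ Fin d
  reassoc {a} {b}     (inj₁ i) = inj₁ (i ↑ˡ b)
  reassoc {a} {b} {d} (inj₂ i) = Sum.map (a ↑ʳ_) (λ x → x) (splitAt b {d} i)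

  splitAt-cast-+ : ∀ a b d .(p : a + (b + d) ≡ (a + b) + d) (i : Fin (a + (b + d))) →
                   splitAt (a + b) (cast p i) ≡ reassoc (splitAt a i)
  splitAt-cast-+ zero b d p i =
    ≡.trans (≡.cong (splitAt b) (cast-is-id p i)) (≡.sym (map-id (splitAt b i)))
    where
    map-id : (x : Fin b ⊎ Fin d) → Sum.map (λ x → x) (λ x → x) x ≡ x
    map-id (inj₁ _) = ≡.refl
    map-id (inj₂ _) = ≡.refl
  splitAt-cast-+ (suc a) b d p zero    = ≡.refl
  splitAt-cast-+ (suc a) b d p (suc i) = ≡.trans
    (≡.cong (Sum.map suc (λ x → x)) (splitAt-cast-+ a b d _ i)) (shift (splitAt a i))
    where
    shift : (x : Fin a ⊎ Fin (b + d)) →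
            Sum.map suc (λ y → y) (reassoc {a} {b} {d} x) ≡ reassoc {suc a} {b} {d} (Sum.map suc (λ y → y) x)
    shift (inj₁ _) = ≡.refl
    shift (inj₂ y) with splitAt b {d} y
    ... | inj₁ _ = ≡.refl
    ... | inj₂ _ = ≡.refl

  block-reassoc : ∀ {m₁ n₁ m₂ n₂ m₃ n₃}
                  (A : Matrix m₁ n₁) (B : Matrix m₂ n₂) (C : Matrix m₃ n₃) x y →
                  block (A ⊞ B) C (reassoc x) (reassoc y) ≈ block A (B ⊞ C) x y
  block-reassoc {m₁} {n₁} {m₂} {n₂} A B C = go
    where
    atˡ : ∀ i j → (A ⊞ B) (i ↑ˡ m₂) j ≡ block A B (inj₁ i) (splitAt n₁ j)
    atˡ i j = ≡.cong (λ x → block A B x (splitAt n₁ j)) (splitAt-↑ˡ m₁ i m₂)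
    atʳ : ∀ i j → (A ⊞ B) (m₁ ↑ʳ i) j ≡ block A B (inj₂ i) (splitAt n₁ j)
    atʳ i j = ≡.cong (λ x → block A B x (splitAt n₁ j)) (splitAt-↑ʳ m₁ m₂ i)
    go : ∀ x y → block (A ⊞ B) C (reassoc x) (reassoc y) ≈ block A (B ⊞ C) x y
    go (inj₁ i) (inj₁ j) = reflexive (≡.trans (atˡ i (j ↑ˡ n₂))
      (≡.cong (block A B (inj₁ i)) (splitAt-↑ˡ n₁ j n₂)))
    go (inj₁ i) (inj₂ j) with splitAt n₂ j
    ... | inj₁ j′ = reflexive (≡.trans (atˡ i (n₁ ↑ʳ j′))
      (≡.cong (block A B (inj₁ i)) (splitAt-↑ʳ n₁ n₂ j′)))
    ... | inj₂ j′ = refl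
    go (inj₂ i) (inj₁ j) with splitAt m₂ i
    ... | inj₁ i′ = reflexive (≡.trans (atʳ i′ (j ↑ˡ n₂))
      (≡.cong (block A B (inj₂ i′)) (splitAt-↑ˡ n₁ j n₂)))
    ... | inj₂ i′ = refl
    go (inj₂ i) (inj₂ j) with splitAt m₂ i | splitAt n₂ j
    ... | inj₁ i′ | inj₁ j′ = reflexive (≡.trans (atʳ i′ (n₁ ↑ʳ j′))
      (≡.cong (block A B (inj₂ i′)) (splitAt-↑ʳ n₁ n₂ j′)))
    ... | inj₁ i′ | inj₂ j′ = refl
    ... | inj₂ i′ | inj₁ j′ = refl
    ... | inj₂ i′ | inj₂ j′ = refl

  ⊞-assoc : ∀ {m₁ n₁ m₂ n₂ m₃ n₃} (A : Matrix m₁ n₁) (B : Matrix m₂ n₂) (C : Matrix m₃ n₃) →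
            subst₂ (flip Matrix) (+-assoc n₁ n₂ n₃) (+-assoc m₁ m₂ m₃) ((A ⊞ B) ⊞ C)
              ≋ A ⊞ (B ⊞ C)
  ⊞-assoc {m₁} {n₁} {m₂} {n₂} {m₃} {n₃} A B C i j = begin
    subst₂ (flip Matrix) p q ((A ⊞ B) ⊞ C) i j
      ≡⟨ subst₂-matrix p q ((A ⊞ B) ⊞ C) i j ⟩
    block (A ⊞ B) C (splitAt (m₁ + m₂) (cast (≡.sym q) i)) (splitAt (n₁ + n₂) (cast (≡.sym p) j))
      ≡⟨ ≡.cong₂ (block (A ⊞ B) C) (splitAt-cast-+ m₁ m₂ m₃ (≡.sym q) i)
                                   (splitAt-cast-+ n₁ n₂ n₃ (≡.sym p) j) ⟩
    block (A ⊞ B) C (reassoc (splitAt m₁ i)) (reassoc (splitAt n₁ j))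
      ≈⟨ block-reassoc A B C (splitAt m₁ i) (splitAt n₁ j) ⟩
    block A (B ⊞ C) (splitAt m₁ i) (splitAt n₁ j) ∎
    where
    p = +-assoc n₁ n₂ n₃
    q = +-assoc m₁ m₂ m₃

  ⊞-identityʳ : ∀ {m n} (A : Matrix m n) →
                subst₂ (flip Matrix) (+-identityʳ n) (+-identityʳ m) (A ⊞ δ {0}) ≋ A
  ⊞-identityʳ {m} {n} A i j = reflexive (≡.trans
    (subst₂-matrix (+-identityʳ n) (+-identityʳ m) (A ⊞ δ {0}) i j)
    (≡.cong₂ (block A (δ {0})) (splitAt-cast-0 _ i) (splitAt-cast-0 _ j)))

  δ-injective : ∀ {n m} {f : Fin n → Fin m} → (∀ {i j} → f i ≡ f j → i ≡ j) →
                ∀ i j → δ (f i) (f j) ≈ δ i j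
  δ-injective {f = f} inj i j with i Finₚ.≟ j
  ... | yes ≡.refl = trans (δ-1 (f i)) (sym (δ-1 i))
    where
    δ-1 : ∀ {n} (i : Fin n) → δ i i ≈ 1#
    δ-1 zero    = refl
    δ-1 (suc i) = δ-1 i
  ... | no  i≢j    = trans (δ-0 (f i) (f j) (λ p → i≢j (inj p))) (sym (δ-0 i j i≢j))
    where
    δ-0 : ∀ {n} (i j : Fin n) → ¬ i ≡ j → δ i j ≈ 0#
    δ-0 zero    zero    p = contradiction ≡.refl p
    δ-0 zero    (suc j) p = refl
    δ-0 (suc i) zero    p = refl
    δ-0 (suc i) (suc j) p = δ-0 i j (λ q → p (≡.cong suc q))

  splitAt-swap : ∀ n m i → splitAt m (swap n m i) ≡ Sum.swap (splitAt n i)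
  splitAt-swap n m i = splitAt-join m n (Sum.swap (splitAt n i))

  swap-involutive-Fin : ∀ n m i → swap m n (swap n m i) ≡ i
  swap-involutive-Fin n m i = ≡.trans
    (≡.cong (λ x → join n m (Sum.swap x)) (splitAt-swap n m i))
    (≡.trans (≡.cong (join n m) (swap-involutive (splitAt n i))) (join-splitAt n m i))

  δ-swap : ∀ n m i j → δ i (swap n m j) ≈ δ (swap m n i) j
  δ-swap n m i j = trans
    (sym (δ-injective {f = swap m n} swap-injective i (swap n m j)))
    (reflexive (≡.cong (δ (swap m n i)) (swap-involutive-Fin n m j)))
    where
    swap-injective : ∀ {i j} → swap m n i ≡ swap m n j → i ≡ j
    swap-injective {i} {j} p = ≡.trans (≡.sym (swap-involutive-Fin m n i))
      (≡.trans (≡.cong (swap n m) p) (swap-involutive-Fin m n j))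

  permutation-·ʳ : ∀ {m n k} (A : Matrix m n) (f : Fin k → Fin n) →
                   A · permutationMatrix f ≋ λ i j → A i (f j)
  permutation-·ʳ A f i j = sum-δʳ (f j) (A i)

  swap-·ˡ : ∀ {n m k} (A : Matrix (n + m) k) →
            permutationMatrix (swap n m) · A ≋ λ i j → A (swap m n i) j
  swap-·ˡ {n} {m} A i j = trans
    (sum-cong-≋ (λ l → *-congʳ (δ-swap n m i l)))
    (sum-δˡ (swap m n i) (λ l → A l j))

  swap-natural : ∀ {n m n′ m′} (A : Matrix m n) (B : Matrix m′ n′) →
                 permutationMatrix (swap m m′) · (A ⊞ B)
                   ≋ (B ⊞ A) · permutationMatrix (swap n n′)
  swap-natural {n} {m} {n′} {m′} A B i j = begin
    (permutationMatrix (swap m m′) · (A ⊞ B)) i j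
      ≈⟨ swap-·ˡ {m} {m′} (A ⊞ B) i j ⟩
    block A B (splitAt m (swap m′ m i)) (splitAt n j)
      ≡⟨ ≡.cong (λ x → block A B x (splitAt n j)) (splitAt-swap m′ m i) ⟩
    block A B (Sum.swap (splitAt m′ i)) (splitAt n j)
      ≡⟨ block-swap (splitAt m′ i) (splitAt n j) ⟩
    block B A (splitAt m′ i) (Sum.swap (splitAt n j))
      ≡⟨ ≡.cong (block B A (splitAt m′ i)) (splitAt-swap n n′ j) ⟨
    (B ⊞ A) i (swap n n′ j)
      ≈⟨ permutation-·ʳ (B ⊞ A) (swap n n′) i j ⟨
    ((B ⊞ A) · permutationMatrix (swap n n′)) i j ∎
    where
    block-swap : ∀ x y → block A B (Sum.swap x) y ≡ block B A x (Sum.swap y)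
    block-swap (inj₁ _) (inj₁ _) = ≡.refl
    block-swap (inj₁ _) (inj₂ _) = ≡.refl
    block-swap (inj₂ _) (inj₁ _) = ≡.refl
    block-swap (inj₂ _) (inj₂ _) = ≡.refl

  _⊞ᶠ_ : ∀ {n m n′ m′} → (Fin n → Fin m) → (Fin n′ → Fin m′) → Fin (n + n′) → Fin (m + m′)
  _⊞ᶠ_ {n} {m} {n′} {m′} f g i = join m m′ (Sum.map f g (splitAt n i))

  permutation-⊞ : ∀ {n m n′ m′} (f : Fin n → Fin m) (g : Fin n′ → Fin m′) →
                  permutationMatrix f ⊞ permutationMatrix g ≋ permutationMatrix (f ⊞ᶠ g)
  permutation-⊞ {n} {m} {n′} {m′} f g i j = begin
    block (permutationMatrix f) (permutationMatrix g) (splitAt m i) (splitAt n j)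
      ≡⟨ lemma (splitAt m i) (splitAt n j) ⟩
    block δ δ (splitAt m i) (Sum.map f g (splitAt n j))
      ≡⟨ ≡.cong (block δ δ (splitAt m i)) (splitAt-join m m′ (Sum.map f g (splitAt n j))) ⟨
    block δ δ (splitAt m i) (splitAt m ((f ⊞ᶠ g) j))
      ≈⟨ block-δ m i ((f ⊞ᶠ g) j) ⟩
    δ i ((f ⊞ᶠ g) j) ∎
    where
    lemma : ∀ x y → block (permutationMatrix f) (permutationMatrix g) x y
                      ≡ block δ δ x (Sum.map f g y)
    lemma (inj₁ _) (inj₁ _) = ≡.refl
    lemma (inj₁ _) (inj₂ _) = ≡.refl
    lemma (inj₂ _) (inj₁ _) = ≡.refl
    lemma (inj₂ _) (inj₂ _) = ≡.refl

  permutation-subst₂ : ∀ {n m n′ m′} (p : n ≡ n′) (q : m ≡ m′) (f : Fin n → Fin m) →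
                       subst₂ (flip Matrix) p q (permutationMatrix f)
                         ≋ permutationMatrix (λ i → cast q (f (cast (≡.sym p) i)))
  permutation-subst₂ ≡.refl ≡.refl f i j = reflexive (≡.cong (δ i)
    (≡.sym (≡.trans (cast-is-id ≡.refl _) (≡.cong f (cast-is-id ≡.refl j)))))

  permutation-· : ∀ {n m k} (f : Fin m → Fin k) (g : Fin n → Fin m) →
                  permutationMatrix f · permutationMatrix g
                    ≋ permutationMatrix (λ i → f (g i))
  permutation-· f g = permutation-·ʳ (permutationMatrix f) g

  permutation-cong : ∀ {n m} {f g : Fin n → Fin m} → (∀ i → f i ≡ g i) →
                     permutationMatrix f ≋ permutationMatrix g
  permutation-cong p i j = reflexive (≡.cong (δ i) (p j))

  swap-↑ˡ : ∀ n m i → swap n m (i ↑ˡ m) ≡ m ↑ʳ i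
  swap-↑ˡ n m i = ≡.cong (λ x → join m n (Sum.swap x)) (splitAt-↑ˡ n i m)

  swap-↑ʳ : ∀ n m i → swap n m (n ↑ʳ i) ≡ i ↑ˡ n
  swap-↑ʳ n m i = ≡.cong (λ x → join m n (Sum.swap x)) (splitAt-↑ʳ n m i)

  ⊞ᶠ-↑ˡ : ∀ {n m n′ m′} (f : Fin n → Fin m) (g : Fin n′ → Fin m′) i →
          (f ⊞ᶠ g) (i ↑ˡ n′) ≡ f i ↑ˡ m′
  ⊞ᶠ-↑ˡ {n} {m} {n′} {m′} f g i = ≡.cong (λ x → join m m′ (Sum.map f g x)) (splitAt-↑ˡ n i n′)

  ⊞ᶠ-↑ʳ : ∀ {n m n′ m′} (f : Fin n → Fin m) (g : Fin n′ → Fin m′) i →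
          (f ⊞ᶠ g) (n ↑ʳ i) ≡ m ↑ʳ g i
  ⊞ᶠ-↑ʳ {n} {m} {n′} {m′} f g i = ≡.cong (λ x → join m m′ (Sum.map f g x)) (splitAt-↑ʳ n n′ i)

  data Three n m k : Fin (n + (m + k)) → Set where
    in₁ : (i : Fin n) → Three n m k (i ↑ˡ (m + k))
    in₂ : (i : Fin m) → Three n m k (n ↑ʳ (i ↑ˡ k))
    in₃ : (i : Fin k) → Three n m k (n ↑ʳ (m ↑ʳ i))

  three : ∀ n m k i → Three n m k i
  three n m k i with splitAt n i in eq
  ... | inj₁ x = subst (Three n m k) (Finₚ.splitAt⁻¹-↑ˡ {n} eq) (in₁ x)
  ... | inj₂ y with splitAt m y in eq′
  ...   | inj₁ x = subst (Three n m k)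
                     (≡.trans (≡.cong (n ↑ʳ_) (Finₚ.splitAt⁻¹-↑ˡ eq′)) (Finₚ.splitAt⁻¹-↑ʳ eq)) (in₂ x)
  ...   | inj₂ x = subst (Three n m k)
                     (≡.trans (≡.cong (n ↑ʳ_) (Finₚ.splitAt⁻¹-↑ʳ eq′)) (Finₚ.splitAt⁻¹-↑ʳ eq)) (in₃ x)

  cast-in₁ : ∀ n m k (i : Fin n) .(p : n + (m + k) ≡ (n + m) + k) →
             cast p (i ↑ˡ (m + k)) ≡ (i ↑ˡ m) ↑ˡ k
  cast-in₁ n m k i p = toℕ-injective (≡.trans (toℕ-cast p (i ↑ˡ (m + k))) (≡.trans
    (toℕ-↑ˡ i (m + k)) (≡.sym (≡.trans (toℕ-↑ˡ (i ↑ˡ m) k) (toℕ-↑ˡ i m)))))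

  cast-in₂ : ∀ n m k (i : Fin m) .(p : n + (m + k) ≡ (n + m) + k) →
             cast p (n ↑ʳ (i ↑ˡ k)) ≡ (n ↑ʳ i) ↑ˡ k
  cast-in₂ n m k i p = toℕ-injective (≡.trans (toℕ-cast p (n ↑ʳ (i ↑ˡ k))) (≡.trans
    (≡.trans (toℕ-↑ʳ n (i ↑ˡ k)) (≡.cong (n +_) (toℕ-↑ˡ i k)))
    (≡.sym (≡.trans (toℕ-↑ˡ (n ↑ʳ i) k) (toℕ-↑ʳ n i)))))

  cast-in₃ : ∀ n m k (i : Fin k) .(p : n + (m + k) ≡ (n + m) + k) →
             cast p (n ↑ʳ (m ↑ʳ i)) ≡ (n + m) ↑ʳ i
  cast-in₃ n m k i p = toℕ-injective (≡.trans (toℕ-cast p (n ↑ʳ (m ↑ʳ i))) (≡.trans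
    (≡.trans (toℕ-↑ʳ n (m ↑ʳ i)) (≡.cong (n +_) (toℕ-↑ʳ m i)))
    (≡.sym (≡.trans (toℕ-↑ʳ (n + m) i) (+-assoc n m _)))))

  cast-flip : ∀ {n m} .(p : n ≡ m) .(q : m ≡ n) {i j} → cast p i ≡ j → cast q j ≡ i
  cast-flip p q {i} ≡.refl = Finₚ.cast-involutive q p i

  swap-hexagon : ∀ n m k i →
    (_⊞ᶠ_ {m} {m} (λ x → x) (swap n k))
      (cast (+-assoc m n k) ((swap n m ⊞ᶠ (λ x → x)) (cast (≡.sym (+-assoc n m k)) i)))
    ≡ cast (+-assoc m k n) (swap n (m + k) (cast ≡.refl i))
  swap-hexagon n m k i = ≡.trans (go i (three n m k i))
    (≡.cong (λ x → cast (+-assoc m k n) (swap n (m + k) x)) (≡.sym (cast-is-id ≡.refl i)))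
    where
    f = swap n m ⊞ᶠ (λ (x : Fin k) → x)
    g = _⊞ᶠ_ {m} {m} (λ x → x) (swap n k)
    p = ≡.sym (+-assoc n m k)
    q = +-assoc m n k
    r = +-assoc m k n
    go : (i : Fin (n + (m + k))) → Three n m k i → g (cast q (f (cast p i))) ≡ cast r (swap n (m + k) i)
    go _ (in₁ i) = ≡.trans
      (≡.cong g (≡.trans (≡.cong (cast q) (≡.trans (≡.cong f (cast-in₁ n m k i p))
        (≡.trans (⊞ᶠ-↑ˡ (swap n m) (λ x → x) (i ↑ˡ m)) (≡.cong (_↑ˡ k) (swap-↑ˡ n m i)))))
        (cast-flip (≡.sym q) q (cast-in₂ m n k i (≡.sym q)))))
      (≡.trans (⊞ᶠ-↑ʳ {m} {m} (λ x → x) (swap n k) (i ↑ˡ k))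
      (≡.trans (≡.cong (m ↑ʳ_) (swap-↑ˡ n k i))
      (≡.sym (≡.trans (≡.cong (cast r) (swap-↑ˡ n (m + k) i))
        (cast-flip (≡.sym r) r (cast-in₃ m k n i (≡.sym r)))))))
    go _ (in₂ i) = ≡.trans
      (≡.cong g (≡.trans (≡.cong (cast q) (≡.trans (≡.cong f (cast-in₂ n m k i p))
        (≡.trans (⊞ᶠ-↑ˡ (swap n m) (λ x → x) (n ↑ʳ i)) (≡.cong (_↑ˡ k) (swap-↑ʳ n m i)))))
        (cast-flip (≡.sym q) q (cast-in₁ m n k i (≡.sym q)))))
      (≡.trans (⊞ᶠ-↑ˡ {m} {m} (λ x → x) (swap n k) i)
      (≡.sym (≡.trans (≡.cong (cast r) (swap-↑ʳ n (m + k) (i ↑ˡ k)))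
        (cast-flip (≡.sym r) r (cast-in₁ m k n i (≡.sym r))))))
    go _ (in₃ i) = ≡.trans
      (≡.cong g (≡.trans (≡.cong (cast q) (≡.trans (≡.cong f (cast-in₃ n m k i p))
        (⊞ᶠ-↑ʳ (swap n m) (λ x → x) i)))
        (cast-flip (≡.sym q) q (cast-in₃ m n k i (≡.sym q)))))
      (≡.trans (⊞ᶠ-↑ʳ {m} {m} (λ x → x) (swap n k) (n ↑ʳ i))
      (≡.trans (≡.cong (m ↑ʳ_) (swap-↑ʳ n k i))
      (≡.sym (≡.trans (≡.cong (cast r) (swap-↑ʳ n (m + k) (m ↑ʳ i)))
        (cast-flip (≡.sym r) r (cast-in₂ m k n i (≡.sym r)))))))

  matrix-hexagon : ∀ n m k →
    (δ {m} ⊞ permutationMatrix (swap n k))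
      · subst₂ (flip Matrix) (+-assoc n m k) (+-assoc m n k)
          (permutationMatrix (swap n m) ⊞ δ {k})
    ≋ subst₂ (flip Matrix) ≡.refl (+-assoc m k n) (permutationMatrix (swap n (m + k)))
  matrix-hexagon n m k = ≋.trans
    (·-cong (permutation-⊞ {m} {m} (λ x → x) (swap n k))
      (≋.trans (subst₂-≋ (+-assoc n m k) (+-assoc m n k) (permutation-⊞ (swap n m) (λ (x : Fin k) → x)))
        (permutation-subst₂ (+-assoc n m k) (+-assoc m n k) (swap n m ⊞ᶠ (λ (x : Fin k) → x)))))
    (≋.trans (permutation-· (_⊞ᶠ_ {m} {m} (λ x → x) (swap n k))
      (λ i → cast (+-assoc m n k) ((swap n m ⊞ᶠ (λ (x : Fin k) → x))
        (cast (≡.sym (+-assoc n m k)) i))))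
    (≋.trans (permutation-cong (swap-hexagon n m k))
      (≋.sym (permutation-subst₂ ≡.refl (+-assoc m k n) (swap n (m + k))))))
    where
    subst₂-≋ : ∀ {n m n′ m′} (p : n ≡ n′) (q : m ≡ m′) {A B : Matrix m n} → A ≋ B →
               subst₂ (flip Matrix) p q A ≋ subst₂ (flip Matrix) p q B
    subst₂-≋ ≡.refl ≡.refl α = α

  Mat : PROP c ℓ
  Mat = record
    { Hom = λ n m → Matrix m n ; _≈_ = _≋_ ; isEquivalence = ≋-isEquivalence
    ; id = λ n → δ
    ; _⨾_ = λ A B → B · A
    ; _⊕_ = _⊞_
    ; σ = λ n m → permutationMatrix (swap n m)
    ; ⨾-cong = λ p q → ·-cong q p
    ; ⨾-assoc = λ A B C → ≋.sym (·-assoc C B A)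
    ; ⨾-idˡ = λ A i j → sum-δʳ j (A i)
    ; ⨾-idʳ = λ A i j → sum-δˡ i (λ l → A l j)
    ; ⊕-cong = λ {n} {m} p q i j → block-cong p q (splitAt m i) (splitAt n j)
    ; ⊕-id = λ n m → block-δ n
    ; ⊕-interchange = λ A B A′ B′ → ⊞-· B A B′ A′
    ; ⊕-assoc = ⊞-assoc
    ; ⊕-idˡ = λ A i j → refl
    ; ⊕-idʳ = ⊞-identityʳ
    ; σ-natural = swap-natural
    ; σ-involutive = λ n m → ≋.trans (permutation-· (swap m n) (swap n m))
        (permutation-cong (swap-involutive-Fin n m))
    ; σ-hexagon = matrix-hexagon
    }

module _ (R : CommutativeRing c ℓ) where
  open CommutativeRing R using (Carrier; _≈_; _≉_; 0#; 1#; _*_; *-rawMagma) renaming (_+_ to _+ᴿ_)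
  open import Algebra.Definitions.RawMagma *-rawMagma using (_∣_)

  record IsIdeal {p} (I : Pred Carrier p) : Set (c ⊔ ℓ ⊔ p) where
    field
      resp     : I Respects _≈_
      0∈       : 0# ∈ I
      +-closed : ∀ {x y} → x ∈ I → y ∈ I → x +ᴿ y ∈ I
      *-closed : ∀ r {x} → x ∈ I → r * x ∈ I

  -- The textbook definition: an integral domain in which every ideal,
  -- without any decidability or finiteness assumption on it, has a generator.
  -- Applied to ideals such as { y | y ≈ 0# or P }, the last field decides P
  -- (compare zero? below), so classical reasoning is available for propositions
  -- of level c ⊔ ℓ.
  record IsPID : Set (lsuc (c ⊔ ℓ)) where
    field
      1≉0            : 1# ≉ 0#
      noZeroDivisors : ∀ {x y} → x * y ≈ 0# → x ≈ 0# ⊎ y ≈ 0#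
      principal      : (I : Pred Carrier (c ⊔ ℓ)) → IsIdeal I →
                       ∃ λ d → ∀ x → x ∈ I ⇔ d ∣ x

module MatrixPullbacks (R : CommutativeRing c ℓ) (pid : IsPID R) where
  open CommutativeRing R renaming
    (_+_ to _+ᴿ_; +-assoc to +ᴿ-assoc; +-identityʳ to +ᴿ-identityʳ; zero to *-zero)
  open import Algebra.Properties.Semiring.Sum semiring
    using (sum; sum-cong-≋; *-distribˡ-sum; *-distribʳ-sum; ∑-comm; ∑-distrib-+)
  open import Algebra.Properties.Ring ring
    using (-‿distribˡ-*; -‿distribʳ-*; -‿+-comm; -0#≈0#; -‿involutive; x∙y⁻¹≈ε⇒x≈y)
  open import Algebra.Properties.CommutativeSemigroup +-commutativeSemigroup
    using (interchange)
  open import Algebra.Definitions.RawMagma *-rawMagma using (_∣_; _,_)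
  open SetoidReasoning setoid
  open Matrices R
  open IsPID pid
  open Pullbacks Mat

  Vect : ℕ → Set c
  Vect n = Fin n → Carrier

  infixr 7 _*ᵥ_

  _*ᵥ_ : ∀ {m n} → Matrix m n → Vect n → Vect m
  (M *ᵥ v) i = sum λ j → M i j * v j

  *ᵥ-cong : ∀ {m n} (M : Matrix m n) {v w : Vect n} → (∀ j → v j ≈ w j) →
            ∀ i → (M *ᵥ v) i ≈ (M *ᵥ w) i
  *ᵥ-cong M p i = sum-cong-≋ (λ j → *-congˡ (p j))

  *ᵥ-+ : ∀ {m n} (M : Matrix m n) (v w : Vect n) i →
         (M *ᵥ (λ j → v j +ᴿ w j)) i ≈ (M *ᵥ v) i +ᴿ (M *ᵥ w) i
  *ᵥ-+ M v w i = trans (sum-cong-≋ (λ j → distribˡ (M i j) (v j) (w j)))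
                       (∑-distrib-+ (λ j → M i j * v j) (λ j → M i j * w j))

  *ᵥ-* : ∀ {m n} (M : Matrix m n) (v : Vect n) x i →
         (M *ᵥ (λ j → v j * x)) i ≈ (M *ᵥ v) i * x
  *ᵥ-* M v x i = trans (sum-cong-≋ (λ j → sym (*-assoc (M i j) (v j) x)))
                       (sym (*-distribʳ-sum x (λ j → M i j * v j)))

  *ᵥ-0 : ∀ {m n} (M : Matrix m n) i → (M *ᵥ (λ _ → 0#)) i ≈ 0#
  *ᵥ-0 {n = n} M i = sum-0 n (λ j → zeroʳ (M i j))

  zero? : ∀ x → x ≈ 0# ⊎ x ≉ 0#
  zero? x with principal I ideal
    where
    I : Pred Carrier (c ⊔ ℓ)
    I y = Lift c (y ≈ 0#) ⊎ Lift c (x ≈ 0#)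
    ideal : IsIdeal R I
    ideal = record
      { resp     = λ { p (inj₁ (lift q)) → inj₁ (lift (trans (sym p) q)) ; p (inj₂ q) → inj₂ q }
      ; 0∈       = inj₁ (lift refl)
      ; +-closed = λ { (inj₁ (lift p)) (inj₁ (lift q)) →
                         inj₁ (lift (trans (+-cong p q) (+-identityˡ 0#)))
                     ; (inj₁ _) (inj₂ q) → inj₂ q
                     ; (inj₂ p) _ → inj₂ p }
      ; *-closed = λ { r (inj₁ (lift p)) → inj₁ (lift (trans (*-congˡ p) (zeroʳ r)))
                     ; r (inj₂ p) → inj₂ p } }
  ... | d , I⇔ with Equivalence.from (I⇔ d) (1# , *-identityˡ d)
  ...   | inj₂ (lift p) = inj₁ p
  ...   | inj₁ (lift d≈0) = inj₂ λ x≈0 → case-∣ (Equivalence.to (I⇔ 1#) (inj₂ (lift x≈0)))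
    where
    case-∣ : ¬ (d ∣ 1#)
    case-∣ (q , p) = 1≉0 (trans (sym p) (trans (*-congˡ d≈0) (zeroʳ q)))

  record Kernel {m n} (M : Matrix m n) : Set (c ⊔ ℓ) where
    field
      {nullity}   : ℕ
      basis       : Matrix n nullity
      sound       : ∀ w i → (M *ᵥ (basis *ᵥ w)) i ≈ 0#
      complete    : ∀ v → (∀ i → (M *ᵥ v) i ≈ 0#) →
                    ∃ λ w → ∀ j → (basis *ᵥ w) j ≈ v j
      independent : ∀ w → (∀ j → (basis *ᵥ w) j ≈ 0#) → ∀ k → w k ≈ 0#

  kernel : ∀ {m} n (M : Matrix m n) → Kernel M
  kernel zero M = record
    { nullity     = 0
    ; basis       = λ ()
    ; sound       = λ _ _ → refl
    ; complete    = λ v p → (λ ()) , λ ()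
    ; independent = λ w p → λ () }
  kernel {m} (suc n) M with principal I ideal
    where
    M′ : Matrix m n
    M′ i j = M i (suc j)
    I : Pred Carrier (c ⊔ ℓ)
    I x = ∃ λ (v : Vect n) → ∀ i → M i zero * x +ᴿ (M′ *ᵥ v) i ≈ 0#
    ideal : IsIdeal R I
    ideal = record
      { resp     = λ p (v , q) → v , λ i → trans (+-congʳ (*-congˡ (sym p))) (q i)
      ; 0∈       = (λ _ → 0#) , λ i → trans (+-cong (zeroʳ _) (*ᵥ-0 M′ i)) (+-identityˡ 0#)
      ; +-closed = λ (v , p) (w , q) → (λ j → v j +ᴿ w j) , λ i →
          trans (+-cong (distribˡ _ _ _) (*ᵥ-+ M′ v w i))
            (trans (interchange _ _ _ _) (trans (+-cong (p i) (q i)) (+-identityˡ 0#)))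
      ; *-closed = λ r {x} (v , p) → (λ j → v j * r) , λ i →
          trans (+-cong (trans (*-congˡ (*-comm r x)) (sym (*-assoc _ _ _))) (*ᵥ-* M′ v r i))
            (trans (sym (distribʳ r _ _)) (trans (*-congʳ (p i)) (zeroˡ r))) }
  ... | d , I⇔ with zero? d
  ...   | inj₁ d≈0 = record
    { nullity     = nullity
    ; basis       = K
    ; sound       = λ w i → trans
        (+-cong (trans (*-congˡ (sum-0 nullity (λ k → zeroˡ (w k)))) (zeroʳ _)) (sound w i))
        (+-identityˡ 0#)
    ; complete    = complete′
    ; independent = λ w p → independent w (λ j → p (suc j)) }
    where
    open Kernel (kernel n (λ i j → M i (suc j)))
    K : Matrix (suc n) nullity
    K zero    k = 0#
    K (suc j) k = basis j k
    complete′ : ∀ v → (∀ i → (M *ᵥ v) i ≈ 0#) → ∃ λ w → ∀ j → (K *ᵥ w) j ≈ v j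
    complete′ v p = proj₁ tail-sol , λ
      { zero    → trans (sum-0 nullity (λ k → zeroˡ (proj₁ tail-sol k))) (sym v₀≈0)
      ; (suc j) → proj₂ tail-sol j }
      where
      v₀≈0 : v zero ≈ 0#
      v₀≈0 with Equivalence.to (I⇔ (v zero)) ((λ j → v (suc j)) , p)
      ... | q , eq = trans (sym eq) (trans (*-congˡ d≈0) (zeroʳ q))
      tail-sol = complete (λ j → v (suc j)) λ i → trans
        (sym (trans (+-congʳ (trans (*-congˡ v₀≈0) (zeroʳ _))) (+-identityˡ _))) (p i)
  ...   | inj₂ d≉0 = record
    { nullity     = suc nullity
    ; basis       = K
    ; sound       = sound′
    ; complete    = complete′
    ; independent = independent′ }
    where
    M′ : Matrix m n
    M′ i j = M i (suc j)
    open Kernel (kernel n M′)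
    d∈I = Equivalence.from (I⇔ d) (1# , *-identityˡ d)
    y : Vect n
    y = proj₁ d∈I
    K : Matrix (suc n) (suc nullity)
    K zero    zero    = d
    K zero    (suc k) = 0#
    K (suc j) zero    = y j
    K (suc j) (suc k) = basis j k
    K-zero : ∀ w → (K *ᵥ w) zero ≈ d * w zero
    K-zero w = trans (+-congˡ (sum-0 nullity (λ k → zeroˡ (w (suc k))))) (+ᴿ-identityʳ _)
    sound′ : ∀ w i → (M *ᵥ (K *ᵥ w)) i ≈ 0#
    sound′ w i = begin
      M i zero * (K *ᵥ w) zero +ᴿ (M′ *ᵥ (λ j → y j * w zero +ᴿ (basis *ᵥ w′) j)) i
        ≈⟨ +-cong (*-congˡ (K-zero w))
                  (*ᵥ-+ M′ (λ j → y j * w zero) (basis *ᵥ w′) i) ⟩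
      M i zero * (d * w zero) +ᴿ ((M′ *ᵥ (λ j → y j * w zero)) i +ᴿ (M′ *ᵥ (basis *ᵥ w′)) i)
        ≈⟨ +-cong (sym (*-assoc _ _ _)) (+-cong (*ᵥ-* M′ y (w zero) i) (sound w′ i)) ⟩
      (M i zero * d) * w zero +ᴿ ((M′ *ᵥ y) i * w zero +ᴿ 0#)
        ≈⟨ +-congˡ (+ᴿ-identityʳ _) ⟩
      (M i zero * d) * w zero +ᴿ (M′ *ᵥ y) i * w zero
        ≈⟨ distribʳ (w zero) _ _ ⟨
      (M i zero * d +ᴿ (M′ *ᵥ y) i) * w zero
        ≈⟨ *-congʳ (proj₂ d∈I i) ⟩
      0# * w zero
        ≈⟨ zeroˡ _ ⟩
      0# ∎
      where
      w′ : Vect nullity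
      w′ k = w (suc k)
    complete′ : ∀ v → (∀ i → (M *ᵥ v) i ≈ 0#) → ∃ λ w → ∀ j → (K *ᵥ w) j ≈ v j
    complete′ v p with Equivalence.to (I⇔ (v zero)) ((λ j → v (suc j)) , p)
    ... | q , qd≈v₀ = w , λ
      { zero    → trans (K-zero w) (trans (*-comm d q) qd≈v₀)
      ; (suc j) → begin
          y j * q +ᴿ (basis *ᵥ proj₁ sol) j
            ≈⟨ +-congˡ (proj₂ sol j) ⟩
          y j * q +ᴿ (v (suc j) +ᴿ y j * - q)
            ≈⟨ +-comm _ _ ⟩
          (v (suc j) +ᴿ y j * - q) +ᴿ y j * q
            ≈⟨ +ᴿ-assoc _ _ _ ⟩
          v (suc j) +ᴿ (y j * - q +ᴿ y j * q)
            ≈⟨ +-congˡ (trans (sym (distribˡ (y j) (- q) q))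
                 (trans (*-congˡ (-‿inverseˡ q)) (zeroʳ (y j)))) ⟩
          v (suc j) +ᴿ 0#
            ≈⟨ +ᴿ-identityʳ _ ⟩
          v (suc j) ∎ }
      where
      M′y : ∀ i → M i zero * v zero ≈ (M′ *ᵥ y) i * - q
      M′y i = x∙y⁻¹≈ε⇒x≈y _ _ (begin
        M i zero * v zero +ᴿ - ((M′ *ᵥ y) i * - q)
          ≈⟨ +-cong (trans (*-congˡ (sym (trans (*-comm d q) qd≈v₀))) (sym (*-assoc _ _ _)))
                    (trans (-‿cong (sym (-‿distribʳ-* _ q))) (-‿involutive _)) ⟩
        (M i zero * d) * q +ᴿ (M′ *ᵥ y) i * q
          ≈⟨ distribʳ q _ _ ⟨
        (M i zero * d +ᴿ (M′ *ᵥ y) i) * q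
          ≈⟨ trans (*-congʳ (proj₂ d∈I i)) (zeroˡ q) ⟩
        0# ∎)
      sol = complete (λ j → v (suc j) +ᴿ y j * - q) λ i → begin
        (M′ *ᵥ (λ j → v (suc j) +ᴿ y j * - q)) i
          ≈⟨ *ᵥ-+ M′ (λ j → v (suc j)) (λ j → y j * - q) i ⟩
        (M′ *ᵥ (λ j → v (suc j))) i +ᴿ (M′ *ᵥ (λ j → y j * - q)) i
          ≈⟨ +-comm _ _ ⟩
        (M′ *ᵥ (λ j → y j * - q)) i +ᴿ (M′ *ᵥ (λ j → v (suc j))) i
          ≈⟨ +-congʳ (trans (*ᵥ-* M′ y (- q) i) (sym (M′y i))) ⟩
        M i zero * v zero +ᴿ (M′ *ᵥ (λ j → v (suc j))) i
          ≈⟨ p i ⟩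
        0# ∎
      w : Vect (suc nullity)
      w zero    = q
      w (suc k) = proj₁ sol k
    independent′ : ∀ w → (∀ j → (K *ᵥ w) j ≈ 0#) → ∀ k → w k ≈ 0#
    independent′ w p = λ { zero → w₀≈0 ; (suc k) → rest k }
      where
      w₀≈0 : w zero ≈ 0#
      w₀≈0 with noZeroDivisors (trans (sym (K-zero w)) (p zero))
      ... | inj₁ d≈0 = contradiction d≈0 d≉0
      ... | inj₂ q   = q
      rest : ∀ k → w (suc k) ≈ 0#
      rest = independent (λ k → w (suc k)) λ j → trans
        (sym (trans (+-congʳ (trans (*-congˡ w₀≈0) (zeroʳ (y j)))) (+-identityˡ _))) (p (suc j))

  sum-neg : ∀ {n} (t : Fin n → Carrier) → sum (λ i → - t i) ≈ - sum t
  sum-neg {zero}  t = sym -0#≈0#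
  sum-neg {suc n} t = trans (+-congˡ (sum-neg (λ i → t (suc i)))) (-‿+-comm _ _)

  -- The pullback of A and B is the kernel of the block row [ A  -B ].
  module _ {a b x} (A : Matrix x a) (B : Matrix x b) where
    row : Fin x → Fin a ⊎ Fin b → Carrier
    row i (inj₁ j) = A i j
    row i (inj₂ j) = - B i j

    difference : Matrix x (a + b)
    difference i j = row i (splitAt a j)

    pair : Vect a → Vect b → Vect (a + b)
    pair u v j = [ u , v ]′ (splitAt a j)

    difference-pair : ∀ u v i →
      (difference *ᵥ pair u v) i ≈ (A *ᵥ u) i +ᴿ - (B *ᵥ v) i
    difference-pair u v i = trans
      (sum-splitAt a (λ y → row i y * [ u , v ]′ y))
      (+-congˡ (trans (sum-cong-≋ (λ j → sym (-‿distribˡ-* (B i j) (v j))))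
                      (sum-neg (λ j → B i j * v j))))

    open Kernel (kernel (a + b) difference)

    P₁ : Matrix a nullity
    P₁ i k = basis (i ↑ˡ b) k

    P₂ : Matrix b nullity
    P₂ i k = basis (a ↑ʳ i) k

    basis-pair : ∀ w j → pair (P₁ *ᵥ w) (P₂ *ᵥ w) j ≈ (basis *ᵥ w) j
    basis-pair w j with splitAt a j in eq
    ... | inj₁ i = reflexive (≡.cong (basis *ᵥ w) (Finₚ.splitAt⁻¹-↑ˡ eq))
    ... | inj₂ i = reflexive (≡.cong (basis *ᵥ w) (Finₚ.splitAt⁻¹-↑ʳ eq))

    commutes : ∀ w i → (A *ᵥ (P₁ *ᵥ w)) i ≈ (B *ᵥ (P₂ *ᵥ w)) i
    commutes w i = x∙y⁻¹≈ε⇒x≈y _ _ (trans (sym (difference-pair (P₁ *ᵥ w) (P₂ *ᵥ w) i))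
      (trans (*ᵥ-cong difference (basis-pair w) i) (sound w i)))

    solve : ∀ u v → (∀ i → (A *ᵥ u) i ≈ (B *ᵥ v) i) →
            ∃ λ w → ∀ j → (basis *ᵥ w) j ≈ pair u v j
    solve u v p = complete (pair u v) λ i →
      trans (difference-pair u v i) (trans (+-congʳ (p i)) (-‿inverseʳ _))

    injective : ∀ w w′ → (∀ j → (P₁ *ᵥ w) j ≈ (P₁ *ᵥ w′) j) →
                (∀ j → (P₂ *ᵥ w) j ≈ (P₂ *ᵥ w′) j) → ∀ k → w k ≈ w′ k
    injective w w′ p q k = x∙y⁻¹≈ε⇒x≈y _ _ (independent (λ k → w k +ᴿ - w′ k) zero′ k)
      where
      same : ∀ j → (basis *ᵥ w) j ≈ (basis *ᵥ w′) j
      same j = trans (sym (basis-pair w j)) (trans (pairs (splitAt a j)) (basis-pair w′ j))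
        where
        pairs : ∀ y → [ P₁ *ᵥ w , P₂ *ᵥ w ]′ y ≈ [ P₁ *ᵥ w′ , P₂ *ᵥ w′ ]′ y
        pairs (inj₁ i) = p i
        pairs (inj₂ i) = q i
      zero′ : ∀ j → (basis *ᵥ (λ k → w k +ᴿ - w′ k)) j ≈ 0#
      zero′ j = begin
        (basis *ᵥ (λ k → w k +ᴿ - w′ k)) j
          ≈⟨ *ᵥ-+ basis w (λ k → - w′ k) j ⟩
        (basis *ᵥ w) j +ᴿ sum (λ k → basis j k * - w′ k)
          ≈⟨ +-cong (same j) (trans (sum-cong-≋ (λ k → sym (-‿distribʳ-* (basis j k) (w′ k))))
               (sum-neg (λ k → basis j k * w′ k))) ⟩
        (basis *ᵥ w′) j +ᴿ - (basis *ᵥ w′) j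
          ≈⟨ -‿inverseʳ _ ⟩
        0# ∎

    matrix-isPullback : IsPullback A B P₁ P₂
    matrix-isPullback = record
      { commute     = λ i k → trans (sum-cong-≋ (λ l → *-congˡ (sym (sum-δʳ k (P₁ l)))))
          (trans (commutes (λ l → δ l k) i) (sum-cong-≋ (λ l → *-congˡ (sum-δʳ k (P₂ l)))))
      ; universal   = λ p k j → proj₁ (col p j) k
      ; universal⨾₁ = univ₁
      ; universal⨾₂ = univ₂
      ; unique      = λ p {u} q r k j → injective (λ l → u l j) (λ l → proj₁ (col p j) l)
          (λ i → trans (q i j) (sym (univ₁ p i j)))
          (λ i → trans (r i j) (sym (univ₂ p i j))) k }
      where
      module _ {q} {H₁ : Matrix a q} {H₂ : Matrix b q} (p : A · H₁ ≋ B · H₂) where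
        col : ∀ j → ∃ λ w → ∀ i → (basis *ᵥ w) i ≈ pair (λ l → H₁ l j) (λ l → H₂ l j) i
        col j = solve (λ l → H₁ l j) (λ l → H₂ l j) (λ i → p i j)
        univ₁ : P₁ · (λ k j → proj₁ (col j) k) ≋ H₁
        univ₁ i j = trans (proj₂ (col j) (i ↑ˡ b))
          (reflexive (≡.cong [ (λ l → H₁ l j) , (λ l → H₂ l j) ]′ (splitAt-↑ˡ a i b)))
        univ₂ : P₂ · (λ k j → proj₁ (col j) k) ≋ H₂
        univ₂ i j = trans (proj₂ (col j) (a ↑ʳ i))
          (reflexive (≡.cong [ (λ l → H₁ l j) , (λ l → H₂ l j) ]′ (splitAt-↑ʳ a b i)))

  abstract
    Mat-pullback : HasPullbacks
    Mat-pullback A B = record { isPullback = matrix-isPullback A B }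

  upper : ∀ a {a′ q} → Matrix (a + a′) q → Matrix a q
  upper a {a′} H i = H (i ↑ˡ a′)

  lower : ∀ a {a′ q} → Matrix (a + a′) q → Matrix a′ q
  lower a H i = H (a ↑ʳ i)

  stack : ∀ {a a′ q} → Matrix a q → Matrix a′ q → Matrix (a + a′) q
  stack {a} H H′ i = [ H , H′ ]′ (splitAt a i)

  upper-stack : ∀ {a a′ q} (H : Matrix a q) (H′ : Matrix a′ q) → upper a (stack H H′) ≋ H
  upper-stack {a} {a′} H H′ i j = reflexive (≡.cong (λ x → [ H , H′ ]′ x j) (splitAt-↑ˡ a i a′))

  lower-stack : ∀ {a a′ q} (H : Matrix a q) (H′ : Matrix a′ q) → lower a (stack H H′) ≋ H′
  lower-stack {a} {a′} H H′ i j = reflexive (≡.cong (λ x → [ H , H′ ]′ x j) (splitAt-↑ʳ a a′ i))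

  upper-⊞ : ∀ {x a x′ a′ q} (A : Matrix x a) (A′ : Matrix x′ a′) (H : Matrix (a + a′) q) →
            upper x ((A ⊞ A′) · H) ≋ A · upper a H
  upper-⊞ {x} {a} {x′} {a′} A A′ H i j = begin
    sum (λ l → block A A′ (splitAt x (i ↑ˡ x′)) (splitAt a l) * H l j)
      ≡⟨ ≡.cong (λ y → sum (λ l → block A A′ y (splitAt a l) * H l j)) (splitAt-↑ˡ x i x′) ⟩
    sum (λ l → block A A′ (inj₁ i) (splitAt a l) * H l j)
      ≈⟨ sum-+ a (λ l → block A A′ (inj₁ i) (splitAt a l) * H l j) ⟩
    sum (λ l → block A A′ (inj₁ i) (splitAt a (l ↑ˡ a′)) * H (l ↑ˡ a′) j)
      +ᴿ sum (λ l → block A A′ (inj₁ i) (splitAt a (a ↑ʳ l)) * H (a ↑ʳ l) j)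
      ≈⟨ +-cong
           (sum-cong-≋ (λ l → reflexive
             (≡.cong (λ y → block A A′ (inj₁ i) y * H (l ↑ˡ a′) j) (splitAt-↑ˡ a l a′))))
           (sum-0 a′ (λ l → trans (reflexive
             (≡.cong (λ y → block A A′ (inj₁ i) y * H (a ↑ʳ l) j) (splitAt-↑ʳ a a′ l)))
             (zeroˡ _))) ⟩
    sum (λ l → A i l * H (l ↑ˡ a′) j) +ᴿ 0#
      ≈⟨ +ᴿ-identityʳ _ ⟩
    sum (λ l → A i l * H (l ↑ˡ a′) j) ∎

  lower-⊞ : ∀ {x a x′ a′ q} (A : Matrix x a) (A′ : Matrix x′ a′) (H : Matrix (a + a′) q) →
            lower x ((A ⊞ A′) · H) ≋ A′ · lower a H
  lower-⊞ {x} {a} {x′} {a′} A A′ H i j = begin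
    sum (λ l → block A A′ (splitAt x (x ↑ʳ i)) (splitAt a l) * H l j)
      ≡⟨ ≡.cong (λ y → sum (λ l → block A A′ y (splitAt a l) * H l j)) (splitAt-↑ʳ x x′ i) ⟩
    sum (λ l → block A A′ (inj₂ i) (splitAt a l) * H l j)
      ≈⟨ sum-+ a (λ l → block A A′ (inj₂ i) (splitAt a l) * H l j) ⟩
    sum (λ l → block A A′ (inj₂ i) (splitAt a (l ↑ˡ a′)) * H (l ↑ˡ a′) j)
      +ᴿ sum (λ l → block A A′ (inj₂ i) (splitAt a (a ↑ʳ l)) * H (a ↑ʳ l) j)
      ≈⟨ +-cong
           (sum-0 a (λ l → trans (reflexive
             (≡.cong (λ y → block A A′ (inj₂ i) y * H (l ↑ˡ a′) j) (splitAt-↑ˡ a l a′)))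
             (zeroˡ _)))
           (sum-cong-≋ (λ l → reflexive
             (≡.cong (λ y → block A A′ (inj₂ i) y * H (a ↑ʳ l) j) (splitAt-↑ʳ a a′ l)))) ⟩
    0# +ᴿ sum (λ l → A′ i l * H (a ↑ʳ l) j)
      ≈⟨ +-identityˡ _ ⟩
    sum (λ l → A′ i l * H (a ↑ʳ l) j) ∎

  rows-ext : ∀ a {a′ q} {H H′ : Matrix (a + a′) q} →
             upper a H ≋ upper a H′ → lower a H ≋ lower a H′ → H ≋ H′
  rows-ext a {a′} {_} {H} {H′} p r i j = ≡.subst (λ i → H i j ≈ H′ i j)
    (join-splitAt a a′ i) (go (splitAt a i))
    where
    go : ∀ y → H (join a a′ y) j ≈ H′ (join a a′ y) j
    go (inj₁ i) = p i j
    go (inj₂ i) = r i j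

  ·-congˡ : ∀ {m n k} (A : Matrix m n) {B B′ : Matrix n k} → B ≋ B′ → A · B ≋ A · B′
  ·-congˡ A p = ·-cong (≋.refl {x = A}) p

  Mat-⊕-pullback : ⊕-PreservesPullbacks
  Mat-⊕-pullback {a} {b} {x} {p} {a′} {b′} {x′} {p′} {A} {B} {P₁} {P₂} {A′} {B′} {P₁′} {P₂′} pb pb′ =
    record
      { commute     = ≋.trans (≋.sym (⊞-· A P₁ A′ P₁′)) (≋.trans
          (λ i j → block-cong P.commute P′.commute (splitAt x i) (splitAt p j))
          (⊞-· B P₂ B′ P₂′))
      ; universal   = λ eq → stack (P.universal (eqᵘ eq)) (P′.universal (eqˡ eq))
      ; universal⨾₁ = λ {_} {H₁} {H₂} eq → rows-ext a
          (≋.trans (upper-⊞ P₁ P₁′ (stack (P.universal (eqᵘ eq)) (P′.universal (eqˡ eq))))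
            (≋.trans (·-congˡ P₁ (upper-stack (P.universal (eqᵘ eq)) (P′.universal (eqˡ eq))))
              (P.universal⨾₁ (eqᵘ eq))))
          (≋.trans (lower-⊞ P₁ P₁′ (stack (P.universal (eqᵘ eq)) (P′.universal (eqˡ eq))))
            (≋.trans (·-congˡ P₁′ (lower-stack (P.universal (eqᵘ eq)) (P′.universal (eqˡ eq))))
              (P′.universal⨾₁ (eqˡ eq))))
      ; universal⨾₂ = λ {_} {H₁} {H₂} eq → rows-ext b
          (≋.trans (upper-⊞ P₂ P₂′ (stack (P.universal (eqᵘ eq)) (P′.universal (eqˡ eq))))
            (≋.trans (·-congˡ P₂ (upper-stack (P.universal (eqᵘ eq)) (P′.universal (eqˡ eq))))
              (P.universal⨾₂ (eqᵘ eq))))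
          (≋.trans (lower-⊞ P₂ P₂′ (stack (P.universal (eqᵘ eq)) (P′.universal (eqˡ eq))))
            (≋.trans (·-congˡ P₂′ (lower-stack (P.universal (eqᵘ eq)) (P′.universal (eqˡ eq))))
              (P′.universal⨾₂ (eqˡ eq))))
      ; unique      = λ {_} {H₁} {H₂} eq {U} r s → rows-ext p
          (≋.trans
            (P.unique (eqᵘ eq)
              (≋.trans (≋.sym (upper-⊞ P₁ P₁′ U)) (λ i → r (i ↑ˡ a′)))
              (≋.trans (≋.sym (upper-⊞ P₂ P₂′ U)) (λ i → s (i ↑ˡ b′))))
            (≋.sym (upper-stack (P.universal (eqᵘ eq)) (P′.universal (eqˡ eq)))))
          (≋.trans
            (P′.unique (eqˡ eq)
              (≋.trans (≋.sym (lower-⊞ P₁ P₁′ U)) (λ i → r (a ↑ʳ i)))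
              (≋.trans (≋.sym (lower-⊞ P₂ P₂′ U)) (λ i → s (b ↑ʳ i))))
            (≋.sym (lower-stack (P.universal (eqᵘ eq)) (P′.universal (eqˡ eq)))))
      }
    where
    module P = IsPullback pb
    module P′ = IsPullback pb′
    module _ {q} {H₁ : Matrix (a + a′) q} {H₂ : Matrix (b + b′) q}
             (eq : (A ⊞ A′) · H₁ ≋ (B ⊞ B′) · H₂) where
      eqᵘ : A · upper a H₁ ≋ B · upper b H₂
      eqᵘ = ≋.trans (≋.sym (upper-⊞ A A′ H₁)) (≋.trans (λ i → eq (i ↑ˡ x′)) (upper-⊞ B B′ H₂))
      eqˡ : A′ · lower a H₁ ≋ B′ · lower b H₂
      eqˡ = ≋.trans (≋.sym (lower-⊞ A A′ H₁)) (≋.trans (λ i → eq (x ↑ʳ i)) (lower-⊞ B B′ H₂))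

SpanMat : (R : CommutativeRing c ℓ) → IsPID R → PROP c (c ⊔ ℓ)
SpanMat R pid = Spans.Span (Matrices.Mat R) Mat-pullback Mat-⊕-pullback
  where open MatrixPullbacks R pid

Signature : ∀ c → Set (lsuc c)
Signature c = ℕ → ℕ → Set c

infixr 5 _⨾_
infixr 6 _⊕_

data Term (G : Signature c) : Signature c where
  gen     : ∀ {n m} → G n m → Term G n m
  id₀     : Term G 0 0
  id₁     : Term G 1 1
  σ₁₁     : Term G 2 2
  _⨾_     : ∀ {n m k} → Term G n m → Term G m k → Term G n k
  _⊕_     : ∀ {n m n′ m′} → Term G n m → Term G n′ m′ → Term G (n + n′) (m + m′)

module _ {G : Signature c} where

  -- The general identities and symmetries are the composites of id₁ and σ₁₁
  -- dictated by coherence; _∼_ below makes them satisfy the laws of a PROP.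
  idᵗ : ∀ n → Term G n n
  idᵗ zero    = id₀
  idᵗ (suc n) = id₁ ⊕ idᵗ n

  σ₁ᵗ : ∀ m → Term G (1 + m) (m + 1)
  σ₁ᵗ zero    = id₁
  σ₁ᵗ (suc m) = (σ₁₁ ⊕ idᵗ m) ⨾ (id₁ ⊕ σ₁ᵗ m)

  σᵗ : ∀ n m → Term G (n + m) (m + n)
  σᵗ zero    m = subst (Term G m) (≡.sym (+-identityʳ m)) (idᵗ m)
  σᵗ (suc n) m = (id₁ ⊕ σᵗ n m) ⨾
                 subst (Term G (suc m + n)) (+-assoc m 1 n) (σ₁ᵗ m ⊕ idᵗ n)

  rename : {H : Signature c′} → (∀ {n m} → G n m → H n m) →
           ∀ {n m} → Term G n m → Term H n m
  rename φ (gen g) = gen (φ g)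
  rename φ id₀     = id₀
  rename φ id₁     = id₁
  rename φ σ₁₁     = σ₁₁
  rename φ (f ⨾ g) = rename φ f ⨾ rename φ g
  rename φ (f ⊕ g) = rename φ f ⊕ rename φ g

  reverse : ∀ {n m} → Term G n m → Term (flip G) m n
  reverse (gen g) = gen g
  reverse id₀     = id₀
  reverse id₁     = id₁
  reverse σ₁₁     = σ₁₁
  reverse (f ⨾ g) = reverse g ⨾ reverse f
  reverse (f ⊕ g) = reverse f ⊕ reverse g

Equations : Signature c → ∀ e → Set (c ⊔ lsuc e)
Equations G e = ∀ {n m} → Rel (Term G n m) e

record Presentation c e : Set (lsuc (c ⊔ e)) where
  field
    Gen : Signature c
    Eqn : Equations Gen e

module Presented (P : Presentation c e) where
  open Presentation P

  infix 4 _∼_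

  data _∼_ : ∀ {n m} → Rel (Term Gen n m) (c ⊔ e) where
    axiom : ∀ {n m} {f g : Term Gen n m} → Eqn f g → f ∼ g

    refl  : ∀ {n m} {f : Term Gen n m} → f ∼ f
    sym   : ∀ {n m} {f g : Term Gen n m} → f ∼ g → g ∼ f
    trans : ∀ {n m} {f g h : Term Gen n m} → f ∼ g → g ∼ h → f ∼ h

    ⨾-cong  : ∀ {n m k} {f f′ : Term Gen n m} {g g′ : Term Gen m k} →
              f ∼ f′ → g ∼ g′ → (f ⨾ g) ∼ (f′ ⨾ g′)
    ⨾-assoc : ∀ {n m k l} (f : Term Gen n m) (g : Term Gen m k) (h : Term Gen k l) →
              ((f ⨾ g) ⨾ h) ∼ (f ⨾ (g ⨾ h))
    ⨾-idˡ   : ∀ {n m} (f : Term Gen n m) → (idᵗ n ⨾ f) ∼ f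
    ⨾-idʳ   : ∀ {n m} (f : Term Gen n m) → (f ⨾ idᵗ m) ∼ f

    ⊕-cong        : ∀ {n m n′ m′} {f f′ : Term Gen n m} {g g′ : Term Gen n′ m′} →
                    f ∼ f′ → g ∼ g′ → (f ⊕ g) ∼ (f′ ⊕ g′)
    ⊕-id          : ∀ n m → (idᵗ n ⊕ idᵗ m) ∼ idᵗ (n + m)
    ⊕-interchange : ∀ {n m k n′ m′ k′}
                    (f : Term Gen n m) (g : Term Gen m k)
                    (f′ : Term Gen n′ m′) (g′ : Term Gen m′ k′) →
                    ((f ⨾ g) ⊕ (f′ ⨾ g′)) ∼ ((f ⊕ f′) ⨾ (g ⊕ g′))
    ⊕-assoc       : ∀ {n₁ m₁ n₂ m₂ n₃ m₃}
                    (f : Term Gen n₁ m₁) (g : Term Gen n₂ m₂) (h : Term Gen n₃ m₃) →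
                    subst₂ (Term Gen) (+-assoc n₁ n₂ n₃) (+-assoc m₁ m₂ m₃) ((f ⊕ g) ⊕ h)
                      ∼ (f ⊕ (g ⊕ h))
    ⊕-idˡ         : ∀ {n m} (f : Term Gen n m) → (idᵗ 0 ⊕ f) ∼ f
    ⊕-idʳ         : ∀ {n m} (f : Term Gen n m) →
                    subst₂ (Term Gen) (+-identityʳ n) (+-identityʳ m) (f ⊕ idᵗ 0) ∼ f

    σ-natural    : ∀ {n m n′ m′} (f : Term Gen n m) (g : Term Gen n′ m′) →
                   ((f ⊕ g) ⨾ σᵗ m m′) ∼ (σᵗ n n′ ⨾ (g ⊕ f))
    σ-involutive : ∀ n m → (σᵗ n m ⨾ σᵗ m n) ∼ idᵗ (n + m)
    σ-hexagon    : ∀ n m k →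
                   (subst₂ (Term Gen) (+-assoc n m k) (+-assoc m n k) (σᵗ n m ⊕ idᵗ k)
                     ⨾ (idᵗ m ⊕ σᵗ n k))
                   ∼ subst₂ (Term Gen) ≡.refl (+-assoc m k n) (σᵗ n (m + k))

  presented : PROP c (c ⊔ e)
  presented = record
    { Hom = Term Gen ; _≈_ = _∼_
    ; isEquivalence = record { refl = refl ; sym = sym ; trans = trans }
    ; id = idᵗ ; _⨾_ = _⨾_ ; _⊕_ = _⊕_ ; σ = σᵗ
    ; ⨾-cong = ⨾-cong ; ⨾-assoc = ⨾-assoc ; ⨾-idˡ = ⨾-idˡ ; ⨾-idʳ = ⨾-idʳ
    ; ⊕-cong = ⊕-cong ; ⊕-id = ⊕-id ; ⊕-interchange = ⊕-interchange
    ; ⊕-assoc = ⊕-assoc ; ⊕-idˡ = ⊕-idˡ ; ⊕-idʳ = ⊕-idʳ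
    ; σ-natural = σ-natural ; σ-involutive = σ-involutive ; σ-hexagon = σ-hexagon
    }

infix  8 _ᵒᵖ
infixl 6 _+ᴾ_
infixl 5 _/ᴾ_

data ReversedEqn {G : Signature c} (E : Equations G e) : Equations (flip G) (c ⊔ e) where
  reversed : ∀ {n m} {f g : Term G n m} → E f g → ReversedEqn E (reverse f) (reverse g)

_ᵒᵖ : Presentation c e → Presentation c (c ⊔ e)
P ᵒᵖ = record { Gen = flip Gen ; Eqn = ReversedEqn Eqn }
  where open Presentation P

data SumEqn {G : Signature c} {H : Signature c′} (E : Equations G e) (F : Equations H e′) :
            Equations (λ n m → G n m ⊎ H n m) (c ⊔ c′ ⊔ e ⊔ e′) where
  left  : ∀ {n m} {f g : Term G n m} → E f g → SumEqn E F (rename inj₁ f) (rename inj₁ g)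
  right : ∀ {n m} {f g : Term H n m} → F f g → SumEqn E F (rename inj₂ f) (rename inj₂ g)

_+ᴾ_ : Presentation c e → Presentation c′ e′ → Presentation (c ⊔ c′) (c ⊔ c′ ⊔ e ⊔ e′)
P +ᴾ Q = record { Gen = λ n m → P.Gen n m ⊎ Q.Gen n m ; Eqn = SumEqn P.Eqn Q.Eqn }
  where
  module P = Presentation P
  module Q = Presentation Q

_/ᴾ_ : (P : Presentation c e) → Equations (Presentation.Gen P) e′ → Presentation c (e ⊔ e′)
P /ᴾ F = record { Gen = Gen ; Eqn = λ f g → Eqn f g ⊎ F f g }
  where open Presentation P

module _ (R : CommutativeRing c ℓ) where
  open CommutativeRing R using (Carrier; _≈_; _≉_; -_; 0#; 1#; _*_) renaming (_+_ to _+ᴿ_)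

  data HAGen : Signature c where
    copy    : HAGen 1 2
    discard : HAGen 1 0
    add     : HAGen 2 1
    zero    : HAGen 0 1
    scalar  : Carrier → HAGen 1 1

  module HATerms where
    Δ• : Term HAGen 1 2
    Δ• = gen copy
    ε• : Term HAGen 1 0
    ε• = gen discard
    μ◦ : Term HAGen 2 1
    μ◦ = gen add
    η◦ : Term HAGen 0 1
    η◦ = gen zero
    s : Carrier → Term HAGen 1 1
    s k = gen (scalar k)

  module _ where
    open HATerms

    -- R is a setoid: s-cong identifies the generators s k and s k′ when k and k′
    -- are equal elements of R.
    data HAEqn : Equations HAGen (c ⊔ ℓ) where
      s-cong : ∀ {k k′} → k ≈ k′ → HAEqn (s k) (s k′)
      A1  : HAEqn ((η◦ ⊕ id₁) ⨾ μ◦) id₁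
      A2  : HAEqn (σ₁₁ ⨾ μ◦) μ◦
      A3  : HAEqn ((μ◦ ⊕ id₁) ⨾ μ◦) ((id₁ ⊕ μ◦) ⨾ μ◦)
      A4  : HAEqn (Δ• ⨾ (ε• ⊕ id₁)) id₁
      A5  : HAEqn (Δ• ⨾ σ₁₁) Δ•
      A6  : HAEqn (Δ• ⨾ (Δ• ⊕ id₁)) (Δ• ⨾ (id₁ ⊕ Δ•))
      A7  : HAEqn (μ◦ ⨾ ε•) (ε• ⊕ ε•)
      A8  : HAEqn (μ◦ ⨾ Δ•) ((Δ• ⊕ Δ•) ⨾ (id₁ ⊕ σ₁₁ ⊕ id₁) ⨾ (μ◦ ⊕ μ◦))
      A9  : HAEqn (η◦ ⨾ Δ•) (η◦ ⊕ η◦)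
      A10 : HAEqn (η◦ ⨾ ε•) id₀
      A11 : HAEqn (s 1#) id₁
      A12 : ∀ k₁ k₂ → HAEqn (s k₁ ⨾ s k₂) (s (k₁ * k₂))
      A13 : ∀ k → HAEqn (μ◦ ⨾ s k) ((s k ⊕ s k) ⨾ μ◦)
      A14 : ∀ k → HAEqn (η◦ ⨾ s k) η◦
      A15 : ∀ k → HAEqn (s k ⨾ Δ•) (Δ• ⨾ (s k ⊕ s k))
      A16 : ∀ k → HAEqn (s k ⨾ ε•) ε•
      A17 : HAEqn (s 0#) (ε• ⨾ η◦)
      A18 : ∀ k₁ k₂ → HAEqn (Δ• ⨾ (s k₁ ⊕ s k₂) ⨾ μ◦) (s (k₁ +ᴿ k₂))

  HA : Presentation c (c ⊔ ℓ)
  HA = record { Gen = HAGen ; Eqn = HAEqn }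

  IHGen : Signature c
  IHGen = Presentation.Gen (HA +ᴾ HA ᵒᵖ)

  module IHTerms where
    Δ• : Term IHGen 1 2
    Δ• = gen (inj₁ copy)
    ε• : Term IHGen 1 0
    ε• = gen (inj₁ discard)
    μ◦ : Term IHGen 2 1
    μ◦ = gen (inj₁ add)
    η◦ : Term IHGen 0 1
    η◦ = gen (inj₁ zero)
    s : Carrier → Term IHGen 1 1
    s k = gen (inj₁ (scalar k))

    μ• : Term IHGen 2 1
    μ• = gen (inj₂ copy)
    η• : Term IHGen 0 1
    η• = gen (inj₂ discard)
    Δ◦ : Term IHGen 1 2
    Δ◦ = gen (inj₂ add)
    ε◦ : Term IHGen 1 0
    ε◦ = gen (inj₂ zero)
    s̄ : Carrier → Term IHGen 1 1
    s̄ k = gen (inj₂ (scalar k))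

  module _ where
    open IHTerms

    data WEqn : Equations IHGen (c ⊔ ℓ) where
      W1  : ∀ l → l ≉ 0# → WEqn (s l ⨾ s̄ l) id₁
      W2  : WEqn (η◦ ⨾ ε◦) id₀
      W3ˡ : WEqn ((Δ◦ ⊕ id₁) ⨾ (id₁ ⊕ μ◦)) (μ◦ ⨾ Δ◦)
      W3ʳ : WEqn (μ◦ ⨾ Δ◦) ((id₁ ⊕ Δ◦) ⨾ (μ◦ ⊕ id₁))
      W4ˡ : WEqn ((Δ• ⊕ id₁) ⨾ (id₁ ⊕ μ•)) (μ• ⨾ Δ•)
      W4ʳ : WEqn (μ• ⨾ Δ•) ((id₁ ⊕ Δ•) ⨾ (μ• ⊕ id₁))
      W5  : WEqn (η◦ ⨾ Δ◦) (η• ⨾ Δ• ⨾ (id₁ ⊕ s (- 1#)))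
      W6  : WEqn (μ◦ ⨾ ε◦) ((id₁ ⊕ s (- 1#)) ⨾ μ• ⨾ ε•)
      W7  : ∀ k → WEqn ((s k ⊕ id₁) ⨾ μ•) ((id₁ ⊕ s̄ k) ⨾ μ• ⨾ s k)
      W8  : ∀ k → WEqn (Δ• ⨾ (s̄ k ⊕ id₁)) (s̄ k ⨾ Δ• ⨾ (id₁ ⊕ s k))

  IHSp : PROP c (c ⊔ ℓ)
  IHSp = Presented.presented (HA +ᴾ HA ᵒᵖ /ᴾ WEqn)

{-# OPTIONS --safe #-}
-- Every term f of HA is linear, f (a x + v) = f(a) x + f(v); composing with f column by column
-- therefore rewrites f to the normal form of its matrix, so HA is Mat R.  In IHSp, (W1)-(W8)
-- make ε◦ a test "w = 0" under which multiples of w may be added to any other wire, and η• a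
-- free wire invariant under translation; the opposite A† of a matrix becomes the system
-- y - A x = 0 with x free.  Over a PID the kernel of M has a basis K with a retraction L, and
-- d (1 - K L) = N M for some N and some d ≠ 0.  Hence the systems M x = 0 and x = K t imply each
-- other up to d, which (W1) makes invisible, and A ; B† = P₁† ; P₂ for every pullback (P₁ , P₂)
-- of (A , B).  So the span (l , r) ↦ l† ; r is invariant under isomorphism and functorial, and it
-- is inverse to the interpretation of the generators as spans, for which (W1)-(W8) are pullbacks.
module Submission where

open import Defs hiding (_⨾_; _⊕_)
open import Algebra.Bundles using (CommutativeRing; RawRing)
open import Algebra.Solver.Ring.AlmostCommutativeRing
  using (fromCommutativeRing; _-Raw-AlmostCommutative⟶_)
import Algebra.Solver.Ring
open import Data.Fin.Base using (Fin; zero; suc; splitAt; join; cast; _↑ˡ_; _↑ʳ_)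
open import Data.Fin.Properties
  using (splitAt-↑ˡ; splitAt-↑ʳ; join-splitAt; cast-is-id; cast-involutive)
open import Data.Maybe.Base using (Maybe; just; nothing)
open import Data.Nat.Base as ℕ using (ℕ; zero; suc; _+_)
open import Data.Nat.Properties as ℕ using (+-assoc; +-identityʳ)
open import Data.Product.Base using (Σ; ∃; _×_; _,_; proj₁; proj₂)
open import Data.Sum.Base as Sum using (_⊎_; inj₁; inj₂; [_,_]′)
open import Function.Base using (flip)
open import Function.Bundles using (_⇔_; Equivalence)
open import Level using (Level; _⊔_; Lift; lift) renaming (suc to lsuc)
open import Relation.Binary.PropositionalEquality as ≡ using (_≡_; subst; subst₂)
import Relation.Binary.Reasoning.Setoid as SetoidReasoning
open import Relation.Nullary.Decidable using (yes; no)
open import Relation.Nullary.Negation using (contradiction)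
open import Relation.Unary using (Pred; _∈_)

-- The equational theory cannot speak of one solution at a time: that a vector killed by M has the
-- form K w is usable only if w depends linearly on the vector, and a test implies another only
-- through a linear map. `kernel` solves for each vector separately, so kernels are rebuilt with
-- explicit maps L and N. The factor d is forced: multiplication by 2 on the integers has kernel 0,
-- hence 1 - K L = 1, and no N inverts 2. Completeness of HA turns every identity without opposites
-- into ring identities on vectors; diagrammatic reasoning is left only where a state or an effect
-- meets a linear map. Two features of the setting shape the statements. Sums of arities reassociate
-- only up to transport, so the inductions peel single wires from the left, where `+` computes. And
-- `Mat-pullback` is abstract, so only its universal property is available and pullback squares are
-- proved for arbitrary cones.

private variable
  c ℓ c′ ℓ′ e e′ : Level

-- Symmetries and opposites of PROPs

module PROPProperties (P : PROP c ℓ) where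
  open PROP P

  module HomReasoning {n m} = SetoidReasoning (setoid n m)

  infixr 4 _⟩⨾⟨_ refl⟩⨾⟨_
  infixl 5 _⟩⨾⟨refl
  infixr 6 _⟩⊕⟨_ refl⟩⊕⟨_
  infixl 7 _⟩⊕⟨refl

  _⟩⨾⟨_ : ∀ {n m k} {f f′ : Hom n m} {g g′ : Hom m k} → f ≈ f′ → g ≈ g′ → f ⨾ g ≈ f′ ⨾ g′
  _⟩⨾⟨_ = ⨾-cong

  refl⟩⨾⟨_ : ∀ {n m k} {f : Hom n m} {g g′ : Hom m k} → g ≈ g′ → f ⨾ g ≈ f ⨾ g′
  refl⟩⨾⟨_ = ⨾-cong Eq.refl

  _⟩⨾⟨refl : ∀ {n m k} {f f′ : Hom n m} {g : Hom m k} → f ≈ f′ → f ⨾ g ≈ f′ ⨾ g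
  p ⟩⨾⟨refl = ⨾-cong p Eq.refl

  _⟩⊕⟨_ : ∀ {n m n′ m′} {f f′ : Hom n m} {g g′ : Hom n′ m′} → f ≈ f′ → g ≈ g′ → f ⊕ g ≈ f′ ⊕ g′
  _⟩⊕⟨_ = ⊕-cong

  refl⟩⊕⟨_ : ∀ {n m n′ m′} {f : Hom n m} {g g′ : Hom n′ m′} → g ≈ g′ → f ⊕ g ≈ f ⊕ g′
  refl⟩⊕⟨_ = ⊕-cong Eq.refl

  _⟩⊕⟨refl : ∀ {n m n′ m′} {f f′ : Hom n m} {g : Hom n′ m′} → f ≈ f′ → f ⊕ g ≈ f′ ⊕ g
  p ⟩⊕⟨refl = ⊕-cong p Eq.refl

  assoc : ∀ {n m k l} {f : Hom n m} {g : Hom m k} {h : Hom k l} → (f ⨾ g) ⨾ h ≈ f ⨾ g ⨾ h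
  assoc = ⨾-assoc _ _ _

  assoc˘ : ∀ {n m k l} {f : Hom n m} {g : Hom m k} {h : Hom k l} → f ⨾ g ⨾ h ≈ (f ⨾ g) ⨾ h
  assoc˘ = Eq.sym assoc

  idˡ : ∀ {n m} {f : Hom n m} → id n ⨾ f ≈ f
  idˡ = ⨾-idˡ _

  idʳ : ∀ {n m} {f : Hom n m} → f ⨾ id m ≈ f
  idʳ = ⨾-idʳ _

  pullˡ : ∀ {n m k l} {f : Hom n m} {g : Hom m k} {h : Hom k l} {fg : Hom n k} →
          f ⨾ g ≈ fg → f ⨾ g ⨾ h ≈ fg ⨾ h
  pullˡ p = Eq.trans assoc˘ (p ⟩⨾⟨refl)

  pullʳ : ∀ {n m k l} {f : Hom n m} {g : Hom m k} {h : Hom k l} {gh : Hom m l} →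
          g ⨾ h ≈ gh → (f ⨾ g) ⨾ h ≈ f ⨾ gh
  pullʳ p = Eq.trans assoc (refl⟩⨾⟨ p)

  replaceˡ : ∀ {n m m′ k l} {f : Hom n m} {g : Hom m k} {h : Hom k l}
             {f′ : Hom n m′} {g′ : Hom m′ k} →
             f ⨾ g ≈ f′ ⨾ g′ → f ⨾ g ⨾ h ≈ f′ ⨾ g′ ⨾ h
  replaceˡ p = Eq.trans (pullˡ p) assoc

  interchange : ∀ {n m k n′ m′ k′} {f : Hom n m} {g : Hom m k} {f′ : Hom n′ m′} {g′ : Hom m′ k′} →
                (f ⊕ f′) ⨾ (g ⊕ g′) ≈ (f ⨾ g) ⊕ (f′ ⨾ g′)
  interchange = Eq.sym (⊕-interchange _ _ _ _)

  merge : ∀ {n m k n′ m′ k′} {f : Hom n m} {g : Hom m k} {f′ : Hom n′ m′} {g′ : Hom m′ k′}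
          {h : Hom n k} {h′ : Hom n′ k′} → f ⨾ g ≈ h → f′ ⨾ g′ ≈ h′ → (f ⊕ f′) ⨾ (g ⊕ g′) ≈ h ⊕ h′
  merge p q = Eq.trans interchange (p ⟩⊕⟨ q)

  slide : ∀ {n m k n′ m′ k′} {f : Hom n m} {g : Hom m k} {f′ : Hom n′ m′} {g′ : Hom m′ k′}
          {l l′} {h : Hom n l} {i : Hom l k} {h′ : Hom n′ l′} {i′ : Hom l′ k′} →
          f ⨾ g ≈ h ⨾ i → f′ ⨾ g′ ≈ h′ ⨾ i′ → (f ⊕ f′) ⨾ (g ⊕ g′) ≈ (h ⊕ h′) ⨾ (i ⊕ i′)
  slide p q = Eq.trans (merge p q) (⊕-interchange _ _ _ _)

  -- On concrete numerals and in the first summand 1 the associativity proofs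
  -- of ℕ reduce to refl, so no transport appears below.
  σ₁-0 : σ 1 0 ≈ id 1
  σ₁-0 = begin
    σ 1 0                                ≈⟨ idʳ ⟨
    σ 1 0 ⨾ id 1                         ≈⟨ refl⟩⨾⟨ σ-involutive 1 0 ⟨
    σ 1 0 ⨾ σ 1 0 ⨾ σ 0 1                ≈⟨ Eq.trans ((⊕-idʳ (σ 1 0) ⟩⨾⟨ ⊕-idˡ (σ 1 0)) ⟩⨾⟨refl) assoc ⟨
    ((σ 1 0 ⊕ id 0) ⨾ (id 0 ⊕ σ 1 0)) ⨾ σ 0 1  ≈⟨ σ-hexagon 1 0 0 ⟩⨾⟨refl ⟩
    σ 1 0 ⨾ σ 0 1                        ≈⟨ σ-involutive 1 0 ⟩
    id 1                                 ∎
    where open HomReasoning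

  -- The hexagon at zero makes this symmetry idempotent, and an invertible idempotent is an
  -- identity. `σ₁-0` rests on the same argument.
  σ₀-0 : σ 0 0 ≈ id 0
  σ₀-0 = begin
    σ 0 0                                ≈⟨ idʳ ⟨
    σ 0 0 ⨾ id 0                         ≈⟨ refl⟩⨾⟨ σ-involutive 0 0 ⟨
    σ 0 0 ⨾ σ 0 0 ⨾ σ 0 0                ≈⟨ Eq.trans ((⊕-idʳ (σ 0 0) ⟩⨾⟨ ⊕-idˡ (σ 0 0)) ⟩⨾⟨refl) assoc ⟨
    ((σ 0 0 ⊕ id 0) ⨾ (id 0 ⊕ σ 0 0)) ⨾ σ 0 0  ≈⟨ σ-hexagon 0 0 0 ⟩⨾⟨refl ⟩
    σ 0 0 ⨾ σ 0 0                        ≈⟨ σ-involutive 0 0 ⟩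
    id 0                                 ∎
    where open HomReasoning

  σ₀-1 : σ 0 1 ≈ id 1
  σ₀-1 = begin
    σ 0 1          ≈⟨ idʳ ⟨
    σ 0 1 ⨾ id 1   ≈⟨ refl⟩⨾⟨ σ₁-0 ⟨
    σ 0 1 ⨾ σ 1 0  ≈⟨ σ-involutive 0 1 ⟩
    id 1           ∎
    where open HomReasoning

  σ₀ : ∀ m → σ 0 m ≈ subst (Hom m) (≡.sym (+-identityʳ m)) (id m)
  σ₀ zero    = σ₀-0
  σ₀ (suc m) = begin
    σ 0 (suc m)                                         ≈⟨ σ-hexagon 0 1 m ⟨
    (σ 0 1 ⊕ id m) ⨾ (id 1 ⊕ σ 0 m)                     ≈⟨ (Eq.trans (σ₀-1 ⟩⊕⟨refl) (⊕-id 1 m)) ⟩⨾⟨refl ⟩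
    id (suc m) ⨾ (id 1 ⊕ σ 0 m)                         ≈⟨ idˡ ⟩
    id 1 ⊕ σ 0 m                                        ≈⟨ refl⟩⊕⟨ σ₀ m ⟩
    id 1 ⊕ subst (Hom m) (≡.sym (+-identityʳ m)) (id m) ≈⟨ transported (+-identityʳ m) ⟩
    subst (Hom (suc m)) (≡.sym (+-identityʳ (suc m))) (id (suc m)) ∎
    where
    open HomReasoning
    transported : ∀ {k} (p : k ≡ m) →
           id 1 ⊕ subst (Hom m) (≡.sym p) (id m)
             ≈ subst (Hom (suc m)) (≡.sym (≡.cong suc p)) (id (suc m))
    transported ≡.refl = ⊕-id 1 m

  σ₁-suc : ∀ m → σ 1 (suc m) ≈ (σ 1 1 ⊕ id m) ⨾ (id 1 ⊕ σ 1 m)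
  σ₁-suc m = Eq.sym (σ-hexagon 1 1 m)

  -- The hexagon decomposes only the second argument of `σ`. Here `σ m (suc n)` is decomposed
  -- instead, and its two inverses `σ (suc n) m` and `Y ⨾ X` are compared. The result is the
  -- recursion by which `σᵗ` is defined.
  σ-suc : ∀ n m → σ (suc n) m ≈
          (id 1 ⊕ σ n m) ⨾ subst (Hom (suc m + n)) (+-assoc m 1 n) (σ 1 m ⊕ id n)
  σ-suc n m = begin
    σ (suc n) m                            ≈⟨ idʳ ⟨
    σ (suc n) m ⨾ id (m + suc n)           ≈⟨ refl⟩⨾⟨ inverse ⟨
    σ (suc n) m ⨾ σ m (suc n) ⨾ Y ⨾ X      ≈⟨ pullˡ (σ-involutive (suc n) m) ⟩
    id (suc n + m) ⨾ Y ⨾ X                 ≈⟨ idˡ ⟩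
    Y ⨾ X                                  ∎
    where
    open HomReasoning
    X : Hom (suc m + n) (m + suc n)
    X = subst (Hom (suc m + n)) (+-assoc m 1 n) (σ 1 m ⊕ id n)
    X⁻ : Hom (m + suc n) (suc m + n)
    X⁻ = subst₂ Hom (+-assoc m 1 n) ≡.refl (σ m 1 ⊕ id n)
    Y = id 1 ⊕ σ n m
    X⁻X : X⁻ ⨾ X ≈ id _
    X⁻X = cancel (+-assoc m 1 n) (Eq.trans (merge (σ-involutive m 1) idʳ) (⊕-id (m + 1) n))
      where
      cancel : ∀ {k k′ l} (p : k ≡ k′) {f : Hom k l} {g : Hom l k} → f ⨾ g ≈ id k →
               subst₂ Hom p ≡.refl f ⨾ subst (Hom l) p g ≈ id k′
      cancel ≡.refl q = q
    inverse : σ m (suc n) ⨾ Y ⨾ X ≈ id (m + suc n)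
    inverse = begin
      σ m (suc n) ⨾ Y ⨾ X                  ≈⟨ σ-hexagon m 1 n ⟩⨾⟨refl ⟨
      (X⁻ ⨾ (id 1 ⊕ σ m n)) ⨾ Y ⨾ X        ≈⟨ pullʳ (pullˡ (Eq.trans (merge idʳ (σ-involutive m n)) (⊕-id 1 (m + n)))) ⟩
      X⁻ ⨾ id (suc m + n) ⨾ X              ≈⟨ refl⟩⨾⟨ idˡ ⟩
      X⁻ ⨾ X                               ≈⟨ X⁻X ⟩
      id (m + suc n) ∎

infix 9 _ᴼᴾ
-- With values here the reversal of terms is covariant, so the soundness proof for interpretations
-- applies to `_†` as well.
_ᴼᴾ : PROP c ℓ → PROP c ℓ
P ᴼᴾ = record
  { Hom = flip Hom ; _≈_ = _≈_ ; isEquivalence = isEquivalence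
  ; id = id ; _⨾_ = flip _⨾_ ; _⊕_ = _⊕_ ; σ = flip σ
  ; ⨾-cong = flip ⨾-cong
  ; ⨾-assoc = λ f g h → Eq.sym (⨾-assoc h g f)
  ; ⨾-idˡ = ⨾-idʳ ; ⨾-idʳ = ⨾-idˡ
  ; ⊕-cong = ⊕-cong ; ⊕-id = ⊕-id
  ; ⊕-interchange = λ f g f′ g′ → ⊕-interchange g f g′ f′
  ; ⊕-assoc = λ {n₁} {m₁} {n₂} {m₂} {n₃} {m₃} f g h →
      Eq.trans (Eq.reflexive (subst₂-flip (+-assoc n₁ n₂ n₃) (+-assoc m₁ m₂ m₃) ((f ⊕ g) ⊕ h)))
               (⊕-assoc f g h)
  ; ⊕-idˡ = ⊕-idˡ
  ; ⊕-idʳ = λ {n} {m} f →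
      Eq.trans (Eq.reflexive (subst₂-flip (+-identityʳ n) (+-identityʳ m) (f ⊕ id 0))) (⊕-idʳ f)
  ; σ-natural = λ {n} {m} {n′} {m′} f g → Eq.sym (σ-natural g f)
  ; σ-involutive = λ n m → σ-involutive n m
  ; σ-hexagon = hexagon
  }
  where
  open PROP P
  subst₂-flip : ∀ {n m n′ m′} (p : n ≡ n′) (q : m ≡ m′) (f : Hom m n) →
                subst₂ (flip Hom) p q f ≡ subst₂ Hom q p f
  subst₂-flip ≡.refl ≡.refl f = ≡.refl
  open PROPProperties P
  -- Reversing the hexagon gives the inverse of an instance of `σ-hexagon`, not an instance; hence
  -- the passage through the inverse `S`.
  hexagon : ∀ n m k →
    (id m ⊕ σ k n) ⨾ subst₂ (flip Hom) (+-assoc n m k) (+-assoc m n k) (σ m n ⊕ id k)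
      ≈ subst₂ (flip Hom) ≡.refl (+-assoc m k n) (σ (m + k) n)
  hexagon n m k = begin
    Y ⨾ X                          ≈⟨ idˡ ⟨
    id _ ⨾ Y ⨾ X                   ≈⟨ SS ⟩⨾⟨refl ⟨
    (S ⨾ subst₂ Hom ≡.refl (+-assoc m k n) (σ n (m + k))) ⨾ Y ⨾ X
      ≈⟨ (refl⟩⨾⟨ Eq.sym (σ-hexagon n m k)) ⟩⨾⟨refl ⟩
    (S ⨾ X⁻ ⨾ (id m ⊕ σ n k)) ⨾ Y ⨾ X ≈⟨ pullʳ (pullʳ (pullˡ (Eq.trans (merge idˡ (σ-involutive n k)) (⊕-id m _)))) ⟩
    S ⨾ X⁻ ⨾ id _ ⨾ X              ≈⟨ refl⟩⨾⟨ (refl⟩⨾⟨ idˡ) ⟩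
    S ⨾ X⁻ ⨾ X                     ≈⟨ refl⟩⨾⟨ X⁻X ⟩
    S ⨾ id _                       ≈⟨ idʳ ⟩
    S                              ∎
    where
    open HomReasoning
    X = subst₂ (flip Hom) (+-assoc n m k) (+-assoc m n k) (σ m n ⊕ id k)
    X⁻ = subst₂ Hom (+-assoc n m k) (+-assoc m n k) (σ n m ⊕ id k)
    Y = id m ⊕ σ k n
    S = subst₂ (flip Hom) ≡.refl (+-assoc m k n) (σ (m + k) n)
    SS : S ⨾ subst₂ Hom ≡.refl (+-assoc m k n) (σ n (m + k)) ≈ id _
    SS = go (+-assoc m k n) (σ-involutive (m + k) n)
      where
      go : ∀ {a b b′} (p : b ≡ b′) {f : Hom b a} {g : Hom a b} → f ⨾ g ≈ id b →
           subst₂ (flip Hom) ≡.refl p f ⨾ subst₂ Hom ≡.refl p g ≈ id b′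
      go ≡.refl q = q
    X⁻X : X⁻ ⨾ X ≈ id _
    X⁻X = go (+-assoc n m k) (+-assoc m n k) (Eq.trans (merge (σ-involutive n m) idˡ) (⊕-id (n + m) k))
      where
      go : ∀ {a a′ b b′} (p : a ≡ a′) (q : b ≡ b′) {f : Hom a b} {g : Hom b a} → f ⨾ g ≈ id a →
           subst₂ Hom p q f ⨾ subst₂ (flip Hom) p q g ≈ id a′
      go ≡.refl ≡.refl r = r

-- Interpretations of presented PROPs

module Extension (P : Presentation c e) (Q : PROP c′ ℓ′) where
  open Presentation P
  open Presented P using (_∼_; presented; axiom; refl; sym; trans)
  module ∼ = Presented P
  open PROP Q
  open PROPProperties Q

  -- `map` is a parameter rather than an extension of a map on generators: renaming, reversal and
  -- the two semantics each have their own recursion, and all of them are shown to respect the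
  -- presented equality by the one proof `map-cong`.
  record IsInterpretation (map : ∀ {n m} → Term Gen n m → Hom n m) : Set (c ⊔ c′ ⊔ ℓ′ ⊔ e) where
    field
      map-id₀   : map id₀ ≈ id 0
      map-id₁   : map id₁ ≈ id 1
      map-σ₁₁   : map σ₁₁ ≈ σ 1 1
      map-⨾     : ∀ {n m k} (f : Term Gen n m) (g : Term Gen m k) → map (f Defs.⨾ g) ≈ map f ⨾ map g
      map-⊕     : ∀ {n m n′ m′} (f : Term Gen n m) (g : Term Gen n′ m′) →
                  map (f Defs.⊕ g) ≈ map f ⊕ map g
      map-axiom : ∀ {n m} {f g : Term Gen n m} → Eqn f g → map f ≈ map g

    map-id : ∀ n → map (idᵗ n) ≈ id n
    map-id zero    = map-id₀
    map-id (suc n) = Eq.trans (map-⊕ _ _) (Eq.trans (map-id₁ ⟩⊕⟨ map-id n) (⊕-id 1 n))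

    map-⨾-cong : ∀ {n m k} {f : Term Gen n m} {g : Term Gen m k} {f′ g′} →
                 map f ≈ f′ → map g ≈ g′ → map (f Defs.⨾ g) ≈ f′ ⨾ g′
    map-⨾-cong p q = Eq.trans (map-⨾ _ _) (p ⟩⨾⟨ q)

    map-⊕-cong : ∀ {n m n′ m′} {f : Term Gen n m} {g : Term Gen n′ m′} {f′ g′} →
                 map f ≈ f′ → map g ≈ g′ → map (f Defs.⊕ g) ≈ f′ ⊕ g′
    map-⊕-cong p q = Eq.trans (map-⊕ _ _) (p ⟩⊕⟨ q)

    map-σ₁ : ∀ m → map (σ₁ᵗ m) ≈ σ 1 m
    map-σ₁ zero    = Eq.trans map-id₁ (Eq.sym σ₁-0)
    map-σ₁ (suc m) = Eq.trans
      (map-⨾-cong (map-⊕-cong map-σ₁₁ (map-id m)) (map-⊕-cong map-id₁ (map-σ₁ m)))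
      (Eq.sym (σ₁-suc m))

    map-subst-cod : ∀ {n m m′} (p : m ≡ m′) {f : Term Gen n m} {f′ : Hom n m} → map f ≈ f′ →
                    map (subst (Term Gen n) p f) ≈ subst (Hom n) p f′
    map-subst-cod ≡.refl q = q

    map-σ : ∀ n m → map (σᵗ n m) ≈ σ n m
    map-σ zero    m = Eq.trans (map-subst-cod (≡.sym (+-identityʳ m)) (map-id m)) (Eq.sym (σ₀ m))
    map-σ (suc n) m = Eq.trans
      (map-⨾-cong (map-⊕-cong map-id₁ (map-σ n m))
        (map-subst-cod (+-assoc m 1 n) (map-⊕-cong (map-σ₁ m) (map-id n))))
      (Eq.sym (σ-suc n m))

    map-subst-cong : ∀ {n m n′ m′} (p : n ≡ n′) (q : m ≡ m′) {f : Term Gen n m} {f′ : Hom n m} →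
                     map f ≈ f′ → map (subst₂ (Term Gen) p q f) ≈ subst₂ Hom p q f′
    map-subst-cong ≡.refl ≡.refl r = r

    map-cong : ∀ {n m} {f g : Term Gen n m} → f ∼ g → map f ≈ map g
    map-cong (axiom p)     = map-axiom p
    map-cong refl          = Eq.refl
    map-cong (sym p)       = Eq.sym (map-cong p)
    map-cong (trans p q)   = Eq.trans (map-cong p) (map-cong q)
    map-cong (∼.⨾-cong p q) = Eq.trans (map-⨾-cong (map-cong p) (map-cong q)) (Eq.sym (map-⨾ _ _))
    map-cong (∼.⨾-assoc f g h) = Eq.trans (map-⨾-cong (map-⨾ f g) Eq.refl) (Eq.trans assoc
      (Eq.sym (map-⨾-cong Eq.refl (map-⨾ g h))))
    map-cong (∼.⨾-idˡ f) = Eq.trans (map-⨾-cong (map-id _) Eq.refl) idˡ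
    map-cong (∼.⨾-idʳ f) = Eq.trans (map-⨾-cong Eq.refl (map-id _)) idʳ
    map-cong (∼.⊕-cong p q) = Eq.trans (map-⊕-cong (map-cong p) (map-cong q)) (Eq.sym (map-⊕ _ _))
    map-cong (∼.⊕-id n m) = Eq.trans (map-⊕-cong (map-id n) (map-id m))
      (Eq.trans (⊕-id n m) (Eq.sym (map-id (n + m))))
    map-cong (∼.⊕-interchange f g f′ g′) = Eq.trans (map-⊕-cong (map-⨾ f g) (map-⨾ f′ g′))
      (Eq.trans (⊕-interchange _ _ _ _) (Eq.sym (map-⨾-cong (map-⊕ f f′) (map-⊕ g g′))))
    map-cong (∼.⊕-assoc {n₁} {m₁} {n₂} {m₂} {n₃} {m₃} f g h) = Eq.trans
      (map-subst-cong (+-assoc n₁ n₂ n₃) (+-assoc m₁ m₂ m₃) (map-⊕-cong (map-⊕ f g) Eq.refl))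
      (Eq.trans (⊕-assoc _ _ _) (Eq.sym (map-⊕-cong Eq.refl (map-⊕ g h))))
    map-cong (∼.⊕-idˡ f) = Eq.trans (map-⊕-cong map-id₀ Eq.refl) (⊕-idˡ _)
    map-cong (∼.⊕-idʳ {n} {m} f) = Eq.trans
      (map-subst-cong (+-identityʳ n) (+-identityʳ m) (map-⊕-cong Eq.refl map-id₀)) (⊕-idʳ _)
    map-cong (∼.σ-natural {n} {m} {n′} {m′} f g) = Eq.trans (map-⨾-cong (map-⊕ f g) (map-σ m m′))
      (Eq.trans (σ-natural _ _) (Eq.sym (map-⨾-cong (map-σ n n′) (map-⊕ g f))))
    map-cong (∼.σ-involutive n m) = Eq.trans (map-⨾-cong (map-σ n m) (map-σ m n))
      (Eq.trans (σ-involutive n m) (Eq.sym (map-id (n + m))))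
    map-cong (∼.σ-hexagon n m k) = Eq.trans
      (map-⨾-cong (map-subst-cong (+-assoc n m k) (+-assoc m n k) (map-⊕-cong (map-σ n m) (map-id k)))
        (map-⊕-cong (map-id m) (map-σ n k)))
      (Eq.trans (σ-hexagon n m k)
        (Eq.sym (map-subst-cong ≡.refl (+-assoc m k n) (map-σ n (m + k)))))

    morphism : PROPMorphism presented Q
    morphism = record
      { map = map ; cong = map-cong ; map-id = map-id ; map-⨾ = map-⨾ ; map-⊕ = map-⊕ ; map-σ = map-σ }

-- Coefficients are formal differences (a , b) of natural numbers; the clause for
-- b = 0 makes 0 and 1 evaluate to 0# and 1# definitionally.
module IntegerSolver (R : CommutativeRing c ℓ) where
  open CommutativeRing R renaming
    (_+_ to _+ᴿ_; +-identityʳ to +ᴿ-identityʳ; zero to *-zero) hiding (+-assoc)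
  open import Algebra.Properties.Ring ring
    using
    (-‿distribˡ-*; -‿distribʳ-*; -‿+-comm; -0#≈0#; -‿involutive; x≈y⇒x∙y⁻¹≈ε; x∙y⁻¹≈ε⇒x≈y)
  open import Algebra.Properties.CommutativeSemigroup +-commutativeSemigroup
    using (interchange)
  open import Algebra.Properties.Semiring.Mult.TCOptimised semiring
    renaming (_×_ to _·_)
  open import Relation.Binary.Reasoning.Setoid setoid

  differences : RawRing _ _
  differences = record
    { Carrier = ℕ × ℕ
    ; _≈_     = _≡_
    ; _+_     = λ (a , b) (c , d) → a ℕ.+ c , b ℕ.+ d
    ; _*_     = λ (a , b) (c , d) → a ℕ.* c ℕ.+ b ℕ.* d , a ℕ.* d ℕ.+ b ℕ.* c
    ; -_      = λ (a , b) → b , a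
    ; 0#      = 0 , 0
    ; 1#      = 1 , 0
    }

  ⟦_⟧ : ℕ × ℕ → Carrier
  ⟦ a , zero ⟧  = a · 1#
  ⟦ a , suc b ⟧ = a · 1# - suc b · 1#

  ⟦⟧-minus : ∀ a b → ⟦ a , b ⟧ ≈ a · 1# - b · 1#
  ⟦⟧-minus a zero    = sym (trans (+-congˡ -0#≈0#) (+ᴿ-identityʳ _))
  ⟦⟧-minus a (suc b) = refl

  *-minus : ∀ a b c d → (a - b) * (c - d) ≈ (a * c +ᴿ b * d) - (a * d +ᴿ b * c)
  *-minus a b c d = begin
    (a - b) * (c - d)
      ≈⟨ distribʳ _ _ _ ⟩
    a * (c - d) +ᴿ - b * (c - d)
      ≈⟨ +-cong (distribˡ _ _ _) (distribˡ _ _ _) ⟩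
    (a * c +ᴿ a * - d) +ᴿ (- b * c +ᴿ - b * - d)
      ≈⟨ +-cong (+-congˡ (sym (-‿distribʳ-* a d)))
                (+-cong (sym (-‿distribˡ-* b c))
                  (trans (sym (-‿distribˡ-* b (- d)))
                    (trans (-‿cong (sym (-‿distribʳ-* b d))) (-‿involutive _)))) ⟩
    (a * c - a * d) +ᴿ (- (b * c) +ᴿ b * d)
      ≈⟨ +-congˡ (+-comm _ _) ⟩
    (a * c - a * d) +ᴿ (b * d - b * c)
      ≈⟨ interchange _ _ _ _ ⟩
    (a * c +ᴿ b * d) +ᴿ (- (a * d) - b * c)
      ≈⟨ +-congˡ (-‿+-comm _ _) ⟩
    (a * c +ᴿ b * d) - (a * d +ᴿ b * c) ∎

  homomorphism : differences -Raw-AlmostCommutative⟶ fromCommutativeRing R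
  homomorphism = record
    { ⟦_⟧    = ⟦_⟧
    ; +-homo = λ (a , b) (c , d) → begin
        ⟦ a ℕ.+ c , b ℕ.+ d ⟧
          ≈⟨ ⟦⟧-minus (a ℕ.+ c) (b ℕ.+ d) ⟩
        (a ℕ.+ c) · 1# - (b ℕ.+ d) · 1#
          ≈⟨ +-cong (×-homo-+ 1# a c)
               (trans (-‿cong (×-homo-+ 1# b d)) (sym (-‿+-comm _ _))) ⟩
        (a · 1# +ᴿ c · 1#) +ᴿ (- (b · 1#) - d · 1#)
          ≈⟨ interchange _ _ _ _ ⟩
        (a · 1# - b · 1#) +ᴿ (c · 1# - d · 1#)
          ≈⟨ +-cong (⟦⟧-minus a b) (⟦⟧-minus c d) ⟨
        ⟦ a , b ⟧ +ᴿ ⟦ c , d ⟧ ∎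
    ; *-homo = λ (a , b) (c , d) → begin
        ⟦ a ℕ.* c ℕ.+ b ℕ.* d , a ℕ.* d ℕ.+ b ℕ.* c ⟧
          ≈⟨ ⟦⟧-minus (a ℕ.* c ℕ.+ b ℕ.* d) (a ℕ.* d ℕ.+ b ℕ.* c) ⟩
        (a ℕ.* c ℕ.+ b ℕ.* d) · 1# - (a ℕ.* d ℕ.+ b ℕ.* c) · 1#
          ≈⟨ +-cong (expand a c b d) (-‿cong (expand a d b c)) ⟩
        (a · 1# * c · 1# +ᴿ b · 1# * d · 1#) - (a · 1# * d · 1# +ᴿ b · 1# * c · 1#)
          ≈⟨ *-minus _ _ _ _ ⟨
        (a · 1# - b · 1#) * (c · 1# - d · 1#)
          ≈⟨ *-cong (⟦⟧-minus a b) (⟦⟧-minus c d) ⟨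
        ⟦ a , b ⟧ * ⟦ c , d ⟧ ∎
    ; -‿homo = λ (a , b) → begin
        ⟦ b , a ⟧                ≈⟨ ⟦⟧-minus b a ⟩
        b · 1# - a · 1#          ≈⟨ +-comm _ _ ⟩
        - (a · 1#) +ᴿ b · 1#      ≈⟨ +-congˡ (-‿involutive _) ⟨
        - (a · 1#) - - (b · 1#)  ≈⟨ -‿+-comm _ _ ⟩
        - (a · 1# - b · 1#)      ≈⟨ -‿cong (⟦⟧-minus a b) ⟨
        - ⟦ a , b ⟧ ∎
    ; 0-homo = refl
    ; 1-homo = refl
    }
    where
    expand : ∀ a b c d → (a ℕ.* b ℕ.+ c ℕ.* d) · 1# ≈ a · 1# * b · 1# +ᴿ c · 1# * d · 1#
    expand a b c d = trans (×-homo-+ 1# (a ℕ.* b) (c ℕ.* d))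
      (+-cong (×1-homo-* a b) (×1-homo-* c d))

  -- The integers a - b and c - d are compared by cross-addition in ℕ. Distinct integers may still
  -- agree in `R`, so a failed comparison asserts nothing.
  weaklyDecide : (p q : ℕ × ℕ) → Maybe (⟦ p ⟧ ≈ ⟦ q ⟧)
  weaklyDecide (a , b) (c , d) with a ℕ.+ d ℕ.≟ c ℕ.+ b
  ... | no  _ = nothing
  ... | yes p = just (x∙y⁻¹≈ε⇒x≈y _ _ (begin
    ⟦ a , b ⟧ - ⟦ c , d ⟧
      ≈⟨ +-cong (⟦⟧-minus a b) (-‿cong (⟦⟧-minus c d)) ⟩
    (a · 1# - b · 1#) - (c · 1# - d · 1#)
      ≈⟨ +-congˡ (trans (sym (-‿+-comm _ _)) (trans (+-congˡ (-‿involutive _)) (+-comm _ _))) ⟩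
    (a · 1# - b · 1#) +ᴿ (d · 1# - c · 1#)
      ≈⟨ interchange _ _ _ _ ⟩
    (a · 1# +ᴿ d · 1#) +ᴿ (- (b · 1#) - c · 1#)
      ≈⟨ +-congˡ (trans (+-comm _ _) (-‿+-comm _ _)) ⟩
    (a · 1# +ᴿ d · 1#) - (c · 1# +ᴿ b · 1#)
      ≈⟨ +-cong (sym (×-homo-+ 1# a d)) (-‿cong (sym (×-homo-+ 1# c b))) ⟩
    (a ℕ.+ d) · 1# - (c ℕ.+ b) · 1#
      ≈⟨ x≈y⇒x∙y⁻¹≈ε (reflexive (≡.cong (_· 1#) p)) ⟩
    0# ∎))

  open Algebra.Solver.Ring differences (fromCommutativeRing R) homomorphism weaklyDecide public
    using (solve; _:=_; _:+_; _:*_; _:-_; :-_; con; Polynomial)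

  𝟘 𝟙 : ∀ {n} → Polynomial n
  𝟘 = con (0 , 0)
  𝟙 = con (1 , 0)

-- Matrix semantics of HA

module MatrixSemantics (R : CommutativeRing c ℓ) (pid : IsPID R) where
  open CommutativeRing R renaming
    (_+_ to _+ᴿ_; +-assoc to +ᴿ-assoc; +-identityʳ to +ᴿ-identityʳ; zero to *-zero)
  open Matrices R
  open MatrixPullbacks R pid using (Vect; _*ᵥ_; *ᵥ-cong)
  open import Algebra.Properties.Semiring.Sum semiring using (sum; sum-cong-≋)
  open SetoidReasoning setoid
  open IntegerSolver R

  ⟦_⟧ᵐ : ∀ {n m} → Term (HAGen R) n m → Matrix m n
  ⟦ gen copy ⟧ᵐ       = λ _ _ → 1#
  ⟦ gen discard ⟧ᵐ    = λ ()
  ⟦ gen add ⟧ᵐ        = λ _ _ → 1#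
  ⟦ gen zero ⟧ᵐ       = λ _ ()
  ⟦ gen (scalar k) ⟧ᵐ = λ _ _ → k
  ⟦ id₀ ⟧ᵐ            = δ
  ⟦ id₁ ⟧ᵐ            = δ
  ⟦ σ₁₁ ⟧ᵐ            = permutationMatrix (swap 1 1)
  ⟦ f Defs.⨾ g ⟧ᵐ     = ⟦ g ⟧ᵐ · ⟦ f ⟧ᵐ
  ⟦ f Defs.⊕ g ⟧ᵐ     = ⟦ f ⟧ᵐ ⊞ ⟦ g ⟧ᵐ

  infix 4 _≈ᵥ_
  _≈ᵥ_ : ∀ {n} → Vect n → Vect n → Set ℓ
  u ≈ᵥ v = ∀ i → u i ≈ v i

  _++ᵥ_ : ∀ {n m} → Vect n → Vect m → Vect (n + m)
  _++ᵥ_ {n} u v i = [ u , v ]′ (splitAt n i)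

  takeᵥ : ∀ n {m} → Vect (n + m) → Vect n
  takeᵥ n {m} v i = v (i ↑ˡ m)

  dropᵥ : ∀ n {m} → Vect (n + m) → Vect m
  dropᵥ n v i = v (n ↑ʳ i)

  []-cong : ∀ {n m} {u u′ : Vect n} {v v′ : Vect m} → u ≈ᵥ u′ → v ≈ᵥ v′ →
            ∀ x → [ u , v ]′ x ≈ [ u′ , v′ ]′ x
  []-cong p q (inj₁ i) = p i
  []-cong p q (inj₂ i) = q i

  ++ᵥ-cong : ∀ {n m} {u u′ : Vect n} {v v′ : Vect m} → u ≈ᵥ u′ → v ≈ᵥ v′ →
             (u ++ᵥ v) ≈ᵥ (u′ ++ᵥ v′)
  ++ᵥ-cong {n} p q i = []-cong p q (splitAt n i)

  -- The action of `⟦_⟧ᵐ` on vectors, computed without sums: both sides of an axiom reduce to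
  -- expressions in a few entries. `*ᵥ-apply` and `action-injective` carry the result back to
  -- matrices.
  apply : ∀ {n m} → Term (HAGen R) n m → Vect n → Vect m
  apply (gen copy)       v _ = v zero
  apply (gen discard)    v ()
  apply (gen add)        v _ = v zero +ᴿ v (suc zero)
  apply (gen zero)       v _ = 0#
  apply (gen (scalar k)) v _ = k * v zero
  apply id₀              v   = v
  apply id₁              v   = v
  apply σ₁₁              v i = v (swap 1 1 i)
  apply (f Defs.⨾ g)     v   = apply g (apply f v)
  apply (Defs._⊕_ {n} f g) v = apply f (takeᵥ n v) ++ᵥ apply g (dropᵥ n v)

  apply-cong : ∀ {n m} (f : Term (HAGen R) n m) {u v : Vect n} → u ≈ᵥ v → apply f u ≈ᵥ apply f v
  apply-cong (gen copy)       p i = p zero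
  apply-cong (gen add)        p i = +-cong (p zero) (p (suc zero))
  apply-cong (gen zero)       p i = refl
  apply-cong (gen (scalar k)) p i = *-congˡ (p zero)
  apply-cong id₀              p i = p i
  apply-cong id₁              p i = p i
  apply-cong σ₁₁              p i = p (swap 1 1 i)
  apply-cong (f Defs.⨾ g)     p i = apply-cong g (apply-cong f p) i
  apply-cong (Defs._⊕_ {n} {m} f g) p i =
    []-cong (apply-cong f (λ j → p (j ↑ˡ _))) (apply-cong g (λ j → p (n ↑ʳ j))) (splitAt m i)

  ·-*ᵥ : ∀ {m n k} (A : Matrix m n) (B : Matrix n k) (v : Vect k) → ((A · B) *ᵥ v) ≈ᵥ (A *ᵥ (B *ᵥ v))
  ·-*ᵥ A B v i = ·-assoc A B (λ j (_ : Fin 1) → v j) i zero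

  ⊞-*ᵥ : ∀ {m n m′ n′} (A : Matrix m n) (B : Matrix m′ n′) v →
         ((A ⊞ B) *ᵥ v) ≈ᵥ ((A *ᵥ takeᵥ n v) ++ᵥ (B *ᵥ dropᵥ n v))
  ⊞-*ᵥ {m} {n} {m′} {n′} A B v i = go (splitAt m i)
    where
    entry : ∀ x → sum (λ j → block A B x (splitAt n j) * v j)
              ≈ sum (λ j → block A B x (inj₁ j) * v (j ↑ˡ n′)) +ᴿ sum (λ j → block A B x (inj₂ j) * v (n ↑ʳ j))
    entry x = trans (sum-+ n (λ j → block A B x (splitAt n j) * v j)) (+-cong
      (sum-cong-≋ (λ j → *-congʳ (reflexive (≡.cong (block A B x) (splitAt-↑ˡ n j n′)))))
      (sum-cong-≋ (λ j → *-congʳ (reflexive (≡.cong (block A B x) (splitAt-↑ʳ n n′ j))))))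
    go : ∀ x → sum (λ j → block A B x (splitAt n j) * v j)
               ≈ [ A *ᵥ takeᵥ n v , B *ᵥ dropᵥ n v ]′ x
    go (inj₁ i) = trans (entry (inj₁ i))
      (trans (+-congˡ (sum-0 n′ (λ _ → zeroˡ _))) (+ᴿ-identityʳ _))
    go (inj₂ i) = trans (entry (inj₂ i))
      (trans (+-congʳ (sum-0 n (λ _ → zeroˡ _))) (+-identityˡ _))

  δ-*ᵥ : ∀ {n} (v : Vect n) → (δ *ᵥ v) ≈ᵥ v
  δ-*ᵥ v i = sum-δˡ i v

  *ᵥ-apply : ∀ {n m} (f : Term (HAGen R) n m) (v : Vect n) → (⟦ f ⟧ᵐ *ᵥ v) ≈ᵥ apply f v
  *ᵥ-apply (gen copy)       v i = solve 1 (λ x → 𝟙 :* x :+ 𝟘 := x) refl _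
  *ᵥ-apply (gen add)        v i = solve 2 (λ x y → 𝟙 :* x :+ (𝟙 :* y :+ 𝟘) := x :+ y) refl _ _
  *ᵥ-apply (gen zero)       v i = refl
  *ᵥ-apply (gen (scalar k)) v i = +ᴿ-identityʳ _
  *ᵥ-apply id₀              v ()
  *ᵥ-apply id₁              v   = δ-*ᵥ v
  *ᵥ-apply σ₁₁              v zero =
    solve 2 (λ x y → 𝟘 :* x :+ (𝟙 :* y :+ 𝟘) := y) refl _ _
  *ᵥ-apply σ₁₁              v (suc zero) =
    solve 2 (λ x y → 𝟙 :* x :+ (𝟘 :* y :+ 𝟘) := x) refl _ _
  *ᵥ-apply (f Defs.⨾ g)     v i = begin
    (⟦ f Defs.⨾ g ⟧ᵐ *ᵥ v) i         ≈⟨ ·-*ᵥ ⟦ g ⟧ᵐ ⟦ f ⟧ᵐ v i ⟩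
    (⟦ g ⟧ᵐ *ᵥ (⟦ f ⟧ᵐ *ᵥ v)) i      ≈⟨ *ᵥ-cong ⟦ g ⟧ᵐ (*ᵥ-apply f v) i ⟩
    (⟦ g ⟧ᵐ *ᵥ apply f v) i          ≈⟨ *ᵥ-apply g (apply f v) i ⟩
    apply g (apply f v) i ∎
  *ᵥ-apply (Defs._⊕_ {n} f g) v i = trans (⊞-*ᵥ ⟦ f ⟧ᵐ ⟦ g ⟧ᵐ v i)
    (++ᵥ-cong (*ᵥ-apply f (takeᵥ n v)) (*ᵥ-apply g (dropᵥ n v)) i)

  *ᵥ-congˡ : ∀ {m n} {A B : Matrix m n} → A ≋ B → ∀ v → (A *ᵥ v) ≈ᵥ (B *ᵥ v)
  *ᵥ-congˡ p v i = sum-cong-≋ (λ j → *-congʳ (p i j))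

  action-injective : ∀ {m n} {A B : Matrix m n} → (∀ v → (A *ᵥ v) ≈ᵥ (B *ᵥ v)) → A ≋ B
  action-injective {A = A} {B} p i j = trans (sym (sum-δʳ j (A i)))
    (trans (p (λ l → δ l j) i) (sum-δʳ j (B i)))

  ⟦⟧ᵐ-cong : ∀ {n m} (f g : Term (HAGen R) n m) → (∀ v → apply f v ≈ᵥ apply g v) → ⟦ f ⟧ᵐ ≋ ⟦ g ⟧ᵐ
  ⟦⟧ᵐ-cong f g p = action-injective {A = ⟦ f ⟧ᵐ} {⟦ g ⟧ᵐ} λ v i →
    trans (*ᵥ-apply f v i) (trans (p v i) (sym (*ᵥ-apply g v i)))

  axiom-sound : ∀ {n m} {f g : Term (HAGen R) n m} → HAEqn R f g → ∀ v → apply f v ≈ᵥ apply g v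
  axiom-sound (s-cong p)  v i          = *-congʳ p
  axiom-sound A1          v zero       = +-identityˡ _
  axiom-sound A2          v zero       = +-comm _ _
  axiom-sound A3          v zero       = +ᴿ-assoc _ _ _
  axiom-sound A4          v zero       = refl
  axiom-sound A5          v i          = refl
  axiom-sound A6          v zero             = refl
  axiom-sound A6          v (suc zero)       = refl
  axiom-sound A6          v (suc (suc zero)) = refl
  axiom-sound A8          v zero       = refl
  axiom-sound A8          v (suc zero) = refl
  axiom-sound A9          v zero       = refl
  axiom-sound A9          v (suc zero) = refl
  axiom-sound A11         v zero       = *-identityˡ _
  axiom-sound (A12 k₁ k₂) v i          = trans (sym (*-assoc _ _ _)) (*-congʳ (*-comm _ _))
  axiom-sound (A13 k)     v zero       = distribˡ _ _ _
  axiom-sound (A14 k)     v i          = zeroʳ k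
  axiom-sound (A15 k)     v zero       = refl
  axiom-sound (A15 k)     v (suc zero) = refl
  axiom-sound A17         v i          = zeroˡ _
  axiom-sound (A18 k₁ k₂) v i          = sym (distribʳ _ _ _)

  module HA→Mat = Extension (HA R) (Mat)

  ⟦⟧ᵐ-isInterpretation : HA→Mat.IsInterpretation ⟦_⟧ᵐ
  ⟦⟧ᵐ-isInterpretation = record
    { map-id₀ = λ () ; map-id₁ = λ _ _ → refl ; map-σ₁₁ = λ _ _ → refl
    ; map-⨾ = λ _ _ _ _ → refl ; map-⊕ = λ _ _ _ _ → refl
    ; map-axiom = λ {_} {_} {f} {g} p → ⟦⟧ᵐ-cong f g (axiom-sound p) }

  open HA→Mat.IsInterpretation ⟦⟧ᵐ-isInterpretation public
    using () renaming (map-cong to ⟦⟧ᵐ-sound; map-id to ⟦⟧ᵐ-id; map-σ to ⟦⟧ᵐ-σ)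

-- Induction on terms up to the laws of a PROP

module PresentedProperties (𝒫 : Presentation c e) where
  open Presented 𝒫 using (presented)
  open PROP presented
  open PROPProperties presented

  -- `id 1` unfolds to `id₁ ⊕ id₀`. The axioms are stated with the primitive `id₁` and the laws of a
  -- PROP with `id 1`, so the two have to be exchanged; `σ₁₁≈σ` does the same for the symmetry.
  id₁≈id : id₁ ≈ id 1
  id₁≈id = Eq.sym (⊕-idʳ id₁)

  σ₁₁≈σ : σ₁₁ ≈ σ 1 1
  σ₁₁≈σ = Eq.sym (begin
    (id₁ ⊕ id 1) ⨾ (((σ₁₁ ⊕ id₀) ⨾ (id₁ ⊕ id₁)) ⊕ id₀)
      ≈⟨ refl⟩⨾⟨ ⊕-idʳ _ ⟩
    id 2 ⨾ (σ₁₁ ⊕ id₀) ⨾ (id₁ ⊕ id₁)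
      ≈⟨ idˡ ⟩
    (σ₁₁ ⊕ id₀) ⨾ (id₁ ⊕ id₁)
      ≈⟨ ⊕-idʳ _ ⟩⨾⟨ (refl⟩⊕⟨ id₁≈id) ⟩
    σ₁₁ ⨾ id 2
      ≈⟨ idʳ ⟩
    σ₁₁ ∎)
    where
    open HomReasoning

  -- Terms are composites of whiskered generators, on which + of ℕ computes: this replaces an
  -- induction step for ⊕, where transports along +-assoc would be unavoidable.
  module TermInduction {p} (P : ∀ {n m} → Hom n m → Set p)
    (resp : ∀ {n m} {f g : Hom n m} → f ≈ g → P f → P g)
    (compose : ∀ {n m k} {f : Hom n m} {g : Hom m k} → P f → P g → P (f ⨾ g))
    (identity : ∀ n → P (id n))
    (wire : ∀ {n m} {f : Hom n m} → P f → P (id 1 ⊕ f))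
    (generator : ∀ {n m} (g : Presentation.Gen 𝒫 n m) k → P (gen g ⊕ id k))
    (symmetry : ∀ k → P (σ₁₁ ⊕ id k)) where

    wires : ∀ k {n m} {f : Hom n m} → P f → P (id k ⊕ f)
    wires zero    {f = f} p = resp (Eq.sym (⊕-idˡ f)) p
    wires (suc k) {f = f} p = resp
      (Eq.sym (Eq.trans (⊕-assoc id₁ (id k) f) (id₁≈id ⟩⊕⟨refl)))
      (wire (wires k p))

    transport : ∀ {n m n′ m′} (p : n ≡ n′) (q : m ≡ m′) {f : Hom n m} →
                P (subst₂ Hom p q f) → P f
    transport ≡.refl ≡.refl x = x

    context : ∀ {n m} (f : Hom n m) k → P (f ⊕ id k)
    context (gen g) k = generator g k
    context id₀     k = resp (Eq.sym (⊕-idˡ _)) (identity k)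
    context id₁     k = identity (suc k)
    context σ₁₁     k = symmetry k
    context (f Defs.⨾ g) k = resp (merge Eq.refl idˡ) (compose (context f k) (context g k))
    context (Defs._⊕_ {n} {m} {n′} {m′} f g) k =
      transport (+-assoc n n′ k) (+-assoc m m′ k)
        (resp (Eq.trans (merge idʳ idˡ) (Eq.sym (⊕-assoc f g (id k))))
          (compose (context f (n′ + k)) (wires m (context g k))))

    all : ∀ {n m} (f : Hom n m) → P f
    all {n} {m} f = transport (≡.sym (+-identityʳ n)) (≡.sym (+-identityʳ m))
      (resp (undo (+-identityʳ n) (+-identityʳ m) (⊕-idʳ f)) (context f 0))
      where
      undo : ∀ {n m n′ m′} (p : n ≡ n′) (q : m ≡ m′) {f : Hom n m} {g : Hom n′ m′} →
             subst₂ Hom p q f ≈ g → f ≈ subst₂ Hom (≡.sym p) (≡.sym q) g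
      undo ≡.refl ≡.refl r = r

-- Normal forms: HA presents matrices

module HACompleteness (R : CommutativeRing c ℓ) (pid : IsPID R) where
  open CommutativeRing R renaming
    (_+_ to _+ᴿ_; +-assoc to +ᴿ-assoc; +-identityʳ to +ᴿ-identityʳ; zero to *-zero;
     _≈_ to _≈ᴿ_; refl to ≈-refl; sym to ≈-sym; trans to ≈-trans; setoid to setoidᴿ;
     isEquivalence to ≈-isEquivalence)
  open Matrices R
  open MatrixPullbacks R pid using (Vect; _*ᵥ_)
  open MatrixSemantics R pid
  open HATerms R
  module ∼ = Presented (HA R)
  HAᴾ : PROP _ _
  HAᴾ = ∼.presented
  open PROP HAᴾ
  open PROPProperties HAᴾ
  open PresentedProperties (HA R)
  open HomReasoning

  private
    i = id 1
    S = σ 1 1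
    M = i ⊕ (S ⊕ i)

  s-cong′ : ∀ {k l} → k ≈ᴿ l → s k ≈ s l
  s-cong′ p = ∼.axiom (s-cong p)

  μ-unitˡ : (η◦ ⊕ i) ⨾ μ◦ ≈ i
  μ-unitˡ = begin
    (η◦ ⊕ i) ⨾ μ◦    ≈⟨ (refl⟩⊕⟨ id₁≈id) ⟩⨾⟨refl ⟨
    (η◦ ⊕ id₁) ⨾ μ◦  ≈⟨ ∼.axiom A1 ⟩
    id₁              ≈⟨ id₁≈id ⟩
    i                ∎

  μ-comm : S ⨾ μ◦ ≈ μ◦
  μ-comm = Eq.trans (Eq.sym σ₁₁≈σ ⟩⨾⟨refl) (∼.axiom A2)

  μ-assoc : (μ◦ ⊕ i) ⨾ μ◦ ≈ (i ⊕ μ◦) ⨾ μ◦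
  μ-assoc = begin
    (μ◦ ⊕ i) ⨾ μ◦    ≈⟨ (refl⟩⊕⟨ id₁≈id) ⟩⨾⟨refl ⟨
    (μ◦ ⊕ id₁) ⨾ μ◦  ≈⟨ ∼.axiom A3 ⟩
    (id₁ ⊕ μ◦) ⨾ μ◦  ≈⟨ (id₁≈id ⟩⊕⟨refl) ⟩⨾⟨refl ⟩
    (i ⊕ μ◦) ⨾ μ◦    ∎

  Δ-counitˡ : Δ• ⨾ (ε• ⊕ i) ≈ i
  Δ-counitˡ = begin
    Δ• ⨾ (ε• ⊕ i)    ≈⟨ refl⟩⨾⟨ (refl⟩⊕⟨ id₁≈id) ⟨
    Δ• ⨾ (ε• ⊕ id₁)  ≈⟨ ∼.axiom A4 ⟩
    id₁              ≈⟨ id₁≈id ⟩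
    i                ∎

  Δ-comm : Δ• ⨾ S ≈ Δ•
  Δ-comm = Eq.trans (refl⟩⨾⟨ Eq.sym σ₁₁≈σ) (∼.axiom A5)

  Δ-coassoc : Δ• ⨾ (Δ• ⊕ i) ≈ Δ• ⨾ (i ⊕ Δ•)
  Δ-coassoc = begin
    Δ• ⨾ (Δ• ⊕ i)    ≈⟨ refl⟩⨾⟨ (refl⟩⊕⟨ id₁≈id) ⟨
    Δ• ⨾ (Δ• ⊕ id₁)  ≈⟨ ∼.axiom A6 ⟩
    Δ• ⨾ (id₁ ⊕ Δ•)  ≈⟨ refl⟩⨾⟨ (id₁≈id ⟩⊕⟨refl) ⟩
    Δ• ⨾ (i ⊕ Δ•)    ∎

  bialgebra : μ◦ ⨾ Δ• ≈ (Δ• ⊕ Δ•) ⨾ M ⨾ (μ◦ ⊕ μ◦)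
  bialgebra = Eq.trans (∼.axiom A8)
    (refl⟩⨾⟨ ((id₁≈id ⟩⊕⟨ σ₁₁≈σ ⟩⊕⟨ id₁≈id) ⟩⨾⟨refl))

  s-1 : s 1# ≈ i
  s-1 = Eq.trans (∼.axiom A11) id₁≈id

  η-S : (i ⊕ η◦) ⨾ S ≈ η◦ ⊕ i
  η-S = Eq.trans (σ-natural i η◦) (Eq.trans (σ₁-0 ⟩⨾⟨refl) idˡ)

  S-ε : S ⨾ (ε• ⊕ i) ≈ i ⊕ ε•
  S-ε = Eq.trans (Eq.sym (σ-natural i ε•)) (Eq.trans (refl⟩⨾⟨ σ₁-0) idʳ)

  S-ε′ : S ⨾ (i ⊕ ε•) ≈ ε• ⊕ i
  S-ε′ = Eq.trans (Eq.sym (σ-natural ε• i)) (Eq.trans (refl⟩⨾⟨ σ₀-1) idʳ)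

  Δ-counitʳ : Δ• ⨾ (i ⊕ ε•) ≈ i
  Δ-counitʳ = begin
    Δ• ⨾ (i ⊕ ε•)      ≈⟨ Δ-comm ⟩⨾⟨refl ⟨
    (Δ• ⨾ S) ⨾ (i ⊕ ε•) ≈⟨ pullʳ S-ε′ ⟩
    Δ• ⨾ (ε• ⊕ i)      ≈⟨ Δ-counitˡ ⟩
    i                  ∎

  μ-unitʳ : (i ⊕ η◦) ⨾ μ◦ ≈ i
  μ-unitʳ = begin
    (i ⊕ η◦) ⨾ μ◦       ≈⟨ refl⟩⨾⟨ μ-comm ⟨
    (i ⊕ η◦) ⨾ S ⨾ μ◦   ≈⟨ pullˡ η-S ⟩
    (η◦ ⊕ i) ⨾ μ◦       ≈⟨ μ-unitˡ ⟩
    i                   ∎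

  id-suc-⊕ : ∀ n {k l} (f : Hom k l) → id (suc n) ⊕ f ≈ i ⊕ (id n ⊕ f)
  id-suc-⊕ n f = Eq.trans (Eq.sym (⊕-id 1 n) ⟩⊕⟨refl) (⊕-assoc i (id n) f)

  M-natural : ∀ {p q r t : Hom 1 1} → ((p ⊕ q) ⊕ (r ⊕ t)) ⨾ M ≈ M ⨾ ((p ⊕ r) ⊕ (q ⊕ t))
  M-natural {p} {q} {r} {t} = begin
    ((p ⊕ q) ⊕ (r ⊕ t)) ⨾ M          ≈⟨ reassoc′ p q r t ⟩⨾⟨refl ⟩
    (p ⊕ ((q ⊕ r) ⊕ t)) ⨾ M          ≈⟨ slide (Eq.trans idʳ (Eq.sym idˡ))
                                           (slide (σ-natural q r) (Eq.trans idʳ (Eq.sym idˡ))) ⟩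
    M ⨾ (p ⊕ ((r ⊕ q) ⊕ t))          ≈⟨ refl⟩⨾⟨ reassoc′ p r q t ⟨
    M ⨾ ((p ⊕ r) ⊕ (q ⊕ t))          ∎
    where
    reassoc′ : ∀ (p q r t : Hom 1 1) → (p ⊕ q) ⊕ (r ⊕ t) ≈ p ⊕ ((q ⊕ r) ⊕ t)
    reassoc′ p q r t = Eq.trans (⊕-assoc p q (r ⊕ t)) (refl⟩⊕⟨ Eq.sym (⊕-assoc q r t))

  -- The map (x , v) ↦ k x + v. The lemmas on how it passes through `ε•`, `s`, `η◦`, `Δ•` and `μ◦`
  -- are the linearity of these generators, each derived from the axioms that name the generator.
  act : Carrier → Hom 2 1
  act k = (s k ⊕ i) ⨾ μ◦

  act-ε : ∀ k → act k ⨾ ε• ≈ ε• ⊕ ε•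
  act-ε k = begin
    ((s k ⊕ i) ⨾ μ◦) ⨾ ε•    ≈⟨ pullʳ (∼.axiom A7) ⟩
    (s k ⊕ i) ⨾ (ε• ⊕ ε•)    ≈⟨ merge (∼.axiom (A16 k)) idˡ ⟩
    ε• ⊕ ε•                  ∎

  act-s : ∀ k l → act k ⨾ s l ≈ (i ⊕ s l) ⨾ act (l * k)
  act-s k l = begin
    ((s k ⊕ i) ⨾ μ◦) ⨾ s l           ≈⟨ pullʳ (∼.axiom (A13 l)) ⟩
    (s k ⊕ i) ⨾ (s l ⊕ s l) ⨾ μ◦     ≈⟨ replaceˡ (slide
                                          (Eq.trans (∼.axiom (A12 k l)) (Eq.trans (s-cong′ (*-comm k l)) (Eq.sym idˡ)))
                                          (Eq.trans idˡ (Eq.sym idʳ))) ⟩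
    (i ⊕ s l) ⨾ (s (l * k) ⊕ i) ⨾ μ◦ ∎

  act-η : ∀ k → (i ⊕ η◦) ⨾ act k ≈ s k
  act-η k = begin
    (i ⊕ η◦) ⨾ (s k ⊕ i) ⨾ μ◦  ≈⟨ replaceˡ (slide (Eq.trans idˡ (Eq.sym idʳ)) (Eq.trans idʳ (Eq.sym idˡ))) ⟩
    (s k ⊕ id 0) ⨾ (i ⊕ η◦) ⨾ μ◦ ≈⟨ ⊕-idʳ (s k) ⟩⨾⟨ μ-unitʳ ⟩
    s k ⨾ i                    ≈⟨ idʳ ⟩
    s k                        ∎

  -- The map (x , v , w) ↦ (k x + v , l x + w).
  act₂ : Carrier → Carrier → Hom 3 2
  act₂ k l = (Δ• ⊕ id 2) ⨾ M ⨾ (act k ⊕ act l)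

  act-Δ : ∀ k → act k ⨾ Δ• ≈ (i ⊕ Δ•) ⨾ act₂ k k
  act-Δ k = begin
    ((s k ⊕ i) ⨾ μ◦) ⨾ Δ•
      ≈⟨ pullʳ bialgebra ⟩
    (s k ⊕ i) ⨾ (Δ• ⊕ Δ•) ⨾ M ⨾ (μ◦ ⊕ μ◦)
      ≈⟨ replaceˡ (slide (∼.axiom (A15 k))
           (Eq.trans idˡ (Eq.sym (Eq.trans (refl⟩⨾⟨ ⊕-id 1 1) idʳ)))) ⟩
    (Δ• ⊕ Δ•) ⨾ ((s k ⊕ s k) ⊕ (i ⊕ i)) ⨾ M ⨾ (μ◦ ⊕ μ◦)
      ≈⟨ refl⟩⨾⟨ replaceˡ M-natural ⟩
    (Δ• ⊕ Δ•) ⨾ M ⨾ ((s k ⊕ i) ⊕ (s k ⊕ i)) ⨾ (μ◦ ⊕ μ◦)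
      ≈⟨ refl⟩⨾⟨ (refl⟩⨾⟨ interchange) ⟩
    (Δ• ⊕ Δ•) ⨾ M ⨾ (act k ⊕ act k)
      ≈⟨ merge idˡ idʳ ⟩⨾⟨refl ⟨
    ((i ⊕ Δ•) ⨾ (Δ• ⊕ id 2)) ⨾ M ⨾ (act k ⊕ act k)
      ≈⟨ assoc ⟩
    (i ⊕ Δ•) ⨾ act₂ k k ∎

  μ-medial : M ⨾ (μ◦ ⊕ μ◦) ⨾ μ◦ ≈ (μ◦ ⊕ μ◦) ⨾ μ◦
  μ-medial = begin
    M ⨾ (μ◦ ⊕ μ◦) ⨾ μ◦                       ≈⟨ refl⟩⨾⟨ inner ⟩
    M ⨾ (i ⊕ (μ◦ ⊕ i)) ⨾ (μ◦ ⊕ i) ⨾ μ◦       ≈⟨ pullˡ (merge idˡ (merge μ-comm idˡ)) ⟩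
    (i ⊕ (μ◦ ⊕ i)) ⨾ (μ◦ ⊕ i) ⨾ μ◦           ≈⟨ inner ⟨
    (μ◦ ⊕ μ◦) ⨾ μ◦                           ∎
    where
    inner : (μ◦ ⊕ μ◦) ⨾ μ◦ ≈ (i ⊕ (μ◦ ⊕ i)) ⨾ (μ◦ ⊕ i) ⨾ μ◦
    inner = begin
      (μ◦ ⊕ μ◦) ⨾ μ◦                         ≈⟨ merge idʳ idˡ ⟩⨾⟨refl ⟨
      ((μ◦ ⊕ id 2) ⨾ (i ⊕ μ◦)) ⨾ μ◦          ≈⟨ pullʳ (Eq.sym μ-assoc) ⟩
      (μ◦ ⊕ id 2) ⨾ (μ◦ ⊕ i) ⨾ μ◦            ≈⟨ Eq.trans (refl⟩⊕⟨ Eq.sym (⊕-id 1 1)) (Eq.sym (⊕-assoc μ◦ i i)) ⟩⨾⟨refl ⟩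
      ((μ◦ ⊕ i) ⊕ i) ⨾ (μ◦ ⊕ i) ⨾ μ◦         ≈⟨ replaceˡ (slide μ-assoc Eq.refl) ⟩
      ((i ⊕ μ◦) ⊕ i) ⨾ (μ◦ ⊕ i) ⨾ μ◦         ≈⟨ ⊕-assoc i μ◦ i ⟩⨾⟨refl ⟩
      (i ⊕ (μ◦ ⊕ i)) ⨾ (μ◦ ⊕ i) ⨾ μ◦         ∎

  act₂-μ : ∀ k l → act₂ k l ⨾ μ◦ ≈ (i ⊕ μ◦) ⨾ act (k +ᴿ l)
  act₂-μ k l = begin
    ((Δ• ⊕ id 2) ⨾ M ⨾ (act k ⊕ act l)) ⨾ μ◦
      ≈⟨ pullʳ (pullʳ (Eq.trans (⊕-interchange _ _ _ _ ⟩⨾⟨refl) assoc)) ⟩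
    (Δ• ⊕ id 2) ⨾ M ⨾ ((s k ⊕ i) ⊕ (s l ⊕ i)) ⨾ (μ◦ ⊕ μ◦) ⨾ μ◦
      ≈⟨ refl⟩⨾⟨ replaceˡ (Eq.sym M-natural) ⟩
    (Δ• ⊕ id 2) ⨾ ((s k ⊕ s l) ⊕ (i ⊕ i)) ⨾ M ⨾ (μ◦ ⊕ μ◦) ⨾ μ◦
      ≈⟨ refl⟩⨾⟨ (refl⟩⨾⟨ μ-medial) ⟩
    (Δ• ⊕ id 2) ⨾ ((s k ⊕ s l) ⊕ (i ⊕ i)) ⨾ (μ◦ ⊕ μ◦) ⨾ μ◦
      ≈⟨ refl⟩⨾⟨ pullˡ (merge Eq.refl (Eq.trans (⊕-id 1 1 ⟩⨾⟨refl) idˡ)) ⟩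
    (Δ• ⊕ id 2) ⨾ (((s k ⊕ s l) ⨾ μ◦) ⊕ μ◦) ⨾ μ◦
      ≈⟨ pullˡ (merge (∼.axiom (A18 k l)) idˡ) ⟩
    (s (k +ᴿ l) ⊕ μ◦) ⨾ μ◦
      ≈⟨ Eq.sym (merge idˡ idʳ) ⟩⨾⟨refl ⟩
    ((i ⊕ μ◦) ⨾ (s (k +ᴿ l) ⊕ i)) ⨾ μ◦
      ≈⟨ assoc ⟩
    (i ⊕ μ◦) ⨾ act (k +ᴿ l) ∎

  M-σ : M ⨾ σ 2 2 ≈ (S ⊕ S) ⨾ M
  M-σ = begin
    M ⨾ σ 2 2
      ≈⟨ refl⟩⨾⟨ σ-suc 1 2 ⟩
    M ⨾ (i ⊕ σ 1 2) ⨾ (σ 1 2 ⊕ i)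
      ≈⟨ refl⟩⨾⟨ ((refl⟩⊕⟨ σ₁-suc 1) ⟩⨾⟨ (σ₁-suc 1 ⟩⊕⟨refl)) ⟩
    M ⨾ (i ⊕ ((S ⊕ i) ⨾ (i ⊕ S))) ⨾ (((S ⊕ i) ⨾ (i ⊕ S)) ⊕ i)
      ≈⟨ pullˡ (merge idˡ (pullˡ (Eq.trans (merge (σ-involutive 1 1) idˡ) (⊕-id 2 1)))) ⟩
    (i ⊕ (id 3 ⨾ (i ⊕ S))) ⨾ (((S ⊕ i) ⨾ (i ⊕ S)) ⊕ i)
      ≈⟨ (refl⟩⊕⟨ idˡ) ⟩⨾⟨ Eq.trans (refl⟩⊕⟨ Eq.sym idˡ) (⊕-interchange _ _ _ _) ⟩
    (i ⊕ (i ⊕ S)) ⨾ ((S ⊕ i) ⊕ i) ⨾ ((i ⊕ S) ⊕ i)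
      ≈⟨ pullˡ (Eq.trans (Eq.sym (⊕-assoc i i S) ⟩⨾⟨ Eq.trans (⊕-assoc S i i) (refl⟩⊕⟨ ⊕-id 1 1))
                  (merge (Eq.trans (⊕-id 1 1 ⟩⨾⟨refl) idˡ) idʳ)) ⟩
    (S ⊕ S) ⨾ ((i ⊕ S) ⊕ i)
      ≈⟨ refl⟩⨾⟨ ⊕-assoc i S i ⟩
    (S ⊕ S) ⨾ M ∎

  act₂-σ : ∀ k l → act₂ k l ⨾ S ≈ (i ⊕ S) ⨾ act₂ l k
  act₂-σ k l = begin
    ((Δ• ⊕ id 2) ⨾ M ⨾ (act k ⊕ act l)) ⨾ S
      ≈⟨ pullʳ (pullʳ (σ-natural _ _)) ⟩
    (Δ• ⊕ id 2) ⨾ M ⨾ σ 2 2 ⨾ (act l ⊕ act k)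
      ≈⟨ refl⟩⨾⟨ replaceˡ M-σ ⟩
    (Δ• ⊕ id 2) ⨾ (S ⊕ S) ⨾ M ⨾ (act l ⊕ act k)
      ≈⟨ replaceˡ (slide (Eq.trans Δ-comm (Eq.sym idˡ)) (Eq.trans idˡ (Eq.sym idʳ))) ⟩
    (i ⊕ S) ⨾ act₂ l k ∎

  apply-resp : ∀ {n m} {f g : Hom n m} → f ≈ g → ∀ v → apply f v ≈ᵥ apply g v
  apply-resp {f = f} {g} p v j = ≈-trans (≈-sym (*ᵥ-apply f v j))
    (≈-trans (*ᵥ-congˡ (⟦⟧ᵐ-sound p) v j) (*ᵥ-apply g v j))

  apply-id : ∀ n v → apply (id n) v ≈ᵥ v
  apply-id n v j = ≈-trans (≈-sym (*ᵥ-apply (id n) v j))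
    (≈-trans (*ᵥ-congˡ (⟦⟧ᵐ-id n) v j) (δ-*ᵥ v j))

  act-cong : ∀ {k l} → k ≈ᴿ l → act k ≈ act l
  act-cong p = (s-cong′ p ⟩⊕⟨refl) ⟩⨾⟨refl

  tailᵥ : ∀ {n} → Vect (suc n) → Vect n
  tailᵥ a j = a (suc j)

  -- acc a is the map (x , v) ↦ a x + v.
  acc : ∀ {n} → Vect n → Hom (suc n) n
  acc {zero}  a = ε•
  acc {suc n} a = ((Δ• ⊕ id (suc n)) ⨾ (i ⊕ (S ⊕ id n))) ⨾ (act (a zero) ⊕ acc (tailᵥ a))

  acc-cong : ∀ {n} {a b : Vect n} → a ≈ᵥ b → acc a ≈ acc b
  acc-cong {zero}  p = Eq.refl
  acc-cong {suc n} p = refl⟩⨾⟨ (act-cong (p zero) ⟩⊕⟨ acc-cong (λ j → p (suc j)))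

  -- The map (x , v , w) ↦ (v , x , w), where v occupies n wires.
  past : ∀ n k → Hom (1 + (n + k)) (n + (1 + k))
  past n k = subst (Hom (suc n + k)) (+-assoc n 1 k) (σ 1 n ⊕ id k)

  -- The map (x , v , w) ↦ (x , v , x , w).
  spread : ∀ n k → Hom (1 + (n + k)) ((1 + n) + (1 + k))
  spread n k = (Δ• ⊕ id (n + k)) ⨾ (i ⊕ past n k)

  past-natural : ∀ {n m} (g : Hom n m) k →
                 past n k ⨾ (g ⊕ id (suc k)) ≈ (i ⊕ (g ⊕ id k)) ⨾ past m k
  past-natural {n} {m} g k = begin
    past n k ⨾ (g ⊕ id (suc k))
      ≈⟨ refl⟩⨾⟨ Eq.trans (refl⟩⊕⟨ Eq.sym (⊕-id 1 k)) (Eq.sym (⊕-assoc g i (id k))) ⟩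
    past n k ⨾ subst₂ Hom (+-assoc n 1 k) (+-assoc m 1 k) ((g ⊕ i) ⊕ id k)
      ≈⟨ transported (+-assoc n 1 k) (+-assoc m 1 k)
           (slide (Eq.sym (σ-natural i g)) (Eq.refl {x = id k ⨾ id k})) ⟩
    ((i ⊕ g) ⊕ id k) ⨾ past m k
      ≈⟨ ⊕-assoc i g (id k) ⟩⨾⟨refl ⟩
    (i ⊕ (g ⊕ id k)) ⨾ past m k ∎
    where
    transported : ∀ {w x y x′ y′ l} (p : x ≡ x′) (q : y ≡ y′) {F : Hom w x} {G : Hom x y}
                  {F′ : Hom w l} {G′ : Hom l y} → F ⨾ G ≈ F′ ⨾ G′ →
                  subst (Hom w) p F ⨾ subst₂ Hom p q G ≈ F′ ⨾ subst (Hom l) q G′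
    transported ≡.refl ≡.refl r = r

  spread-natural : ∀ {n m} (g : Hom n m) k →
                   spread n k ⨾ ((i ⊕ g) ⊕ id (suc k)) ≈ (i ⊕ (g ⊕ id k)) ⨾ spread m k
  spread-natural {n} {m} g k = begin
    ((Δ• ⊕ id (n + k)) ⨾ (i ⊕ past n k)) ⨾ ((i ⊕ g) ⊕ id (suc k))
      ≈⟨ pullʳ (refl⟩⨾⟨ ⊕-assoc i g (id (suc k))) ⟩
    (Δ• ⊕ id (n + k)) ⨾ (i ⊕ past n k) ⨾ (i ⊕ (g ⊕ id (suc k)))
      ≈⟨ refl⟩⨾⟨ slide Eq.refl (past-natural g k) ⟩
    (Δ• ⊕ id (n + k)) ⨾ (i ⊕ (i ⊕ (g ⊕ id k))) ⨾ (i ⊕ past m k)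
      ≈⟨ replaceˡ (Eq.trans (refl⟩⨾⟨ Eq.sym (id-suc-⊕ 1 _))
           (slide (Eq.trans idʳ (Eq.sym idˡ)) (Eq.trans idˡ (Eq.sym idʳ)))) ⟩
    (i ⊕ (g ⊕ id k)) ⨾ spread m k ∎

  -- `acc` peels off one output at a time, whereas a generator may have zero, one or two wires on
  -- either side. This lemma and `acc-split₂` regroup `acc` so that the wires touched by the
  -- generator form one block; for one wire this is the definition of `acc`.
  acc-split₀ : ∀ {k} (a : Vect k) → acc a ≈ spread 0 k ⨾ (ε• ⊕ acc a)
  acc-split₀ {k} a = Eq.sym (begin
    ((Δ• ⊕ id k) ⨾ (i ⊕ (σ 1 0 ⊕ id k))) ⨾ (ε• ⊕ acc a)
      ≈⟨ (Eq.trans (refl⟩⨾⟨ Eq.trans (refl⟩⊕⟨ Eq.trans (σ₁-0 ⟩⊕⟨refl) (⊕-id 1 k)) (⊕-id 1 (suc k))) idʳ) ⟩⨾⟨refl ⟩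
    (Δ• ⊕ id k) ⨾ (ε• ⊕ acc a)
      ≈⟨ refl⟩⨾⟨ merge idʳ idˡ ⟨
    (Δ• ⊕ id k) ⨾ (ε• ⊕ id (suc k)) ⨾ (id 0 ⊕ acc a)
      ≈⟨ refl⟩⨾⟨ (Eq.trans (refl⟩⊕⟨ Eq.sym (⊕-id 1 k)) (Eq.sym (⊕-assoc ε• i (id k))) ⟩⨾⟨ ⊕-idˡ (acc a)) ⟩
    (Δ• ⊕ id k) ⨾ ((ε• ⊕ i) ⊕ id k) ⨾ acc a
      ≈⟨ pullˡ (merge Δ-counitˡ idˡ) ⟩
    (i ⊕ id k) ⨾ acc a
      ≈⟨ Eq.trans (⊕-id 1 k ⟩⨾⟨refl) idˡ ⟩
    acc a ∎)

  acc-split₂ : ∀ {k} (a : Vect (2 + k)) →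
               acc a ≈ spread 2 k ⨾ (act₂ (a zero) (a (suc zero)) ⊕ acc (tailᵥ (tailᵥ a)))
  acc-split₂ {k} a = begin
    ((Δ• ⊕ id (2 + k)) ⨾ (i ⊕ (S ⊕ id (suc k)))) ⨾ (p ⊕ (((Δ• ⊕ id (suc k)) ⨾ (i ⊕ (S ⊕ id k))) ⨾ (q ⊕ r)))
      ≈⟨ refl⟩⨾⟨ merge idˡ Eq.refl ⟨
    ((Δ• ⊕ id (2 + k)) ⨾ (i ⊕ (S ⊕ id (suc k))))
      ⨾ (id 2 ⊕ ((Δ• ⊕ id (suc k)) ⨾ (i ⊕ (S ⊕ id k)))) ⨾ (p ⊕ (q ⊕ r))
      ≈⟨ pullˡ wiringˡ ⟩
    (C ⨾ D ⨾ E) ⨾ (p ⊕ (q ⊕ r))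
      ≈⟨ Eq.sym wiringʳ ⟩⨾⟨ Eq.sym (⊕-assoc p q r) ⟩
    (spread 2 k ⨾ (((Δ• ⊕ id 2) ⨾ M) ⊕ id (suc k))) ⨾ ((p ⊕ q) ⊕ r)
      ≈⟨ pullʳ (merge assoc idˡ) ⟩
    spread 2 k ⨾ (((Δ• ⊕ id 2) ⨾ M ⨾ (p ⊕ q)) ⊕ r) ∎
    where
    p = act (a zero)
    q = act (a (suc zero))
    r = acc (tailᵥ (tailᵥ a))
    -- Common form of both wirings: `C` makes three copies of x at once, then `D` and `E` move them
    -- into the places x v₁ x v₂ x w. Tripling in two ways is where coassociativity enters.
    C : Hom (3 + k) (5 + k)
    C = (Δ• ⨾ (i ⊕ Δ•)) ⊕ id (2 + k)
    D E : Hom (5 + k) (5 + k)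
    D = i ⊕ ((i ⊕ S) ⊕ id (suc k))
    E = i ⊕ (S ⊕ (S ⊕ id k))
    wiringˡ : ((Δ• ⊕ id (2 + k)) ⨾ (i ⊕ (S ⊕ id (suc k))))
                ⨾ (id 2 ⊕ ((Δ• ⊕ id (suc k)) ⨾ (i ⊕ (S ⊕ id k)))) ≈ C ⨾ D ⨾ E
    wiringˡ = begin
      ((Δ• ⊕ id (2 + k)) ⨾ (i ⊕ (S ⊕ id (suc k)))) ⨾ (id 2 ⊕ ((Δ• ⊕ id (suc k)) ⨾ (i ⊕ (S ⊕ id k))))
        ≈⟨ pullʳ (refl⟩⨾⟨ Eq.trans (Eq.sym idˡ ⟩⊕⟨refl) (⊕-interchange _ _ _ _)) ⟩
      (Δ• ⊕ id (2 + k)) ⨾ (i ⊕ (S ⊕ id (suc k))) ⨾ (id 2 ⊕ (Δ• ⊕ id (suc k))) ⨾ (id 2 ⊕ (i ⊕ (S ⊕ id k)))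
        ≈⟨ refl⟩⨾⟨ replaceˡ step₁ ⟩
      (Δ• ⊕ id (2 + k)) ⨾ (i ⊕ ((Δ• ⊕ i) ⊕ id (suc k))) ⨾ (i ⊕ (σ 2 1 ⊕ id (suc k))) ⨾ (id 2 ⊕ (i ⊕ (S ⊕ id k)))
        ≈⟨ pullˡ step₂ ⟩
      C ⨾ (i ⊕ (σ 2 1 ⊕ id (suc k))) ⨾ (id 2 ⊕ (i ⊕ (S ⊕ id k)))
        ≈⟨ refl⟩⨾⟨ step₃ ⟩
      C ⨾ D ⨾ E ∎
      where
      step₁ : (i ⊕ (S ⊕ id (suc k))) ⨾ (id 2 ⊕ (Δ• ⊕ id (suc k)))
                ≈ (i ⊕ ((Δ• ⊕ i) ⊕ id (suc k))) ⨾ (i ⊕ (σ 2 1 ⊕ id (suc k)))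
      step₁ = Eq.trans (refl⟩⨾⟨ Eq.trans (id-suc-⊕ 1 _) (refl⟩⊕⟨ Eq.sym (⊕-assoc i Δ• (id (suc k)))))
        (slide Eq.refl (slide (Eq.sym (σ-natural Δ• i)) Eq.refl))
      step₂ : (Δ• ⊕ id (2 + k)) ⨾ (i ⊕ ((Δ• ⊕ i) ⊕ id (suc k))) ≈ C
      step₂ = Eq.trans (refl⟩⨾⟨ Eq.trans (refl⟩⊕⟨ Eq.trans (⊕-assoc Δ• i (id (suc k))) (refl⟩⊕⟨ ⊕-id 1 (suc k)))
                                         (Eq.sym (⊕-assoc i Δ• (id (2 + k)))))
        (merge Eq.refl idˡ)
      step₃ : (i ⊕ (σ 2 1 ⊕ id (suc k))) ⨾ (id 2 ⊕ (i ⊕ (S ⊕ id k))) ≈ D ⨾ E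
      step₃ = begin
        (i ⊕ (σ 2 1 ⊕ id (suc k))) ⨾ (id 2 ⊕ (i ⊕ (S ⊕ id k)))
          ≈⟨ (refl⟩⊕⟨ (σ-suc 1 1 ⟩⊕⟨refl)) ⟩⨾⟨ Eq.trans (id-suc-⊕ 1 _) (refl⟩⊕⟨ Eq.sym (id-suc-⊕ 1 _)) ⟩
        (i ⊕ (((i ⊕ S) ⨾ (S ⊕ i)) ⊕ id (suc k))) ⨾ (i ⊕ (id 2 ⊕ (S ⊕ id k)))
          ≈⟨ (Eq.sym (merge idˡ (merge Eq.refl idˡ))) ⟩⨾⟨refl ⟩
        (D ⨾ (i ⊕ ((S ⊕ i) ⊕ id (suc k)))) ⨾ (i ⊕ (id 2 ⊕ (S ⊕ id k)))
          ≈⟨ pullʳ (merge idˡ (Eq.trans (Eq.trans (⊕-assoc S i (id (suc k))) (refl⟩⊕⟨ ⊕-id 1 (suc k)) ⟩⨾⟨refl)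
               (merge idʳ idˡ))) ⟩
        D ⨾ E ∎
    wiringʳ : spread 2 k ⨾ (((Δ• ⊕ id 2) ⨾ M) ⊕ id (suc k)) ≈ C ⨾ D ⨾ E
    wiringʳ = begin
      ((Δ• ⊕ id (2 + k)) ⨾ (i ⊕ (σ 1 2 ⊕ id k))) ⨾ (((Δ• ⊕ id 2) ⨾ M) ⊕ id (suc k))
        ≈⟨ pullʳ (refl⟩⨾⟨ Eq.sym (merge Eq.refl idˡ)) ⟩
      (Δ• ⊕ id (2 + k)) ⨾ (i ⊕ (σ 1 2 ⊕ id k)) ⨾ ((Δ• ⊕ id 2) ⊕ id (suc k)) ⨾ (M ⊕ id (suc k))
        ≈⟨ refl⟩⨾⟨ replaceˡ (Eq.trans (refl⟩⨾⟨ Eq.trans (⊕-assoc Δ• (id 2) (id (suc k))) (refl⟩⊕⟨ ⊕-id 2 (suc k)))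
             (slide (Eq.trans idˡ (Eq.sym idʳ)) (Eq.trans idʳ (Eq.sym idˡ)))) ⟩
      (Δ• ⊕ id (2 + k)) ⨾ (Δ• ⊕ id (3 + k)) ⨾ (id 2 ⊕ (σ 1 2 ⊕ id k)) ⨾ (M ⊕ id (suc k))
        ≈⟨ pullˡ (Eq.trans (refl⟩⨾⟨ Eq.trans (refl⟩⊕⟨ Eq.sym (⊕-id 1 (2 + k))) (Eq.sym (⊕-assoc Δ• i (id (2 + k)))))
             (merge Δ-coassoc idˡ)) ⟩
      C ⨾ (id 2 ⊕ (σ 1 2 ⊕ id k)) ⨾ (M ⊕ id (suc k))
        ≈⟨ refl⟩⨾⟨ (Eq.trans (refl⟩⊕⟨ Eq.trans (σ₁-suc 1 ⟩⊕⟨refl) (Eq.sym (merge Eq.refl idˡ)))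
             (Eq.trans (Eq.sym idˡ ⟩⊕⟨refl) (⊕-interchange _ _ _ _)) ⟩⨾⟨refl) ⟩
      C ⨾ ((id 2 ⊕ ((S ⊕ i) ⊕ id k)) ⨾ (id 2 ⊕ ((i ⊕ S) ⊕ id k))) ⨾ (M ⊕ id (suc k))
        ≈⟨ refl⟩⨾⟨ Eq.trans assoc (first ⟩⨾⟨ second) ⟩
      C ⨾ D ⨾ E ∎
      where
      first : id 2 ⊕ ((S ⊕ i) ⊕ id k) ≈ D
      first = Eq.trans (id-suc-⊕ 1 _) (refl⟩⊕⟨ Eq.trans
        (refl⟩⊕⟨ Eq.trans (⊕-assoc S i (id k)) (refl⟩⊕⟨ ⊕-id 1 k)) (Eq.sym (⊕-assoc i S (id (suc k)))))
      second : (id 2 ⊕ ((i ⊕ S) ⊕ id k)) ⨾ (M ⊕ id (suc k)) ≈ E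
      second = Eq.trans
        (Eq.trans (id-suc-⊕ 1 _) (refl⟩⊕⟨ Eq.trans (refl⟩⊕⟨ ⊕-assoc i S (id k)) (Eq.sym (id-suc-⊕ 1 _)))
          ⟩⨾⟨ Eq.trans (⊕-assoc i (S ⊕ i) (id (suc k)))
                (refl⟩⊕⟨ Eq.trans (⊕-assoc S i (id (suc k))) (refl⟩⊕⟨ ⊕-id 1 (suc k))))
        (merge idˡ (merge idˡ idʳ))

  -- f (a x + v) = f(a) x + f(v)
  Linearity : ∀ {n m} → Hom n m → Set _
  Linearity {n} f = ∀ {a : Vect n} {b} → apply f a ≈ᵥ b → acc a ⨾ f ≈ (i ⊕ f) ⨾ acc b

  -- Linearity survives idle wires: `spread` gives one copy of x to the wires of `g` and one to the
  -- idle wires, whose coefficients `r` are not changed. `F` and `G` are the accumulators before and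
  -- after `g`.
  linear-context : ∀ {n m k} {g : Hom n m} {F : Hom (suc n) n} {G : Hom (suc m) m}
    {r r′ : Vect k} {x : Hom (suc (n + k)) (n + k)} {y : Hom (suc (m + k)) (m + k)} →
    F ⨾ g ≈ (i ⊕ g) ⨾ G → r ≈ᵥ r′ →
    x ≈ spread n k ⨾ (F ⊕ acc r) → y ≈ spread m k ⨾ (G ⊕ acc r′) →
    x ⨾ (g ⊕ id k) ≈ (i ⊕ (g ⊕ id k)) ⨾ y
  linear-context {n} {m} {k} {g} {F} {G} {r} {r′} {x} {y} linear p xs ys = begin
    x ⨾ (g ⊕ id k)                                     ≈⟨ xs ⟩⨾⟨refl ⟩
    (spread n k ⨾ (F ⊕ acc r)) ⨾ (g ⊕ id k)            ≈⟨ pullʳ (slide linear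
                                                           (Eq.trans idʳ (Eq.trans (acc-cong p) (Eq.sym idˡ)))) ⟩
    spread n k ⨾ ((i ⊕ g) ⊕ id (suc k)) ⨾ (G ⊕ acc r′) ≈⟨ replaceˡ (spread-natural g k) ⟩
    (i ⊕ (g ⊕ id k)) ⨾ spread m k ⨾ (G ⊕ acc r′)       ≈⟨ refl⟩⨾⟨ ys ⟨
    (i ⊕ (g ⊕ id k)) ⨾ y                               ∎

  linear-generator : ∀ {n m} (g : HAGen R n m) k → Linearity (gen g ⊕ id k)
  linear-generator copy k {a} {b} p = linear-context
    (Eq.trans (act-Δ (a zero)) (refl⟩⨾⟨ ((refl⟩⨾⟨ (refl⟩⨾⟨ (act-cong (p zero) ⟩⊕⟨ act-cong (p (suc zero))))))))
    (λ j → ≈-trans (≈-sym (apply-id k (tailᵥ a) j)) (p (suc (suc j))))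
    Eq.refl (acc-split₂ b)
  linear-generator discard k {a} {b} p = linear-context
    (Eq.trans (act-ε (a zero)) (Eq.sym (Eq.trans (refl⟩⨾⟨ Eq.sym (⊕-idʳ ε•)) (merge idˡ idʳ))))
    (λ j → ≈-trans (≈-sym (apply-id k (tailᵥ a) j)) (p j))
    Eq.refl (acc-split₀ b)
  linear-generator add k {a} {b} p = linear-context
    (Eq.trans (act₂-μ (a zero) (a (suc zero))) (refl⟩⨾⟨ act-cong (p zero)))
    (λ j → ≈-trans (≈-sym (apply-id k (tailᵥ (tailᵥ a)) j)) (p (suc j)))
    (acc-split₂ a) Eq.refl
  linear-generator zero k {a} {b} p = linear-context
    (Eq.sym (Eq.trans (act-η (b zero)) (Eq.trans (s-cong′ (≈-sym (p zero))) (∼.axiom A17))))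
    (λ j → ≈-trans (≈-sym (apply-id k a j)) (p (suc j)))
    (acc-split₀ a) Eq.refl
  linear-generator (scalar l) k {a} {b} p = linear-context
    (Eq.trans (act-s (a zero) l) (refl⟩⨾⟨ act-cong (p zero)))
    (λ j → ≈-trans (≈-sym (apply-id k (tailᵥ a) j)) (p (suc j)))
    Eq.refl Eq.refl

  linear-symmetry : ∀ k → Linearity (σ₁₁ ⊕ id k)
  linear-symmetry k {a} {b} p = linear-context
    (begin
      act₂ (a zero) (a (suc zero)) ⨾ σ₁₁      ≈⟨ refl⟩⨾⟨ σ₁₁≈σ ⟩
      act₂ (a zero) (a (suc zero)) ⨾ S        ≈⟨ act₂-σ _ _ ⟩
      (i ⊕ S) ⨾ act₂ (a (suc zero)) (a zero)
        ≈⟨ (refl⟩⊕⟨ Eq.sym σ₁₁≈σ) ⟩⨾⟨ (refl⟩⨾⟨ (refl⟩⨾⟨ (act-cong (p zero) ⟩⊕⟨ act-cong (p (suc zero))))) ⟩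
      (i ⊕ σ₁₁) ⨾ act₂ (b zero) (b (suc zero)) ∎)
    (λ j → ≈-trans (≈-sym (apply-id k (tailᵥ (tailᵥ a)) j)) (p (suc (suc j))))
    (acc-split₂ a) (acc-split₂ b)

  linear-wire : ∀ {n m} {f : Hom n m} → Linearity f → Linearity (i ⊕ f)
  linear-wire {n} {m} {f} linear {a} {b} p = begin
    (((Δ• ⊕ id (suc n)) ⨾ (i ⊕ (S ⊕ id n))) ⨾ (act (a zero) ⊕ acc (tailᵥ a))) ⨾ (i ⊕ f)
      ≈⟨ pullʳ (slide (Eq.trans idʳ (Eq.trans (act-cong (p zero)) (Eq.sym idˡ))) (linear (λ j → p (suc j)))) ⟩
    ((Δ• ⊕ id (suc n)) ⨾ (i ⊕ (S ⊕ id n))) ⨾ (id 2 ⊕ (i ⊕ f)) ⨾ (act (b zero) ⊕ acc (tailᵥ b))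
      ≈⟨ Eq.trans assoc (refl⟩⨾⟨ replaceˡ (Eq.trans (refl⟩⨾⟨ Eq.trans (id-suc-⊕ 1 _) (refl⟩⊕⟨ Eq.sym (id-suc-⊕ 1 f)))
           (slide Eq.refl (slide (Eq.trans idʳ (Eq.sym idˡ)) (Eq.trans idˡ (Eq.sym idʳ)))))) ⟩
    (Δ• ⊕ id (suc n)) ⨾ (i ⊕ (id 2 ⊕ f)) ⨾ (i ⊕ (S ⊕ id m)) ⨾ (act (b zero) ⊕ acc (tailᵥ b))
      ≈⟨ replaceˡ (Eq.trans (refl⟩⨾⟨ Eq.trans (refl⟩⊕⟨ id-suc-⊕ 1 f) (Eq.sym (id-suc-⊕ 1 _)))
           (slide (Eq.trans idʳ (Eq.sym idˡ)) (Eq.trans idˡ (Eq.sym idʳ)))) ⟩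
    (i ⊕ (i ⊕ f)) ⨾ (Δ• ⊕ id (suc m)) ⨾ (i ⊕ (S ⊕ id m)) ⨾ (act (b zero) ⊕ acc (tailᵥ b))
      ≈⟨ refl⟩⨾⟨ assoc˘ ⟩
    (i ⊕ (i ⊕ f)) ⨾ acc b ∎

  linear : ∀ {n m} (f : Hom n m) → Linearity f
  linear = TermInduction.all Linearity
    (λ {n} {m} {f} {g} p linear {a} q → Eq.trans (refl⟩⨾⟨ Eq.sym p)
      (Eq.trans (linear (λ j → ≈-trans (apply-resp p a j) (q j))) ((refl⟩⊕⟨ p) ⟩⨾⟨refl)))
    (λ {_} {_} {_} {f} {g} linear-f linear-g {a} q → Eq.trans (pullˡ (linear-f (λ _ → ≈-refl)))
      (Eq.trans (pullʳ (linear-g q)) (pullˡ (merge idˡ Eq.refl))))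
    (λ n {a} q → Eq.trans idʳ (Eq.trans (acc-cong (λ j → ≈-trans (≈-sym (apply-id n a j)) (q j)))
      (Eq.sym (Eq.trans (⊕-id 1 n ⟩⨾⟨refl) idˡ))))
    linear-wire linear-generator linear-symmetry

  zeros : ∀ n → Hom 0 n
  zeros zero    = id 0
  zeros (suc n) = η◦ ⊕ zeros n

  zeros-+ : ∀ n m → zeros (n + m) ≈ zeros n ⊕ zeros m
  zeros-+ zero    m = Eq.sym (⊕-idˡ _)
  zeros-+ (suc n) m = Eq.trans (refl⟩⊕⟨ zeros-+ n m) (Eq.sym (⊕-assoc η◦ (zeros n) (zeros m)))

  zeros-1 : zeros 1 ≈ η◦
  zeros-1 = ⊕-idʳ η◦

  zeros-2 : zeros 2 ≈ η◦ ⊕ η◦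
  zeros-2 = refl⟩⊕⟨ zeros-1

  -- The case without columns of `fromMatrix-natural`: linear maps fix 0.
  zeros-natural : ∀ {n m} (f : Hom n m) → zeros n ⨾ f ≈ zeros m
  zeros-natural (gen copy)    = Eq.trans (zeros-1 ⟩⨾⟨refl) (Eq.trans (∼.axiom A9) (Eq.sym zeros-2))
  zeros-natural (gen discard) = Eq.trans (zeros-1 ⟩⨾⟨refl) (∼.axiom A10)
  zeros-natural (gen add)     = Eq.trans (zeros-2 ⟩⨾⟨refl) (Eq.trans
    (Eq.trans (Eq.sym idˡ ⟩⊕⟨ Eq.sym idʳ) (⊕-interchange _ _ _ _) ⟩⨾⟨refl)
    (Eq.trans (pullʳ μ-unitˡ) (Eq.trans idʳ (Eq.trans (⊕-idˡ η◦) (Eq.sym zeros-1)))))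
  zeros-natural (gen zero)    = Eq.trans idˡ (Eq.sym zeros-1)
  zeros-natural (gen (scalar k)) = Eq.trans (zeros-1 ⟩⨾⟨refl) (Eq.trans (∼.axiom (A14 k)) (Eq.sym zeros-1))
  zeros-natural id₀           = idˡ
  zeros-natural id₁           = Eq.trans (refl⟩⨾⟨ id₁≈id) idʳ
  zeros-natural σ₁₁           = Eq.trans (zeros-2 ⟩⨾⟨ σ₁₁≈σ) (Eq.trans (σ-natural η◦ η◦)
    (Eq.trans (σ₀-0 ⟩⨾⟨refl) (Eq.trans idˡ (Eq.sym zeros-2))))
  zeros-natural (f Defs.⨾ g)  = Eq.trans (pullˡ (zeros-natural f)) (zeros-natural g)
  zeros-natural (Defs._⊕_ {n} {m} {n′} {m′} f g) = Eq.trans (zeros-+ n n′ ⟩⨾⟨refl)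
    (Eq.trans (merge (zeros-natural f) (zeros-natural g)) (Eq.sym (zeros-+ m m′)))

  -- A x is the first column times x₀ plus the remaining columns applied to the remaining entries.
  -- Columns are used rather than rows because linearity of a term appended on the right rewrites
  -- one column at a time.
  fromMatrix : ∀ {n m} → Matrix m n → Hom n m
  fromMatrix {zero}  {m} A = zeros m
  fromMatrix {suc n} {m} A = (i ⊕ fromMatrix (λ r j → A r (suc j))) ⨾ acc (λ r → A r zero)

  fromMatrix-cong : ∀ {n m} {A B : Matrix m n} → A ≋ B → fromMatrix A ≈ fromMatrix B
  fromMatrix-cong {zero}  p = Eq.refl
  fromMatrix-cong {suc n} p =
    (refl⟩⊕⟨ fromMatrix-cong (λ r j → p r (suc j))) ⟩⨾⟨ acc-cong (λ r → p r zero)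

  -- `linear f` pushes `f` through the first accumulator and leaves `f` behind the remaining
  -- columns, so only the number of columns decreases and `f` stays arbitrary.
  fromMatrix-natural : ∀ {n m k} (A : Matrix m n) (f : Hom m k) →
                       fromMatrix A ⨾ f ≈ fromMatrix (λ r j → apply f (λ l → A l j) r)
  fromMatrix-natural {zero}  A f = zeros-natural f
  fromMatrix-natural {suc n} A f = Eq.trans (pullʳ (linear f (λ _ → ≈-refl)))
    (pullˡ (merge idˡ (fromMatrix-natural (λ r j → A r (suc j)) f)))

  act-0 : act 0# ≈ ε• ⊕ i
  act-0 = begin
    (s 0# ⊕ i) ⨾ μ◦               ≈⟨ (∼.axiom A17 ⟩⊕⟨ Eq.sym idˡ) ⟩⨾⟨refl ⟩
    ((ε• ⨾ η◦) ⊕ (i ⨾ i)) ⨾ μ◦    ≈⟨ ⊕-interchange _ _ _ _ ⟩⨾⟨refl ⟩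
    ((ε• ⊕ i) ⨾ (η◦ ⊕ i)) ⨾ μ◦    ≈⟨ pullʳ μ-unitˡ ⟩
    (ε• ⊕ i) ⨾ i                  ≈⟨ idʳ ⟩
    ε• ⊕ i                        ∎

  acc-0 : ∀ n → acc {n} (λ _ → 0#) ≈ ε• ⊕ id n
  acc-0 zero    = Eq.sym (⊕-idʳ ε•)
  acc-0 (suc n) = begin
    ((Δ• ⊕ id (suc n)) ⨾ (i ⊕ (S ⊕ id n))) ⨾ (act 0# ⊕ acc {n} (λ _ → 0#))
      ≈⟨ refl⟩⨾⟨ Eq.trans (act-0 ⟩⊕⟨ acc-0 n) (Eq.trans (⊕-assoc ε• i (ε• ⊕ id n))
           (refl⟩⊕⟨ Eq.sym (⊕-assoc i ε• (id n)))) ⟩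
    ((Δ• ⊕ id (suc n)) ⨾ (i ⊕ (S ⊕ id n))) ⨾ (ε• ⊕ ((i ⊕ ε•) ⊕ id n))
      ≈⟨ pullʳ (merge idˡ (merge S-ε′ idˡ)) ⟩
    (Δ• ⊕ id (suc n)) ⨾ (ε• ⊕ ((ε• ⊕ i) ⊕ id n))
      ≈⟨ refl⟩⨾⟨ Eq.trans (refl⟩⊕⟨ Eq.trans (⊕-assoc ε• i (id n)) (refl⟩⊕⟨ ⊕-id 1 n))
           (Eq.sym (⊕-assoc ε• ε• (id (suc n)))) ⟩
    (Δ• ⊕ id (suc n)) ⨾ ((ε• ⊕ ε•) ⊕ id (suc n))
      ≈⟨ merge discard-both idˡ ⟩
    ε• ⊕ id (suc n) ∎
    where
    discard-both : Δ• ⨾ (ε• ⊕ ε•) ≈ ε•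
    discard-both = begin
      Δ• ⨾ (ε• ⊕ ε•)                 ≈⟨ refl⟩⨾⟨ merge idʳ idˡ ⟨
      Δ• ⨾ (ε• ⊕ i) ⨾ (id 0 ⊕ ε•)    ≈⟨ pullˡ Δ-counitˡ ⟩
      i ⨾ (id 0 ⊕ ε•)                ≈⟨ Eq.trans idˡ (⊕-idˡ ε•) ⟩
      ε•                             ∎

  fromMatrix-δ : ∀ n → fromMatrix (δ {n}) ≈ id n
  fromMatrix-δ zero    = Eq.refl
  fromMatrix-δ (suc n) = begin
    (i ⊕ fromMatrix (λ r j → δ {suc n} r (suc j))) ⨾ acc (λ r → δ {suc n} r zero)
      -- The later columns of `δ` are those of the smaller `δ` with a 0 on top, that is, the result
      -- of composing the smaller normal form with `η◦ ⊕ id n`.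
      ≈⟨ (refl⟩⊕⟨ Eq.trans (fromMatrix-cong shifted)
           (Eq.trans (Eq.sym (fromMatrix-natural δ (η◦ ⊕ id n))) (Eq.trans (fromMatrix-δ n ⟩⨾⟨refl) idˡ)))
         ⟩⨾⟨ acc-cong {b = e₀} unit ⟩
    (i ⊕ (η◦ ⊕ id n)) ⨾ spread 1 n ⨾ (act 1# ⊕ acc (λ _ → 0#))
      ≈⟨ replaceˡ (Eq.sym (spread-natural η◦ n)) ⟩
    spread 0 n ⨾ ((i ⊕ η◦) ⊕ id (suc n)) ⨾ (act 1# ⊕ acc (λ _ → 0#))
      ≈⟨ refl⟩⨾⟨ merge (Eq.trans (act-η 1#) s-1) (Eq.trans idˡ (acc-0 n)) ⟩
    ((Δ• ⊕ id n) ⨾ (i ⊕ (σ 1 0 ⊕ id n))) ⨾ (i ⊕ (ε• ⊕ id n))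
      ≈⟨ pullʳ (merge idˡ (merge (Eq.trans (σ₁-0 ⟩⨾⟨refl) idˡ) idˡ)) ⟩
    (Δ• ⊕ id n) ⨾ (i ⊕ (ε• ⊕ id n))
      ≈⟨ refl⟩⨾⟨ ⊕-assoc i ε• (id n) ⟨
    (Δ• ⊕ id n) ⨾ ((i ⊕ ε•) ⊕ id n)
      ≈⟨ merge Δ-counitʳ idˡ ⟩
    i ⊕ id n
      ≈⟨ ⊕-id 1 n ⟩
    id (suc n) ∎
    where
    shifted : ∀ r j → δ {suc n} r (suc j) ≈ᴿ apply (η◦ ⊕ id n) (λ l → δ l j) r
    shifted zero    j = ≈-refl
    shifted (suc r) j = ≈-sym (apply-id n (λ l → δ l j) r)
    e₀ : Vect (suc n)
    e₀ zero    = 1#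
    e₀ (suc _) = 0#
    unit : ∀ r → δ {suc n} r zero ≈ᴿ e₀ r
    unit zero    = ≈-refl
    unit (suc r) = ≈-refl

  fromMatrix-⟦⟧ : ∀ {n m} (f : Hom n m) → fromMatrix ⟦ f ⟧ᵐ ≈ f
  fromMatrix-⟦⟧ {n} f = begin
    fromMatrix ⟦ f ⟧ᵐ
      ≈⟨ fromMatrix-cong (λ r j → ≈-trans (≈-sym (sum-δʳ j (⟦ f ⟧ᵐ r))) (*ᵥ-apply f (λ l → δ l j) r)) ⟩
    fromMatrix (λ r j → apply f (λ l → δ l j) r)
      ≈⟨ fromMatrix-natural δ f ⟨
    fromMatrix δ ⨾ f
      ≈⟨ fromMatrix-δ n ⟩⨾⟨refl ⟩
    id n ⨾ f
      ≈⟨ idˡ ⟩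
    f ∎

  -- Terms with the same action have the same matrix, hence the same normal form. From here on
  -- identities within HA are proved by evaluation.
  complete : ∀ {n m} {f g : Hom n m} → (∀ v → apply f v ≈ᵥ apply g v) → f ≈ g
  complete {f = f} {g} p = Eq.trans (Eq.sym (fromMatrix-⟦⟧ f))
    (Eq.trans (fromMatrix-cong (⟦⟧ᵐ-cong f g p)) (fromMatrix-⟦⟧ g))

  apply-acc : ∀ {n} (a : Vect n) v j → apply (acc a) v j ≈ᴿ a j * v zero +ᴿ v (suc j)
  apply-acc {suc n} a v zero    = ≈-refl
  apply-acc {suc n} a v (suc j) = ≈-trans (apply-acc (tailᵥ a) _ j)
    (+-congˡ (≈-trans (apply-id n _ j) (apply-id (suc n) (tailᵥ v) (suc j))))

  apply-zeros : ∀ n v j → apply (zeros n) v j ≈ᴿ 0#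
  apply-zeros (suc n) v zero    = ≈-refl
  apply-zeros (suc n) v (suc j) = apply-zeros n _ j

  apply-fromMatrix : ∀ {n m} (A : Matrix m n) v → apply (fromMatrix A) v ≈ᵥ (A *ᵥ v)
  apply-fromMatrix {zero}  {m} A v j = apply-zeros m v j
  apply-fromMatrix {suc n} A v j = ≈-trans (apply-acc (λ r → A r zero) _ j)
    (+-congˡ (≈-trans (apply-fromMatrix (λ r l → A r (suc l)) _ j) ≈-refl))

-- Linear maps between tuples of vectors

module LinearMaps (R : CommutativeRing c ℓ) (pid : IsPID R) where
  open CommutativeRing R renaming
    (_+_ to _+ᴿ_; +-assoc to +ᴿ-assoc; +-identityʳ to +ᴿ-identityʳ; zero to *-zero;
     _≈_ to _≈ᴿ_; refl to ≈-refl; sym to ≈-sym; trans to ≈-trans; setoid to setoidᴿ;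
     isEquivalence to ≈-isEquivalence; reflexive to ≈-reflexive)
  open Matrices R
  open MatrixPullbacks R pid using (Vect; _*ᵥ_; *ᵥ-cong; *ᵥ-+; *ᵥ-*; sum-neg)
  open import Algebra.Properties.Semiring.Sum semiring using (sum-cong-≋; ∑-distrib-+; *-distribˡ-sum)
  open import Algebra.Properties.Ring ring using (-‿distribˡ-*; -‿distribʳ-*)
  open MatrixSemantics R pid
  open HACompleteness R pid 
    using (HAᴾ; apply-id; complete; fromMatrix; apply-fromMatrix; zeros; apply-zeros)
  open HATerms R
  open PROP HAᴾ

  infixr 6 _⊗_
  data Shape : Set where
    ⟨_⟩ : ℕ → Shape
    _⊗_ : Shape → Shape → Shape

  size : Shape → ℕ
  size ⟨ n ⟩   = n
  size (s ⊗ t) = size s + size t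

  El : Shape → Set c
  El ⟨ n ⟩   = Vect n
  El (s ⊗ t) = El s × El t

  infix 4 _≈ᴱ_
  _≈ᴱ_ : ∀ {s} → El s → El s → Set ℓ
  _≈ᴱ_ {⟨ n ⟩} u v = u ≈ᵥ v
  _≈ᴱ_ {s ⊗ t} (u , v) (u′ , v′) = (u ≈ᴱ u′) × (v ≈ᴱ v′)

  infixl 6 _+ᴱ_
  _+ᴱ_ : ∀ {s} → El s → El s → El s
  _+ᴱ_ {⟨ n ⟩} u v i = u i +ᴿ v i
  _+ᴱ_ {s ⊗ t} (u , v) (u′ , v′) = u +ᴱ u′ , v +ᴱ v′

  flat : ∀ {s} → El s → Vect (size s)
  flat {⟨ n ⟩} v = v
  flat {s ⊗ t} (u , v) = flat u ++ᵥ flat v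

  unflat : ∀ {s} → Vect (size s) → El s
  unflat {⟨ n ⟩} v = v
  unflat {s ⊗ t} v = unflat (takeᵥ (size s) v) , unflat (dropᵥ (size s) v)

  ++ᵥ-take-drop : ∀ n {m} (v : Vect (n + m)) → (takeᵥ n v ++ᵥ dropᵥ n v) ≈ᵥ v
  ++ᵥ-take-drop n {m} v i = ≈-trans (go (splitAt n i)) (≈-reflexive (≡.cong v (join-splitAt n m i)))
    where
    go : ∀ x → [ takeᵥ n v , dropᵥ n v ]′ x ≈ᴿ v (join n m x)
    go (inj₁ j) = ≈-refl
    go (inj₂ j) = ≈-refl

  takeᵥ-++ : ∀ {n m} (u : Vect n) (v : Vect m) → takeᵥ n (u ++ᵥ v) ≈ᵥ u
  takeᵥ-++ {n} {m} u v i = ≈-reflexive (≡.cong [ u , v ]′ (splitAt-↑ˡ n i m))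

  dropᵥ-++ : ∀ {n m} (u : Vect n) (v : Vect m) → dropᵥ n (u ++ᵥ v) ≈ᵥ v
  dropᵥ-++ {n} {m} u v i = ≈-reflexive (≡.cong [ u , v ]′ (splitAt-↑ʳ n m i))

  flat-unflat : ∀ {s} (v : Vect (size s)) → flat {s} (unflat v) ≈ᵥ v
  flat-unflat {⟨ n ⟩} v i = ≈-refl
  flat-unflat {s ⊗ t} v i = ≈-trans
    (++ᵥ-cong (flat-unflat {s} (takeᵥ (size s) v)) (flat-unflat {t} (dropᵥ (size s) v)) i)
    (++ᵥ-take-drop (size s) v i)

  flat-cong : ∀ {s} {u v : El s} → u ≈ᴱ v → flat u ≈ᵥ flat v
  flat-cong {⟨ n ⟩} p       = p
  flat-cong {s ⊗ t} (p , q) = ++ᵥ-cong (flat-cong p) (flat-cong q)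

  flat-injective : ∀ {s} {u v : El s} → flat u ≈ᵥ flat v → u ≈ᴱ v
  flat-injective {⟨ n ⟩} p = p
  flat-injective {s ⊗ t} {u , v} {u′ , v′} p =
    flat-injective (λ i → ≈-trans (≈-sym (takeᵥ-++ (flat u) (flat v) i))
      (≈-trans (p (i ↑ˡ size t)) (takeᵥ-++ (flat u′) (flat v′) i))) ,
    flat-injective (λ i → ≈-trans (≈-sym (dropᵥ-++ (flat u) (flat v) i))
      (≈-trans (p (size s ↑ʳ i)) (dropᵥ-++ (flat u′) (flat v′) i)))

  flat-+ : ∀ {s} (u v : El s) i → flat (u +ᴱ v) i ≈ᴿ flat u i +ᴿ flat v i
  flat-+ {⟨ n ⟩} u v i = ≈-refl
  flat-+ {s ⊗ t} (u , v) (u′ , v′) i = go (splitAt (size s) i)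
    where
    go : ∀ x → [ flat (u +ᴱ u′) , flat (v +ᴱ v′) ]′ x
               ≈ᴿ [ flat u , flat v ]′ x +ᴿ [ flat u′ , flat v′ ]′ x
    go (inj₁ j) = flat-+ u u′ j
    go (inj₂ j) = flat-+ v v′ j

  ≈ᴱ-refl : ∀ {s} {u : El s} → u ≈ᴱ u
  ≈ᴱ-refl {⟨ n ⟩} i = ≈-refl
  ≈ᴱ-refl {s ⊗ t}   = ≈ᴱ-refl , ≈ᴱ-refl

  ≈ᴱ-sym : ∀ {s} {u v : El s} → u ≈ᴱ v → v ≈ᴱ u
  ≈ᴱ-sym {⟨ n ⟩} p i     = ≈-sym (p i)
  ≈ᴱ-sym {s ⊗ t} (p , q) = ≈ᴱ-sym p , ≈ᴱ-sym q

  ≈ᴱ-trans : ∀ {s} {u v w : El s} → u ≈ᴱ v → v ≈ᴱ w → u ≈ᴱ w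
  ≈ᴱ-trans {⟨ n ⟩} p q i           = ≈-trans (p i) (q i)
  ≈ᴱ-trans {s ⊗ t} (p , q) (r , s′) = ≈ᴱ-trans p r , ≈ᴱ-trans q s′

  -- Linear maps act on tuples of vectors rather than on vectors indexed by sums, so that
  -- identities between terms of HA are checked componentwise.
  record Lin (s t : Shape) : Set (c ⊔ ℓ) where
    field
      term    : Hom (size s) (size t)
      fun     : El s → El t
      correct : ∀ u → apply term (flat u) ≈ᵥ flat (fun u)
  open Lin public

  infixr 5 _⨾ᴸ_
  infixr 6 _⊕ᴸ_

  idᴸ : ∀ {s} → Lin s s
  idᴸ {s} = record { term = id (size s) ; fun = λ u → u ; correct = λ u → apply-id (size s) (flat u) }

  _⨾ᴸ_ : ∀ {s t u} → Lin s t → Lin t u → Lin s u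
  f ⨾ᴸ g = record
    { term    = term f ⨾ term g
    ; fun     = λ u → fun g (fun f u)
    ; correct = λ u i → ≈-trans (apply-cong (term g) (correct f u) i) (correct g (fun f u) i) }

  _⊕ᴸ_ : ∀ {s t s′ t′} → Lin s t → Lin s′ t′ → Lin (s ⊗ s′) (t ⊗ t′)
  f ⊕ᴸ g = record
    { term    = term f ⊕ term g
    ; fun     = λ (u , v) → fun f u , fun g v
    ; correct = λ (u , v) → ++ᵥ-cong
        (λ i → ≈-trans (apply-cong (term f) (takeᵥ-++ (flat u) (flat v)) i) (correct f u i))
        (λ i → ≈-trans (apply-cong (term g) (dropᵥ-++ (flat u) (flat v)) i) (correct g v i)) }

  -- Opaque, since unfolding the normal form of a concrete matrix is expensive.
  abstract
    matrixTerm : ∀ {n m} → Matrix m n → Hom n m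
    matrixTerm = fromMatrix

    apply-matrixTerm : ∀ {n m} (A : Matrix m n) v → apply (matrixTerm A) v ≈ᵥ (A *ᵥ v)
    apply-matrixTerm = apply-fromMatrix

  fromAction : ∀ {s t} (A : Matrix (size t) (size s)) (F : El s → El t) →
               (∀ u → (A *ᵥ flat u) ≈ᵥ flat (F u)) → Lin s t
  fromAction A F p = record
    { term = matrixTerm A ; fun = F
    ; correct = λ u i → ≈-trans (apply-matrixTerm A (flat u) i) (p u i) }

  mat : ∀ {n m} → Matrix m n → Lin ⟨ n ⟩ ⟨ m ⟩
  mat A = fromAction A (A *ᵥ_) (λ u i → ≈-refl)

  dotᴸ : ∀ {n} → Vect n → Lin ⟨ n ⟩ ⟨ 1 ⟩
  dotᴸ v = mat (λ _ → v)

  reindex : ∀ {s t} (φ : Fin (size t) → Fin (size s)) (F : El s → El t) →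
            (∀ u i → flat u (φ i) ≈ᴿ flat (F u) i) → Lin s t
  reindex φ F p = fromAction (λ i j → δ (φ i) j) F (λ u i → ≈-trans (sum-δˡ (φ i) (flat u)) (p u i))

  fstᴸ : ∀ {s t} → Lin (s ⊗ t) s
  fstᴸ {s} {t} = reindex (_↑ˡ size t) proj₁ (λ (u , v) → takeᵥ-++ (flat u) (flat v))

  sndᴸ : ∀ {s t} → Lin (s ⊗ t) t
  sndᴸ {s} {t} = reindex (size s ↑ʳ_) proj₂ (λ (u , v) → dropᵥ-++ (flat u) (flat v))

  dupᴸ : ∀ {s} → Lin s (s ⊗ s)
  dupᴸ {s} = reindex (λ i → [ (λ j → j) , (λ j → j) ]′ (splitAt (size s) i)) (λ u → u , u)
    (λ u i → go u (splitAt (size s) i))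
    where
    go : ∀ (u : El s) x → flat u ([ (λ j → j) , (λ j → j) ]′ x) ≈ᴿ [ flat u , flat u ]′ x
    go u (inj₁ j) = ≈-refl
    go u (inj₂ j) = ≈-refl

  pairᴸ : ∀ {s t u} → Lin s t → Lin s u → Lin s (t ⊗ u)
  pairᴸ f g = record
    { term = term (dupᴸ ⨾ᴸ (f ⊕ᴸ g)) ; fun = λ u → fun f u , fun g u ; correct = correct (dupᴸ ⨾ᴸ (f ⊕ᴸ g)) }

  private
    plus : ∀ {n} → Lin (⟨ n ⟩ ⊗ ⟨ n ⟩) ⟨ n ⟩
    plus {n} = fromAction (λ i j → δ (i ↑ˡ n) j +ᴿ δ (n ↑ʳ i) j) (λ (u , v) i → u i +ᴿ v i)
      (λ (u , v) i → ≈-trans (sum-cong-≋ {n + n} (λ j → distribʳ ((u ++ᵥ v) j) (δ (i ↑ˡ n) j) (δ (n ↑ʳ i) j)))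
        (≈-trans (∑-distrib-+ (λ j → δ (i ↑ˡ n) j * (u ++ᵥ v) j) (λ j → δ (n ↑ʳ i) j * (u ++ᵥ v) j))
          (+-cong (≈-trans (sum-δˡ (i ↑ˡ n) (u ++ᵥ v)) (takeᵥ-++ u v i))
                  (≈-trans (sum-δˡ (n ↑ʳ i) (u ++ᵥ v)) (dropᵥ-++ u v i)))))

    minus : ∀ {n} → Lin ⟨ n ⟩ ⟨ n ⟩
    minus {n} = fromAction (λ i j → - δ i j) (λ u i → - u i)
      (λ u i → ≈-trans (sum-cong-≋ (λ j → ≈-sym (-‿distribˡ-* (δ i j) (u j))))
        (≈-trans (sum-neg (λ j → δ i j * u j)) (-‿cong (sum-δˡ i u))))

  infixl 6 _+ᴸ_ _-ᴸ_
  _+ᴸ_ : ∀ {s n} → Lin s ⟨ n ⟩ → Lin s ⟨ n ⟩ → Lin s ⟨ n ⟩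
  f +ᴸ g = pairᴸ f g ⨾ᴸ plus

  _-ᴸ_ : ∀ {s n} → Lin s ⟨ n ⟩ → Lin s ⟨ n ⟩ → Lin s ⟨ n ⟩
  f -ᴸ g = f +ᴸ (g ⨾ᴸ minus)

  scaleᴸ : ∀ {n} → Carrier → Lin ⟨ n ⟩ ⟨ n ⟩
  scaleᴸ k = fromAction (λ i j → k * δ i j) (λ u i → k * u i)
    (λ u i → ≈-trans (sum-cong-≋ (λ j → *-assoc k (δ i j) (u j)))
      (≈-trans (≈-sym (*-distribˡ-sum k (λ j → δ i j * u j))) (*-congˡ (sum-δˡ i u))))

  zeroᴸ : ∀ {s n} → Lin s ⟨ n ⟩
  zeroᴸ {s} = fromAction (λ _ _ → 0#) (λ _ _ → 0#) (λ u i → sum-0 (size s) (λ _ → zeroˡ _))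

  -- In contrast to `zeroᴸ`, whose term is an opaque normal form, the term is `zeros n` itself, the
  -- tensor of `η◦` whose reversal `zero†` is analysed wire by wire.
  zerosᴸ : ∀ n → Lin ⟨ 0 ⟩ ⟨ n ⟩
  zerosᴸ n = record { term = zeros n ; fun = λ _ _ → 0# ; correct = λ u i → apply-zeros n u i }

  discards : ∀ n → Hom n 0
  discards zero    = id 0
  discards (suc n) = ε• ⊕ discards n

  discardsᴸ : ∀ n → Lin ⟨ n ⟩ ⟨ 0 ⟩
  discardsᴸ n = record { term = discards n ; fun = λ _ () ; correct = λ u () }

  headᴸ : ∀ {n} → Lin ⟨ suc n ⟩ ⟨ 1 ⟩
  headᴸ = reindex (λ _ → zero) (λ u _ → u zero) (λ u i → ≈-refl)

  tailᴸ : ∀ {n} → Lin ⟨ suc n ⟩ ⟨ n ⟩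
  tailᴸ = reindex suc (λ u i → u (suc i)) (λ u i → ≈-refl)

  consᵥ : ∀ {n} → Vect 1 → Vect n → Vect (suc n)
  consᵥ x v zero    = x zero
  consᵥ x v (suc i) = v i

  consᴸ : ∀ {n} → Lin (⟨ 1 ⟩ ⊗ ⟨ n ⟩) ⟨ suc n ⟩
  consᴸ {n} = record
    { term = id (suc n) ; fun = λ (x , v) → consᵥ x v
    ; correct = λ { (x , v) zero → ≈-refl ; (x , v) (suc i) → apply-id n v i } }

  -- Reassociation ⟨ 1 + n ⟩ ⊗ s = ⟨ 1 ⟩ ⊗ (⟨ n ⟩ ⊗ s); both shapes have definitionally the same size.
  consˡᴸ : ∀ {n s} → Lin (⟨ 1 ⟩ ⊗ (⟨ n ⟩ ⊗ s)) (⟨ suc n ⟩ ⊗ s)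
  consˡᴸ {n} {s} = record
    { term = id (suc (n + size s)) ; fun = λ (x , (u , v)) → consᵥ x u , v
    ; correct = λ (x , (u , v)) i → ≈-trans (apply-id _ (flat (x , (u , v))) i) (go x u v i) }
    where
    go : ∀ (x : Vect 1) (u : Vect n) (v : El s) i → (x ++ᵥ (u ++ᵥ flat v)) i ≈ᴿ (consᵥ x u ++ᵥ flat v) i
    go x u v zero    = ≈-refl
    go x u v (suc i) with splitAt n i
    ... | inj₁ _ = ≈-refl
    ... | inj₂ _ = ≈-refl

  unitˡᴸ : ∀ {s} → Lin s (⟨ 0 ⟩ ⊗ s)
  unitˡᴸ {s} = record { term = id (size s) ; fun = λ u → (λ ()) , u ; correct = λ u → apply-id _ (flat u) }

  counitˡᴸ : ∀ {s} → Lin (⟨ 0 ⟩ ⊗ s) s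
  counitˡᴸ {s} = record { term = id (size s) ; fun = proj₂ ; correct = λ (_ , u) → apply-id _ (flat u) }

  -- As for `consˡᴸ`, both shapes have the same size by computation because the leading blocks have
  -- size 1; the underlying term is therefore an identity without transport.
  assocᴸ : ∀ {s} → Lin ((⟨ 1 ⟩ ⊗ ⟨ 1 ⟩) ⊗ s) (⟨ 1 ⟩ ⊗ (⟨ 1 ⟩ ⊗ s))
  assocᴸ {s} = record
    { term = id (2 + size s) ; fun = λ ((x , y) , u) → x , (y , u)
    ; correct = λ { u zero → ≈-refl ; u (suc zero) → ≈-refl ; (_ , u) (suc (suc i)) → apply-id (size s) (flat u) i } }

  assoc⁻ᴸ : ∀ {s} → Lin (⟨ 1 ⟩ ⊗ (⟨ 1 ⟩ ⊗ s)) ((⟨ 1 ⟩ ⊗ ⟨ 1 ⟩) ⊗ s)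
  assoc⁻ᴸ {s} = record
    { term = id (2 + size s) ; fun = λ (x , (y , u)) → (x , y) , u
    ; correct = λ { u zero → ≈-refl ; u (suc zero) → ≈-refl ; (_ , (_ , u)) (suc (suc i)) → apply-id (size s) (flat u) i } }

  joinᴸ : ∀ {s} → Lin s ⟨ size s ⟩
  joinᴸ {s} = record { term = id (size s) ; fun = flat ; correct = λ u → apply-id (size s) (flat u) }

  splitᴸ : ∀ {s} → Lin ⟨ size s ⟩ s
  splitᴸ {s} = record
    { term = id (size s) ; fun = unflat
    ; correct = λ u i → ≈-trans (apply-id (size s) u i) (≈-sym (flat-unflat {s} u i)) }

  copyᴸ : Lin ⟨ 1 ⟩ (⟨ 1 ⟩ ⊗ ⟨ 1 ⟩)
  copyᴸ = record { term = Δ• ; fun = λ u → u , u ; correct = λ { u zero → ≈-refl ; u (suc zero) → ≈-refl } }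

  discardᴸ : Lin ⟨ 1 ⟩ ⟨ 0 ⟩
  discardᴸ = record { term = ε• ; fun = λ _ () ; correct = λ u () }

  addᴸ : Lin (⟨ 1 ⟩ ⊗ ⟨ 1 ⟩) ⟨ 1 ⟩
  addᴸ = record { term = μ◦ ; fun = λ (u , v) i → u i +ᴿ v i ; correct = λ { u zero → ≈-refl } }

  η◦ᴸ : Lin ⟨ 0 ⟩ ⟨ 1 ⟩
  η◦ᴸ = record { term = η◦ ; fun = λ _ _ → 0# ; correct = λ u i → ≈-refl }

  scalarᴸ : Carrier → Lin ⟨ 1 ⟩ ⟨ 1 ⟩
  scalarᴸ k = record { term = s k ; fun = λ u i → k * u i ; correct = λ { u zero → ≈-refl } }

  apply-term : ∀ {s t} (f : Lin s t) v → apply (term f) v ≈ᵥ flat (fun f (unflat v))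
  apply-term {s} f v i = ≈-trans (apply-cong (term f) (λ j → ≈-sym (flat-unflat {s} v j)) i)
    (correct f (unflat v) i)

  lin-eq : ∀ {s t} (f g : Lin s t) → (∀ u → fun f u ≈ᴱ fun g u) → term f ≈ term g
  lin-eq f g p = complete (λ v i → ≈-trans (apply-term f v i)
    (≈-trans (flat-cong (p (unflat v)) i) (≈-sym (apply-term g v i))))

  fun-cong : ∀ {s t} (f : Lin s t) {u v : El s} → u ≈ᴱ v → fun f u ≈ᴱ fun f v
  fun-cong f {u} {v} p = flat-injective (λ i → ≈-trans (≈-sym (correct f u i))
    (≈-trans (apply-cong (term f) (flat-cong p) i) (correct f v i)))

  matrixOf : ∀ {s t} → Lin s t → Matrix (size t) (size s)
  matrixOf f = ⟦ term f ⟧ᵐ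

  matrixOf-action : ∀ {s t} (f : Lin s t) u → (matrixOf f *ᵥ flat u) ≈ᵥ flat (fun f u)
  matrixOf-action f u i = ≈-trans (*ᵥ-apply (term f) (flat u) i) (correct f u i)

  -- `fun` is a bare function; its linearity is borrowed from the matrix of `term` through
  -- `correct`.
  fun-minus : ∀ {n m} (f : Lin ⟨ n ⟩ ⟨ m ⟩) u v i →
              fun f (λ j → u j - v j) i ≈ᴿ fun f u i - fun f v i
  fun-minus f u v i = ≈-trans (≈-sym (matrixOf-action f _ i))
    (≈-trans (*ᵥ-+ (matrixOf f) u (λ j → - v j) i)
      (+-cong (matrixOf-action f u i)
        (≈-trans (≈-trans (sum-cong-≋ (λ j → ≈-sym (-‿distribʳ-* (matrixOf f i j) (v j))))
          (sum-neg (λ j → matrixOf f i j * v j))) (-‿cong (matrixOf-action f v i)))))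

  fun-scale : ∀ {n m} (f : Lin ⟨ n ⟩ ⟨ m ⟩) k u i → fun f (λ j → k * u j) i ≈ᴿ k * fun f u i
  fun-scale f k u i = ≈-trans (≈-sym (matrixOf-action f _ i))
    (≈-trans (*ᵥ-cong (matrixOf f) (λ j → *-comm k (u j)) i)
      (≈-trans (*ᵥ-* (matrixOf f) u k i)
        (≈-trans (*-congʳ (matrixOf-action f u i)) (*-comm _ k))))

  swap₃ : ∀ a b k → Hom (a + (b + k)) (b + (a + k))
  swap₃ a b k = subst₂ Hom (+-assoc a b k) (+-assoc b a k) (σ a b ⊕ id k)

  apply-σ : ∀ a b (u : Vect a) (v : Vect b) → apply (σ a b) (u ++ᵥ v) ≈ᵥ (v ++ᵥ u)
  apply-σ a b u v i = ≈-trans (≈-sym (*ᵥ-apply (σ a b) (u ++ᵥ v) i))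
    (≈-trans (*ᵥ-congˡ (⟦⟧ᵐ-σ a b) (u ++ᵥ v) i)
    (≈-trans (swap-·ˡ {a} {b} (λ j (_ : Fin 1) → (u ++ᵥ v) j) i zero)
    (≈-trans (≈-reflexive (≡.cong [ u , v ]′ (splitAt-swap b a i))) (go (splitAt b i)))))
    where
    go : ∀ x → [ u , v ]′ (Sum.swap x) ≈ᴿ [ v , u ]′ x
    go (inj₁ _) = ≈-refl
    go (inj₂ _) = ≈-refl

  apply-subst₂ : ∀ {n m n′ m′} (p : n ≡ n′) (q : m ≡ m′) (f : Hom n m) (v : Vect n′) i →
                 apply (subst₂ Hom p q f) v i ≈ᴿ apply f (λ j → v (cast p j)) (cast (≡.sym q) i)
  apply-subst₂ ≡.refl ≡.refl f v i = ≈-trans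
    (apply-cong f (λ j → ≈-reflexive (≡.cong v (≡.sym (cast-is-id ≡.refl j)))) i)
    (≈-reflexive (≡.cong (apply f _) (≡.sym (cast-is-id ≡.refl i))))

  ++ᵥ-assoc : ∀ {a b k} (u : Vect a) (v : Vect b) (w : Vect k) i →
              ((u ++ᵥ v) ++ᵥ w) (cast (≡.sym (+-assoc a b k)) i) ≈ᴿ (u ++ᵥ (v ++ᵥ w)) i
  ++ᵥ-assoc {a} {b} {k} u v w i = ≈-trans
    (≈-reflexive (≡.cong [ u ++ᵥ v , w ]′ (splitAt-cast-+ a b k (≡.sym (+-assoc a b k)) i)))
    (go (splitAt a i))
    where
    go : ∀ x → [ u ++ᵥ v , w ]′ (reassoc x) ≈ᴿ [ u , v ++ᵥ w ]′ x
    go (inj₁ j) = takeᵥ-++ u v j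
    go (inj₂ j) with splitAt b {k} j
    ... | inj₁ l = dropᵥ-++ u v l
    ... | inj₂ l = ≈-refl

  ++ᵥ-assoc⁻ : ∀ {a b k} (u : Vect a) (v : Vect b) (w : Vect k) i →
               (u ++ᵥ (v ++ᵥ w)) (cast (+-assoc a b k) i) ≈ᴿ ((u ++ᵥ v) ++ᵥ w) i
  ++ᵥ-assoc⁻ {a} {b} {k} u v w i = ≈-trans (≈-sym (++ᵥ-assoc u v w (cast (+-assoc a b k) i)))
    (≈-reflexive (≡.cong ((u ++ᵥ v) ++ᵥ w) (cast-involutive (≡.sym (+-assoc a b k)) (+-assoc a b k) i)))

  swap₃ᴸ : ∀ {a b s} → Lin (⟨ a ⟩ ⊗ (⟨ b ⟩ ⊗ s)) (⟨ b ⟩ ⊗ (⟨ a ⟩ ⊗ s))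
  swap₃ᴸ {a} {b} {s} = record
    { term = swap₃ a b (size s) ; fun = λ (u , (v , w)) → v , (u , w)
    ; correct = λ (u , (v , w)) i →
        ≈-trans (apply-subst₂ (+-assoc a b (size s)) (+-assoc b a (size s)) (σ a b ⊕ id (size s))
                  (u ++ᵥ (v ++ᵥ flat w)) i)
        (≈-trans (apply-cong (σ a b ⊕ id (size s)) (++ᵥ-assoc⁻ u v (flat w)) _)
        (≈-trans (++ᵥ-cong
            (λ j → ≈-trans (apply-cong (σ a b) (takeᵥ-++ (u ++ᵥ v) (flat w)) j) (apply-σ a b u v j))
            (λ j → ≈-trans (apply-id (size s) _ j) (dropᵥ-++ (u ++ᵥ v) (flat w) j)) _)
          (++ᵥ-assoc v u (flat w) i))) }

  σᴸ : ∀ {a b} → Lin (⟨ a ⟩ ⊗ ⟨ b ⟩) (⟨ b ⟩ ⊗ ⟨ a ⟩)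
  σᴸ {a} {b} = record { term = σ a b ; fun = λ (u , v) → v , u ; correct = λ (u , v) → apply-σ a b u v }

  -- K is a basis of the kernel of M, presented with a retraction L; multiples of the
  -- complementary projection 1 - K L factor through M.
  record SplitKernel {n m p} (M : Lin ⟨ n ⟩ ⟨ m ⟩) (K : Lin ⟨ p ⟩ ⟨ n ⟩) : Set (c ⊔ ℓ) where
    field
      L   : Lin ⟨ n ⟩ ⟨ p ⟩
      N   : Lin ⟨ m ⟩ ⟨ n ⟩
      d   : Carrier
      d≉0 : d ≉ 0#
      MK  : ∀ t → fun M (fun K t) ≈ᵥ (λ _ → 0#)
      LK  : ∀ t → fun L (fun K t) ≈ᵥ t
      NM  : ∀ v i → fun N (fun M v) i ≈ᴿ d * (v i - fun K (fun L v) i)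

-- Interacting Hopf algebras: inclusion of HA and reversal

module InteractingHopf (R : CommutativeRing c ℓ) (pid : IsPID R) where
  open CommutativeRing R renaming
    (_+_ to _+ᴿ_; +-assoc to +ᴿ-assoc; +-identityʳ to +ᴿ-identityʳ; zero to *-zero;
     _≈_ to _≈ᴿ_; _≉_ to _≉ᴿ_; refl to ≈-refl; sym to ≈-sym; trans to ≈-trans; setoid to setoidᴿ;
     isEquivalence to ≈-isEquivalence; reflexive to ≈-reflexive)
  open IsPID pid
  open Matrices R
  open MatrixPullbacks R pid using (Vect; _*ᵥ_)
  open MatrixSemantics R pid
  open HACompleteness R pid using (HAᴾ; complete; act; apply-id; zeros)
  module H = PROP HAᴾ
  open LinearMaps R pid
  open IntegerSolver R using (solve; _:=_; _:+_; _:*_; _:-_; :-_; 𝟘; 𝟙)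
  open IHTerms R
  private
    module G = HATerms R
    IH = HA R +ᴾ HA R ᵒᵖ /ᴾ WEqn R
  module ∼ = Presented IH
  open PROP (IHSp R)
  open PROPProperties (IHSp R)
  open PresentedProperties IH
  open HomReasoning

  private
    i = id 1
    S = σ 1 1

  infix 9 ↑_
  ↑_ : ∀ {n m} → H.Hom n m → Hom n m
  ↑_ = rename inj₁

  infixl 10 _†
  _† : ∀ {n m} → Hom n m → Hom m n
  f † = rename Sum.swap (reverse f)

  module HA→IH = Extension (HA R) (IHSp R)

  ↑-isInterpretation : HA→IH.IsInterpretation ↑_
  ↑-isInterpretation = record
    { map-id₀ = Eq.refl ; map-id₁ = id₁≈id ; map-σ₁₁ = σ₁₁≈σ
    ; map-⨾ = λ _ _ → Eq.refl ; map-⊕ = λ _ _ → Eq.refl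
    ; map-axiom = λ p → ∼.axiom (inj₁ (left p)) }

  open HA→IH.IsInterpretation ↑-isInterpretation public
    using () renaming (map-cong to ↑-cong; map-id to ↑-id; map-σ to ↑-σ)

  -- The presentation states its reversed equations for `rename inj₂ (reverse f)`. Reversal inside
  -- the coproduct has to reach the same terms before those equations apply.
  ↑-† : ∀ {n m} (f : H.Hom n m) → (↑ f) † ≡ rename inj₂ (reverse f)
  ↑-† (gen g) = ≡.refl
  ↑-† id₀     = ≡.refl
  ↑-† id₁     = ≡.refl
  ↑-† σ₁₁     = ≡.refl
  ↑-† (f Defs.⨾ g) = ≡.cong₂ Defs._⨾_ (↑-† g) (↑-† f)
  ↑-† (f Defs.⊕ g) = ≡.cong₂ Defs._⊕_ (↑-† f) (↑-† g)

  reverse-† : ∀ {n m} (f : H.Hom n m) → (rename inj₂ (reverse f)) † ≡ ↑ f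
  reverse-† (gen g) = ≡.refl
  reverse-† id₀     = ≡.refl
  reverse-† id₁     = ≡.refl
  reverse-† σ₁₁     = ≡.refl
  reverse-† (f Defs.⨾ g) = ≡.cong₂ Defs._⨾_ (reverse-† f) (reverse-† g)
  reverse-† (f Defs.⊕ g) = ≡.cong₂ Defs._⊕_ (reverse-† f) (reverse-† g)

  -1*-1 : - 1# * - 1# ≈ᴿ 1#
  -1*-1 = solve 0 ((:- 𝟙) :* (:- 𝟙) := 𝟙) ≈-refl

  -1≉0 : - 1# ≉ᴿ 0#
  -1≉0 p = 1≉0 (≈-trans (≈-sym -1*-1) (≈-trans (*-congʳ p) (zeroˡ _)))

  -- -1 is its own inverse, so (W1) identifies its opposite with itself. This makes (W5) and (W6)
  -- exchange under `_†`, which would otherwise produce `s̄ (- 1#)` in place of `s (- 1#)`.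
  s̄-minus : s̄ (- 1#) ≈ s (- 1#)
  s̄-minus = begin
    s̄ (- 1#)                          ≈⟨ idˡ ⟨
    i ⨾ s̄ (- 1#)                      ≈⟨ ↑-cong (complete λ { v zero → ≈-sym (solve 1 (λ x → (:- 𝟙) :* ((:- 𝟙) :* x) := x) ≈-refl (v zero)) }) ⟩⨾⟨refl ⟩
    (s (- 1#) ⨾ s (- 1#)) ⨾ s̄ (- 1#)  ≈⟨ pullʳ (∼.axiom (inj₂ (W1 _ -1≉0))) ⟩
    s (- 1#) ⨾ id₁                    ≈⟨ Eq.trans (refl⟩⨾⟨ id₁≈id) idʳ ⟩
    s (- 1#)                          ∎

  module IH→IHᴼᴾ = Extension IH (IHSp R ᴼᴾ)

  †-isInterpretation : IH→IHᴼᴾ.IsInterpretation _†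
  †-isInterpretation = record
    { map-id₀ = Eq.refl ; map-id₁ = id₁≈id ; map-σ₁₁ = σ₁₁≈σ
    ; map-⨾ = λ _ _ → Eq.refl ; map-⊕ = λ _ _ → Eq.refl
    ; map-axiom = †-axiom }
    where
    †-axiom : ∀ {n m} {f g : Hom n m} → Presentation.Eqn IH f g → f † ≈ g †
    †-axiom (inj₁ (left {f = f} {g} p)) = ≡.subst₂ _≈_ (≡.sym (↑-† f)) (≡.sym (↑-† g))
      (∼.axiom (inj₁ (right (reversed p))))
    †-axiom (inj₁ (right (reversed {f = f} {g} p))) = ≡.subst₂ _≈_ (≡.sym (reverse-† f)) (≡.sym (reverse-† g))
      (∼.axiom (inj₁ (left p)))
    †-axiom (inj₂ (W1 l p)) = ∼.axiom (inj₂ (W1 l p))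
    †-axiom (inj₂ W2)  = ∼.axiom (inj₂ W2)
    †-axiom (inj₂ W3ˡ) = Eq.sym (∼.axiom (inj₂ W3ʳ))
    †-axiom (inj₂ W3ʳ) = Eq.sym (∼.axiom (inj₂ W3ˡ))
    †-axiom (inj₂ W4ˡ) = Eq.sym (∼.axiom (inj₂ W4ʳ))
    †-axiom (inj₂ W4ʳ) = Eq.sym (∼.axiom (inj₂ W4ˡ))
    †-axiom (inj₂ W5)  = Eq.trans (∼.axiom (inj₂ W6))
      (Eq.trans assoc˘ (((refl⟩⊕⟨ Eq.sym s̄-minus) ⟩⨾⟨refl) ⟩⨾⟨refl))
    †-axiom (inj₂ W6)  = Eq.trans (∼.axiom (inj₂ W5))
      (Eq.trans (refl⟩⨾⟨ (refl⟩⨾⟨ (refl⟩⊕⟨ Eq.sym s̄-minus))) assoc˘)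
    †-axiom (inj₂ (W7 k)) = Eq.trans (∼.axiom (inj₂ (W8 k))) assoc˘
    †-axiom (inj₂ (W8 k)) = Eq.trans (∼.axiom (inj₂ (W7 k))) assoc˘

  open IH→IHᴼᴾ.IsInterpretation †-isInterpretation public
    using () renaming (map-cong to †-cong; map-id to †-id; map-σ to †-σ)

  -- Single-wire laws for tests and free wires

  cap : Hom 2 0
  cap = μ• ⨾ ε•

  frobeniusˡ : (Δ• ⊕ i) ⨾ (i ⊕ μ•) ≈ μ• ⨾ Δ•
  frobeniusˡ = Eq.trans ((refl⟩⊕⟨ Eq.sym id₁≈id) ⟩⨾⟨ (Eq.sym id₁≈id ⟩⊕⟨refl)) (∼.axiom (inj₂ W4ˡ))

  frobeniusʳ : (i ⊕ Δ•) ⨾ (μ• ⊕ i) ≈ μ• ⨾ Δ•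
  frobeniusʳ = Eq.trans ((Eq.sym id₁≈id ⟩⊕⟨refl) ⟩⨾⟨ (refl⟩⊕⟨ Eq.sym id₁≈id)) (Eq.sym (∼.axiom (inj₂ W4ʳ)))

  frobenius◦ˡ : (Δ◦ ⊕ i) ⨾ (i ⊕ μ◦) ≈ μ◦ ⨾ Δ◦
  frobenius◦ˡ = Eq.trans ((refl⟩⊕⟨ Eq.sym id₁≈id) ⟩⨾⟨ (Eq.sym id₁≈id ⟩⊕⟨refl)) (∼.axiom (inj₂ W3ˡ))

  Δ•-counitʳ : Δ• ⨾ (i ⊕ ε•) ≈ i
  Δ•-counitʳ = ↑-cong {f = G.Δ• H.⨾ (H.id 1 H.⊕ G.ε•)} (complete λ { v zero → ≈-refl })

  Δ•-counitˡ : Δ• ⨾ (ε• ⊕ i) ≈ i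
  Δ•-counitˡ = ↑-cong {f = G.Δ• H.⨾ (G.ε• H.⊕ H.id 1)} (complete λ { v zero → ≈-refl })

  μ◦-unitˡ : (η◦ ⊕ i) ⨾ μ◦ ≈ i
  μ◦-unitˡ = ↑-cong {f = (G.η◦ H.⊕ H.id 1) H.⨾ G.μ◦} (complete λ { v zero → +-identityˡ _ })

  -- The reversed (A14) lets `ε◦` absorb `s̄ k`, and (W1) cancels `s k` against it. This is the step
  -- by which a non-zero factor in front of a test disappears.
  s⨾ε◦ : ∀ {k} → k ≉ᴿ 0# → s k ⨾ ε◦ ≈ ε◦
  s⨾ε◦ {k} k≉0 = begin
    s k ⨾ ε◦           ≈⟨ refl⟩⨾⟨ †-cong (↑-cong (∼′.axiom (A14 k))) ⟨
    s k ⨾ s̄ k ⨾ ε◦     ≈⟨ pullˡ (Eq.trans (∼.axiom (inj₂ (W1 k k≉0))) id₁≈id) ⟩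
    i ⨾ ε◦             ≈⟨ idˡ ⟩
    ε◦                 ∎
    where module ∼′ = Presented (HA R)

  -- The test x = y is the test x - y = 0: (W6) with the sign moved to the other side.
  cap-subtracts : (i ⊕ s (- 1#)) ⨾ μ◦ ⨾ ε◦ ≈ cap
  cap-subtracts = begin
    (i ⊕ s (- 1#)) ⨾ μ◦ ⨾ ε◦
      ≈⟨ refl⟩⨾⟨ Eq.trans (∼.axiom (inj₂ W6)) ((id₁≈id ⟩⊕⟨refl) ⟩⨾⟨refl) ⟩
    (i ⊕ s (- 1#)) ⨾ (i ⊕ s (- 1#)) ⨾ cap
      ≈⟨ pullˡ (merge idˡ (↑-cong {f = G.s (- 1#) H.⨾ G.s (- 1#)} {g = H.id 1}
           (complete λ { v zero → solve 1 (λ x → (:- 𝟙) :* ((:- 𝟙) :* x) := x) ≈-refl (v zero) }))) ⟩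
    (i ⊕ i) ⨾ cap
      ≈⟨ Eq.trans (⊕-id 1 1 ⟩⨾⟨refl) idˡ ⟩
    cap ∎

  η◦-cap : (η◦ ⊕ i) ⨾ cap ≈ ε◦
  η◦-cap = begin
    (η◦ ⊕ i) ⨾ cap                        ≈⟨ refl⟩⨾⟨ cap-subtracts ⟨
    (η◦ ⊕ i) ⨾ (i ⊕ s (- 1#)) ⨾ μ◦ ⨾ ε◦   ≈⟨ Eq.trans (refl⟩⨾⟨ assoc˘) (pullˡ (↑-cong
      {f = (G.η◦ H.⊕ H.id 1) H.⨾ (H.id 1 H.⊕ G.s (- 1#)) H.⨾ G.μ◦} {g = G.s (- 1#)}
      (complete λ { v zero → +-identityˡ _ }))) ⟩
    s (- 1#) ⨾ ε◦                         ≈⟨ s⨾ε◦ -1≉0 ⟩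
    ε◦                                    ∎

  μ•-capˡ : μ• ≈ (Δ• ⊕ i) ⨾ (i ⊕ cap)
  μ•-capˡ = begin
    μ•                               ≈⟨ Eq.trans (refl⟩⨾⟨ Δ•-counitʳ) idʳ ⟨
    μ• ⨾ Δ• ⨾ (i ⊕ ε•)               ≈⟨ replaceˡ (Eq.sym frobeniusˡ) ⟩
    (Δ• ⊕ i) ⨾ (i ⊕ μ•) ⨾ (i ⊕ ε•)   ≈⟨ refl⟩⨾⟨ merge idˡ Eq.refl ⟩
    (Δ• ⊕ i) ⨾ (i ⊕ cap)             ∎

  μ•-capʳ : μ• ≈ (i ⊕ Δ•) ⨾ (cap ⊕ i)
  μ•-capʳ = begin
    μ•                               ≈⟨ Eq.trans (refl⟩⨾⟨ Δ•-counitˡ) idʳ ⟨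
    μ• ⨾ Δ• ⨾ (ε• ⊕ i)               ≈⟨ replaceˡ (Eq.sym frobeniusʳ) ⟩
    (i ⊕ Δ•) ⨾ (μ• ⊕ i) ⨾ (ε• ⊕ i)   ≈⟨ refl⟩⨾⟨ merge Eq.refl idˡ ⟩
    (i ⊕ Δ•) ⨾ (cap ⊕ i)             ∎

  η◦-μ• : (η◦ ⊕ i) ⨾ μ• ≈ ε◦ ⨾ η◦
  η◦-μ• = begin
    (η◦ ⊕ i) ⨾ μ•                        ≈⟨ refl⟩⨾⟨ μ•-capˡ ⟩
    (η◦ ⊕ i) ⨾ (Δ• ⊕ i) ⨾ (i ⊕ cap)      ≈⟨ pullˡ (merge (↑-cong {f = G.η◦ H.⨾ G.Δ•} {g = G.η◦ H.⊕ G.η◦}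
                                              (complete λ { v zero → ≈-refl ; v (suc zero) → ≈-refl })) idˡ) ⟩
    ((η◦ ⊕ η◦) ⊕ i) ⨾ (i ⊕ cap)          ≈⟨ ⊕-assoc η◦ η◦ i ⟩⨾⟨refl ⟩
    (η◦ ⊕ (η◦ ⊕ i)) ⨾ (i ⊕ cap)          ≈⟨ merge idʳ η◦-cap ⟩
    η◦ ⊕ ε◦                              ≈⟨ merge idˡ idʳ ⟨
    (id 0 ⊕ ε◦) ⨾ (η◦ ⊕ id 0)            ≈⟨ ⊕-idˡ ε◦ ⟩⨾⟨ ⊕-idʳ η◦ ⟩
    ε◦ ⨾ η◦                              ∎

  -- The single-wire source of `shear`: if one copy of a wire is tested to vanish, the other copy
  -- can be replaced by a fresh zero.
  Δ•-ε◦ : Δ• ⨾ (ε◦ ⊕ i) ≈ ε◦ ⨾ η◦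
  Δ•-ε◦ = begin
    Δ• ⨾ (ε◦ ⊕ i)                         ≈⟨ refl⟩⨾⟨ (Eq.sym η◦-cap ⟩⊕⟨ Eq.sym idˡ) ⟩
    Δ• ⨾ (((η◦ ⊕ i) ⨾ cap) ⊕ (i ⨾ i))     ≈⟨ refl⟩⨾⟨ ⊕-interchange _ _ _ _ ⟩
    Δ• ⨾ ((η◦ ⊕ i) ⊕ i) ⨾ (cap ⊕ i)       ≈⟨ pullˡ (Eq.trans (Eq.sym (⊕-idˡ Δ•) ⟩⨾⟨
                                               Eq.trans (⊕-assoc η◦ i i) (refl⟩⊕⟨ ⊕-id 1 1))
                                               (slide (Eq.trans idˡ (Eq.sym idʳ)) (Eq.trans idʳ (Eq.sym idˡ)))) ⟩
    ((η◦ ⊕ i) ⨾ (i ⊕ Δ•)) ⨾ (cap ⊕ i)     ≈⟨ pullʳ (Eq.sym μ•-capʳ) ⟩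
    (η◦ ⊕ i) ⨾ μ•                         ≈⟨ η◦-μ• ⟩
    ε◦ ⨾ η◦                               ∎

  cup◦ : Hom 0 2
  cup◦ = η◦ ⨾ Δ◦

  cup◦-subtracts : cup◦ ≈ η• ⨾ Δ• ⨾ (i ⊕ s (- 1#))
  cup◦-subtracts = Eq.trans (∼.axiom (inj₂ W5)) (refl⟩⨾⟨ (refl⟩⨾⟨ (id₁≈id ⟩⊕⟨refl)))

  Δ◦-cup : Δ◦ ≈ (cup◦ ⊕ i) ⨾ (i ⊕ μ◦)
  Δ◦-cup = begin
    Δ◦                               ≈⟨ Eq.trans (μ◦-unitˡ ⟩⨾⟨refl) idˡ ⟨
    ((η◦ ⊕ i) ⨾ μ◦) ⨾ Δ◦             ≈⟨ pullʳ (Eq.sym frobenius◦ˡ) ⟩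
    (η◦ ⊕ i) ⨾ (Δ◦ ⊕ i) ⨾ (i ⊕ μ◦)   ≈⟨ pullˡ (merge Eq.refl idˡ) ⟩
    (cup◦ ⊕ i) ⨾ (i ⊕ μ◦)            ∎

  cup◦-εʳ : cup◦ ⨾ (i ⊕ ε•) ≈ η•
  cup◦-εʳ = begin
    cup◦ ⨾ (i ⊕ ε•)                             ≈⟨ cup◦-subtracts ⟩⨾⟨refl ⟩
    (η• ⨾ Δ• ⨾ (i ⊕ s (- 1#))) ⨾ (i ⊕ ε•)       ≈⟨ pullʳ (↑-cong
      {f = (G.Δ• H.⨾ (H.id 1 H.⊕ G.s (- 1#))) H.⨾ (H.id 1 H.⊕ G.ε•)} {g = H.id 1}
      (complete λ { v zero → ≈-refl })) ⟩
    η• ⨾ i                                      ≈⟨ idʳ ⟩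
    η•                                          ∎

  Δ◦-comm : Δ◦ ⨾ S ≈ Δ◦
  Δ◦-comm = Eq.trans (refl⟩⨾⟨ Eq.sym σ₁₁≈σ) (†-cong (∼.axiom (inj₁ (left A2))))

  μ•-comm : S ⨾ μ• ≈ μ•
  μ•-comm = Eq.trans (Eq.sym σ₁₁≈σ ⟩⨾⟨refl) (†-cong (∼.axiom (inj₁ (left A5))))

  S-ε : S ⨾ (ε• ⊕ i) ≈ i ⊕ ε•
  S-ε = Eq.trans (Eq.sym (σ-natural i ε•)) (Eq.trans (refl⟩⨾⟨ σ₁-0) idʳ)

  Δ◦-ε : Δ◦ ⨾ (ε• ⊕ i) ≈ ε• ⨾ η•
  Δ◦-ε = begin
    Δ◦ ⨾ (ε• ⊕ i)                           ≈⟨ Eq.sym Δ◦-comm ⟩⨾⟨refl ⟩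
    (Δ◦ ⨾ S) ⨾ (ε• ⊕ i)                     ≈⟨ pullʳ S-ε ⟩
    Δ◦ ⨾ (i ⊕ ε•)                           ≈⟨ Δ◦-cup ⟩⨾⟨refl ⟩
    ((cup◦ ⊕ i) ⨾ (i ⊕ μ◦)) ⨾ (i ⊕ ε•)      ≈⟨ pullʳ (merge idˡ (∼.axiom (inj₁ (left A7)))) ⟩
    (cup◦ ⊕ i) ⨾ (i ⊕ (ε• ⊕ ε•))            ≈⟨ refl⟩⨾⟨ ⊕-assoc i ε• ε• ⟨
    (cup◦ ⊕ i) ⨾ ((i ⊕ ε•) ⊕ ε•)            ≈⟨ merge cup◦-εʳ idˡ ⟩
    η• ⊕ ε•                                 ≈⟨ merge idˡ idʳ ⟨
    (id 0 ⊕ ε•) ⨾ (η• ⊕ id 0)               ≈⟨ ⊕-idˡ ε• ⟩⨾⟨ ⊕-idʳ η• ⟩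
    ε• ⨾ η•                                 ∎

  -- The single-wire source of `translate`: adding x to a free wire gives a free wire and forgets x.
  η•-μ◦ : (η• ⊕ i) ⨾ μ◦ ≈ ε• ⨾ η•
  η•-μ◦ = begin
    (η• ⊕ i) ⨾ μ◦
      ≈⟨ (Eq.sym cup◦-εˡ ⟩⊕⟨ Eq.sym (Eq.trans idˡ idˡ)) ⟩⨾⟨refl ⟩
    ((η◦ ⨾ Δ◦ ⨾ (ε• ⊕ i)) ⊕ (i ⨾ i ⨾ i)) ⨾ μ◦
      ≈⟨ Eq.trans (⊕-interchange _ _ _ _) (refl⟩⨾⟨ ⊕-interchange _ _ _ _) ⟩⨾⟨refl ⟩
    ((η◦ ⊕ i) ⨾ (Δ◦ ⊕ i) ⨾ ((ε• ⊕ i) ⊕ i)) ⨾ μ◦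
      ≈⟨ pullʳ (pullʳ (↑-cong {f = ((G.ε• H.⊕ H.id 1) H.⊕ H.id 1) H.⨾ G.μ◦}
           {g = (H.id 1 H.⊕ G.μ◦) H.⨾ (G.ε• H.⊕ H.id 1)} (complete λ { v zero → ≈-refl }))) ⟩
    (η◦ ⊕ i) ⨾ (Δ◦ ⊕ i) ⨾ (i ⊕ μ◦) ⨾ (ε• ⊕ i)
      ≈⟨ refl⟩⨾⟨ Eq.trans (pullˡ frobenius◦ˡ) assoc ⟩
    (η◦ ⊕ i) ⨾ μ◦ ⨾ Δ◦ ⨾ (ε• ⊕ i)
      ≈⟨ pullˡ μ◦-unitˡ ⟩
    i ⨾ Δ◦ ⨾ (ε• ⊕ i)
      ≈⟨ Eq.trans idˡ Δ◦-ε ⟩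
    ε• ⨾ η• ∎
    where
    cup◦-εˡ : η◦ ⨾ Δ◦ ⨾ (ε• ⊕ i) ≈ η•
    cup◦-εˡ = begin
      η◦ ⨾ Δ◦ ⨾ (ε• ⊕ i)          ≈⟨ refl⟩⨾⟨ (Eq.sym Δ◦-comm ⟩⨾⟨refl) ⟩
      η◦ ⨾ (Δ◦ ⨾ S) ⨾ (ε• ⊕ i)    ≈⟨ refl⟩⨾⟨ pullʳ S-ε ⟩
      η◦ ⨾ Δ◦ ⨾ (i ⊕ ε•)          ≈⟨ assoc˘ ⟩
      cup◦ ⨾ (i ⊕ ε•)             ≈⟨ cup◦-εʳ ⟩
      η•                          ∎

  difference : H.Hom 2 2
  difference = ((G.Δ• H.⨾ (H.id 1 H.⊕ G.s (- 1#))) H.⊕ H.id 1) H.⨾ (H.id 1 H.⊕ G.μ◦)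

  -- Splitting y into two summands means choosing t freely and returning t and y - t. The relational
  -- generator is thereby reduced to a free wire followed by a map of HA.
  Δ◦-difference : Δ◦ ≈ (η• ⊕ i) ⨾ ↑ difference
  Δ◦-difference = begin
    Δ◦
      ≈⟨ Δ◦-cup ⟩
    (cup◦ ⊕ i) ⨾ (i ⊕ μ◦)
      ≈⟨ Eq.trans (cup◦-subtracts ⟩⊕⟨ Eq.sym idˡ) (⊕-interchange _ _ _ _) ⟩⨾⟨refl ⟩
    ((η• ⊕ i) ⨾ ((Δ• ⨾ (i ⊕ s (- 1#))) ⊕ i)) ⨾ (i ⊕ μ◦)
      ≈⟨ assoc ⟩
    (η• ⊕ i) ⨾ ↑ difference ∎

  -- (W7) with its output discarded; (A16) absorbs the `s k` that it leaves. Commutativity of `μ•`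
  -- brings the scalar to the required side.
  cap-slide : ∀ k → (s̄ k ⊕ i) ⨾ cap ≈ (i ⊕ s k) ⨾ cap
  cap-slide k = begin
    (s̄ k ⊕ i) ⨾ cap            ≈⟨ refl⟩⨾⟨ cap-comm ⟨
    (s̄ k ⊕ i) ⨾ S ⨾ cap        ≈⟨ replaceˡ (σ-natural (s̄ k) i) ⟩
    S ⨾ (i ⊕ s̄ k) ⨾ cap        ≈⟨ refl⟩⨾⟨ axiom-slide ⟨
    S ⨾ (s k ⊕ i) ⨾ cap        ≈⟨ replaceˡ (Eq.sym (σ-natural i (s k))) ⟩
    (i ⊕ s k) ⨾ S ⨾ cap        ≈⟨ refl⟩⨾⟨ cap-comm ⟩
    (i ⊕ s k) ⨾ cap            ∎
    where
    cap-comm : S ⨾ cap ≈ cap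
    cap-comm = pullˡ μ•-comm
    axiom-slide : (s k ⊕ i) ⨾ cap ≈ (i ⊕ s̄ k) ⨾ cap
    axiom-slide = begin
      (s k ⊕ i) ⨾ μ• ⨾ ε•           ≈⟨ pullˡ (Eq.trans ((refl⟩⊕⟨ Eq.sym id₁≈id) ⟩⨾⟨refl) (∼.axiom (inj₂ (W7 k)))) ⟩
      ((id₁ ⊕ s̄ k) ⨾ μ• ⨾ s k) ⨾ ε• ≈⟨ pullʳ (pullʳ (∼.axiom (inj₁ (left (A16 k))))) ⟩
      (id₁ ⊕ s̄ k) ⨾ cap             ≈⟨ (id₁≈id ⟩⊕⟨refl) ⟩⨾⟨refl ⟩
      (i ⊕ s̄ k) ⨾ cap               ∎

  residue : Carrier → H.Hom 2 2
  residue k = (H.id 1 H.⊕ G.Δ•) H.⨾ (((H.id 1 H.⊕ G.s k) H.⨾ (H.id 1 H.⊕ G.s (- 1#)) H.⨾ G.μ◦) H.⊕ H.id 1)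

  -- The relation p = k x with output x, written as a map of HA followed by the test p - k x = 0. It
  -- is the counterpart for tests of `Δ◦-difference`.
  s̄-μ• : ∀ k → (s̄ k ⊕ i) ⨾ μ• ≈ ↑ (residue k) ⨾ (ε◦ ⊕ i)
  s̄-μ• k = begin
    (s̄ k ⊕ i) ⨾ μ•
      ≈⟨ refl⟩⨾⟨ μ•-capʳ ⟩
    (s̄ k ⊕ i) ⨾ (i ⊕ Δ•) ⨾ (cap ⊕ i)
      ≈⟨ replaceˡ (slide (Eq.trans idʳ (Eq.sym idˡ)) (Eq.trans idˡ (Eq.sym idʳ))) ⟩
    (i ⊕ Δ•) ⨾ (s̄ k ⊕ id 2) ⨾ (cap ⊕ i)
      ≈⟨ refl⟩⨾⟨ Eq.trans (Eq.trans (refl⟩⊕⟨ Eq.sym (⊕-id 1 1)) (Eq.sym (⊕-assoc (s̄ k) i i)) ⟩⨾⟨refl)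
                   (merge (cap-slide k) idˡ) ⟩
    (i ⊕ Δ•) ⨾ (((i ⊕ s k) ⨾ cap) ⊕ i)
      ≈⟨ refl⟩⨾⟨ (Eq.trans (refl⟩⨾⟨ Eq.sym cap-subtracts) (Eq.sym (pullʳ assoc)) ⟩⊕⟨ Eq.sym idˡ) ⟩
    (i ⊕ Δ•) ⨾ ((((i ⊕ s k) ⨾ (i ⊕ s (- 1#)) ⨾ μ◦) ⨾ ε◦) ⊕ (i ⨾ i))
      ≈⟨ refl⟩⨾⟨ ⊕-interchange _ _ _ _ ⟩
    (i ⊕ Δ•) ⨾ (((i ⊕ s k) ⨾ (i ⊕ s (- 1#)) ⨾ μ◦) ⊕ i) ⨾ (ε◦ ⊕ i)
      ≈⟨ assoc˘ ⟩
    ↑ (residue k) ⨾ (ε◦ ⊕ i) ∎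

  -- Tests and free wires against linear maps

  [_] : ∀ {s t} → Lin s t → Hom (size s) (size t)
  [ f ] = ↑ term f

  []-eq : ∀ {s t} (f g : Lin s t) → (∀ u → fun f u ≈ᴱ fun g u) → [ f ] ≈ [ g ]
  []-eq f g p = ↑-cong (lin-eq f g p)

  []-id⊕ : ∀ {k s t} (f : Lin s t) → [ idᴸ {⟨ k ⟩} ⊕ᴸ f ] ≈ id k ⊕ [ f ]
  []-id⊕ {k} f = ↑-id k ⟩⊕⟨refl

  -- Effects and states: zero† tests that n wires vanish, discard† introduces n free wires.
  zero† : ∀ n → Hom n 0
  zero† n = (↑ zeros n) †

  discard† : ∀ n → Hom 0 n
  discard† n = (↑ discards n) †

  zeros-zero† : ∀ n → ↑ zeros n ⨾ zero† n ≈ id 0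
  zeros-zero† zero    = idˡ
  zeros-zero† (suc n) = Eq.trans (merge (∼.axiom (inj₂ W2)) (zeros-zero† n)) (⊕-id 0 0)

  discard†-zero† : ∀ n → discard† n ⨾ zero† n ≈ id 0
  discard†-zero† n = †-cong (↑-cong {f = zeros n H.⨾ discards n} {g = H.id 0} (complete λ v ()))

  scale-zero† : ∀ {k} → k ≉ᴿ 0# → ∀ n → [ scaleᴸ {n} k ] ⨾ zero† n ≈ zero† n
  scale-zero† k≉0 zero = Eq.trans ([]-eq (scaleᴸ {0} _) idᴸ (λ u ()) ⟩⨾⟨refl) idˡ
  scale-zero† {k} k≉0 (suc n) = begin
    [ scaleᴸ {suc n} k ] ⨾ zero† (suc n)
      ≈⟨ Eq.trans (Eq.sym idˡ) (Eq.trans (Eq.sym (↑-id (suc n)) ⟩⨾⟨refl)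
           (Eq.trans ([]-eq (consᴸ ⨾ᴸ scaleᴸ k) ((scalarᴸ k ⊕ᴸ scaleᴸ {n} k) ⨾ᴸ consᴸ)
             (λ { u zero → ≈-refl ; u (suc j) → ≈-refl }))
           (Eq.trans (refl⟩⨾⟨ ↑-id (suc n)) idʳ))) ⟩⨾⟨refl ⟩
    (s k ⊕ [ scaleᴸ {n} k ]) ⨾ (ε◦ ⊕ zero† n)
      ≈⟨ merge (s⨾ε◦ k≉0) (scale-zero† k≉0 n) ⟩
    zero† (suc n) ∎

  shearᴸ : ∀ {m k} → Matrix k m → Lin (⟨ m ⟩ ⊗ ⟨ k ⟩) (⟨ m ⟩ ⊗ ⟨ k ⟩)
  shearᴸ A = pairᴸ fstᴸ ((fstᴸ ⨾ᴸ mat A) +ᴸ sndᴸ)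

  -- Induction on the tested wires. The copy of the first wire that feeds the first column of `A`
  -- becomes `η◦` by `Δ•-ε◦`, and a column multiplied by zero adds nothing.
  shear-zero† : ∀ m {k} (A : Matrix k m) → [ shearᴸ A ] ⨾ (zero† m ⊕ id k) ≈ zero† m ⊕ id k
  shear-zero† zero    {k} A = Eq.trans
    (Eq.trans ([]-eq (shearᴸ A) idᴸ (λ u → (λ ()) , λ j → +-identityˡ _)) (↑-id k) ⟩⨾⟨refl) idˡ
  shear-zero† (suc m) {k} A = begin
    [ shearᴸ A ] ⨾ (zero† (suc m) ⊕ id k)
      ≈⟨ factor ⟩⨾⟨ ⊕-assoc ε◦ (zero† m) (id k) ⟩
    ((Δ• ⊕ id (m + k)) ⨾ (i ⊕ [ column ]) ⨾ (i ⊕ [ shearᴸ A′ ])) ⨾ (ε◦ ⊕ (zero† m ⊕ id k))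
      ≈⟨ pullʳ (pullʳ (merge idˡ (shear-zero† m A′))) ⟩
    (Δ• ⊕ id (m + k)) ⨾ (i ⊕ [ column ]) ⨾ (ε◦ ⊕ (zero† m ⊕ id k))
      ≈⟨ refl⟩⨾⟨ slide (Eq.trans idˡ (Eq.sym idʳ)) (Eq.sym idˡ) ⟩
    (Δ• ⊕ id (m + k)) ⨾ (ε◦ ⊕ id (suc (m + k))) ⨾ (id 0 ⊕ ([ column ] ⨾ (zero† m ⊕ id k)))
      ≈⟨ replaceˡ (Eq.trans (refl⟩⨾⟨ Eq.trans (refl⟩⊕⟨ Eq.sym (⊕-id 1 (m + k))) (Eq.sym (⊕-assoc ε◦ i (id (m + k)))))
           (slide Δ•-ε◦ Eq.refl)) ⟩
    (ε◦ ⊕ id (m + k)) ⨾ (η◦ ⊕ id (m + k)) ⨾ (id 0 ⊕ ([ column ] ⨾ (zero† m ⊕ id k)))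
      ≈⟨ refl⟩⨾⟨ Eq.trans (refl⟩⨾⟨ ⊕-idˡ _) (pullˡ unaffected) ⟩
    (ε◦ ⊕ id (m + k)) ⨾ id (m + k) ⨾ (zero† m ⊕ id k)
      ≈⟨ refl⟩⨾⟨ Eq.trans idˡ (Eq.sym (⊕-idˡ _)) ⟩
    (ε◦ ⊕ id (m + k)) ⨾ (id 0 ⊕ (zero† m ⊕ id k))
      ≈⟨ merge idʳ idˡ ⟩
    ε◦ ⊕ (zero† m ⊕ id k)
      ≈⟨ ⊕-assoc ε◦ (zero† m) (id k) ⟨
    zero† (suc m) ⊕ id k ∎
    where
    A′ : Matrix k m
    A′ r j = A r (suc j)
    column : Lin (⟨ 1 ⟩ ⊗ (⟨ m ⟩ ⊗ ⟨ k ⟩)) (⟨ m ⟩ ⊗ ⟨ k ⟩)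
    column = pairᴸ (sndᴸ ⨾ᴸ fstᴸ) ((fstᴸ ⨾ᴸ mat (λ r _ → A r zero)) +ᴸ (sndᴸ ⨾ᴸ sndᴸ))
    unaffected : (η◦ ⊕ id (m + k)) ⨾ [ column ] ≈ id (m + k)
    unaffected = begin
      (η◦ ⊕ id (m + k)) ⨾ [ column ]
        ≈⟨ Eq.trans (refl⟩⊕⟨ Eq.sym (↑-id (m + k)) ⟩⨾⟨refl) (Eq.sym idˡ) ⟩
      id (m + k) ⨾ (η◦ ⊕ ↑ H.id (m + k)) ⨾ [ column ]
        ≈⟨ Eq.sym (↑-id (m + k)) ⟩⨾⟨refl ⟩
      [ composite ]
        ≈⟨ []-eq composite idᴸ (λ (w , v) → (λ j → ≈-refl) ,
             λ j → solve 2 (λ a x → (a :* 𝟘 :+ 𝟘) :+ x := x) ≈-refl _ _) ⟩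
      ↑ H.id (m + k)
        ≈⟨ ↑-id (m + k) ⟩
      id (m + k) ∎
      where
      composite : Lin (⟨ m ⟩ ⊗ ⟨ k ⟩) (⟨ m ⟩ ⊗ ⟨ k ⟩)
      composite = unitˡᴸ ⨾ᴸ (η◦ᴸ ⊕ᴸ idᴸ) ⨾ᴸ column
    factor : [ shearᴸ A ] ≈ (Δ• ⊕ id (m + k)) ⨾ (i ⊕ [ column ]) ⨾ (i ⊕ [ shearᴸ A′ ])
    factor = begin
      [ shearᴸ A ]
        ≈⟨ Eq.trans (Eq.sym idˡ) (Eq.sym (↑-id (suc (m + k))) ⟩⨾⟨refl) ⟩
      [ consˡᴸ ⨾ᴸ shearᴸ A ]
        ≈⟨ []-eq (consˡᴸ ⨾ᴸ shearᴸ A)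
             (((copyᴸ ⊕ᴸ idᴸ) ⨾ᴸ (assocᴸ ⨾ᴸ ((idᴸ ⊕ᴸ column) ⨾ᴸ (idᴸ ⊕ᴸ shearᴸ A′)))) ⨾ᴸ consˡᴸ)
             (λ (x , (w , v)) → (λ j → ≈-refl) ,
               λ j → solve 3 (λ a b v → (a :+ b) :+ v := b :+ ((a :+ 𝟘) :+ v)) ≈-refl _ _ _) ⟩
      ((Δ• ⊕ ↑ H.id (m + k)) ⨾ ↑ H.id (2 + (m + k)) ⨾ (i ⊕ [ column ]) ⨾ (i ⊕ [ shearᴸ A′ ])) ⨾ ↑ H.id (suc (m + k))
        ≈⟨ Eq.trans (refl⟩⨾⟨ ↑-id (suc (m + k))) idʳ ⟩
      (Δ• ⊕ ↑ H.id (m + k)) ⨾ ↑ H.id (2 + (m + k)) ⨾ (i ⊕ [ column ]) ⨾ (i ⊕ [ shearᴸ A′ ])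
        ≈⟨ (refl⟩⊕⟨ ↑-id (m + k)) ⟩⨾⟨ Eq.trans (↑-id (2 + (m + k)) ⟩⨾⟨refl) idˡ ⟩
      (Δ• ⊕ id (m + k)) ⨾ (i ⊕ [ column ]) ⨾ (i ⊕ [ shearᴸ A′ ]) ∎

  -- Under the constraint w = 0, any linear function of w may be added to the remaining wires.
  shear : ∀ {m s t} (G G′ : Lin s (⟨ m ⟩ ⊗ t)) (N : Lin ⟨ m ⟩ t) →
          (∀ u → proj₁ (fun G′ u) ≈ᵥ proj₁ (fun G u)) →
          (∀ u → proj₂ (fun G′ u) ≈ᴱ fun N (proj₁ (fun G u)) +ᴱ proj₂ (fun G u)) →
          [ G ] ⨾ (zero† m ⊕ id (size t)) ≈ [ G′ ] ⨾ (zero† m ⊕ id (size t))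
  shear {m} {s} {t} G G′ N p q = Eq.sym (begin
    [ G′ ] ⨾ (zero† m ⊕ id k)
      ≈⟨ []-eq G′ (G ⨾ᴸ ((idᴸ ⊕ᴸ joinᴸ) ⨾ᴸ (shearᴸ A ⨾ᴸ (idᴸ ⊕ᴸ splitᴸ {t})))) (λ u → p u , flat-injective (λ j →
           ≈-trans (flat-cong (q u) j) (≈-trans (flat-+ (fun N (proj₁ (fun G u))) (proj₂ (fun G u)) j)
             (≈-trans (+-congʳ (≈-sym (matrixOf-action N (proj₁ (fun G u)) j))) (≈-sym (flat-unflat {t} _ j)))))) ⟩⨾⟨refl ⟩
    ([ G ] ⨾ (↑ H.id m ⊕ ↑ H.id k) ⨾ [ shearᴸ A ] ⨾ (↑ H.id m ⊕ ↑ H.id k)) ⨾ (zero† m ⊕ id k)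
      ≈⟨ (refl⟩⨾⟨ Eq.trans (ids ⟩⨾⟨ (Eq.trans (refl⟩⨾⟨ ids) idʳ)) idˡ) ⟩⨾⟨refl ⟩
    ([ G ] ⨾ [ shearᴸ A ]) ⨾ (zero† m ⊕ id k)
      ≈⟨ pullʳ (shear-zero† m A) ⟩
    [ G ] ⨾ (zero† m ⊕ id k) ∎)
    where
    k = size t
    A = matrixOf N
    ids : ↑ H.id m ⊕ ↑ H.id k ≈ id (m + k)
    ids = Eq.trans (↑-id m ⟩⊕⟨ ↑-id k) (⊕-id m k)

  translateᴸ : ∀ {p s} → Lin s ⟨ p ⟩ → Lin (⟨ p ⟩ ⊗ s) (⟨ p ⟩ ⊗ s)
  translateᴸ L = pairᴸ ((sndᴸ ⨾ᴸ L) +ᴸ fstᴸ) sndᴸ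

  -- Induction on the free wires. The summand added to the first one is discarded by `η•-μ◦`, after
  -- which the row that computed it has no effect.
  discard†-translate : ∀ p {s} (L : Lin s ⟨ p ⟩) →
    (discard† p ⊕ id (size s)) ⨾ [ translateᴸ L ] ≈ discard† p ⊕ id (size s)
  discard†-translate zero    {s} L = Eq.trans
    (refl⟩⨾⟨ Eq.trans ([]-eq (translateᴸ L) idᴸ (λ u → (λ ()) , ≈ᴱ-refl)) (↑-id (size s))) idʳ
  discard†-translate (suc p) {s} L = begin
    (discard† (suc p) ⊕ id k) ⨾ [ translateᴸ L ]
      ≈⟨ ⊕-assoc η• (discard† p) (id k) ⟩⨾⟨ factor ⟩
    (η• ⊕ (discard† p ⊕ id k)) ⨾ (i ⊕ [ translateᴸ L′ ]) ⨾ (i ⊕ [ row ]) ⨾ (μ◦ ⊕ id (p + k))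
      ≈⟨ pullˡ (merge idʳ (discard†-translate p L′)) ⟩
    (η• ⊕ (discard† p ⊕ id k)) ⨾ (i ⊕ [ row ]) ⨾ (μ◦ ⊕ id (p + k))
      ≈⟨ replaceˡ (slide (Eq.trans idʳ (Eq.sym idˡ)) (Eq.sym idʳ)) ⟩
    (id 0 ⊕ ((discard† p ⊕ id k) ⨾ [ row ])) ⨾ (η• ⊕ id (suc (p + k))) ⨾ (μ◦ ⊕ id (p + k))
      ≈⟨ ⊕-idˡ _ ⟩⨾⟨ (Eq.trans (refl⟩⊕⟨ Eq.sym (⊕-id 1 (p + k))) (Eq.sym (⊕-assoc η• i (id (p + k)))) ⟩⨾⟨refl) ⟩
    ((discard† p ⊕ id k) ⨾ [ row ]) ⨾ ((η• ⊕ i) ⊕ id (p + k)) ⨾ (μ◦ ⊕ id (p + k))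
      ≈⟨ refl⟩⨾⟨ slide η•-μ◦ Eq.refl ⟩
    ((discard† p ⊕ id k) ⨾ [ row ]) ⨾ (ε• ⊕ id (p + k)) ⨾ (η• ⊕ id (p + k))
      ≈⟨ Eq.trans assoc (refl⟩⨾⟨ pullˡ unaffected) ⟩
    (discard† p ⊕ id k) ⨾ id (p + k) ⨾ (η• ⊕ id (p + k))
      ≈⟨ Eq.sym (⊕-idˡ _) ⟩⨾⟨ idˡ ⟩
    (id 0 ⊕ (discard† p ⊕ id k)) ⨾ (η• ⊕ id (p + k))
      ≈⟨ merge idˡ idʳ ⟩
    η• ⊕ (discard† p ⊕ id k)
      ≈⟨ ⊕-assoc η• (discard† p) (id k) ⟨
    discard† (suc p) ⊕ id k ∎
    where
    k = size s
    L′ : Lin s ⟨ p ⟩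
    L′ = L ⨾ᴸ tailᴸ
    row : Lin (⟨ p ⟩ ⊗ s) (⟨ 1 ⟩ ⊗ (⟨ p ⟩ ⊗ s))
    row = pairᴸ (sndᴸ ⨾ᴸ (L ⨾ᴸ headᴸ)) idᴸ
    unaffected : [ row ] ⨾ (ε• ⊕ id (p + k)) ≈ id (p + k)
    unaffected = begin
      [ row ] ⨾ (ε• ⊕ id (p + k))
        ≈⟨ refl⟩⨾⟨ Eq.trans (refl⟩⊕⟨ Eq.sym (↑-id (p + k))) (Eq.sym idʳ) ⟩
      [ row ] ⨾ (ε• ⊕ ↑ H.id (p + k)) ⨾ id (p + k)
        ≈⟨ refl⟩⨾⟨ (refl⟩⨾⟨ Eq.sym (↑-id (p + k))) ⟩
      [ composite ]
        ≈⟨ []-eq composite idᴸ (λ u → ≈ᴱ-refl) ⟩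
      ↑ H.id (p + k)
        ≈⟨ ↑-id (p + k) ⟩
      id (p + k) ∎
      where
      composite : Lin (⟨ p ⟩ ⊗ s) (⟨ p ⟩ ⊗ s)
      composite = row ⨾ᴸ ((discardᴸ ⊕ᴸ idᴸ) ⨾ᴸ counitˡᴸ)
    factor : [ translateᴸ L ] ≈ (i ⊕ [ translateᴸ L′ ]) ⨾ (i ⊕ [ row ]) ⨾ (μ◦ ⊕ id (p + k))
    factor = begin
      [ translateᴸ L ]
        ≈⟨ Eq.trans (Eq.sym idˡ) (Eq.sym (↑-id (suc (p + k))) ⟩⨾⟨refl) ⟩
      [ consˡᴸ ⨾ᴸ translateᴸ L ]
        ≈⟨ []-eq (consˡᴸ ⨾ᴸ translateᴸ L)
             (((idᴸ ⊕ᴸ translateᴸ L′) ⨾ᴸ ((idᴸ ⊕ᴸ row) ⨾ᴸ (assoc⁻ᴸ ⨾ᴸ (addᴸ ⊕ᴸ idᴸ)))) ⨾ᴸ consˡᴸ)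
             (λ (x , (t , u)) → (λ { zero → +-comm _ _ ; (suc j) → ≈-refl }) , ≈ᴱ-refl) ⟩
      ((i ⊕ [ translateᴸ L′ ]) ⨾ (i ⊕ [ row ]) ⨾ ↑ H.id (2 + (p + k)) ⨾ (μ◦ ⊕ ↑ H.id (p + k))) ⨾ ↑ H.id (suc (p + k))
        ≈⟨ Eq.trans (refl⟩⨾⟨ ↑-id (suc (p + k))) idʳ ⟩
      (i ⊕ [ translateᴸ L′ ]) ⨾ (i ⊕ [ row ]) ⨾ ↑ H.id (2 + (p + k)) ⨾ (μ◦ ⊕ ↑ H.id (p + k))
        ≈⟨ refl⟩⨾⟨ (refl⟩⨾⟨ Eq.trans (↑-id (2 + (p + k)) ⟩⨾⟨ (refl⟩⊕⟨ ↑-id (p + k))) idˡ) ⟩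
      (i ⊕ [ translateᴸ L′ ]) ⨾ (i ⊕ [ row ]) ⨾ (μ◦ ⊕ id (p + k)) ∎

  -- A free wire may be translated by any linear function of the other wires.
  translate : ∀ {p s t} (G G′ : Lin (⟨ p ⟩ ⊗ s) t) (L : Lin s ⟨ p ⟩) →
              (∀ w u → fun G′ (w , u) ≈ᴱ fun G ((λ j → fun L u j +ᴿ w j) , u)) →
              (discard† p ⊕ id (size s)) ⨾ [ G ] ≈ (discard† p ⊕ id (size s)) ⨾ [ G′ ]
  translate {p} {s} G G′ L q = begin
    (discard† p ⊕ id (size s)) ⨾ [ G ]
      ≈⟨ Eq.sym (discard†-translate p L) ⟩⨾⟨refl ⟩
    ((discard† p ⊕ id (size s)) ⨾ [ translateᴸ L ]) ⨾ [ G ]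
      ≈⟨ pullʳ ([]-eq (translateᴸ L ⨾ᴸ G) G′ (λ (w , u) → ≈ᴱ-sym (q w u))) ⟩
    (discard† p ⊕ id (size s)) ⨾ [ G′ ] ∎

  -- A free wire constrained to equal a linear function of the others can be eliminated.
  eliminate : ∀ {p s t} (G : Lin s t) (L : Lin s ⟨ p ⟩) →
              (discard† p ⊕ id (size s)) ⨾ [ pairᴸ (fstᴸ -ᴸ (sndᴸ ⨾ᴸ L)) (sndᴸ ⨾ᴸ G) ] ⨾ (zero† p ⊕ id (size t))
              ≈ [ G ]
  eliminate {p} {s} {t} G L = begin
    (discard† p ⊕ id (size s)) ⨾ [ pairᴸ (fstᴸ -ᴸ (sndᴸ ⨾ᴸ L)) (sndᴸ ⨾ᴸ G) ] ⨾ (zero† p ⊕ id (size t))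
      ≈⟨ replaceˡ (translate constrained (idᴸ ⊕ᴸ G) L (λ w u →
           (λ j → solve 2 (λ x y → x := (y :+ x) :- y) ≈-refl _ _) , ≈ᴱ-refl)) ⟩
    (discard† p ⊕ id (size s)) ⨾ [ idᴸ {⟨ p ⟩} ⊕ᴸ G ] ⨾ (zero† p ⊕ id (size t))
      ≈⟨ refl⟩⨾⟨ ([]-id⊕ {p} G ⟩⨾⟨refl) ⟩
    (discard† p ⊕ id (size s)) ⨾ (id p ⊕ [ G ]) ⨾ (zero† p ⊕ id (size t))
      ≈⟨ refl⟩⨾⟨ merge idˡ idʳ ⟩
    (discard† p ⊕ id (size s)) ⨾ (zero† p ⊕ [ G ])
      ≈⟨ merge (discard†-zero† p) idˡ ⟩
    id 0 ⊕ [ G ]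
      ≈⟨ ⊕-idˡ _ ⟩
    [ G ] ∎
    where
    constrained : Lin (⟨ p ⟩ ⊗ s) (⟨ p ⟩ ⊗ t)
    constrained = pairᴸ (fstᴸ -ᴸ (sndᴸ ⨾ᴸ L)) (sndᴸ ⨾ᴸ G)

  -- The opposite of a matrix as a linear system

  cell : Carrier → H.Hom 2 2
  cell k = (G.Δ• H.⊕ H.id 1) H.⨾ (H.id 1 H.⊕ H.σ 1 1) H.⨾ (act k H.⊕ H.id 1)

  uncell : Carrier → Lin (⟨ 1 ⟩ ⊗ ⟨ 1 ⟩) (⟨ 1 ⟩ ⊗ ⟨ 1 ⟩)
  uncell k = pairᴸ sndᴸ (fstᴸ -ᴸ (sndᴸ ⨾ᴸ scalarᴸ k))

  zero†-1 : zero† 1 ≈ ε◦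
  zero†-1 = ⊕-idʳ ε◦

  discard†-1 : discard† 1 ≈ η•
  discard†-1 = ⊕-idʳ η•

  -- `cell k` is (x , v) ↦ (k x + v , x), and `uncell k` is its inverse. On input (p , x), reversing
  -- the addition makes t free with remainder p - t, and reversing the copy tests t - k x = 0.
  -- Translating t by k x turns this into the test t = 0, and shearing by t leaves the remainder p -
  -- k x.
  cell-† : ∀ k → (↑ cell k) † ≈ [ uncell k ]
  cell-† k = begin
    (((Δ◦ ⨾ (s̄ k ⊕ i)) ⊕ i) ⨾ (i ⊕ S †)) ⨾ (μ• ⊕ i)
      ≈⟨ Eq.trans assoc (Eq.trans (refl⟩⊕⟨ Eq.sym idˡ) (⊕-interchange _ _ _ _) ⟩⨾⟨
           ((refl⟩⊕⟨ †-σ 1 1) ⟩⨾⟨refl)) ⟩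
    ((Δ◦ ⊕ i) ⨾ ((s̄ k ⊕ i) ⊕ i)) ⨾ (i ⊕ S) ⨾ (μ• ⊕ i)
      ≈⟨ Eq.trans assoc (refl⟩⨾⟨ replaceˡ s̄-past) ⟩
    (Δ◦ ⊕ i) ⨾ (i ⊕ S) ⨾ ((s̄ k ⊕ i) ⊕ i) ⨾ (μ• ⊕ i)
      ≈⟨ refl⟩⨾⟨ (refl⟩⨾⟨ slide (s̄-μ• k) Eq.refl) ⟩
    (Δ◦ ⊕ i) ⨾ (i ⊕ S) ⨾ (↑ residue k ⊕ i) ⨾ ((ε◦ ⊕ i) ⊕ i)
      ≈⟨ Eq.trans (Δ◦-difference ⟩⊕⟨ Eq.sym idˡ) (⊕-interchange _ _ _ _) ⟩⨾⟨refl ⟩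
    (((η• ⊕ i) ⊕ i) ⨾ (↑ difference ⊕ i)) ⨾ (i ⊕ S) ⨾ (↑ residue k ⊕ i) ⨾ ((ε◦ ⊕ i) ⊕ i)
      ≈⟨ Eq.trans assoc (refl⟩⨾⟨ Eq.trans (refl⟩⨾⟨ assoc˘) assoc˘) ⟩
    ((η• ⊕ i) ⊕ i) ⨾ ↑ ((difference H.⊕ H.id 1) H.⨾ (H.id 1 H.⊕ H.σ 1 1) H.⨾ (residue k H.⊕ H.id 1)) ⨾ ((ε◦ ⊕ i) ⊕ i)
      ≈⟨ Eq.trans (⊕-assoc η• i i) (Eq.sym discard†-1 ⟩⊕⟨ ⊕-id 1 1) ⟩⨾⟨ (↑-cong (complete (λ v j →
           ≈-trans (raw v j) (≈-sym (apply-term G₁ v j)))) ⟩⨾⟨ Eq.trans (⊕-assoc ε◦ i i) (Eq.sym zero†-1 ⟩⊕⟨ ⊕-id 1 1)) ⟩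
    (discard† 1 ⊕ id 2) ⨾ [ G₁ ] ⨾ (zero† 1 ⊕ id 2)
      ≈⟨ replaceˡ (translate G₁ G₂ (sndᴸ ⨾ᴸ scalarᴸ k) (λ w u →
           (λ j → solve 2 (λ x y → x := (y :+ x) :- y) ≈-refl _ _) ,
           ((λ j → ≈-refl) , λ j → solve 3 (λ x y z → (x :- y) :- z := x :- (y :+ z)) ≈-refl _ _ _))) ⟩
    (discard† 1 ⊕ id 2) ⨾ [ G₂ ] ⨾ (zero† 1 ⊕ id 2)
      ≈⟨ refl⟩⨾⟨ shear (idᴸ ⊕ᴸ uncell k) G₂ (pairᴸ zeroᴸ (zeroᴸ -ᴸ idᴸ)) (λ u j → ≈-refl) (λ u →
           (λ j → ≈-sym (+-identityˡ _)) , λ j → solve 2 (λ x y → x :- y := (𝟘 :- y) :+ x) ≈-refl _ _) ⟨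
    (discard† 1 ⊕ id 2) ⨾ (i ⊕ [ uncell k ]) ⨾ (zero† 1 ⊕ id 2)
      ≈⟨ refl⟩⨾⟨ merge idˡ idʳ ⟩
    (discard† 1 ⊕ id 2) ⨾ (zero† 1 ⊕ [ uncell k ])
      ≈⟨ merge (discard†-zero† 1) idˡ ⟩
    id 0 ⊕ [ uncell k ]
      ≈⟨ ⊕-idˡ _ ⟩
    [ uncell k ] ∎
    where
    G₁ G₂ : Lin (⟨ 1 ⟩ ⊗ (⟨ 1 ⟩ ⊗ ⟨ 1 ⟩)) (⟨ 1 ⟩ ⊗ (⟨ 1 ⟩ ⊗ ⟨ 1 ⟩))
    G₁ = pairᴸ (fstᴸ -ᴸ (sndᴸ ⨾ᴸ (sndᴸ ⨾ᴸ scalarᴸ k))) (pairᴸ (sndᴸ ⨾ᴸ sndᴸ) ((sndᴸ ⨾ᴸ fstᴸ) -ᴸ fstᴸ))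
    G₂ = pairᴸ fstᴸ (pairᴸ (sndᴸ ⨾ᴸ sndᴸ) (((sndᴸ ⨾ᴸ fstᴸ) -ᴸ (sndᴸ ⨾ᴸ (sndᴸ ⨾ᴸ scalarᴸ k))) -ᴸ fstᴸ))
    raw : ∀ v → apply ((difference H.⊕ H.id 1) H.⨾ (H.id 1 H.⊕ H.σ 1 1) H.⨾ (residue k H.⊕ H.id 1)) v
                ≈ᵥ flat (fun G₁ (unflat v))
    raw v zero             = solve 3 (λ k p x → p :+ (:- 𝟙) :* (k :* x) := p :- k :* x) ≈-refl k (v zero) (v (suc (suc zero)))
    raw v (suc zero)       = ≈-refl
    raw v (suc (suc zero)) = solve 2 (λ p y → (:- 𝟙) :* p :+ y := y :- p) ≈-refl (v zero) (v (suc zero))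
    s̄-past : ((s̄ k ⊕ i) ⊕ i) ⨾ (i ⊕ S) ≈ (i ⊕ S) ⨾ ((s̄ k ⊕ i) ⊕ i)
    s̄-past = Eq.trans (spread₁ ⟩⨾⟨refl) (Eq.trans (slide (Eq.trans idʳ (Eq.sym idˡ)) (Eq.trans idˡ (Eq.sym idʳ)))
      (refl⟩⨾⟨ Eq.sym spread₁))
      where
      spread₁ : (s̄ k ⊕ i) ⊕ i ≈ s̄ k ⊕ id 2
      spread₁ = Eq.trans (⊕-assoc (s̄ k) i i) (refl⟩⊕⟨ ⊕-id 1 1)

  swap₃-† : ∀ a b k → (↑ swap₃ a b k) † ≈ ↑ swap₃ b a k
  swap₃-† a b k = transported (+-assoc a b k) (+-assoc b a k)
    (Eq.trans (Eq.trans (†-cong (↑-σ a b)) (†-σ a b) ⟩⊕⟨ Eq.trans (†-cong (↑-id k)) (†-id k))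
      (Eq.sym (↑-σ b a ⟩⊕⟨ ↑-id k)))
    where
    transported : ∀ {n m n′ m′} (p : n ≡ n′) (q : m ≡ m′) {f : H.Hom n m} {g : H.Hom m n} →
                  (↑ f) † ≈ ↑ g → (↑ subst₂ H.Hom p q f) † ≈ ↑ subst₂ H.Hom q p g
    transported ≡.refl ≡.refl r = r

  [_]† : ∀ {s t} → Lin s t → Hom (size t) (size s)
  [ f ]† = [ f ] †

  []†-eq : ∀ {s t} (f g : Lin s t) → (∀ u → fun f u ≈ᴱ fun g u) → [ f ]† ≈ [ g ]†
  []†-eq f g p = †-cong ([]-eq f g p)

  ↑id-† : ∀ n → (↑ H.id n) † ≈ id n
  ↑id-† n = Eq.trans (†-cong (↑-id n)) (†-id n)

  -- The identities below are opposites of identities between terms of HA.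
  zero†-swap : ∀ a b k → zero† a ⊕ (zero† b ⊕ id k) ≈ ↑ swap₃ a b k ⨾ (zero† b ⊕ (zero† a ⊕ id k))
  zero†-swap a b k = begin
    zero† a ⊕ (zero† b ⊕ id k)
      ≈⟨ refl⟩⊕⟨ (refl⟩⊕⟨ ↑id-† k) ⟨
    [ f ]†
      ≈⟨ []†-eq f (g ⨾ᴸ swap₃ᴸ) (λ u → ≈ᴱ-refl) ⟩
    (↑ swap₃ b a k) † ⨾ (zero† b ⊕ (zero† a ⊕ (↑ H.id k) †))
      ≈⟨ swap₃-† b a k ⟩⨾⟨ (refl⟩⊕⟨ (refl⟩⊕⟨ ↑id-† k)) ⟩
    ↑ swap₃ a b k ⨾ (zero† b ⊕ (zero† a ⊕ id k)) ∎
    where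
    f : Lin (⟨ 0 ⟩ ⊗ (⟨ 0 ⟩ ⊗ ⟨ k ⟩)) (⟨ a ⟩ ⊗ (⟨ b ⟩ ⊗ ⟨ k ⟩))
    f = zerosᴸ a ⊕ᴸ (zerosᴸ b ⊕ᴸ idᴸ)
    g : Lin (⟨ 0 ⟩ ⊗ (⟨ 0 ⟩ ⊗ ⟨ k ⟩)) (⟨ b ⟩ ⊗ (⟨ a ⟩ ⊗ ⟨ k ⟩))
    g = zerosᴸ b ⊕ᴸ (zerosᴸ a ⊕ᴸ idᴸ)

  zero†-wire : ∀ m n → zero† m ⊕ id (suc n) ≈ ↑ swap₃ m 1 n ⨾ (i ⊕ (zero† m ⊕ id n))
  zero†-wire m n = begin
    zero† m ⊕ id (suc n)
      ≈⟨ refl⟩⊕⟨ ↑id-† (suc n) ⟨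
    [ f ]†
      ≈⟨ []†-eq f (g ⨾ᴸ swap₃ᴸ) (λ u → ≈ᴱ-refl) ⟩
    (↑ swap₃ 1 m n) † ⨾ ((i ⊕ (zero† m ⊕ (↑ H.id n) †)) ⨾ (↑ H.id (suc n)) †)
      ≈⟨ swap₃-† 1 m n ⟩⨾⟨ Eq.trans ((refl⟩⊕⟨ (refl⟩⊕⟨ ↑id-† n)) ⟩⨾⟨ ↑id-† (suc n)) idʳ ⟩
    ↑ swap₃ m 1 n ⨾ (i ⊕ (zero† m ⊕ id n)) ∎
    where
    f : Lin (⟨ 0 ⟩ ⊗ (⟨ 1 ⟩ ⊗ ⟨ n ⟩)) (⟨ m ⟩ ⊗ (⟨ 1 ⟩ ⊗ ⟨ n ⟩))
    f = zerosᴸ m ⊕ᴸ idᴸ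
    regroup : Lin (⟨ 0 ⟩ ⊗ (⟨ 1 ⟩ ⊗ ⟨ n ⟩)) (⟨ 1 ⟩ ⊗ (⟨ 0 ⟩ ⊗ ⟨ n ⟩))
    regroup = record { term = H.id (suc n) ; fun = λ (w , (x , v)) → x , (w , v) ; correct = λ u → apply-id (suc n) (flat u) }
    g : Lin (⟨ 0 ⟩ ⊗ (⟨ 1 ⟩ ⊗ ⟨ n ⟩)) (⟨ 1 ⟩ ⊗ (⟨ m ⟩ ⊗ ⟨ n ⟩))
    g = regroup ⨾ᴸ (idᴸ ⊕ᴸ (zerosᴸ m ⊕ᴸ idᴸ))

  discard†-wire : ∀ m n → i ⊕ (discard† n ⊕ id m) ≈ (discard† n ⊕ id (suc m)) ⨾ ↑ swap₃ n 1 m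
  discard†-wire m n = begin
    i ⊕ (discard† n ⊕ id m)
      ≈⟨ refl⟩⊕⟨ (refl⟩⊕⟨ ↑id-† m) ⟨
    [ f ]†
      ≈⟨ []†-eq f (swap₃ᴸ ⨾ᴸ g) (λ u → ≈ᴱ-refl) ⟩
    (discard† n ⊕ (↑ H.id (suc m)) †) ⨾ (↑ swap₃ 1 n m) †
      ≈⟨ (refl⟩⊕⟨ ↑id-† (suc m)) ⟩⨾⟨ swap₃-† 1 n m ⟩
    (discard† n ⊕ id (suc m)) ⨾ ↑ swap₃ n 1 m ∎
    where
    f : Lin (⟨ 1 ⟩ ⊗ (⟨ n ⟩ ⊗ ⟨ m ⟩)) (⟨ 1 ⟩ ⊗ (⟨ 0 ⟩ ⊗ ⟨ m ⟩))
    f = idᴸ ⊕ᴸ (discardsᴸ n ⊕ᴸ idᴸ)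
    g : Lin (⟨ n ⟩ ⊗ (⟨ 1 ⟩ ⊗ ⟨ m ⟩)) (⟨ 1 ⟩ ⊗ (⟨ 0 ⟩ ⊗ ⟨ m ⟩))
    g = record
      { term = discards n H.⊕ H.id (suc m) ; fun = λ (w , (x , v)) → x , ((λ ()) , v)
      ; correct = λ u → correct (discardsᴸ n ⊕ᴸ idᴸ {⟨ 1 ⟩ ⊗ ⟨ m ⟩}) u }

  -- The map x ↦ (r x , x), threading the wires of x one at a time.
  rowGraph : ∀ {n} → Vect n → H.Hom n (suc n)
  rowGraph {zero}  r = G.η◦
  rowGraph {suc n} r = (H.id 1 H.⊕ rowGraph (λ j → r (suc j))) H.⨾ (cell (r zero) H.⊕ H.id n)

  rowGraphᴸ : ∀ {n} → Vect n → Lin ⟨ n ⟩ (⟨ 1 ⟩ ⊗ ⟨ n ⟩)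
  rowGraphᴸ r = record
    { term = rowGraph r ; fun = λ u → fun (dotᴸ r) u , u ; correct = go r }
    where
    cellᴸ : Carrier → Lin (⟨ 1 ⟩ ⊗ ⟨ 1 ⟩) (⟨ 1 ⟩ ⊗ ⟨ 1 ⟩)
    cellᴸ k = record
      { term = cell k ; fun = λ (x , v) → (λ j → k * x j +ᴿ v j) , x
      ; correct = λ { u zero → ≈-refl ; u (suc zero) → ≈-refl } }
    go : ∀ {n} (r : Vect n) u → apply (rowGraph r) u ≈ᵥ flat {⟨ 1 ⟩ ⊗ ⟨ n ⟩} (fun (dotᴸ r) u , u)
    go {zero}  r u zero = ≈-refl
    go {suc n} r u j = ≈-trans
      (apply-cong (cell (r zero) H.⊕ H.id n) prefix j)
      (≈-trans (correct (cellᴸ (r zero) ⊕ᴸ idᴸ {⟨ n ⟩}) w j) (suffix j))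
      where
      r′ u′ : Vect n
      r′ l = r (suc l)
      u′ l = u (suc l)
      w : El ((⟨ 1 ⟩ ⊗ ⟨ 1 ⟩) ⊗ ⟨ n ⟩)
      w = ((λ _ → u zero) , fun (dotᴸ r′) u′) , u′
      prefix : apply (H.id 1 H.⊕ rowGraph r′) u ≈ᵥ flat w
      prefix zero          = ≈-refl
      prefix (suc zero)    = go r′ u′ zero
      prefix (suc (suc l)) = go r′ u′ (suc l)
      suffix : flat (fun (cellᴸ (r zero) ⊕ᴸ idᴸ {⟨ n ⟩}) w) ≈ᵥ flat {⟨ 1 ⟩ ⊗ ⟨ suc n ⟩} (fun (dotᴸ r) u , u)
      suffix zero          = ≈-refl
      suffix (suc zero)    = ≈-refl
      suffix (suc (suc l)) = ≈-refl

  subtractRow : ∀ {n} → Vect n → Lin (⟨ 1 ⟩ ⊗ ⟨ n ⟩) (⟨ 1 ⟩ ⊗ ⟨ n ⟩)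
  subtractRow r = pairᴸ (fstᴸ -ᴸ (sndᴸ ⨾ᴸ dotᴸ r)) sndᴸ

  -- Each reversed cell subtracts one term of the row from y while returning its wire of x; at the
  -- end the reversed `η◦` tests what is left of y.
  rowGraph-† : ∀ {n} (r : Vect n) → (↑ rowGraph r) † ≈ [ subtractRow r ] ⨾ (ε◦ ⊕ id n)
  rowGraph-† {zero}  r = Eq.sym (Eq.trans
    (Eq.trans ([]-eq (subtractRow r) idᴸ (λ u →
        (λ j → solve 1 (λ x → x :- 𝟘 := x) ≈-refl _) , λ ())) (↑-id 1) ⟩⨾⟨ ⊕-idʳ ε◦) idˡ)
  rowGraph-† {suc n} r = begin
    ((↑ cell (r zero)) † ⊕ (↑ H.id n) †) ⨾ (i ⊕ (↑ rowGraph r′) †)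
      ≈⟨ (cell-† (r zero) ⟩⊕⟨ Eq.trans (↑id-† n) (Eq.sym (↑-id n))) ⟩⨾⟨
           Eq.trans (Eq.sym idˡ ⟩⊕⟨ rowGraph-† r′) (⊕-interchange _ _ _ _) ⟩
    ([ uncell (r zero) ] ⊕ ↑ H.id n) ⨾ (i ⊕ [ subtractRow r′ ]) ⨾ (i ⊕ (ε◦ ⊕ id n))
      ≈⟨ refl⟩⨾⟨ (refl⟩⨾⟨ move) ⟩
    ([ uncell (r zero) ] ⊕ ↑ H.id n) ⨾ (i ⊕ [ subtractRow r′ ]) ⨾ ↑ swap₃ 1 1 n ⨾ (ε◦ ⊕ id (suc n))
      ≈⟨ Eq.trans (refl⟩⨾⟨ assoc˘) assoc˘ ⟩
    (([ uncell (r zero) ] ⊕ ↑ H.id n) ⨾ (i ⊕ [ subtractRow r′ ]) ⨾ ↑ swap₃ 1 1 n) ⨾ (ε◦ ⊕ id (suc n))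
      ≈⟨ rows ⟩⨾⟨refl ⟩
    [ subtractRow r ] ⨾ (ε◦ ⊕ id (suc n)) ∎
    where
    r′ : Vect n
    r′ j = r (suc j)
    move : i ⊕ (ε◦ ⊕ id n) ≈ ↑ swap₃ 1 1 n ⨾ (ε◦ ⊕ id (suc n))
    move = begin
      i ⊕ (ε◦ ⊕ id n)
        ≈⟨ Eq.trans (refl⟩⊕⟨ (Eq.sym zero†-1 ⟩⊕⟨refl)) (Eq.sym idˡ) ⟩
      id (suc (suc n)) ⨾ (i ⊕ (zero† 1 ⊕ id n))
        ≈⟨ Eq.trans ([]-eq (swap₃ᴸ {1} {1} {⟨ n ⟩} ⨾ᴸ swap₃ᴸ) idᴸ (λ u → ≈ᴱ-refl)) (↑-id (2 + n)) ⟩⨾⟨refl ⟨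
      (↑ swap₃ 1 1 n ⨾ ↑ swap₃ 1 1 n) ⨾ (i ⊕ (zero† 1 ⊕ id n))
        ≈⟨ pullʳ (Eq.sym (zero†-wire 1 n)) ⟩
      ↑ swap₃ 1 1 n ⨾ (zero† 1 ⊕ id (suc n))
        ≈⟨ refl⟩⨾⟨ (zero†-1 ⟩⊕⟨refl) ⟩
      ↑ swap₃ 1 1 n ⨾ (ε◦ ⊕ id (suc n)) ∎
    rows : ([ uncell (r zero) ] ⊕ ↑ H.id n) ⨾ (i ⊕ [ subtractRow r′ ]) ⨾ ↑ swap₃ 1 1 n ≈ [ subtractRow r ]
    rows = begin
      ([ uncell (r zero) ] ⊕ ↑ H.id n) ⨾ (i ⊕ [ subtractRow r′ ]) ⨾ ↑ swap₃ 1 1 n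
        ≈⟨ refl⟩⨾⟨ Eq.trans (↑-id (2 + n) ⟩⨾⟨refl) (Eq.trans idˡ (refl⟩⨾⟨ Eq.trans
             (refl⟩⨾⟨ Eq.trans (refl⟩⊕⟨ ↑-id (suc n)) (⊕-id 1 (suc n))) idʳ)) ⟨
      [ composite ]
        ≈⟨ []-eq composite (unconsᴸ₂ ⨾ᴸ subtractRow r) (λ ((y , x) , v) →
             (λ { zero → solve 3 (λ y a b → (y :- a) :- b := y :- (a :+ b)) ≈-refl _ _ _ }) ,
             λ { zero → ≈-refl ; (suc j) → ≈-refl }) ⟩
      ↑ H.id (2 + n) ⨾ [ subtractRow r ]
        ≈⟨ Eq.trans (↑-id (2 + n) ⟩⨾⟨refl) idˡ ⟩
      [ subtractRow r ] ∎
      where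
      unconsᴸ₂ : Lin ((⟨ 1 ⟩ ⊗ ⟨ 1 ⟩) ⊗ ⟨ n ⟩) (⟨ 1 ⟩ ⊗ ⟨ suc n ⟩)
      unconsᴸ₂ = record
        { term = H.id (2 + n) ; fun = λ ((y , x) , v) → y , consᵥ x v
        ; correct = λ u j → ≈-trans (apply-id (2 + n) (flat u) j) (go u j) }
        where
        go : ∀ u j → flat {(⟨ 1 ⟩ ⊗ ⟨ 1 ⟩) ⊗ ⟨ n ⟩} u j
             ≈ᴿ flat {⟨ 1 ⟩ ⊗ ⟨ suc n ⟩} (proj₁ (proj₁ u) , consᵥ (proj₂ (proj₁ u)) (proj₂ u)) j
        go u zero          = ≈-refl
        go u (suc zero)    = ≈-refl
        go u (suc (suc j)) = ≈-refl
      composite : Lin ((⟨ 1 ⟩ ⊗ ⟨ 1 ⟩) ⊗ ⟨ n ⟩) (⟨ 1 ⟩ ⊗ ⟨ suc n ⟩)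
      composite = (uncell (r zero) ⊕ᴸ idᴸ) ⨾ᴸ (assocᴸ ⨾ᴸ ((idᴸ ⊕ᴸ subtractRow r′) ⨾ᴸ (swap₃ᴸ ⨾ᴸ (idᴸ ⊕ᴸ consᴸ))))

  residualᴸ : ∀ {n m} → Matrix m n → Lin (⟨ n ⟩ ⊗ ⟨ m ⟩) (⟨ m ⟩ ⊗ ⟨ n ⟩)
  residualᴸ A = pairᴸ (sndᴸ -ᴸ (fstᴸ ⨾ᴸ mat A)) fstᴸ

  -- A† relates y to x when y - A x = 0.
  mat-† : ∀ m {n} (A : Matrix m n) →
          [ mat A ]† ≈ (discard† n ⊕ id m) ⨾ [ residualᴸ A ] ⨾ (zero† m ⊕ id n)
  mat-† zero {n} A = begin
    [ mat A ]†
      -- With no rows there are no equations and x is free. The symmetry with 0 bridges n and n + 0,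
      -- which do not agree by computation.
      ≈⟨ †-cong (↑-cong {f = term (mat A)} {g = H.σ 0 n H.⨾ (discards n H.⊕ H.id 0)} (complete λ v ())) ⟩
    (discard† n ⊕ id 0) ⨾ (↑ H.σ 0 n) †
      ≈⟨ refl⟩⨾⟨ Eq.trans (†-cong (↑-σ 0 n)) (Eq.trans (†-σ 0 n) (Eq.sym (↑-σ n 0))) ⟩
    (discard† n ⊕ id 0) ⨾ ↑ H.σ n 0
      ≈⟨ refl⟩⨾⟨ []-eq (σᴸ {n} {0}) (residualᴸ A) (λ u → (λ ()) , λ j → ≈-refl) ⟩
    (discard† n ⊕ id 0) ⨾ [ residualᴸ A ]
      ≈⟨ refl⟩⨾⟨ Eq.trans (refl⟩⨾⟨ ⊕-idˡ (id n)) idʳ ⟨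
    (discard† n ⊕ id 0) ⨾ [ residualᴸ A ] ⨾ (id 0 ⊕ id n) ∎
  mat-† (suc m) {n} A = begin
    [ mat A ]†
      -- The top row is computed beside a kept copy of x, which is then fed to the other rows.
      ≈⟨ []†-eq (mat A) ((rowGraphᴸ r ⨾ᴸ (idᴸ ⊕ᴸ mat A′)) ⨾ᴸ consᴸ)
           (λ { u zero → ≈-refl ; u (suc j) → ≈-refl }) ⟩
    (↑ H.id (suc m)) † ⨾ (i ⊕ [ mat A′ ]†) ⨾ (↑ rowGraph r) †
      ≈⟨ Eq.trans (↑id-† (suc m) ⟩⨾⟨refl) idˡ ⟩
    (i ⊕ [ mat A′ ]†) ⨾ (↑ rowGraph r) †
      ≈⟨ Eq.trans (Eq.sym (Eq.trans idˡ idˡ) ⟩⊕⟨ mat-† m A′)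
           (Eq.trans (⊕-interchange _ _ _ _) (refl⟩⨾⟨ ⊕-interchange _ _ _ _)) ⟩⨾⟨ rowGraph-† r ⟩
    ((i ⊕ (discard† n ⊕ id m)) ⨾ (i ⊕ [ residualᴸ A′ ]) ⨾ (i ⊕ (zero† m ⊕ id n))) ⨾ [ subtractRow r ] ⨾ (ε◦ ⊕ id n)
      -- Subtracting the top row only reads x and leaves the wires tested for `A′` untouched, so all
      -- tests can be moved to the end.
      ≈⟨ Eq.trans assoc (refl⟩⨾⟨ Eq.trans assoc (refl⟩⨾⟨ replaceˡ commute)) ⟩
    (i ⊕ (discard† n ⊕ id m)) ⨾ (i ⊕ [ residualᴸ A′ ]) ⨾ [ subtractRow′ ] ⨾ (i ⊕ (zero† m ⊕ id n)) ⨾ (ε◦ ⊕ id n)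
      ≈⟨ discard†-wire m n ⟩⨾⟨ (refl⟩⨾⟨ (refl⟩⨾⟨ Eq.trans (merge idˡ idʳ) (Eq.sym (⊕-assoc ε◦ (zero† m) (id n))))) ⟩
    ((discard† n ⊕ id (suc m)) ⨾ ↑ swap₃ n 1 m) ⨾ (i ⊕ [ residualᴸ A′ ]) ⨾ [ subtractRow′ ] ⨾ (zero† (suc m) ⊕ id n)
      ≈⟨ Eq.trans assoc (refl⟩⨾⟨ Eq.trans (refl⟩⨾⟨ assoc˘) assoc˘) ⟩
    (discard† n ⊕ id (suc m)) ⨾ (↑ swap₃ n 1 m ⨾ (i ⊕ [ residualᴸ A′ ]) ⨾ [ subtractRow′ ]) ⨾ (zero† (suc m) ⊕ id n)
      ≈⟨ refl⟩⨾⟨ (step ⟩⨾⟨refl) ⟩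
    (discard† n ⊕ id (suc m)) ⨾ [ residualᴸ A ] ⨾ (zero† (suc m) ⊕ id n) ∎
    where
    r : Vect n
    r = A zero
    A′ : Matrix m n
    A′ j = A (suc j)
    column : Lin ⟨ n ⟩ (⟨ 1 ⟩ ⊗ ⟨ n ⟩)
    column = pairᴸ (zeroᴸ -ᴸ dotᴸ r) idᴸ
    subtractRow′ : Lin (⟨ 1 ⟩ ⊗ (⟨ m ⟩ ⊗ ⟨ n ⟩)) (⟨ 1 ⟩ ⊗ (⟨ m ⟩ ⊗ ⟨ n ⟩))
    subtractRow′ = pairᴸ (fstᴸ -ᴸ (sndᴸ ⨾ᴸ (sndᴸ ⨾ᴸ dotᴸ r))) sndᴸ
    Y = zero† m ⊕ id n
    plus-row : [ subtractRow r ] ≈ (i ⊕ [ column ]) ⨾ (μ◦ ⊕ id n)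
    plus-row = Eq.trans
      ([]-eq (subtractRow r) ((idᴸ ⊕ᴸ column) ⨾ᴸ (assoc⁻ᴸ ⨾ᴸ (addᴸ ⊕ᴸ idᴸ))) (λ (y , x) →
        (λ { zero → solve 2 (λ a b → a :- b := a :+ (𝟘 :- b)) ≈-refl _ _ }) , λ j → ≈-refl))
      (refl⟩⨾⟨ Eq.trans (↑-id (2 + n) ⟩⨾⟨ (refl⟩⊕⟨ ↑-id n)) idˡ)
    plus-row′ : [ subtractRow′ ] ≈ (i ⊕ (id m ⊕ [ column ])) ⨾ (i ⊕ ↑ swap₃ m 1 n) ⨾ (μ◦ ⊕ id (m + n))
    plus-row′ = Eq.trans
      ([]-eq subtractRow′ ((idᴸ ⊕ᴸ (idᴸ ⊕ᴸ column)) ⨾ᴸ ((idᴸ ⊕ᴸ swap₃ᴸ) ⨾ᴸ (assoc⁻ᴸ ⨾ᴸ (addᴸ ⊕ᴸ idᴸ)))) (λ (y , (w , x)) →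
        (λ { zero → solve 2 (λ a b → a :- b := a :+ (𝟘 :- b)) ≈-refl _ _ }) , ((λ j → ≈-refl) , λ j → ≈-refl)))
      ((refl⟩⊕⟨ (↑-id m ⟩⊕⟨refl)) ⟩⨾⟨ (refl⟩⨾⟨ Eq.trans (↑-id (2 + (m + n)) ⟩⨾⟨ (refl⟩⊕⟨ ↑-id (m + n))) idˡ))
    commute : (i ⊕ Y) ⨾ [ subtractRow r ] ≈ [ subtractRow′ ] ⨾ (i ⊕ Y)
    commute = begin
      (i ⊕ Y) ⨾ [ subtractRow r ]
        ≈⟨ refl⟩⨾⟨ plus-row ⟩
      (i ⊕ Y) ⨾ (i ⊕ [ column ]) ⨾ (μ◦ ⊕ id n)
        ≈⟨ pullˡ (merge idˡ (Eq.trans (refl⟩⨾⟨ Eq.sym (⊕-idˡ _))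
             (slide (Eq.trans idʳ (Eq.sym idˡ)) (Eq.trans idˡ (Eq.sym idʳ))))) ⟩
      (i ⊕ ((id m ⊕ [ column ]) ⨾ (zero† m ⊕ id (suc n)))) ⨾ (μ◦ ⊕ id n)
        ≈⟨ Eq.trans (Eq.sym idˡ ⟩⊕⟨ (refl⟩⨾⟨ zero†-wire m n)) (⊕-interchange _ _ _ _) ⟩⨾⟨refl ⟩
      ((i ⊕ (id m ⊕ [ column ])) ⨾ (i ⊕ (↑ swap₃ m 1 n ⨾ (i ⊕ Y)))) ⨾ (μ◦ ⊕ id n)
        ≈⟨ pullʳ (Eq.trans (Eq.trans (Eq.sym idˡ ⟩⊕⟨refl) (⊕-interchange _ _ _ _) ⟩⨾⟨refl) assoc) ⟩
      (i ⊕ (id m ⊕ [ column ])) ⨾ (i ⊕ ↑ swap₃ m 1 n) ⨾ (i ⊕ (i ⊕ Y)) ⨾ (μ◦ ⊕ id n)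
        ≈⟨ refl⟩⨾⟨ (refl⟩⨾⟨ Eq.trans (Eq.trans (Eq.sym (⊕-assoc i i Y)) (⊕-id 1 1 ⟩⊕⟨refl) ⟩⨾⟨refl)
             (slide (Eq.trans idˡ (Eq.sym idʳ)) (Eq.trans idʳ (Eq.sym idˡ)))) ⟩
      (i ⊕ (id m ⊕ [ column ])) ⨾ (i ⊕ ↑ swap₃ m 1 n) ⨾ (μ◦ ⊕ id (m + n)) ⨾ (i ⊕ Y)
        ≈⟨ Eq.trans (refl⟩⨾⟨ assoc˘) assoc˘ ⟩
      ((i ⊕ (id m ⊕ [ column ])) ⨾ (i ⊕ ↑ swap₃ m 1 n) ⨾ (μ◦ ⊕ id (m + n))) ⨾ (i ⊕ Y)
        ≈⟨ plus-row′ ⟩⨾⟨refl ⟨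
      [ subtractRow′ ] ⨾ (i ⊕ Y) ∎
    step : ↑ swap₃ n 1 m ⨾ (i ⊕ [ residualᴸ A′ ]) ⨾ [ subtractRow′ ] ≈ [ residualᴸ A ]
    step = begin
      ↑ swap₃ n 1 m ⨾ (i ⊕ [ residualᴸ A′ ]) ⨾ [ subtractRow′ ]
        ≈⟨ refl⟩⨾⟨ (refl⟩⨾⟨ Eq.trans (refl⟩⨾⟨ ↑-id (suc (m + n))) idʳ) ⟨
      [ composite ]
        ≈⟨ []-eq composite ((idᴸ ⊕ᴸ consᴸ) ⨾ᴸ residualᴸ A) (λ u →
             (λ { zero → ≈-refl ; (suc j) → ≈-refl }) , λ j → ≈-refl) ⟩
      (↑ H.id n ⊕ ↑ H.id (suc m)) ⨾ [ residualᴸ A ]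
        ≈⟨ Eq.trans (Eq.trans (↑-id n ⟩⊕⟨ ↑-id (suc m)) (⊕-id n (suc m)) ⟩⨾⟨refl) idˡ ⟩
      [ residualᴸ A ] ∎
      where
      composite : Lin (⟨ n ⟩ ⊗ (⟨ 1 ⟩ ⊗ ⟨ m ⟩)) (⟨ suc m ⟩ ⊗ ⟨ n ⟩)
      composite = swap₃ᴸ ⨾ᴸ ((idᴸ ⊕ᴸ residualᴸ A′) ⨾ᴸ (subtractRow′ ⨾ᴸ consˡᴸ))

  leaf-† : ∀ {n m} (f : Lin ⟨ n ⟩ ⟨ m ⟩) →
           [ f ]† ≈ (discard† n ⊕ id m) ⨾ [ pairᴸ (sndᴸ -ᴸ (fstᴸ ⨾ᴸ f)) fstᴸ ] ⨾ (zero† m ⊕ id n)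
  leaf-† {n} {m} f = begin
    [ f ]†
      ≈⟨ []†-eq f (mat A) (λ u j → ≈-sym (matrixOf-action f u j)) ⟩
    [ mat A ]†
      ≈⟨ mat-† m A ⟩
    (discard† n ⊕ id m) ⨾ [ residualᴸ A ] ⨾ (zero† m ⊕ id n)
      ≈⟨ refl⟩⨾⟨ ([]-eq (residualᴸ A) (pairᴸ (sndᴸ -ᴸ (fstᴸ ⨾ᴸ f)) fstᴸ) (λ (x , y) →
           (λ j → +-congˡ (-‿cong (matrixOf-action f x j))) , λ j → ≈-refl) ⟩⨾⟨refl) ⟩
    (discard† n ⊕ id m) ⨾ [ pairᴸ (sndᴸ -ᴸ (fstᴸ ⨾ᴸ f)) fstᴸ ] ⨾ (zero† m ⊕ id n) ∎
    where A = matrixOf f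

  -- Kernels and pullback squares

  constraint : ∀ {n m} → Lin ⟨ n ⟩ ⟨ m ⟩ → Hom n n
  constraint {n} {m} M = [ pairᴸ M idᴸ ] ⨾ (zero† m ⊕ id n)

  peel : ∀ m {k l} (W : Hom k l) → zero† m ⊕ W ≈ (zero† m ⊕ id k) ⨾ W
  peel m W = Eq.trans (Eq.sym (merge idʳ idˡ)) (refl⟩⨾⟨ ⊕-idˡ W)

  peel₂ : ∀ m n {k l} (W : Hom k l) → zero† m ⊕ (zero† n ⊕ W) ≈ (zero† m ⊕ (zero† n ⊕ id k)) ⨾ W
  peel₂ m n W = Eq.trans (Eq.sym (merge idʳ (merge idʳ idˡ)))
    (refl⟩⨾⟨ Eq.trans (⊕-idˡ _) (⊕-idˡ W))

  shear-⊕ : ∀ {m s t l} (G G′ : Lin s (⟨ m ⟩ ⊗ t)) (N : Lin ⟨ m ⟩ t) (W : Hom (size t) l) →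
            (∀ u → proj₁ (fun G′ u) ≈ᵥ proj₁ (fun G u)) →
            (∀ u → proj₂ (fun G′ u) ≈ᴱ fun N (proj₁ (fun G u)) +ᴱ proj₂ (fun G u)) →
            [ G ] ⨾ (zero† m ⊕ W) ≈ [ G′ ] ⨾ (zero† m ⊕ W)
  shear-⊕ {m} G G′ N W p q = Eq.trans (refl⟩⨾⟨ peel m W) (Eq.trans (pullˡ (shear G G′ N p q))
    (pullʳ (Eq.sym (peel m W))))

  insertᴸ : ∀ k n → Lin ⟨ n ⟩ (⟨ k ⟩ ⊗ ⟨ n ⟩)
  insertᴸ k n = unitˡᴸ ⨾ᴸ (zerosᴸ k ⊕ᴸ idᴸ)

  -- A vacuous test 0 = 0 can be opened at any time; `shear` then fills it with a consequence of the
  -- tests already present.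
  absorb : ∀ k n → [ insertᴸ k n ] ⨾ (zero† k ⊕ id n) ≈ id n
  absorb k n = Eq.trans (Eq.trans (↑-id n ⟩⨾⟨refl) idˡ ⟩⨾⟨refl)
    (Eq.trans (merge (zeros-zero† k) (Eq.trans idʳ (↑-id n))) (⊕-id 0 n))

  -- Both sides are tests of linear constraints on (t , x), t free: on the left t = L x and
  -- M x = 0, on the right x = K t.  By SplitKernel each system is, up to the scalar d, a
  -- linear consequence of the other.
  constraint-kernel : ∀ {n m p} {M : Lin ⟨ n ⟩ ⟨ m ⟩} {K : Lin ⟨ p ⟩ ⟨ n ⟩} → SplitKernel M K →
                constraint M ≈ [ K ]† ⨾ [ K ]
  constraint-kernel {n} {m} {p} {M} {K} split = begin
    [ pairᴸ M idᴸ ] ⨾ (zero† m ⊕ id n)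
      ≈⟨ Eq.sym (eliminate (pairᴸ M idᴸ) L) ⟩⨾⟨refl ⟩
    ((discard† p ⊕ id n) ⨾ [ C₁ ] ⨾ (zero† p ⊕ id (m + n))) ⨾ (zero† m ⊕ id n)
      ≈⟨ pullʳ (pullʳ (Eq.trans (refl⟩⨾⟨ Eq.sym (⊕-idˡ _)) (merge idʳ idˡ))) ⟩
    (discard† p ⊕ id n) ⨾ [ C₁ ] ⨾ (zero† p ⊕ (zero† m ⊕ id n))
      -- The tests M x = 0 and t - L x = 0 imply N (M x) - d K (t - L x) = 0. By `combine` its left
      -- side is d (x - K t), so it is the desired test up to the factor d, which is removed next.
      ≈⟨ refl⟩⨾⟨ (refl⟩⨾⟨ add-constraint) ⟩
    (discard† p ⊕ id n) ⨾ [ C₁ ] ⨾ [ consequence ] ⨾ (zero† p ⊕ (zero† m ⊕ (zero† n ⊕ id n)))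
      ≈⟨ refl⟩⨾⟨ pullˡ ([]-eq (C₁ ⨾ᴸ consequence) (C₂ ⨾ᴸ (idᴸ ⊕ᴸ (idᴸ ⊕ᴸ (scaleᴸ d ⊕ᴸ idᴸ)))) (λ (t , x) →
           (λ j → ≈-refl) , ((λ j → ≈-refl) , ((λ j → combine t x j) , λ j → ≈-refl)))) ⟩
    (discard† p ⊕ id n) ⨾ ([ C₂ ] ⨾ (↑ H.id p ⊕ (↑ H.id m ⊕ ([ scaleᴸ d ] ⊕ ↑ H.id n)))) ⨾ (zero† p ⊕ (zero† m ⊕ (zero† n ⊕ id n)))
      ≈⟨ refl⟩⨾⟨ pullʳ (merge (Eq.trans (↑-id p ⟩⨾⟨refl) idˡ) (merge (Eq.trans (↑-id m ⟩⨾⟨refl) idˡ)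
           (merge (scale-zero† d≉0 n) (Eq.trans idʳ (↑-id n))))) ⟩
    (discard† p ⊕ id n) ⨾ [ C₂ ] ⨾ (zero† p ⊕ (zero† m ⊕ (zero† n ⊕ id n)))
      -- `shear` reads only the first block of wires, so the new test x - K t = 0 has to come first.
      ≈⟨ refl⟩⨾⟨ (refl⟩⨾⟨ rotate) ⟩
    (discard† p ⊕ id n) ⨾ [ C₂ ] ⨾ (↑ H.id p ⊕ ↑ swap₃ m n n) ⨾ ↑ swap₃ p n (m + n) ⨾ (zero† n ⊕ (zero† p ⊕ (zero† m ⊕ id n)))
      ≈⟨ refl⟩⨾⟨ Eq.trans (refl⟩⨾⟨ assoc˘) (pullˡ ([]-eq (C₂ ⨾ᴸ ((idᴸ ⊕ᴸ swap₃ᴸ) ⨾ᴸ swap₃ᴸ)) C₃ (λ u → ≈ᴱ-refl))) ⟩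
    (discard† p ⊕ id n) ⨾ [ C₃ ] ⨾ (zero† n ⊕ (zero† p ⊕ (zero† m ⊕ id n)))
      -- Given x = K t the old tests are redundant: t - L x is -L (x - K t), M x is M (x - K t), and
      -- the output x is K t plus the tested vector. They become vacuous and `Z₀-absorbed` closes
      -- them.
      ≈⟨ refl⟩⨾⟨ shear-⊕ G₀ C₃ (pairᴸ (zeroᴸ -ᴸ L) (pairᴸ M idᴸ)) _ (λ u j → ≈-refl) implied ⟨
    (discard† p ⊕ id n) ⨾ [ G₀ ] ⨾ (zero† n ⊕ (zero† p ⊕ (zero† m ⊕ id n)))
      ≈⟨ refl⟩⨾⟨ pullʳ (merge (Eq.trans (↑-id n ⟩⨾⟨refl) idˡ) Z₀-absorbed) ⟩
    (discard† p ⊕ id n) ⨾ [ residual ] ⨾ (zero† n ⊕ [ K ])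
      ≈⟨ refl⟩⨾⟨ (refl⟩⨾⟨ peel _ _) ⟩
    (discard† p ⊕ id n) ⨾ [ residual ] ⨾ (zero† n ⊕ id p) ⨾ [ K ]
      ≈⟨ Eq.trans (refl⟩⨾⟨ assoc˘) (pullˡ (Eq.sym (leaf-† K))) ⟩
    [ K ]† ⨾ [ K ] ∎
    where
    open SplitKernel split
    C₁ : Lin (⟨ p ⟩ ⊗ ⟨ n ⟩) (⟨ p ⟩ ⊗ (⟨ m ⟩ ⊗ ⟨ n ⟩))
    C₁ = pairᴸ (fstᴸ -ᴸ (sndᴸ ⨾ᴸ L)) (sndᴸ ⨾ᴸ pairᴸ M idᴸ)
    deviation : Lin (⟨ p ⟩ ⊗ ⟨ n ⟩) ⟨ n ⟩
    deviation = sndᴸ -ᴸ (fstᴸ ⨾ᴸ K)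
    C₂ : Lin (⟨ p ⟩ ⊗ ⟨ n ⟩) (⟨ p ⟩ ⊗ (⟨ m ⟩ ⊗ (⟨ n ⟩ ⊗ ⟨ n ⟩)))
    C₂ = pairᴸ (fstᴸ -ᴸ (sndᴸ ⨾ᴸ L)) (pairᴸ (sndᴸ ⨾ᴸ M) (pairᴸ deviation sndᴸ))
    C₃ : Lin (⟨ p ⟩ ⊗ ⟨ n ⟩) (⟨ n ⟩ ⊗ (⟨ p ⟩ ⊗ (⟨ m ⟩ ⊗ ⟨ n ⟩)))
    C₃ = pairᴸ deviation (pairᴸ (fstᴸ -ᴸ (sndᴸ ⨾ᴸ L)) (pairᴸ (sndᴸ ⨾ᴸ M) sndᴸ))
    consequence : Lin (⟨ p ⟩ ⊗ (⟨ m ⟩ ⊗ ⟨ n ⟩)) (⟨ p ⟩ ⊗ (⟨ m ⟩ ⊗ (⟨ n ⟩ ⊗ ⟨ n ⟩)))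
    consequence = pairᴸ fstᴸ (pairᴸ (sndᴸ ⨾ᴸ fstᴸ)
      (pairᴸ ((sndᴸ ⨾ᴸ (fstᴸ ⨾ᴸ N)) -ᴸ (fstᴸ ⨾ᴸ (K ⨾ᴸ scaleᴸ d))) (sndᴸ ⨾ᴸ sndᴸ)))
    combine : ∀ (t : Vect p) (x : Vect n) j →
      fun N (fun M x) j - d * fun K (λ l → t l - fun L x l) j ≈ᴿ d * (x j - fun K t j)
    combine t x j = ≈-trans (+-cong (NM x j) (-‿cong (*-congˡ (fun-minus K t (fun L x) j))))
      (solve 4 (λ d x k kl → d :* (x :- kl) :- d :* (k :- kl) := d :* (x :- k)) ≈-refl d (x j) (fun K t j) (fun K (fun L x) j))
    add-constraint : zero† p ⊕ (zero† m ⊕ id n)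
      ≈ [ consequence ] ⨾ (zero† p ⊕ (zero† m ⊕ (zero† n ⊕ id n)))
    add-constraint = begin
      zero† p ⊕ (zero† m ⊕ id n)
        ≈⟨ refl⟩⊕⟨ Eq.sym (merge (Eq.trans (↑-id m ⟩⨾⟨refl) idˡ) (absorb n n)) ⟩
      zero† p ⊕ ([ idᴸ {⟨ m ⟩} ⊕ᴸ insertᴸ n n ] ⨾ (zero† m ⊕ (zero† n ⊕ id n)))
        ≈⟨ refl⟩⊕⟨ shear-⊕ (idᴸ {⟨ m ⟩} ⊕ᴸ insertᴸ n n) inner (pairᴸ N zeroᴸ) _ (λ u j → ≈-refl) (λ u →
             (λ j → ≈-sym (+ᴿ-identityʳ _)) , λ j → ≈-sym (+-identityˡ _)) ⟩
      zero† p ⊕ ([ inner ] ⨾ (zero† m ⊕ (zero† n ⊕ id n)))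
        ≈⟨ Eq.trans (Eq.sym (Eq.trans (↑-id p ⟩⨾⟨refl) idˡ) ⟩⊕⟨refl) (⊕-interchange _ _ _ _) ⟩
      [ idᴸ {⟨ p ⟩} ⊕ᴸ inner ] ⨾ (zero† p ⊕ (zero† m ⊕ (zero† n ⊕ id n)))
        ≈⟨ shear-⊕ (idᴸ {⟨ p ⟩} ⊕ᴸ inner) consequence (pairᴸ zeroᴸ (pairᴸ (zeroᴸ -ᴸ (K ⨾ᴸ scaleᴸ d)) zeroᴸ)) _
             (λ u j → ≈-refl) (λ u →
             (λ j → ≈-sym (+-identityˡ _)) , ((λ j → solve 2 (λ a b → a :- b := (𝟘 :- b) :+ a) ≈-refl _ _) ,
             λ j → ≈-sym (+-identityˡ _))) ⟩
      [ consequence ] ⨾ (zero† p ⊕ (zero† m ⊕ (zero† n ⊕ id n))) ∎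
      where
      inner : Lin (⟨ m ⟩ ⊗ ⟨ n ⟩) (⟨ m ⟩ ⊗ (⟨ n ⟩ ⊗ ⟨ n ⟩))
      inner = pairᴸ fstᴸ (pairᴸ (fstᴸ ⨾ᴸ N) sndᴸ)
    rotate : zero† p ⊕ (zero† m ⊕ (zero† n ⊕ id n)) ≈
      (↑ H.id p ⊕ ↑ swap₃ m n n) ⨾ ↑ swap₃ p n (m + n) ⨾ (zero† n ⊕ (zero† p ⊕ (zero† m ⊕ id n)))
    rotate = begin
      zero† p ⊕ (zero† m ⊕ (zero† n ⊕ id n))
        ≈⟨ Eq.trans (Eq.sym (Eq.trans (↑-id p ⟩⨾⟨refl) idˡ) ⟩⊕⟨ zero†-swap m n n) (⊕-interchange _ _ _ _) ⟩
      (↑ H.id p ⊕ ↑ swap₃ m n n) ⨾ (zero† p ⊕ (zero† n ⊕ (zero† m ⊕ id n)))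
        ≈⟨ refl⟩⨾⟨ peel₂ p n _ ⟩
      (↑ H.id p ⊕ ↑ swap₃ m n n) ⨾ (zero† p ⊕ (zero† n ⊕ id (m + n))) ⨾ (zero† m ⊕ id n)
        ≈⟨ refl⟩⨾⟨ Eq.trans (zero†-swap p n (m + n) ⟩⨾⟨refl) (pullʳ (Eq.sym (peel₂ n p _))) ⟩
      (↑ H.id p ⊕ ↑ swap₃ m n n) ⨾ ↑ swap₃ p n (m + n) ⨾ (zero† n ⊕ (zero† p ⊕ (zero† m ⊕ id n))) ∎
    residual : Lin (⟨ p ⟩ ⊗ ⟨ n ⟩) (⟨ n ⟩ ⊗ ⟨ p ⟩)
    residual = pairᴸ (sndᴸ -ᴸ (fstᴸ ⨾ᴸ K)) fstᴸ
    Z₀ : Lin ⟨ p ⟩ (⟨ p ⟩ ⊗ (⟨ m ⟩ ⊗ ⟨ n ⟩))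
    Z₀ = K ⨾ᴸ (unitˡᴸ ⨾ᴸ (zerosᴸ p ⊕ᴸ insertᴸ m n))
    G₀ : Lin (⟨ p ⟩ ⊗ ⟨ n ⟩) (⟨ n ⟩ ⊗ (⟨ p ⟩ ⊗ (⟨ m ⟩ ⊗ ⟨ n ⟩)))
    G₀ = residual ⨾ᴸ (idᴸ ⊕ᴸ Z₀)
    Z₀-absorbed : [ Z₀ ] ⨾ (zero† p ⊕ (zero† m ⊕ id n)) ≈ [ K ]
    Z₀-absorbed = Eq.trans (pullʳ (Eq.trans (Eq.trans (↑-id n ⟩⨾⟨refl) idˡ ⟩⨾⟨refl)
      (Eq.trans (merge (zeros-zero† p) (absorb m n)) (⊕-id 0 n)))) idʳ
    implied : ∀ u → proj₂ (fun C₃ u) ≈ᴱ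
      fun (pairᴸ (zeroᴸ -ᴸ L) (pairᴸ M idᴸ)) (proj₁ (fun G₀ u)) +ᴱ proj₂ (fun G₀ u)
    implied (t , x) =
      (λ j → ≈-sym (≈-trans (+-congʳ (+-congˡ (-‿cong (≈-trans (fun-minus L x (fun K t) j) (+-congˡ (-‿cong (LK t j)))))))
        (solve 2 (λ t x → (𝟘 :- (x :- t)) :+ 𝟘 := t :- x) ≈-refl (t j) (fun L x j)))) ,
      ((λ j → ≈-sym (≈-trans (+-congʳ (≈-trans (fun-minus M x (fun K t) j) (+-congˡ (-‿cong (MK t j)))))
        (solve 1 (λ x → (x :- 𝟘) :+ 𝟘 := x) ≈-refl _))) ,
      λ j → solve 2 (λ x k → x := (x :- k) :+ k) ≈-refl (x j) (fun K t j))

  -- The kernel of the map to 0 wires is everything, and its constraint is the identity. An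
  -- invertible `K` is a basis of this kernel with retraction its inverse, so d = 1 and N = 0 serve.
  isometry : ∀ {n p} {K : Lin ⟨ p ⟩ ⟨ n ⟩} {L : Lin ⟨ n ⟩ ⟨ p ⟩} →
             (∀ t → fun L (fun K t) ≈ᵥ t) → (∀ x → fun K (fun L x) ≈ᵥ x) → [ K ]† ⨾ [ K ] ≈ id n
  isometry {n} {p} {K} {L} LK KL = begin
    [ K ]† ⨾ [ K ]
      ≈⟨ constraint-kernel split ⟨
    [ pairᴸ M idᴸ ] ⨾ (id 0 ⊕ id n)
      ≈⟨ Eq.trans (refl⟩⨾⟨ ⊕-id 0 n) idʳ ⟩
    [ pairᴸ M idᴸ ]
      ≈⟨ []-eq (pairᴸ M idᴸ) unitˡᴸ (λ u → (λ ()) , λ j → ≈-refl) ⟩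
    ↑ H.id n
      ≈⟨ ↑-id n ⟩
    id n ∎
    where
    M : Lin ⟨ n ⟩ ⟨ 0 ⟩
    M = discardsᴸ n
    split : SplitKernel M K
    split = record
      { L = L ; N = zeroᴸ ; d = 1# ; d≉0 = 1≉0 ; MK = λ t () ; LK = LK
      ; NM = λ v j → ≈-sym (≈-trans (*-identityˡ _) (≈-trans (+-congˡ (-‿cong (KL v j))) (-‿inverseʳ _))) }

  -- `[ A ] ⨾ [ B ]†` guesses v, tests A u - B v = 0 and returns v. The constraint on (v , u)
  -- factors through the kernel as `[ K ]† ⨾ [ K ]`; forgetting v on the left half and u on the
  -- right half leaves the two legs. The order (v , u) is that of `leaf-†`, which puts its free
  -- wires first.
  pullback-square : ∀ {a b n p} {A : Lin ⟨ a ⟩ ⟨ n ⟩} {B : Lin ⟨ b ⟩ ⟨ n ⟩}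
    {M : Lin ⟨ b + a ⟩ ⟨ n ⟩} {K : Lin ⟨ p ⟩ ⟨ b + a ⟩} {P₁ : Lin ⟨ p ⟩ ⟨ a ⟩} {P₂ : Lin ⟨ p ⟩ ⟨ b ⟩} →
    (∀ v u j → fun M (v ++ᵥ u) j ≈ᴿ fun A u j - fun B v j) →
    (∀ t → fun K t ≈ᵥ (fun P₂ t ++ᵥ fun P₁ t)) →
    SplitKernel M K → [ A ] ⨾ [ B ]† ≈ [ P₁ ]† ⨾ [ P₂ ]
  pullback-square {a} {b} {n} {p} {A} {B} {M} {K} {P₁} {P₂} M≈ K≈ split = begin
    [ A ] ⨾ [ B ]†
      ≈⟨ refl⟩⨾⟨ leaf-† B ⟩
    [ A ] ⨾ (discard† b ⊕ id n) ⨾ [ residual ] ⨾ (zero† n ⊕ id b)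
      ≈⟨ replaceˡ (Eq.trans (Eq.sym (⊕-idˡ _) ⟩⨾⟨refl)
           (slide (Eq.trans idˡ (Eq.sym (Eq.trans (refl⟩⨾⟨ ↑-id b) idʳ))) (Eq.trans idʳ (Eq.sym idˡ)))) ⟩
    (discard† b ⊕ id a) ⨾ (↑ H.id b ⊕ [ A ]) ⨾ [ residual ] ⨾ (zero† n ⊕ id b)
      ≈⟨ refl⟩⨾⟨ Eq.trans assoc˘ ([]-eq ((idᴸ ⊕ᴸ A) ⨾ᴸ residual) (joined ⨾ᴸ (pairᴸ M idᴸ ⨾ᴸ (idᴸ ⊕ᴸ first)))
           (λ (v , u) → (λ j → ≈-sym (M≈ v u j)) , λ j → ≈-sym (takeᵥ-++ v u j)) ⟩⨾⟨refl) ⟩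
    (discard† b ⊕ id a) ⨾ (↑ H.id (b + a) ⨾ [ pairᴸ M idᴸ ] ⨾ (↑ H.id n ⊕ [ first ])) ⨾ (zero† n ⊕ id b)
      ≈⟨ refl⟩⨾⟨ Eq.trans (Eq.trans (↑-id (b + a) ⟩⨾⟨refl) idˡ ⟩⨾⟨refl) (pullʳ
           (Eq.trans (slide (Eq.trans (↑-id n ⟩⨾⟨refl) (Eq.trans idˡ (Eq.sym idʳ))) (Eq.trans idʳ (Eq.sym idˡ))) (refl⟩⨾⟨ ⊕-idˡ _))) ⟩
    (discard† b ⊕ id a) ⨾ [ pairᴸ M idᴸ ] ⨾ (zero† n ⊕ id (b + a)) ⨾ [ first ]
      ≈⟨ refl⟩⨾⟨ Eq.trans assoc˘ (Eq.trans (constraint-kernel split ⟩⨾⟨refl) assoc) ⟩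
    (discard† b ⊕ id a) ⨾ [ K ]† ⨾ [ K ] ⨾ [ first ]
      ≈⟨ pullˡ projected ⟩
    [ P₁ ]† ⨾ [ K ] ⨾ [ first ]
      ≈⟨ refl⟩⨾⟨ []-eq (K ⨾ᴸ first) P₂ (λ t j → ≈-trans (K≈ t (j ↑ˡ a)) (takeᵥ-++ (fun P₂ t) (fun P₁ t) j)) ⟩
    [ P₁ ]† ⨾ [ P₂ ] ∎
    where
    residual : Lin (⟨ b ⟩ ⊗ ⟨ n ⟩) (⟨ n ⟩ ⊗ ⟨ b ⟩)
    residual = pairᴸ (sndᴸ -ᴸ (fstᴸ ⨾ᴸ B)) fstᴸ
    joined : Lin (⟨ b ⟩ ⊗ ⟨ a ⟩) ⟨ b + a ⟩
    joined = joinᴸ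
    first : Lin ⟨ b + a ⟩ ⟨ b ⟩
    first = reindex (_↑ˡ a) (takeᵥ b) (λ u j → ≈-refl)
    projected : (discard† b ⊕ id a) ⨾ [ K ]† ≈ [ P₁ ]†
    projected = begin
      (discard† b ⊕ id a) ⨾ [ K ]†
        ≈⟨ Eq.trans idʳ (refl⟩⊕⟨ ↑id-† a) ⟩⨾⟨refl ⟨
      ((discard† b ⊕ (↑ H.id a) †) ⨾ id (b + a)) ⨾ [ K ]†
        ≈⟨ (refl⟩⨾⟨ Eq.sym (↑id-† (b + a))) ⟩⨾⟨refl ⟩
      [ K ⨾ᴸ (splitᴸ {⟨ b ⟩ ⊗ ⟨ a ⟩} ⨾ᴸ (discardsᴸ b ⊕ᴸ idᴸ)) ]†
        ≈⟨ []†-eq (K ⨾ᴸ (splitᴸ {⟨ b ⟩ ⊗ ⟨ a ⟩} ⨾ᴸ (discardsᴸ b ⊕ᴸ idᴸ))) (P₁ ⨾ᴸ unitˡᴸ)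
             (λ t → (λ ()) , λ j → ≈-trans (K≈ t (b ↑ʳ j)) (dropᵥ-++ (fun P₂ t) (fun P₁ t) j)) ⟩
      (↑ H.id a) † ⨾ [ P₁ ]†
        ≈⟨ Eq.trans (↑id-† a ⟩⨾⟨refl) idˡ ⟩
      [ P₁ ]† ∎

-- Split kernels over a principal ideal domain

module SplitKernels (R : CommutativeRing c ℓ) (pid : IsPID R) where
  open CommutativeRing R renaming
    (_+_ to _+ᴿ_; +-assoc to +ᴿ-assoc; +-identityʳ to +ᴿ-identityʳ; zero to *-zero)
  open import Algebra.Properties.Semiring.Sum semiring using (sum-cong-≋; ∑-distrib-+; *-distribʳ-sum)
  open import Algebra.Properties.Ring ring using (x∙y⁻¹≈ε⇒x≈y)
  open import Algebra.Definitions.RawMagma *-rawMagma using (_∣_; _,_)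
  open SetoidReasoning setoid
  open IsPID pid
  open Matrices R
  open MatrixPullbacks R pid 
    using (Vect; _*ᵥ_; *ᵥ-cong; *ᵥ-+; *ᵥ-*; *ᵥ-0; zero?; upper; lower)
  open MatrixSemantics R pid
  open LinearMaps R pid
  open Pullbacks Mat
  open IntegerSolver R using (solve; _:=_; _:+_; _:*_; _:-_; :-_; 𝟘; 𝟙)

  fun-affine : ∀ {n m} (f : Lin ⟨ n ⟩ ⟨ m ⟩) a k w i →
               fun f (λ j → a j * k +ᴿ w j) i ≈ fun f a i * k +ᴿ fun f w i
  fun-affine f a k w i = trans (sym (matrixOf-action f _ i))
    (trans (*ᵥ-+ (matrixOf f) (λ j → a j * k) w i)
      (+-cong (trans (*ᵥ-* (matrixOf f) a k i) (*-congʳ (matrixOf-action f a i))) (matrixOf-action f w i)))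

  fun-zero : ∀ {n m} (f : Lin ⟨ n ⟩ ⟨ m ⟩) {w : Vect n} → w ≈ᵥ (λ _ → 0#) → fun f w ≈ᵥ (λ _ → 0#)
  fun-zero f p i = trans (fun-cong f p i) (trans (sym (matrixOf-action f _ i)) (*ᵥ-0 (matrixOf f) i))

  fun-* : ∀ {n m} (f : Lin ⟨ n ⟩ ⟨ m ⟩) w k i → fun f (λ j → w j * k) i ≈ fun f w i * k
  fun-* f w k i = trans (sym (matrixOf-action f _ i))
    (trans (*ᵥ-* (matrixOf f) w k i) (*-congʳ (matrixOf-action f w i)))

  fun-neg : ∀ {n m} (f : Lin ⟨ n ⟩ ⟨ m ⟩) w i → fun f (λ j → - w j) i ≈ - fun f w i
  fun-neg f w i = trans (fun-cong f (λ j → solve 1 (λ x → :- x := x :* (:- 𝟙)) refl (w j)) i)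
    (trans (fun-* f w (- 1#) i) (solve 1 (λ x → x :* (:- 𝟙) := :- x) refl _))

  colᴸ : ∀ {n} → Vect n → Lin ⟨ 1 ⟩ ⟨ n ⟩
  colᴸ a = mat (λ i _ → a i)

  *-cancel-0 : ∀ {x y} → x ≉ 0# → x * y ≈ 0# → y ≈ 0#
  *-cancel-0 x≉0 p with noZeroDivisors p
  ... | inj₁ q = contradiction q x≉0
  ... | inj₂ q = q

  nonzero? : ∀ {n} (v : Vect n) → (∃ λ i → v i ≉ 0#) ⊎ (v ≈ᵥ (λ _ → 0#))
  nonzero? {zero}  v = inj₂ λ ()
  nonzero? {suc n} v with zero? (v zero) | nonzero? (λ i → v (suc i))
  ... | inj₂ p | _            = inj₁ (zero , p)
  ... | inj₁ p | inj₁ (i , q) = inj₁ (suc i , q)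
  ... | inj₁ p | inj₂ q       = inj₂ λ { zero → p ; (suc i) → q i }

  module Step {n m p} (M : Lin ⟨ suc n ⟩ ⟨ m ⟩) (K′ : Lin ⟨ p ⟩ ⟨ n ⟩)
              (split : SplitKernel (mat (λ r j → matrixOf M r (suc j))) K′) where
    open SplitKernel split renaming (L to L′; N to N′; d to d′; d≉0 to d′≉0; MK to M′K′; LK to L′K′; NM to N′M′)

    col : Vect m
    col i = matrixOf M i zero

    A′ : Matrix m n
    A′ r j = matrixOf M r (suc j)

    M′ : Lin ⟨ n ⟩ ⟨ m ⟩
    M′ = mat A′

    tail : Vect (suc n) → Vect n
    tail x i = x (suc i)

    M-split : ∀ x i → fun M x i ≈ col i * x zero +ᴿ fun M′ (tail x) i
    M-split x i = sym (matrixOf-action M x i)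

    -- The first entries of kernel vectors of `M`. Its generator `g` decides whether the first
    -- column contributes a new basis vector.
    Leading : Pred Carrier (c ⊔ ℓ)
    Leading x = ∃ λ v → ∀ i → col i * x +ᴿ fun M′ v i ≈ 0#

    Leading-isIdeal : IsIdeal R Leading
    Leading-isIdeal = record
      { resp     = λ p (v , q) → v , λ i → trans (+-congʳ (*-congˡ (sym p))) (q i)
      ; 0∈       = (λ _ → 0#) , λ i → trans (+-cong (zeroʳ _) (*ᵥ-0 A′ i)) (+-identityˡ 0#)
      ; +-closed = λ {x} {y} (v , p) (w , q) → (λ j → v j +ᴿ w j) , λ i → trans
          (trans (+-congˡ (*ᵥ-+ A′ v w i))
            (solve 5 (λ a x y s t → a :* (x :+ y) :+ (s :+ t) := (a :* x :+ s) :+ (a :* y :+ t)) refl (col i) x y (fun M′ v i) (fun M′ w i)))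
          (trans (+-cong (p i) (q i)) (+-identityˡ 0#))
      ; *-closed = λ r {x} (v , p) → (λ j → v j * r) , λ i → trans
          (trans (+-congˡ (*ᵥ-* A′ v r i))
            (solve 4 (λ a x r s → a :* (r :* x) :+ s :* r := (a :* x :+ s) :* r) refl (col i) x r (fun M′ v i)))
          (trans (*-congʳ (p i)) (zeroˡ r)) }

    N′M : ∀ x i → fun N′ (fun M x) i ≈ fun N′ col i * x zero +ᴿ d′ * (tail x i - fun K′ (fun L′ (tail x)) i)
    N′M x i = trans (fun-cong N′ (M-split x) i)
      (trans (fun-affine N′ col (x zero) (fun M′ (tail x)) i) (+-congˡ (N′M′ (tail x) i)))

    -- Every kernel vector starts with 0: the first column of M is independent of the others.
    module Independent (g : Carrier) (Leading⇔ : ∀ x → x ∈ Leading ⇔ g ∣ x) (g≈0 : g ≈ 0#) where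
      -- M′ N′ M′ = d′ M′ because M′ K′ = 0, so this map kills the image of `M′` and detects only
      -- the first column of `M`.
      E : Lin ⟨ m ⟩ ⟨ m ⟩
      E = scaleᴸ d′ -ᴸ (N′ ⨾ᴸ M′)

      E-kills : ∀ x → fun E (fun M′ x) ≈ᵥ (λ _ → 0#)
      E-kills x i = begin
        d′ * fun M′ x i - fun M′ (fun N′ (fun M′ x)) i
          ≈⟨ +-congˡ (-‿cong (trans (fun-cong M′ (λ j → trans (N′M′ x j) (*-comm _ _)) i)
               (trans (fun-* M′ (λ j → x j - fun K′ (fun L′ x) j) d′ i)
                 (*-congʳ (trans (fun-minus M′ x (fun K′ (fun L′ x)) i) (+-congˡ (-‿cong (M′K′ (fun L′ x) i)))))))) ⟩
        d′ * fun M′ x i - (fun M′ x i - 0#) * d′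
          ≈⟨ solve 2 (λ d y → d :* y :- (y :- 𝟘) :* d := 𝟘) refl _ _ ⟩
        0# ∎

      -- If E col = 0, then d′ col = M′ (N′ col) puts d′ into `Leading`; so g divides d′, and g ≈ 0
      -- contradicts d′ ≉ 0.
      pivot : ∃ λ i → fun E col i ≉ 0#
      pivot with nonzero? (fun E col)
      ... | inj₁ q = q
      ... | inj₂ q with Equivalence.to (Leading⇔ d′) ((λ j → - fun N′ col j) , λ i → trans
                          (+-congˡ (fun-neg M′ (fun N′ col) i)) (trans (+-congʳ (*-comm _ _)) (q i)))
      ...   | r , rg≈d′ = contradiction (trans (sym rg≈d′) (trans (*-congˡ g≈0) (zeroʳ r))) d′≉0

      i₀ : Fin m
      i₀ = proj₁ pivot

      d₀ : Carrier
      d₀ = fun E col i₀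

      N₀ : Lin ⟨ m ⟩ ⟨ 1 ⟩
      N₀ = E ⨾ᴸ reindex (λ _ → i₀) (λ u _ → u i₀) (λ u i → refl)

      N₀M : ∀ x → fun N₀ (fun M x) zero ≈ d₀ * x zero
      N₀M x = trans (fun-cong E (M-split x) i₀)
        (trans (fun-affine E col (x zero) (fun M′ (tail x)) i₀)
          (trans (+-congˡ (E-kills (tail x) i₀)) (+ᴿ-identityʳ _)))

      K : Lin ⟨ p ⟩ ⟨ suc n ⟩
      K = pairᴸ zeroᴸ K′ ⨾ᴸ consᴸ

      result : SplitKernel M K
      result = record
        { L   = tailᴸ ⨾ᴸ L′
        -- N₀ (M x) is d₀ x₀, and N′ (M x) is d′ times the projection of the tail plus the unwanted
        -- term N′ col x₀. Multiplying the latter by d₀ allows that term to be subtracted.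
        ; N   = pairᴸ (N₀ ⨾ᴸ scaleᴸ d′) ((N′ ⨾ᴸ scaleᴸ d₀) -ᴸ (N₀ ⨾ᴸ colᴸ (fun N′ col))) ⨾ᴸ consᴸ
        ; d   = d₀ * d′
        ; d≉0 = λ q → d′≉0 (*-cancel-0 (proj₂ pivot) q)
        ; MK  = λ t i → trans (M-split (fun K t) i) (trans (+-cong (zeroʳ _) (M′K′ t i)) (+-identityˡ 0#))
        ; LK  = λ t i → L′K′ t i
        ; NM  = λ
          { x zero → trans (*-congˡ (N₀M x))
              (solve 3 (λ d e x → d :* (e :* x) := (e :* d) :* (x :- 𝟘)) refl d′ d₀ (x zero))
          ; x (suc i) → trans (+-cong (*-congˡ (N′M x i)) (-‿cong (+-congʳ (*-congˡ (N₀M x)))))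
              (solve 6 (λ d e a x y z → e :* (a :* x :+ d :* (y :- z)) :- (a :* (e :* x) :+ 𝟘)
                                         := (e :* d) :* (y :- z))
                refl d′ d₀ (fun N′ col i) (x zero) (x (suc i)) (fun K′ (fun L′ (tail x)) i)) } }

    -- Otherwise (g , y) spans the kernel modulo K′, and since g generates all first entries,
    -- g and the part of y outside the image of K′ are jointly unimodular.
    module Dependent (g : Carrier) (Leading⇔ : ∀ x → x ∈ Leading ⇔ g ∣ x) (g≉0 : g ≉ 0#) where
      divide : ∀ {x} → x ∈ Leading → ∃ λ a → a * g ≈ x
      divide x∈ with Equivalence.to (Leading⇔ _) x∈
      ... | a , p = a , p

      g∈ : g ∈ Leading
      g∈ = Equivalence.from (Leading⇔ g) (1# , *-identityˡ g)

      y : Vect n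
      y = proj₁ g∈

      π : Lin ⟨ n ⟩ ⟨ n ⟩
      π = idᴸ -ᴸ (L′ ⨾ᴸ K′)

      y′ : Vect n
      y′ = fun π y

      πK′ : ∀ t → fun π (fun K′ t) ≈ᵥ (λ _ → 0#)
      πK′ t i = trans (+-congˡ (-‿cong (fun-cong K′ (L′K′ t) i))) (-‿inverseʳ _)

      M′y′ : ∀ i → fun M′ y′ i ≈ fun M′ y i
      M′y′ i = trans (fun-minus M′ y (fun K′ (fun L′ y)) i)
        (trans (+-congˡ (-‿cong (M′K′ (fun L′ y) i))) (solve 1 (λ x → x :- 𝟘 := x) refl _))

      infix 8 _∙_
      _∙_ : Vect n → Vect n → Carrier
      v ∙ w = fun (dotᴸ v) w zero

      -- The ideal generated by g and the entries of `y′`.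
      Content : Pred Carrier (c ⊔ ℓ)
      Content x = ∃ λ ((u , v) : Carrier × Vect n) → Lift c (u * g +ᴿ v ∙ y′ ≈ x)

      Content-isIdeal : IsIdeal R Content
      Content-isIdeal = record
        { resp     = λ p (uv , lift q) → uv , lift (trans q p)
        ; 0∈       = (0# , λ _ → 0#) , lift (trans (+-cong (zeroˡ g) (sum-0 n (λ j → zeroˡ _))) (+-identityˡ 0#))
        ; +-closed = λ ((u , v) , lift p) ((u₁ , v₁) , lift q) → (u +ᴿ u₁ , λ j → v j +ᴿ v₁ j) , lift (trans
            (trans (+-congˡ (trans (sum-cong-≋ (λ j → distribʳ (y′ j) (v j) (v₁ j)))
                      (∑-distrib-+ (λ j → v j * y′ j) (λ j → v₁ j * y′ j))))
              (solve 5 (λ u u₁ g a b → (u :+ u₁) :* g :+ (a :+ b) := (u :* g :+ a) :+ (u₁ :* g :+ b)) refl u u₁ g _ _))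
            (+-cong p q))
        ; *-closed = λ r ((u , v) , lift p) → (r * u , λ j → r * v j) , lift (trans
            (trans (+-congˡ (trans (sum-cong-≋ (λ j → solve 3 (λ r v y → r :* v :* y := v :* y :* r) refl r (v j) (y′ j)))
                      (sym (*-distribʳ-sum r (λ j → v j * y′ j)))))
              (solve 4 (λ r u g a → (r :* u) :* g :+ a :* r := r :* (u :* g :+ a)) refl r u g _))
            (*-congˡ p)) }

      content : ∃ λ r → ∀ x → x ∈ Content ⇔ r ∣ x
      content = principal Content Content-isIdeal

      r : Carrier
      r = proj₁ content

      quotient : ∀ {x} → x ∈ Content → ∃ λ a → a * r ≈ x
      quotient x∈ with Equivalence.to (proj₂ content _) x∈
      ... | a , p = a , p

      g/r : ∃ λ a → a * r ≈ g
      g/r = quotient ((1# , λ _ → 0#) ,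
        lift (trans (+-cong (*-identityˡ g) (sum-0 n (λ j → zeroˡ _))) (+ᴿ-identityʳ g)))

      y′/r : ∀ j → ∃ λ a → a * r ≈ y′ j
      y′/r j = quotient ((0# , λ l → δ j l) ,
        lift (trans (+-cong (zeroˡ g) (sum-δˡ j y′)) (+-identityˡ _)))

      z : Vect n
      z j = proj₁ (y′/r j)

      r≉0 : r ≉ 0#
      r≉0 p = g≉0 (trans (sym (proj₂ g/r)) (trans (*-congˡ p) (zeroʳ _)))

      -- The relation col g + M′ y′ = 0 divided by r. Replacing y by y′ does not affect it, since M′
      -- K′ = 0.
      g/r∈ : proj₁ g/r ∈ Leading
      g/r∈ = z , λ i → *-cancel-0 r≉0 (begin
        r * (col i * proj₁ g/r +ᴿ fun M′ z i)
          ≈⟨ solve 4 (λ r a b s → r :* (a :* b :+ s) := a :* (b :* r) :+ s :* r) refl r (col i) (proj₁ g/r) _ ⟩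
        col i * (proj₁ g/r * r) +ᴿ fun M′ z i * r
          ≈⟨ +-cong (*-congˡ (proj₂ g/r)) (sym (fun-* M′ z r i)) ⟩
        col i * g +ᴿ fun M′ (λ j → z j * r) i
          ≈⟨ +-congˡ (trans (fun-cong M′ (λ j → proj₂ (y′/r j)) i) (M′y′ i)) ⟩
        col i * g +ᴿ fun M′ y i
          ≈⟨ proj₂ g∈ i ⟩
        0# ∎)

      -- Applied to a = g/r: as g generates `Leading` it divides g/r, say g/r = b g, and then g = b
      -- r g makes r invertible.
      unit : ∀ {a b} → b * g ≈ a → a * r ≈ g → b * r ≈ 1#
      unit {a} {b} bg≈a ar≈g = sym (x∙y⁻¹≈ε⇒x≈y _ _ (*-cancel-0 g≉0 (begin
        g * (1# - b * r)
          ≈⟨ solve 3 (λ g b r → g :* (𝟙 :- b :* r) := g :- (b :* g) :* r) refl g b r ⟩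
        g - (b * g) * r
          ≈⟨ +-congˡ (-‿cong (trans (*-congʳ bg≈a) ar≈g)) ⟩
        g - g
          ≈⟨ -‿inverseʳ g ⟩
        0# ∎)))

      r∣1 : r ∣ 1#
      r∣1 = proj₁ b , unit (proj₂ b) (proj₂ g/r)
        where b = divide g/r∈

      abstract
        unimodular : 1# ∈ Content
        unimodular = Equivalence.from (proj₂ content 1#) r∣1

      u : Carrier
      u = proj₁ (proj₁ unimodular)

      v : Vect n
      v = proj₂ (proj₁ unimodular)

      ug+vy′ : u * g +ᴿ v ∙ y′ ≈ 1#
      ug+vy′ with proj₂ unimodular
      ... | lift p = p

      K : Lin ⟨ suc p ⟩ ⟨ suc n ⟩
      K = pairᴸ (headᴸ ⨾ᴸ scaleᴸ g) ((headᴸ ⨾ᴸ colᴸ y) +ᴸ (tailᴸ ⨾ᴸ K′)) ⨾ᴸ consᴸ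

      -- The new coordinate t₀ of a kernel vector. The projection `π` removes the part from `K′`,
      -- and the Bézout relation `ug+vy′` evaluates the rest to t₀.
      L₀ : Lin ⟨ suc n ⟩ ⟨ 1 ⟩
      L₀ = (headᴸ ⨾ᴸ scaleᴸ u) +ᴸ (tailᴸ ⨾ᴸ (π ⨾ᴸ dotᴸ v))

      L : Lin ⟨ suc n ⟩ ⟨ suc p ⟩
      L = pairᴸ L₀ ((tailᴸ ⨾ᴸ L′) -ᴸ (L₀ ⨾ᴸ colᴸ (fun L′ y))) ⨾ᴸ consᴸ

      -- Over the field of fractions, clear the first entry of x by a multiple of (g , y′); `d′`
      -- times the `π`-image of the resulting tail is N′ (M x). It remains to remove from (0 , N′ (M
      -- x)) its component along (g , y′), whose coefficient by `L₀` is v ∙ N′ (M x).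
      N : Lin ⟨ m ⟩ ⟨ suc n ⟩
      N = pairᴸ ((N′ ⨾ᴸ dotᴸ v) ⨾ᴸ scaleᴸ (- g)) (N′ -ᴸ ((N′ ⨾ᴸ dotᴸ v) ⨾ᴸ colᴸ y′)) ⨾ᴸ consᴸ

      K-tail : ∀ t i → fun K t (suc i) ≈ y i * t zero +ᴿ fun K′ (λ j → t (suc j)) i
      K-tail t i = +-congʳ (+ᴿ-identityʳ _)

      L₀K : ∀ t → fun L₀ (fun K t) zero ≈ t zero
      L₀K t = begin
        u * (g * t zero) +ᴿ v ∙ fun π (tail (fun K t))
          ≈⟨ +-congˡ (trans (fun-cong (dotᴸ v) (λ i → trans (fun-cong π (K-tail t) i)
               (trans (fun-affine π y (t zero) (fun K′ (λ j → t (suc j))) i)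
                 (trans (+-congˡ (πK′ (λ j → t (suc j)) i)) (+ᴿ-identityʳ _)))) zero)
               (fun-* (dotᴸ v) y′ (t zero) zero)) ⟩
        u * (g * t zero) +ᴿ v ∙ y′ * t zero
          ≈⟨ solve 4 (λ u g t s → u :* (g :* t) :+ s :* t := (u :* g :+ s) :* t) refl u g (t zero) (v ∙ y′) ⟩
        (u * g +ᴿ v ∙ y′) * t zero
          ≈⟨ *-congʳ ug+vy′ ⟩
        1# * t zero
          ≈⟨ *-identityˡ _ ⟩
        t zero ∎

      -- N′ annihilates col g + M′ y, a relation used up to the nonzero factor g.
      N′col : ∀ i → fun N′ col i * g +ᴿ d′ * y′ i ≈ 0#
      N′col i = trans (sym (trans (fun-affine N′ col g (fun M′ y) i) (+-congˡ (N′M′ y i))))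
        (fun-zero N′ (proj₂ g∈) i)

      q : Carrier
      q = v ∙ fun N′ col

      qg : q * g +ᴿ d′ * (v ∙ y′) ≈ 0#
      qg = trans (sym (trans (fun-affine (dotᴸ v) (fun N′ col) g (λ j → d′ * y′ j) zero)
          (+-congˡ (fun-scale (dotᴸ v) d′ y′ zero))))
        (fun-zero (dotᴸ v) N′col zero)

      vN′M : ∀ x → v ∙ fun N′ (fun M x) ≈ q * x zero +ᴿ d′ * (v ∙ fun π (tail x))
      vN′M x = trans (fun-cong (dotᴸ v) (N′M x) zero)
        (trans (fun-affine (dotᴸ v) (fun N′ col) (x zero) (λ j → d′ * fun π (tail x) j) zero)
          (+-congˡ (fun-scale (dotᴸ v) d′ (fun π (tail x)) zero)))

      -- After multiplication by g this is a combination of the three relations `N′col`, `qg` and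
      -- `ug+vy′`.
      reduced : ∀ i → (fun N′ col i - y′ i * q) +ᴿ d′ * y′ i * u ≈ 0#
      reduced i = *-cancel-0 g≉0 (begin
        g * ((a - b * q) +ᴿ d′ * b * u)
          ≈⟨ solve 7 (λ g a b q d u w → g :* ((a :- b :* q) :+ d :* b :* u)
               := ((a :* g :+ d :* b) :- b :* (q :* g :+ d :* w)) :+ d :* b :* ((u :* g :+ w) :- 𝟙))
               refl g a b q d′ u (v ∙ y′) ⟩
        ((a * g +ᴿ d′ * b) - b * (q * g +ᴿ d′ * (v ∙ y′))) +ᴿ d′ * b * ((u * g +ᴿ v ∙ y′) - 1#)
          ≈⟨ +-cong (+-cong (N′col i) (-‿cong (*-congˡ qg))) (*-congˡ (+-congʳ ug+vy′)) ⟩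
        (0# - b * 0#) +ᴿ d′ * b * (1# - 1#)
          ≈⟨ solve 2 (λ b d → (𝟘 :- b :* 𝟘) :+ d :* b :* (𝟙 :- 𝟙) := 𝟘) refl b d′ ⟩
        0# ∎)
        where
        a = fun N′ col i
        b = y′ i

      K′L : ∀ x i → fun K′ (λ j → fun L x (suc j)) i ≈ fun K′ (fun L′ y) i * - fun L₀ x zero +ᴿ fun K′ (fun L′ (tail x)) i
      K′L x i = trans
        (fun-cong K′ (λ j → solve 3 (λ s a l → s :- (a :* l :+ 𝟘) := a :* (:- l) :+ s) refl
          (fun L′ (tail x) j) (fun L′ y j) (fun L₀ x zero)) i)
        (fun-affine K′ (fun L′ y) (- fun L₀ x zero) (fun L′ (tail x)) i)

      result : SplitKernel M K
      result = record
        { L = L ; N = N ; d = d′ ; d≉0 = d′≉0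
        ; MK = λ t i → begin
            fun M (fun K t) i
              ≈⟨ M-split (fun K t) i ⟩
            col i * (g * t zero) +ᴿ fun M′ (tail (fun K t)) i
              ≈⟨ +-congˡ (trans (fun-cong M′ (K-tail t) i)
                   (trans (fun-affine M′ y (t zero) (fun K′ (λ j → t (suc j))) i)
                     (trans (+-congˡ (M′K′ (λ j → t (suc j)) i)) (+ᴿ-identityʳ _)))) ⟩
            col i * (g * t zero) +ᴿ fun M′ y i * t zero
              ≈⟨ solve 4 (λ a g t s → a :* (g :* t) :+ s :* t := (a :* g :+ s) :* t) refl (col i) g (t zero) _ ⟩
            (col i * g +ᴿ fun M′ y i) * t zero
              ≈⟨ trans (*-congʳ (proj₂ g∈ i)) (zeroˡ _) ⟩
            0# ∎
        ; LK = λ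
          { t zero → L₀K t
          ; t (suc i) → begin
              fun L′ (tail (fun K t)) i - (fun L′ y i * fun L₀ (fun K t) zero +ᴿ 0#)
                ≈⟨ +-cong (trans (fun-cong L′ (K-tail t) i)
                     (trans (fun-affine L′ y (t zero) (fun K′ (λ j → t (suc j))) i) (+-congˡ (L′K′ (λ j → t (suc j)) i))))
                     (-‿cong (+-congʳ (*-congˡ (L₀K t)))) ⟩
              (fun L′ y i * t zero +ᴿ t (suc i)) - (fun L′ y i * t zero +ᴿ 0#)
                ≈⟨ solve 3 (λ a t s → (a :* t :+ s) :- (a :* t :+ 𝟘) := s) refl (fun L′ y i) (t zero) (t (suc i)) ⟩
              t (suc i) ∎ }
        ; NM = λ
          { x zero → begin
              - g * (v ∙ fun N′ (fun M x))
                ≈⟨ *-congˡ (vN′M x) ⟩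
              - g * (q * x zero +ᴿ d′ * (v ∙ fun π (tail x)))
                ≈⟨ solve 7 (λ g q d x w u e → (:- g) :* (q :* x :+ d :* w)
                     := (d :* (x :- g :* (u :* x :+ w)) :- x :* (q :* g :+ d :* e)) :+ d :* x :* ((u :* g :+ e) :- 𝟙))
                     refl g q d′ (x zero) (v ∙ fun π (tail x)) u (v ∙ y′) ⟩
              (d′ * (x zero - fun K (fun L x) zero) - x zero * (q * g +ᴿ d′ * (v ∙ y′)))
                +ᴿ d′ * x zero * ((u * g +ᴿ v ∙ y′) - 1#)
                ≈⟨ +-cong (+-congˡ (-‿cong (*-congˡ qg))) (*-congˡ (+-congʳ ug+vy′)) ⟩
              (d′ * (x zero - fun K (fun L x) zero) - x zero * 0#) +ᴿ d′ * x zero * (1# - 1#)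
                ≈⟨ solve 3 (λ r x d → (r :- x :* 𝟘) :+ d :* x :* (𝟙 :- 𝟙) := r) refl _ (x zero) d′ ⟩
              d′ * (x zero - fun K (fun L x) zero) ∎
          ; x (suc i) → begin
              fun N′ (fun M x) i - (y′ i * (v ∙ fun N′ (fun M x)) +ᴿ 0#)
                ≈⟨ +-cong (N′M x i) (-‿cong (+-congʳ (*-congˡ (vN′M x)))) ⟩
              (fun N′ col i * x zero +ᴿ d′ * fun π (tail x) i)
                - (y′ i * (q * x zero +ᴿ d′ * (v ∙ fun π (tail x))) +ᴿ 0#)
                ≈⟨ solve 8 (λ a x d X b q w u → (a :* x :+ d :* X) :- (b :* (q :* x :+ d :* w) :+ 𝟘)
                     := d :* (X :- b :* (u :* x :+ w)) :+ x :* ((a :- b :* q) :+ d :* b :* u))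
                     refl (fun N′ col i) (x zero) d′ (fun π (tail x) i) (y′ i) q (v ∙ fun π (tail x)) u ⟩
              d′ * (fun π (tail x) i - y′ i * fun L₀ x zero) +ᴿ x zero * ((fun N′ col i - y′ i * q) +ᴿ d′ * y′ i * u)
                ≈⟨ +-congʳ (solve 6 (λ d xi kx y k l → d :* ((xi :- kx) :- (y :- k) :* l)
                     := d :* (xi :- ((y :* l :+ 𝟘) :+ (k :* (:- l) :+ kx))))
                     refl d′ (x (suc i)) (fun K′ (fun L′ (tail x)) i) (y i) (fun K′ (fun L′ y) i) (fun L₀ x zero)) ⟩
              d′ * (x (suc i) - ((y i * fun L₀ x zero +ᴿ 0#) +ᴿ (fun K′ (fun L′ y) i * - fun L₀ x zero +ᴿ fun K′ (fun L′ (tail x)) i)))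
                +ᴿ x zero * ((fun N′ col i - y′ i * q) +ᴿ d′ * y′ i * u)
                ≈⟨ +-cong (*-congˡ (+-congˡ (-‿cong (+-congˡ (sym (K′L x i)))))) (trans (*-congˡ (reduced i)) (zeroʳ _)) ⟩
              d′ * (x (suc i) - fun K (fun L x) (suc i)) +ᴿ 0#
                ≈⟨ +ᴿ-identityʳ _ ⟩
              d′ * (x (suc i) - fun K (fun L x) (suc i)) ∎ } }

    exists : ∃ λ p′ → Σ (Lin ⟨ p′ ⟩ ⟨ suc n ⟩) (SplitKernel M)
    exists with principal Leading Leading-isIdeal
    ... | g , Leading⇔ with zero? g
    ...   | inj₁ g≈0 = p , _ , Independent.result g Leading⇔ g≈0
    ...   | inj₂ g≉0 = suc p , _ , Dependent.result g Leading⇔ g≉0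

  abstract
    splitKernel : ∀ n {m} (M : Lin ⟨ n ⟩ ⟨ m ⟩) → ∃ λ p → Σ (Lin ⟨ p ⟩ ⟨ n ⟩) (SplitKernel M)
    splitKernel zero M = 0 , idᴸ , record
      { L = idᴸ ; N = zeroᴸ ; d = 1# ; d≉0 = 1≉0
      ; MK = λ t → fun-zero M (λ ()) ; LK = λ t i → refl ; NM = λ v () }
    splitKernel (suc n) M with splitKernel n (mat (λ r j → matrixOf M r (suc j)))
    ... | p , K′ , split = Step.exists M K′ split

  -- Any pullback cone factors the kernel vectors of u , v ↦ A u - B v through its apex,
  -- which transports a split kernel to it.
  module _ {a b x p} {A : Matrix x a} {B : Matrix x b} {P₁ : Matrix a p} {P₂ : Matrix b p}
           (pb : IsPullback A B P₁ P₂) where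
    open IsPullback pb

    differenceᴸ : Lin ⟨ b + a ⟩ ⟨ x ⟩
    differenceᴸ = splitᴸ {⟨ b ⟩ ⊗ ⟨ a ⟩} ⨾ᴸ ((sndᴸ ⨾ᴸ mat A) -ᴸ (fstᴸ ⨾ᴸ mat B))

    coneᴸ : Lin ⟨ p ⟩ ⟨ b + a ⟩
    coneᴸ = pairᴸ (mat P₂) (mat P₁) ⨾ᴸ joinᴸ {⟨ b ⟩ ⊗ ⟨ a ⟩}

    private
      K₀ : Lin ⟨ proj₁ (splitKernel (b + a) differenceᴸ) ⟩ ⟨ b + a ⟩
      K₀ = proj₁ (proj₂ (splitKernel (b + a) differenceᴸ))

      open SplitKernel (proj₂ (proj₂ (splitKernel (b + a) differenceᴸ)))
        renaming (L to L₀; N to N₀; MK to MK₀; LK to LK₀; NM to NM₀)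

      k₀ = matrixOf K₀

      k₀-col : ∀ j i → k₀ i j ≈ fun K₀ (λ l → δ l j) i
      k₀-col j i = trans (sym (sum-δʳ j (k₀ i))) (matrixOf-action K₀ (λ l → δ l j) i)

      square : A · lower b k₀ ≋ B · upper b k₀
      square i j = x∙y⁻¹≈ε⇒x≈y _ _ (trans (+-cong
        (*ᵥ-cong A (λ l → k₀-col j (b ↑ʳ l)) i) (-‿cong (*ᵥ-cong B (λ l → k₀-col j (l ↑ˡ a)) i)))
        (MK₀ (λ l → δ l j) i))

      U : Matrix p (proj₁ (splitKernel (b + a) differenceᴸ))
      U = universal square

      cone-U : ∀ t → fun coneᴸ (U *ᵥ t) ≈ᵥ fun K₀ t
      cone-U t i = trans (++ᵥ-cong
          (λ l → trans (sym (·-*ᵥ P₂ U t l)) (*ᵥ-congˡ (universal⨾₂ square) t l))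
          (λ l → trans (sym (·-*ᵥ P₁ U t l)) (*ᵥ-congˡ (universal⨾₁ square) t l)) i)
        (trans (++ᵥ-take-drop b (k₀ *ᵥ t) i) (matrixOf-action K₀ t i))

      difference-cone : ∀ t → fun differenceᴸ (fun coneᴸ t) ≈ᵥ (λ _ → 0#)
      difference-cone t i = trans (+-cong
          (trans (*ᵥ-cong A (dropᵥ-++ (P₂ *ᵥ t) (P₁ *ᵥ t)) i)
            (trans (sym (·-*ᵥ A P₁ t i)) (trans (*ᵥ-congˡ commute t i) (·-*ᵥ B P₂ t i))))
          (-‿cong (*ᵥ-cong B (takeᵥ-++ (P₂ *ᵥ t) (P₁ *ᵥ t)) i)))
        (-‿inverseʳ _)

      V : Lin ⟨ p ⟩ ⟨ proj₁ (splitKernel (b + a) differenceᴸ) ⟩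
      V = coneᴸ ⨾ᴸ L₀

      -- A cone vector lies in the kernel of the difference, so `NM₀` gives d times its deviation
      -- from K₀ L₀ as N₀ 0, and d cancels.
      K₀V : ∀ t → fun K₀ (fun V t) ≈ᵥ fun coneᴸ t
      K₀V t i = sym (x∙y⁻¹≈ε⇒x≈y _ _ (*-cancel-0 d≉0
        (trans (sym (NM₀ (fun coneᴸ t) i)) (fun-zero N₀ (difference-cone t) i))))

      coneᴸ-UV : ∀ t → fun coneᴸ (U *ᵥ fun V t) ≈ᵥ fun coneᴸ t
      coneᴸ-UV t i = trans (cone-U (fun V t) i) (K₀V t i)

      -- The composite `W` fixes both legs of the cone, so the uniqueness clause of the pullback
      -- makes it the identity.
      UV : ∀ t → (U *ᵥ fun V t) ≈ᵥ t
      UV t i = begin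
        (U *ᵥ fun V t) i        ≈⟨ *ᵥ-cong U (matrixOf-action V t) i ⟨
        (U *ᵥ (matrixOf V *ᵥ t)) i ≈⟨ ·-*ᵥ U (matrixOf V) t i ⟨
        (W *ᵥ t) i              ≈⟨ *ᵥ-congˡ W≋δ t i ⟩
        (δ *ᵥ t) i              ≈⟨ δ-*ᵥ t i ⟩
        t i                     ∎
        where
        W : Matrix p p
        W = U · matrixOf V
        PW : ∀ t → fun coneᴸ (W *ᵥ t) ≈ᵥ fun coneᴸ t
        PW t j = trans (fun-cong coneᴸ (λ l → trans (·-*ᵥ U (matrixOf V) t l) (*ᵥ-cong U (matrixOf-action V t) l)) j)
          (coneᴸ-UV t j)
        W≋δ : W ≋ δ
        W≋δ i j = trans
          (unique commute
            (action-injective λ t l → trans (·-*ᵥ P₁ W t l) (trans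
              (sym (dropᵥ-++ (P₂ *ᵥ (W *ᵥ t)) (P₁ *ᵥ (W *ᵥ t)) l)) (trans (PW t (b ↑ʳ l)) (dropᵥ-++ (P₂ *ᵥ t) (P₁ *ᵥ t) l))))
            (action-injective λ t l → trans (·-*ᵥ P₂ W t l) (trans
              (sym (takeᵥ-++ (P₂ *ᵥ (W *ᵥ t)) (P₁ *ᵥ (W *ᵥ t)) l)) (trans (PW t (l ↑ˡ a)) (takeᵥ-++ (P₂ *ᵥ t) (P₁ *ᵥ t) l))))
            i j)
          (sym (unique commute (λ l r → sum-δʳ r (P₁ l)) (λ l r → sum-δʳ r (P₂ l)) i j))

    -- `cone-U` says that the cone after `U` is `K₀`, so composing the old retraction with `U` keeps
    -- the projection, and with it `N₀` and d.
    cone-splitKernel : SplitKernel differenceᴸ coneᴸ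
    cone-splitKernel = record
      { L = L₀ ⨾ᴸ mat U ; N = N₀ ; d = d ; d≉0 = d≉0
      ; MK = difference-cone
      ; LK = UV
      ; NM = λ w i → trans (NM₀ w i) (*-congˡ (+-congˡ (-‿cong (sym (cone-U (fun L₀ w) i))))) }

-- Interpretation of terms as spans

module SpanIsomorphism (R : CommutativeRing c ℓ) (pid : IsPID R) where
  open CommutativeRing R renaming
    (_+_ to _+ᴿ_; +-assoc to +ᴿ-assoc; +-identityʳ to +ᴿ-identityʳ; zero to *-zero;
     _≈_ to _≈ᴿ_; _≉_ to _≉ᴿ_; refl to ≈-refl; sym to ≈-sym; trans to ≈-trans; setoid to setoidᴿ;
     isEquivalence to ≈-isEquivalence; reflexive to ≈-reflexive)
  open import Algebra.Properties.Ring ring using (x∙y⁻¹≈ε⇒x≈y)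
  open IsPID pid
  open Matrices R
  open MatrixPullbacks R pid using (Vect; _*ᵥ_; *ᵥ-cong; Mat-pullback; Mat-⊕-pullback)
  open MatrixSemantics R pid
  open HACompleteness R pid using (complete)
  open LinearMaps R pid
  open InteractingHopf R pid hiding (module ∼)
  open SplitKernels R pid using (*-cancel-0; differenceᴸ; coneᴸ; cone-splitKernel)
  open IntegerSolver R using (solve; _:=_; _:+_; _:*_; _:-_; :-_; 𝟘; 𝟙)
  open Pullbacks Mat
  open Spans Mat Mat-pullback Mat-⊕-pullback hiding (pullˡ; pullʳ; ≃-refl; ≃-sym; ≃-trans)
  module M = PROP Mat
  module I where
    open PROP (IHSp R) public
    open PROPProperties (IHSp R) public
  open I using (_⨾_; _⊕_)

  cograph : ∀ {n m} → Matrix m n → SpanArrow m n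
  cograph A = mkSpan A δ

  cograph-⨾ˢ : ∀ {n m k} (A : Matrix m n) (T : SpanArrow n k) →
               cograph A ⨾ˢ T ≃ mkSpan (A · SpanArrow.left T) (SpanArrow.right T)
  cograph-⨾ˢ A T = ≃.trans
    (≃.sym (any-pullback (cograph A) T (iso-pullbackˡ (M.⨾-idˡ δ) (M.⨾-idˡ δ))))
    (legs (M.⨾-cong (M.⨾-idʳ (SpanArrow.left T)) M.Eq.refl) (M.⨾-idˡ (SpanArrow.right T)))

  graph-cograph : ∀ {a b x p} {A : Matrix x a} {B : Matrix x b} {P₁ : Matrix a p} {P₂ : Matrix b p} →
                  IsPullback A B P₁ P₂ → graph A ⨾ˢ cograph B ≃ mkSpan P₁ P₂
  graph-cograph {A = A} {B} {P₁} {P₂} pb = ≃.trans (≃.sym (any-pullback (graph A) (cograph B) pb))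
    (legs (M.⨾-idʳ P₁) (M.⨾-idʳ P₂))

  ⟦_⟧ˢ : ∀ {n m} → Term (IHGen R) n m → SpanArrow n m
  ⟦ gen (inj₁ g) ⟧ˢ = graph ⟦ gen g ⟧ᵐ
  ⟦ gen (inj₂ g) ⟧ˢ = cograph ⟦ gen g ⟧ᵐ
  ⟦ id₀ ⟧ˢ          = mkSpan δ δ
  ⟦ id₁ ⟧ˢ          = mkSpan δ δ
  ⟦ σ₁₁ ⟧ˢ          = graph (permutationMatrix (swap 1 1))
  ⟦ f Defs.⨾ g ⟧ˢ   = ⟦ f ⟧ˢ ⨾ˢ ⟦ g ⟧ˢ
  ⟦ f Defs.⊕ g ⟧ˢ   = ⟦ f ⟧ˢ ⊕ˢ ⟦ g ⟧ˢ

  opposite : ∀ {n m} → H.Hom n m → Term (IHGen R) m n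
  opposite f = rename inj₂ (reverse f)

  ⟦↑⟧ : ∀ {n m} (f : H.Hom n m) → ⟦ ↑ f ⟧ˢ ≃ graph ⟦ f ⟧ᵐ
  ⟦↑⟧ (gen g) = ≃.refl
  ⟦↑⟧ id₀     = ≃.refl
  ⟦↑⟧ id₁     = ≃.refl
  ⟦↑⟧ σ₁₁     = ≃.refl
  ⟦↑⟧ (f Defs.⨾ g) = ≃.trans (⨾ˢ-cong (⟦↑⟧ f) (⟦↑⟧ g)) (graph-⨾ ⟦ f ⟧ᵐ ⟦ g ⟧ᵐ)
  ⟦↑⟧ (f Defs.⊕ g) = ≃.trans (⊕ˢ-cong (⟦↑⟧ f) (⟦↑⟧ g)) (graph-⊕ ⟦ f ⟧ᵐ ⟦ g ⟧ᵐ)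

  ⟦opposite⟧ : ∀ {n m} (f : H.Hom n m) → ⟦ opposite f ⟧ˢ ≃ cograph ⟦ f ⟧ᵐ
  ⟦opposite⟧ (gen g) = ≃.refl
  ⟦opposite⟧ id₀     = ≃.refl
  ⟦opposite⟧ id₁     = ≃.refl
  -- Reversal leaves `σ₁₁` in place, so its graph must be compared with its cograph; the involution
  -- itself is the isomorphism of apexes.
  ⟦opposite⟧ σ₁₁     = record
    { to = M.σ 1 1 ; from = M.σ 1 1
    ; to⨾from = M.σ-involutive 1 1 ; from⨾to = M.σ-involutive 1 1
    ; to⨾left = M.σ-involutive 1 1 ; to⨾right = M.⨾-idʳ (M.σ 1 1) }
  ⟦opposite⟧ (f Defs.⨾ g) = ≃.trans (⨾ˢ-cong (⟦opposite⟧ g) (⟦opposite⟧ f)) (cograph-⨾ˢ ⟦ g ⟧ᵐ (cograph ⟦ f ⟧ᵐ))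
  ⟦opposite⟧ (Defs._⊕_ {n} {m} {n′} {m′} f g) =
    ≃.trans (⊕ˢ-cong (⟦opposite⟧ f) (⟦opposite⟧ g)) (legs M.Eq.refl (M.⊕-id n n′))

  -- An arrow into an object of Mat is a tuple of vectors, its columns. The universal property can
  -- thus be checked on single vectors, and the universal arrow is assembled column by column.
  record Solution {a b x p} (f : H.Hom a x) (g : H.Hom b x) (p₁ : H.Hom p a) (p₂ : H.Hom p b) : Set (c ⊔ ℓ) where
    field
      commute  : ∀ w → apply f (apply p₁ w) ≈ᵥ apply g (apply p₂ w)
      solution : Vect a → Vect b → Vect p
      cong     : ∀ {u u′ v v′} → u ≈ᵥ u′ → v ≈ᵥ v′ → solution u v ≈ᵥ solution u′ v′
      solved₁  : ∀ u v → apply f u ≈ᵥ apply g v → apply p₁ (solution u v) ≈ᵥ u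
      solved₂  : ∀ u v → apply f u ≈ᵥ apply g v → apply p₂ (solution u v) ≈ᵥ v
      unique   : ∀ w → solution (apply p₁ w) (apply p₂ w) ≈ᵥ w

  solution-isPullback : ∀ {a b x p} {f : H.Hom a x} {g : H.Hom b x} {p₁ : H.Hom p a} {p₂ : H.Hom p b} →
    Solution f g p₁ p₂ → IsPullback ⟦ f ⟧ᵐ ⟦ g ⟧ᵐ ⟦ p₁ ⟧ᵐ ⟦ p₂ ⟧ᵐ
  solution-isPullback {f = f} {g} {p₁} {p₂} sol = record
    { commute = ⟦⟧ᵐ-cong (p₁ H.⨾ f) (p₂ H.⨾ g) S.commute
    ; universal = λ {_} {h₁} {h₂} _ k j → S.solution (λ l → h₁ l j) (λ l → h₂ l j) k
    ; universal⨾₁ = λ {_} {h₁} {h₂} eq i j → ≈-trans (*ᵥ-apply p₁ _ i)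
        (S.solved₁ (λ l → h₁ l j) (λ l → h₂ l j) (columns eq j) i)
    ; universal⨾₂ = λ {_} {h₁} {h₂} eq i j → ≈-trans (*ᵥ-apply p₂ _ i)
        (S.solved₂ (λ l → h₁ l j) (λ l → h₂ l j) (columns eq j) i)
    ; unique = λ {_} {h₁} {h₂} eq {u} q r k j → ≈-trans (≈-sym (S.unique (λ l → u l j) k))
        (S.cong (λ l → ≈-trans (≈-sym (*ᵥ-apply p₁ (λ l → u l j) l)) (q l j))
                (λ l → ≈-trans (≈-sym (*ᵥ-apply p₂ (λ l → u l j) l)) (r l j)) k) }
    where
    module S = Solution sol
    columns : ∀ {q} {h₁ : Matrix _ q} {h₂ : Matrix _ q} → ⟦ f ⟧ᵐ · h₁ ≋ ⟦ g ⟧ᵐ · h₂ →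
              ∀ j → apply f (λ l → h₁ l j) ≈ᵥ apply g (λ l → h₂ l j)
    columns {h₁ = h₁} {h₂} eq j i = ≈-trans (≈-sym (*ᵥ-apply f (λ l → h₁ l j) i))
      (≈-trans (eq i j) (*ᵥ-apply g (λ l → h₂ l j) i))

  ⟦↑⨾opposite⟧ : ∀ {a b x p} {f : H.Hom a x} {g : H.Hom b x} {p₁ : H.Hom p a} {p₂ : H.Hom p b} →
                 Solution f g p₁ p₂ → ⟦ ↑ f ⨾ opposite g ⟧ˢ ≃ mkSpan ⟦ p₁ ⟧ᵐ ⟦ p₂ ⟧ᵐ
  ⟦↑⨾opposite⟧ {f = f} {g} {p₁} {p₂} sol = ≃.trans (⨾ˢ-cong (⟦↑⟧ f) (⟦opposite⟧ g))
    (graph-cograph (solution-isPullback {f = f} {g} {p₁} {p₂} sol))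

  ⟦opposite⨾↑⟧ : ∀ {n m k} (f : H.Hom k n) (g : H.Hom k m) →
                 ⟦ opposite f ⨾ ↑ g ⟧ˢ ≃ mkSpan ⟦ f ⟧ᵐ ⟦ g ⟧ᵐ
  ⟦opposite⨾↑⟧ f g = ≃.trans (⨾ˢ-cong (⟦opposite⟧ f) (⟦↑⟧ g))
    (≃.trans (cograph-⨾ˢ ⟦ f ⟧ᵐ (graph ⟦ g ⟧ᵐ)) (legs (M.⨾-idˡ ⟦ f ⟧ᵐ) M.Eq.refl))

  -- The equations (W1)-(W8) as pullbacks

  open HATerms R
  private
    I₁ : H.Hom 1 1
    I₁ = id₁

  -- An equality u₀ + u₁ = v₀ + v₁ is refined by the triple v₀, u₀ - v₀, u₁: merging its last two
  -- entries gives v, merging its first two gives u.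
  W3-solution : Solution μ◦ μ◦ (μ◦ H.⊕ I₁) (I₁ H.⊕ μ◦)
  W3-solution = record
    { commute  = λ { w zero → +ᴿ-assoc _ _ _ }
    ; solution = λ { u v zero → v zero ; u v (suc zero) → u zero - v zero ; u v (suc (suc zero)) → u (suc zero) }
    ; cong     = λ { p q zero → q zero ; p q (suc zero) → +-cong (p zero) (-‿cong (q zero)) ; p q (suc (suc zero)) → p (suc zero) }
    ; solved₁  = λ { u v p zero → solve 2 (λ x y → y :+ (x :- y) := x) ≈-refl _ _ ; u v p (suc zero) → ≈-refl }
    ; solved₂  = λ { u v p zero → ≈-refl
                   ; u v p (suc zero) → ≈-trans (solve 3 (λ x y z → (x :- y) :+ z := (x :+ z) :- y) ≈-refl _ _ _)
                       (≈-trans (+-congʳ (p zero)) (solve 2 (λ x y → (x :+ y) :- x := y) ≈-refl _ _)) }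
    ; unique   = λ { w zero → ≈-refl ; w (suc zero) → solve 2 (λ x y → (x :+ y) :- x := y) ≈-refl _ _
                   ; w (suc (suc zero)) → ≈-refl } }

  flipped : ∀ {a b x p} {f : H.Hom a x} {g : H.Hom b x} {p₁ : H.Hom p a} {p₂ : H.Hom p b} →
            Solution f g p₁ p₂ → Solution g f p₂ p₁
  flipped sol = record
    { commute  = λ w i → ≈-sym (S.commute w i)
    ; solution = λ u v → S.solution v u
    ; cong     = λ p q → S.cong q p
    ; solved₁  = λ u v p → S.solved₂ v u (λ i → ≈-sym (p i))
    ; solved₂  = λ u v p → S.solved₁ v u (λ i → ≈-sym (p i))
    ; unique   = S.unique }
    where module S = Solution sol

  W4-solution : Solution (Δ• H.⊕ I₁) (I₁ H.⊕ Δ•) Δ• Δ•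
  W4-solution = record
    { commute  = λ { w zero → ≈-refl ; w (suc zero) → ≈-refl ; w (suc (suc zero)) → ≈-refl }
    ; solution = λ u v _ → u zero
    ; cong     = λ p q _ → p zero
    ; solved₁  = λ { u v p zero → ≈-refl ; u v p (suc zero) → ≈-trans (p (suc zero)) (≈-sym (p (suc (suc zero)))) }
    ; solved₂  = λ { u v p zero → p zero ; u v p (suc zero) → p (suc zero) }
    ; unique   = λ { w zero → ≈-refl } }

  W1-solution : ∀ {l} → l ≉ᴿ 0# → Solution (s l) (s l) I₁ I₁
  W1-solution {l} l≉0 = record
    { commute  = λ w i → ≈-refl
    ; solution = λ u v → u
    ; cong     = λ p q → p
    ; solved₁  = λ u v p i → ≈-refl
    ; solved₂  = λ { u v p zero → x∙y⁻¹≈ε⇒x≈y _ _ (*-cancel-0 l≉0 (≈-trans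
                       (solve 3 (λ l x y → l :* (x :- y) := l :* x :- l :* y) ≈-refl l (u zero) (v zero))
                       (≈-trans (+-congʳ (p zero)) (-‿inverseʳ _)))) }
    ; unique   = λ w i → ≈-refl }

  W2-solution : Solution η◦ η◦ id₀ id₀
  W2-solution = record
    { commute = λ w i → ≈-refl ; solution = λ u v () ; cong = λ p q () ; solved₁ = λ u v p ()
    ; solved₂ = λ u v p () ; unique = λ w () }

  antidiagonal : H.Hom 1 2
  antidiagonal = Δ• H.⨾ (I₁ H.⊕ s (- 1#))

  W5-solution : Solution η◦ μ◦ ε• antidiagonal
  W5-solution = record
    { commute  = λ { w zero → solve 1 (λ x → 𝟘 := x :+ (:- 𝟙) :* x) ≈-refl (w zero) }
    ; solution = λ u v _ → v zero
    ; cong     = λ p q _ → q zero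
    ; solved₁  = λ u v p ()
    ; solved₂  = λ { u v p zero → ≈-refl
                   ; u v p (suc zero) → ≈-trans (≈-sym (+ᴿ-identityʳ _)) (≈-trans (+-congˡ (p zero))
                       (solve 2 (λ x y → (:- 𝟙) :* x :+ (x :+ y) := y) ≈-refl (v zero) (v (suc zero)))) }
    ; unique   = λ { w zero → ≈-refl } }

  W6-solution : Solution (I₁ H.⊕ s (- 1#)) Δ• antidiagonal I₁
  W6-solution = record
    { commute  = λ { w zero → ≈-refl ; w (suc zero) → solve 1 (λ x → (:- 𝟙) :* ((:- 𝟙) :* x) := x) ≈-refl (w zero) }
    ; solution = λ u v → v
    ; cong     = λ p q → q
    ; solved₁  = λ { u v p zero → ≈-sym (p zero)
                   ; u v p (suc zero) → ≈-trans (*-congˡ (≈-sym (p (suc zero))))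
                       (solve 1 (λ x → (:- 𝟙) :* ((:- 𝟙) :* x) := x) ≈-refl (u (suc zero))) }
    ; solved₂  = λ u v p i → ≈-refl
    ; unique   = λ w i → ≈-refl }

  W7-solution : ∀ k → Solution (s k H.⊕ I₁) Δ• (Δ• H.⨾ (I₁ H.⊕ s k)) (s k)
  W7-solution k = record
    { commute  = λ { w zero → ≈-refl ; w (suc zero) → ≈-refl }
    ; solution = λ u v _ → u zero
    ; cong     = λ p q _ → p zero
    ; solved₁  = λ { u v p zero → ≈-refl ; u v p (suc zero) → ≈-trans (p zero) (≈-sym (p (suc zero))) }
    ; solved₂  = λ { u v p zero → p zero }
    ; unique   = λ { w zero → ≈-refl } }

  ⟦axiom⟧ : ∀ {n m} {f g : Term (IHGen R) n m} →
            Presentation.Eqn (HA R +ᴾ HA R ᵒᵖ /ᴾ WEqn R) f g → ⟦ f ⟧ˢ ≃ ⟦ g ⟧ˢ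
  ⟦axiom⟧ (inj₁ (left {f = f} {g} p)) = ≃.trans (⟦↑⟧ f)
    (≃.trans (legs M.Eq.refl (⟦⟧ᵐ-cong f g (axiom-sound p))) (≃.sym (⟦↑⟧ g)))
  ⟦axiom⟧ (inj₁ (right (reversed {f = f} {g} p))) = ≃.trans (⟦opposite⟧ f)
    (≃.trans (legs (⟦⟧ᵐ-cong f g (axiom-sound p)) M.Eq.refl) (≃.sym (⟦opposite⟧ g)))
  ⟦axiom⟧ (inj₂ (W1 l l≉0)) = ⟦↑⨾opposite⟧ {f = s l} {s l} {I₁} {I₁} (W1-solution l≉0)
  ⟦axiom⟧ (inj₂ W2)  = ⟦↑⨾opposite⟧ {f = η◦} {η◦} {id₀} {id₀} W2-solution
  ⟦axiom⟧ (inj₂ W3ˡ) = ≃.trans (⟦opposite⨾↑⟧ (μ◦ H.⊕ I₁) (I₁ H.⊕ μ◦))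
    (≃.sym (⟦↑⨾opposite⟧ {f = μ◦} {μ◦} {μ◦ H.⊕ I₁} {I₁ H.⊕ μ◦} W3-solution))
  ⟦axiom⟧ (inj₂ W3ʳ) = ≃.trans (⟦↑⨾opposite⟧ {f = μ◦} {μ◦} {I₁ H.⊕ μ◦} {μ◦ H.⊕ I₁} (flipped W3-solution))
    (≃.sym (⟦opposite⨾↑⟧ (I₁ H.⊕ μ◦) (μ◦ H.⊕ I₁)))
  ⟦axiom⟧ (inj₂ W4ˡ) = ≃.trans (⟦↑⨾opposite⟧ {f = Δ• H.⊕ I₁} {I₁ H.⊕ Δ•} {Δ•} {Δ•} W4-solution)
    (≃.sym (⟦opposite⨾↑⟧ Δ• Δ•))
  ⟦axiom⟧ (inj₂ W4ʳ) = ≃.trans (⟦opposite⨾↑⟧ Δ• Δ•)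
    (≃.sym (⟦↑⨾opposite⟧ {f = I₁ H.⊕ Δ•} {Δ• H.⊕ I₁} {Δ•} {Δ•} (flipped W4-solution)))
  ⟦axiom⟧ (inj₂ W5) = ≃.trans (⟦↑⨾opposite⟧ {f = η◦} {μ◦} {ε•} {antidiagonal} W5-solution)
    (≃.sym {x = ⟦ opposite ε• ⨾ ↑ antidiagonal ⟧ˢ} (⟦opposite⨾↑⟧ ε• antidiagonal))
  -- Both sides are the span of pairs (x , -x) with empty right leg. The right side is reassociated
  -- so that the sign first meets the reversed copy, where `W6-solution` gives the pullback.
  ⟦axiom⟧ (inj₂ W6) = ≃.trans {j = common}
    (⟦↑⨾opposite⟧ {f = μ◦} {η◦} {antidiagonal} {ε•} (flipped W5-solution))
    (≃.sym {x = ⟦ ↑ (I₁ H.⊕ s (- 1#)) ⨾ opposite Δ• ⨾ ↑ ε• ⟧ˢ}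
      (≃.trans (≃.sym (⨾ˢ-assoc ⟦ ↑ (I₁ H.⊕ s (- 1#)) ⟧ˢ ⟦ opposite Δ• ⟧ˢ ⟦ ↑ ε• ⟧ˢ))
      (≃.trans {k = common}
        (⨾ˢ-cong (⟦↑⨾opposite⟧ {f = I₁ H.⊕ s (- 1#)} {Δ•} {antidiagonal} {I₁} W6-solution)
          (≃.refl {x = ⟦ ↑ ε• ⟧ˢ}))
        (≃.trans {k = common} (⨾ˢ-graph (mkSpan ⟦ antidiagonal ⟧ᵐ δ) ⟦ ε• ⟧ᵐ)
          (legs {r = ⟦ I₁ H.⨾ ε• ⟧ᵐ} {r′ = ⟦ ε• ⟧ᵐ} M.Eq.refl (M.⨾-idˡ ⟦ ε• ⟧ᵐ))))))
    where
    common : SpanArrow 2 0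
    common = mkSpan ⟦ antidiagonal ⟧ᵐ ⟦ ε• ⟧ᵐ
  ⟦axiom⟧ (inj₂ (W7 k)) = ≃.trans (⟦↑⨾opposite⟧ {f = s k H.⊕ I₁} {Δ•} {Δ• H.⨾ (I₁ H.⊕ s k)} {s k} (W7-solution k))
    (≃.sym (≃.trans (⨾ˢ-cong (⟦opposite⟧ (I₁ H.⊕ s k)) (⟦opposite⨾↑⟧ Δ• (s k)))
      (cograph-⨾ˢ ⟦ I₁ H.⊕ s k ⟧ᵐ (mkSpan ⟦ Δ• ⟧ᵐ ⟦ s k ⟧ᵐ))))
  ⟦axiom⟧ (inj₂ (W8 k)) = ≃.trans (⟦↑⨾opposite⟧ {f = Δ•} {s k H.⊕ I₁} {s k} {Δ• H.⨾ (I₁ H.⊕ s k)} (flipped (W7-solution k)))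
    (≃.sym (⟦opposite⨾↑⟧ (s k) (Δ• H.⨾ (I₁ H.⊕ s k))))

  module IH→Span = Extension (HA R +ᴾ HA R ᵒᵖ /ᴾ WEqn R) (SpanMat R pid)

  ⟦⟧ˢ-isInterpretation : IH→Span.IsInterpretation ⟦_⟧ˢ
  ⟦⟧ˢ-isInterpretation = record
    { map-id₀ = ≃.refl ; map-id₁ = ≃.refl ; map-σ₁₁ = ≃.refl
    ; map-⨾ = λ _ _ → ≃.refl ; map-⊕ = λ _ _ → ≃.refl ; map-axiom = ⟦axiom⟧ }

  -- From spans back to terms

  represent : ∀ {n m} → SpanArrow n m → I.Hom n m
  represent S = [ mat (SpanArrow.left S) ]† ⨾ [ mat (SpanArrow.right S) ]

  []-mat : ∀ {n m} (f : H.Hom n m) {A : Matrix m n} → ⟦ f ⟧ᵐ ≋ A → [ mat A ] I.≈ ↑ f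
  []-mat f {A} p = ↑-cong (complete λ v i → ≈-trans (apply-term (mat A) v i)
    (≈-trans (≈-sym (*ᵥ-congˡ p v i)) (*ᵥ-apply f v i)))

  mat-cong : ∀ {n m} {A B : Matrix m n} → A ≋ B → [ mat A ] I.≈ [ mat B ]
  mat-cong {A = A} {B} p = []-eq (mat A) (mat B) (*ᵥ-congˡ p)

  mat-· : ∀ {n m k} (A : Matrix m n) (B : Matrix k m) → [ mat (B · A) ] I.≈ [ mat A ] ⨾ [ mat B ]
  mat-· A B = []-eq (mat (B · A)) (mat A ⨾ᴸ mat B) (·-*ᵥ B A)

  mat-δ : ∀ n → [ mat (δ {n}) ] I.≈ I.id n
  mat-δ n = I.Eq.trans ([]-eq (mat δ) idᴸ δ-*ᵥ) (↑-id n)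

  mat-δ† : ∀ n → [ mat (δ {n}) ]† I.≈ I.id n
  mat-δ† n = I.Eq.trans (†-cong (mat-δ n)) (†-id n)

  ⟦term-mat⟧ : ∀ {n m} (A : Matrix m n) → ⟦ term (mat A) ⟧ᵐ ≋ A
  ⟦term-mat⟧ A = action-injective λ v → matrixOf-action (mat A) v

  mat-⊞ : ∀ {n m n′ m′} (A : Matrix m n) (B : Matrix m′ n′) → [ mat (A ⊞ B) ] I.≈ [ mat A ] ⊕ [ mat B ]
  mat-⊞ A B = []-mat (term (mat A) H.⊕ term (mat B)) (M.⊕-cong (⟦term-mat⟧ A) (⟦term-mat⟧ B))

  -- The legs of isomorphic spans differ by an invertible `α.to`, which occurs as
  -- `[ mat α.to ]† ⨾ [ mat α.to ]` between them and is cancelled by `isometry`.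
  represent-cong : ∀ {n m} {S T : SpanArrow n m} → S ≃ T → represent S I.≈ represent T
  represent-cong {S = S} {T} α = begin
    [ mat S.left ]† ⨾ [ mat S.right ]
      ≈⟨ †-cong (mat-cong α.to⨾left) I.⟩⨾⟨ mat-cong α.to⨾right ⟨
    [ mat (T.left · α.to) ]† ⨾ [ mat (T.right · α.to) ]
      ≈⟨ †-cong (mat-· α.to T.left) I.⟩⨾⟨ mat-· α.to T.right ⟩
    ([ mat T.left ]† ⨾ [ mat α.to ]†) ⨾ [ mat α.to ] ⨾ [ mat T.right ]
      ≈⟨ I.pullʳ (I.Eq.trans (I.pullˡ (isometry {K = mat α.to} {mat α.from}
           (λ t i → ≈-trans (≈-sym (·-*ᵥ α.from α.to t i)) (≈-trans (*ᵥ-congˡ α.to⨾from t i) (δ-*ᵥ t i)))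
           (λ t i → ≈-trans (≈-sym (·-*ᵥ α.to α.from t i)) (≈-trans (*ᵥ-congˡ α.from⨾to t i) (δ-*ᵥ t i))))) I.idˡ) ⟩
    [ mat T.left ]† ⨾ [ mat T.right ] ∎
    where
    open I.HomReasoning
    module S = SpanArrow S
    module T = SpanArrow T
    module α = _≃_ α

  pullback-commutes : ∀ {a b x p} {A : Matrix x a} {B : Matrix x b} {P₁ : Matrix a p} {P₂ : Matrix b p} →
    IsPullback A B P₁ P₂ → [ mat A ] ⨾ [ mat B ]† I.≈ [ mat P₁ ]† ⨾ [ mat P₂ ]
  pullback-commutes {A = A} {B} {P₁} {P₂} pb = pullback-square
    {A = mat A} {B = mat B} {M = differenceᴸ pb} {K = coneᴸ pb} {P₁ = mat P₁} {P₂ = mat P₂}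
    (λ v u j → +-cong (*ᵥ-cong A (dropᵥ-++ v u) j) (-‿cong (*ᵥ-cong B (takeᵥ-++ v u) j)))
    (λ t j → ≈-refl)
    (cone-splitKernel pb)

  -- Composition of spans places the pullback legs in the middle as `[ mat p₁ ]† ⨾ [ mat p₂ ]`;
  -- `pullback-commutes` exchanges them for the inner legs of the two factors.
  represent-⨾ : ∀ {n m k} (S : SpanArrow n m) (T : SpanArrow m k) →
                represent (S ⨾ˢ T) I.≈ represent S ⨾ represent T
  represent-⨾ S T = begin
    [ mat (S.left · p₁) ]† ⨾ [ mat (T.right · p₂) ]
      ≈⟨ †-cong (mat-· p₁ S.left) I.⟩⨾⟨ mat-· p₂ T.right ⟩
    ([ mat S.left ]† ⨾ [ mat p₁ ]†) ⨾ [ mat p₂ ] ⨾ [ mat T.right ]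
      ≈⟨ I.pullʳ (I.pullˡ (I.Eq.sym (pullback-commutes isPullback))) ⟩
    [ mat S.left ]† ⨾ ([ mat S.right ] ⨾ [ mat T.left ]†) ⨾ [ mat T.right ]
      ≈⟨ I.Eq.trans (I.refl⟩⨾⟨ I.assoc) I.assoc˘ ⟩
    represent S ⨾ represent T ∎
    where
    open I.HomReasoning
    open Span⨾ S T
    module S = SpanArrow S
    module T = SpanArrow T

  represent-⊕ : ∀ {n m n′ m′} (S : SpanArrow n m) (T : SpanArrow n′ m′) →
                represent (S ⊕ˢ T) I.≈ represent S ⊕ represent T
  represent-⊕ (mkSpan l r) (mkSpan l′ r′) = I.Eq.trans
    (†-cong (mat-⊞ l l′) I.⟩⨾⟨ mat-⊞ r r′) I.interchange

  represent-graph : ∀ {n m} (f : H.Hom n m) {A : Matrix m n} → ⟦ f ⟧ᵐ ≋ A → represent (graph A) I.≈ ↑ f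
  represent-graph f p = I.Eq.trans (mat-δ† _ I.⟩⨾⟨ []-mat f p) I.idˡ

  represent-σ : ∀ n m → represent (graph (permutationMatrix (swap n m))) I.≈ I.σ n m
  represent-σ n m = I.Eq.trans (represent-graph (H.σ n m) (⟦⟧ᵐ-σ n m)) (↑-σ n m)

  -- Both maps preserve composition and sum, so only the generators carry content; each has an
  -- identity as one leg of its span.
  represent-⟦⟧ : ∀ {n m} (f : I.Hom n m) → represent ⟦ f ⟧ˢ I.≈ f
  represent-⟦⟧ (gen (inj₁ g)) = represent-graph (gen g) M.Eq.refl
  represent-⟦⟧ (gen (inj₂ g)) = I.Eq.trans (†-cong ([]-mat (gen g) M.Eq.refl) I.⟩⨾⟨ mat-δ _) I.idʳ
  represent-⟦⟧ id₀   = represent-graph id₀ M.Eq.refl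
  represent-⟦⟧ id₁   = represent-graph id₁ M.Eq.refl
  represent-⟦⟧ σ₁₁   = represent-graph σ₁₁ M.Eq.refl
  represent-⟦⟧ (f Defs.⨾ g) = I.Eq.trans (represent-⨾ ⟦ f ⟧ˢ ⟦ g ⟧ˢ) (represent-⟦⟧ f I.⟩⨾⟨ represent-⟦⟧ g)
  represent-⟦⟧ (f Defs.⊕ g) = I.Eq.trans (represent-⊕ ⟦ f ⟧ˢ ⟦ g ⟧ˢ) (represent-⟦⟧ f I.⟩⊕⟨ represent-⟦⟧ g)

  ⟦represent⟧ : ∀ {n m} (S : SpanArrow n m) → ⟦ represent S ⟧ˢ ≃ S
  ⟦represent⟧ (mkSpan l r) = ≃.trans
    (⨾ˢ-cong (≡.subst (λ f → ⟦ f ⟧ˢ ≃ cograph l) (≡.sym (↑-† (term (mat l))))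
                (≃.trans (⟦opposite⟧ (term (mat l))) (legs (⟦term-mat⟧ l) M.Eq.refl)))
             (≃.trans (⟦↑⟧ (term (mat r))) (legs M.Eq.refl (⟦term-mat⟧ r))))
    (≃.trans (cograph-⨾ˢ l (graph r)) (legs (M.⨾-idˡ l) M.Eq.refl))

  isomorphism : IHSp R ≅ SpanMat R pid
  isomorphism = record
    { to      = IH→Span.IsInterpretation.morphism ⟦⟧ˢ-isInterpretation
    ; from    = record
      { map    = represent
      ; cong   = represent-cong
      ; map-id = λ n → I.Eq.trans (mat-δ† n I.⟩⨾⟨ mat-δ n) I.idˡ
      ; map-⨾  = represent-⨾
      ; map-⊕  = represent-⊕
      ; map-σ  = represent-σ }
    ; from∘to = represent-⟦⟧
    ; to∘from = ⟦represent⟧ }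

theorem5p5 : ∀ {c ℓ} (R : CommutativeRing c ℓ) (pid : IsPID R) → IHSp R ≅ SpanMat R pid
theorem5p5 = SpanIsomorphism.isomorphism
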